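{- Every relation in $\mathsf{CC}$ is computable by a Turing machine of the following type, and conversely every relation computed by such a machine is in $\mathsf{CC}$. The machine has three tapes: a read/write work tape with one head $W$, a read-only input tape with one head $I$, and a "comparator" tape with two heads $M_1,M_2$; all heads move one step at a time as usual. The work tape is initialized with the input length $n$ written in binary and is limited to $O(\log n)$ cells; the input tape is initialized with the input; the comparator tape is initially blank. The work tape controls the actions of the heads $I,M_1,M_2$ but cannot read the symbols they scan. The input and comparator tapes are accessible only through the following special operations, under control of the work tape: move heads $I$, $M_1$, $M_2$ to specified locations; write $0$ or $1$ into a blank cell under $M_1$ (or $M_2$); copy the value of the cell under $I$ into a blank cell under $M_1$ (or $M_2$); negate the value of the cell under $M_1$ (or $M_2$); "sort" the values of the cells under $M_1$ and $M_2$ (i.e., replace them by their minimum and maximum, as a comparator gate does); output the value of the cell under $M_1$ (or $M_2$) and halt.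
   Context: $\mathsf{CC}$ is the class of relations computed by $\mathsf{AC}^0$-uniform (computable by a function in $\mathsf{FAC}^0$) families of polynomial size annotated comparator circuits, where a comparator gate maps an input pair $(p,q)$ on two wires to $(p\wedge q,p\vee q)$ and an annotated comparator circuit has wires, a sequence of comparator gates, a distinguished output wire, and each wire's input annotated by an input bit $x_i$, its negation $\neg x_i$, or a constant $0$ or $1$. -}

module Defs where

open import Data.Nat using (ℕ; zero; suc; _+_; _*_; _^_; _≤_; _<_; _≡ᵇ_; _/_; _%_)
open import Data.Nat.Logarithm using (⌊log₂_⌋)
open import Data.Bool using (Bool; true; false; _∧_; _∨_; not)
open import Data.Fin using (Fin; toℕ)
open import Data.Vec using (Vec; []; _∷_; lookup; _[_]≔_; fromList; toList)
import Data.Vec as V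
open import Data.List using (List; []; _∷_; length)
open import Data.Maybe using (Maybe; just; nothing; maybe)
import Data.Maybe as M
open import Data.Product using (Σ; _×_; _,_; proj₁; proj₂)
open import Data.Sum using (_⊎_; inj₁; inj₂)
open import Relation.Binary.PropositionalEquality using (_≡_)
open import Function.Bundles using (_⇔_)

nth : {A : Set} → List A → ℕ → Maybe A
nth []       _       = nothing
nth (a ∷ as) zero    = just a
nth (a ∷ as) (suc i) = nth as i

upd : {A : Set} → (ℕ → A) → ℕ → A → (ℕ → A)
upd f i a j with j ≡ᵇ i
... | true  = a
... | false = f j

-- Δ₀ (= Σ₀^B without string variables) formulas over (0,1,+,·,=,≤)
-- with bounded number quantifiers; used to define FAC⁰ number functions
-- of number arguments (Cook–Nguyen two-sorted framework).

data Tm (k : ℕ) : Set where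
  var     : Fin k → Tm k
  𝟘 𝟙     : Tm k
  _⊕_ _⊗_ : Tm k → Tm k → Tm k

⟦_⟧t : ∀ {k} → Tm k → Vec ℕ k → ℕ
⟦ var i ⟧t ρ = lookup ρ i
⟦ 𝟘 ⟧t ρ = 0
⟦ 𝟙 ⟧t ρ = 1
⟦ s ⊕ t ⟧t ρ = ⟦ s ⟧t ρ + ⟦ t ⟧t ρ
⟦ s ⊗ t ⟧t ρ = ⟦ s ⟧t ρ * ⟦ t ⟧t ρ

data Fm (k : ℕ) : Set where
  _≐_ _≼_ : Tm k → Tm k → Fm k
  ¬'      : Fm k → Fm k
  _∧'_ _∨'_ : Fm k → Fm k → Fm k
  ∀≤ ∃≤   : Tm k → Fm (suc k) → Fm k   -- ∀x ≤ t, ∃x ≤ t  (x is var zero)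

⟦_⟧f : ∀ {k} → Fm k → Vec ℕ k → Set
⟦ s ≐ t ⟧f ρ = ⟦ s ⟧t ρ ≡ ⟦ t ⟧t ρ
⟦ s ≼ t ⟧f ρ = ⟦ s ⟧t ρ ≤ ⟦ t ⟧t ρ
⟦ ¬' φ ⟧f ρ = ⟦ φ ⟧f ρ → Data.Empty.⊥
  where import Data.Empty
⟦ φ ∧' ψ ⟧f ρ = ⟦ φ ⟧f ρ × ⟦ ψ ⟧f ρ
⟦ φ ∨' ψ ⟧f ρ = ⟦ φ ⟧f ρ ⊎ ⟦ ψ ⟧f ρ
⟦ ∀≤ t φ ⟧f ρ = (x : ℕ) → x ≤ ⟦ t ⟧t ρ → ⟦ φ ⟧f (x ∷ ρ)
⟦ ∃≤ t φ ⟧f ρ = Σ ℕ λ x → x ≤ ⟦ t ⟧t ρ × ⟦ φ ⟧f (x ∷ ρ)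

Δ₀Definable : (k : ℕ) → (Vec ℕ k → Set) → Set
Δ₀Definable k P = Σ (Fm k) λ φ → ∀ ρ → ⟦ φ ⟧f ρ ⇔ P ρ

graph : ∀ {k} → (Vec ℕ k → ℕ) → Vec ℕ (suc k) → Set
graph f (y ∷ ρ) = y ≡ f ρ

FAC⁰Num : (k : ℕ) → (Vec ℕ k → ℕ) → Set
FAC⁰Num k f = (Σ (Tm k) λ t → ∀ ρ → f ρ ≤ ⟦ t ⟧t ρ) × Δ₀Definable (suc k) (graph f)

data Annot (n : ℕ) : Set where
  pos negl : Fin n → Annot n
  const    : Bool → Annot n

record Circuit (n : ℕ) : Set where
  field
    wires  : ℕ
    gates  : List (Fin wires × Fin wires)   -- gate (i , j): wire i ← p∧q, wire j ← p∨q
    output : Fin wires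
    annot  : Vec (Annot n) wires
open Circuit public

annVal : ∀ {n} → Vec Bool n → Annot n → Bool
annVal x (pos i)   = lookup x i
annVal x (negl i)  = not (lookup x i)
annVal x (const b) = b

applyGate : ∀ {m} → Vec Bool m → Fin m × Fin m → Vec Bool m
applyGate v (i , j) = (v [ i ]≔ (lookup v i ∧ lookup v j)) [ j ]≔ (lookup v i ∨ lookup v j)

runGates : ∀ {m} → Vec Bool m → List (Fin m × Fin m) → Vec Bool m
runGates v []       = v
runGates v (g ∷ gs) = runGates (applyGate v g) gs

evalC : ∀ {n} → Circuit n → Vec Bool n → Bool
evalC C x = lookup (runGates (V.map (annVal x) (annot C)) (gates C)) (output C)

size : ∀ {n} → Circuit n → ℕ
size C = wires C + length (gates C)

-- numeric description of a circuit (default 0 out of range)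
annKind : ∀ {n} → Annot n → ℕ
annKind (pos _)       = 0
annKind (negl _)      = 1
annKind (const false) = 2
annKind (const true)  = 3

annIdx : ∀ {n} → Annot n → ℕ
annIdx (pos i)   = toℕ i
annIdx (negl i)  = toℕ i
annIdx (const _) = 0

Family : Set
Family = (n : ℕ) → Circuit n

fWires fGates fOut : Family → Vec ℕ 1 → ℕ
fWires F (n ∷ []) = wires (F n)
fGates F (n ∷ []) = length (gates (F n))
fOut   F (n ∷ []) = toℕ (output (F n))

fGateMin fGateMax fAnnKind fAnnIdx : Family → Vec ℕ 2 → ℕ
fGateMin F (n ∷ k ∷ []) = maybe (λ g → toℕ (proj₁ g)) 0 (nth (gates (F n)) k)
fGateMax F (n ∷ k ∷ []) = maybe (λ g → toℕ (proj₂ g)) 0 (nth (gates (F n)) k)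
fAnnKind F (n ∷ w ∷ []) = maybe annKind 0 (nth (toList (annot (F n))) w)
fAnnIdx  F (n ∷ w ∷ []) = maybe annIdx 0 (nth (toList (annot (F n))) w)

AC⁰Uniform : Family → Set
AC⁰Uniform F =
  FAC⁰Num 1 (fWires F) × FAC⁰Num 1 (fGates F) × FAC⁰Num 1 (fOut F) ×
  FAC⁰Num 2 (fGateMin F) × FAC⁰Num 2 (fGateMax F) ×
  FAC⁰Num 2 (fAnnKind F) × FAC⁰Num 2 (fAnnIdx F)

PolySize : Family → Set
PolySize F = Σ ℕ λ c → ∀ n → size (F n) ≤ c * n ^ c + c

Relation : Set₁
Relation = List Bool → Set

FamilyComputes : Family → Relation → Set
FamilyComputes F R = ∀ x → (evalC (F (length x)) (fromList x) ≡ true) ⇔ R x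

InCC : Relation → Set
InCC R = Σ Family λ F → PolySize F × AC⁰Uniform F × FamilyComputes F R

data Move : Set where
  left stay right : Move

data CHead : Set where
  M₁ M₂ : CHead

data Op : Set where
  noop   : Op
  write  : CHead → Bool → Op
  copy   : CHead → Op
  negate : CHead → Op
  sort   : Op
  halt   : CHead → Op

-- work alphabet Fin (3 + γ): 0 = blank, 1 = '0', 2 = '1', others extra
record Action (q γ : ℕ) : Set where
  field
    next : Fin q
    wsym : Fin (3 + γ)
    dW dI dM₁ dM₂ : Move
    op   : Op

record Machine : Set where
  field
    q γ   : ℕ
    start : Fin q
    δ     : Fin q → Fin (3 + γ) → Action q γ

record Config (q γ : ℕ) : Set where
  field
    state : Fin q
    work  : ℕ → Fin (3 + γ)
    wpos ipos pos₁ pos₂ : ℕ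
    comp  : ℕ → Maybe Bool       -- nothing = blank

move : Move → ℕ → ℕ
move left zero    = zero
move left (suc p) = p
move stay p       = p
move right p       = suc p

bitsAux : ℕ → ℕ → List Bool
bitsAux zero    _       = []
bitsAux (suc f) zero    = []
bitsAux (suc f) (suc m) = ((suc m % 2) ≡ᵇ 1) ∷ bitsAux f (suc m / 2)

-- binary representation, least significant bit first
binary : ℕ → List Bool
binary zero    = false ∷ []
binary (suc m) = bitsAux (suc m) (suc m)

symOf : ∀ {γ} → Maybe Bool → Fin (3 + γ)
symOf nothing      = Fin.zero where import Data.Fin as Fin
symOf (just false) = Fin.suc Fin.zero where import Data.Fin as Fin
symOf (just true)  = Fin.suc (Fin.suc Fin.zero) where import Data.Fin as Fin

blankTape : ℕ → Maybe Bool
blankTape _ = nothing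

initConfig : (M : Machine) → List Bool → Config (Machine.q M) (Machine.γ M)
initConfig M x = record
  { state = Machine.start M
  ; work  = λ i → symOf (nth (binary (length x)) i)
  ; wpos = 0 ; ipos = 0 ; pos₁ = 0 ; pos₂ = 0
  ; comp  = blankTape }

headPos : ∀ {q γ} → Config q γ → CHead → ℕ
headPos c M₁ = Config.pos₁ c
headPos c M₂ = Config.pos₂ c

writeIfBlank : (ℕ → Maybe Bool) → ℕ → Maybe Bool → (ℕ → Maybe Bool)
writeIfBlank t p v with t p
... | nothing = upd t p v
... | just _  = t

sortCells : (ℕ → Maybe Bool) → ℕ → ℕ → (ℕ → Maybe Bool)
sortCells t p₁ p₂ with t p₁ | t p₂
... | just a | just b = upd (upd t p₁ (just (a ∧ b))) p₂ (just (a ∨ b))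
... | _      | _      = t

applyOp : ∀ {q γ} → List Bool → Op → Config q γ → (ℕ → Maybe Bool)
applyOp x noop       c = Config.comp c
applyOp x (write h b) c = writeIfBlank (Config.comp c) (headPos c h) (just b)
applyOp x (copy h)   c = writeIfBlank (Config.comp c) (headPos c h) (nth x (Config.ipos c))
applyOp x (negate h) c = upd (Config.comp c) (headPos c h) (M.map not (Config.comp c (headPos c h)))
applyOp x sort       c = sortCells (Config.comp c) (Config.pos₁ c) (Config.pos₂ c)
applyOp x (halt h)   c = Config.comp c

doAction : ∀ {q γ} → List Bool → Config q γ → Action q γ → Op → Config q γ ⊎ Maybe Bool
doAction x c a (halt h) = inj₂ (Config.comp c (headPos c h))
doAction x c a o = inj₁ record
  { state = Action.next a
  ; work  = upd (Config.work c) (Config.wpos c) (Action.wsym a)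
  ; wpos  = move (Action.dW a) (Config.wpos c)
  ; ipos  = move (Action.dI a) (Config.ipos c)
  ; pos₁  = move (Action.dM₁ a) (Config.pos₁ c)
  ; pos₂  = move (Action.dM₂ a) (Config.pos₂ c)
  ; comp  = applyOp x o c }

step : (M : Machine) → List Bool → Config (Machine.q M) (Machine.γ M) →
       Config (Machine.q M) (Machine.γ M) ⊎ Maybe Bool
step M x c =
  let a = Machine.δ M (Config.state c) (Config.work c (Config.wpos c))
  in doAction x c a (Action.op a)

step' : (M : Machine) → List Bool → Config (Machine.q M) (Machine.γ M) ⊎ Maybe Bool →
        Config (Machine.q M) (Machine.γ M) ⊎ Maybe Bool
step' M x (inj₁ c) = step M x c
step' M x (inj₂ o) = inj₂ o

run : (M : Machine) → List Bool → ℕ → Config (Machine.q M) (Machine.γ M) ⊎ Maybe Bool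
run M x zero    = inj₁ (initConfig M x)
run M x (suc t) = step' M x (run M x t)

MachineComputes : Machine → Relation → Set
MachineComputes M R = Σ ℕ λ c → ∀ x →
  (∀ t cfg → run M x t ≡ inj₁ cfg → Config.wpos cfg < c * (⌊log₂ length x ⌋ + 1))
  × (Σ ℕ λ t → Σ Bool λ b → (run M x t ≡ inj₂ (just b)) × ((b ≡ true) ⇔ R x))

{-# OPTIONS --safe #-}
module Submission where

-- From circuits to machines.  The functions describing the family have Δ₀ graphs, so a machine can
-- evaluate them by exhaustive search with finitely many counters that are polynomially bounded in n.
-- Written in a large base on parallel tracks, such counters fit into as many cells as n has binary
-- digits.  The machine fills one comparator cell per wire and then applies the gates one by one.
--
-- From machines to circuits.  What the machine does depends on n only, but its configuration after t
-- steps need not be Δ₀-definable from n and t; only single steps are.  So the circuit recomputes the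
-- control: for every time t and all cells p₁, p₂ a token walks along the nodes (l, configuration at
-- time l), l ≤ t.  Comparators can move it, because each node has one successor and no fan-out is
-- needed.  Where the token stops, its wire e and the complementary wire ē switch the operation of
-- time t: on cell wires x, y the gates (y,ē) (x,ē) (ē,e) (ē,y) compare x with y if e = 1 and leave
-- them alone if e = 0.  A cell is a pair of complementary rails; the token also records which of the
-- two cells are blank and which rail holds the value, so that negations cost nothing.  As there are
-- polynomially many control configurations, a halting machine halts in polynomial time.

open import Defs
open import Data.Bool using (Bool; true; false; not; _∧_; _∨_)
import Data.Bool as Bool
open import Data.Bool.Properties using (∧-identityʳ; ∨-identityʳ; ∧-zeroʳ; ∨-zeroʳ; ∧-comm; ∨-comm; ∨-idem; not-involutive)
open import Data.Empty using (⊥; ⊥-elim)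
open import Data.Fin using (Fin; zero; suc; toℕ; fromℕ<; _↑ˡ_; _↑ʳ_; splitAt; combine; remQuot; funToFin; finToFun)
open import Data.Fin.Properties using (splitAt-↑ˡ; splitAt-↑ʳ; remQuot-combine; toℕ-fromℕ<; fromℕ<-toℕ; toℕ-injective; toℕ<n; pigeonhole)
import Data.Fin.Properties as Fin
open import Data.List using (List; []; _∷_; length; drop; applyUpTo)
open import Data.List.Properties using (length-applyUpTo)
open import Data.Maybe using (Maybe; just; nothing; maybe; maybe′)
import Data.Maybe as Maybe
open import Data.Maybe.Properties using (just-injective)
open import Data.Nat
open import Data.Nat.DivMod
open import Data.Nat.Logarithm using (⌊log₂_⌋; ⌊log₂⌋-mono-≤; ⌊log₂[2^n]⌋≡n; ⌊log₂⌊n/2⌋⌋≡⌊log₂n⌋∸1)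
open import Data.Nat.Properties
open import Data.Product using (Σ; _×_; _,_; proj₁; proj₂)
open import Data.Sum using (_⊎_; inj₁; inj₂)
open import Data.Unit using (tt)
open import Data.Vec using (Vec; []; _∷_; _++_; lookup; map; tabulate; fromList; toList; _[_]≔_)
import Data.Vec as V
import Data.Vec.Properties as VP
open import Data.Vec.Properties using (lookup-map; map-∘; map-cong; tabulate∘lookup)
open import Data.Vec.Relation.Unary.All using (All; []; _∷_)
open import Function.Bundles using (_⇔_; mk⇔; Equivalence)
open import Relation.Binary.Definitions using (tri<; tri≈; tri>)
open import Relation.Binary.PropositionalEquality
open import Relation.Nullary using (yes; no; ¬_; Dec; Reflects; ofʸ; ofⁿ)


-- Uniformity puts gates at every conceivable node, and most nodes lie on no walk. Their gates must
-- be harmless whatever wires they happen to name, since the code of such a node is arbitrary. A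
-- circuit is one fixed sequence of gates, so the number of a node also serves as its place in a
-- schedule. The time t of a walk is the most significant digit, which puts the operations on the
-- tape in the order of time. The time l that the walk has reached outranks the configuration, so
-- that every step of a token leads forward in the sequence. The cells are chosen before the walk
-- because a node has room for the history of two cells only. The choice is right for one pair, the
-- cells under the heads at time t. Walks carry one more digit κ, whose values 0 and 1 serve the two
-- rails. The initial work tape is a difficulty of its own: a formula for the digits of n would
-- involve powers of 2. Two additional control states peel the digits off instead, which takes
-- nothing but division. In the other direction the control cannot see where the heads on the input
-- and comparator tapes stand, so they are moved out and back by counting.

module Preliminaries where

  ≡ᵇ-refl : ∀ n → (n ≡ᵇ n) ≡ true
  ≡ᵇ-refl zero    = refl
  ≡ᵇ-refl (suc n) = ≡ᵇ-refl n

  ≢⇒≡ᵇ-false : ∀ {m n} → m ≢ n → (m ≡ᵇ n) ≡ false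
  ≢⇒≡ᵇ-false {zero}  {zero}  ne = ⊥-elim (ne refl)
  ≢⇒≡ᵇ-false {zero}  {suc n} ne = refl
  ≢⇒≡ᵇ-false {suc m} {zero}  ne = refl
  ≢⇒≡ᵇ-false {suc m} {suc n} ne = ≢⇒≡ᵇ-false (λ e → ne (cong suc e))

  upd-same : {A : Set} (f : ℕ → A) (i : ℕ) (a : A) → upd f i a i ≡ a
  upd-same f i a rewrite ≡ᵇ-refl i = refl

  upd-other : {A : Set} (f : ℕ → A) {i j : ℕ} (a : A) → j ≢ i → upd f i a j ≡ f j
  upd-other f a ne rewrite ≢⇒≡ᵇ-false ne = refl

  upd-self : {A : Set} (f : ℕ → A) (i j : ℕ) → upd f i (f i) j ≡ f j
  upd-self f i j with j ≟ i
  ... | yes refl = upd-same f i (f i)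
  ... | no ne    = upd-other f (f i) ne

  digit-% : ∀ {a} k {b} .{{_ : NonZero b}} → a < b → (a + k * b) % b ≡ a
  digit-% {a} k {b} a<b = trans ([m+kn]%n≡m%n a k b) (m<n⇒m%n≡m a<b)

  digit-/ : ∀ {a} k {b} .{{_ : NonZero b}} → a < b → (a + k * b) / b ≡ k
  digit-/ {a} k {b} a<b = *-cancelʳ-≡ _ _ b (+-cancelˡ-≡ a _ _ (sym (begin
    a + k * b                                ≡⟨ m≡m%n+[m/n]*n (a + k * b) b ⟩
    (a + k * b) % b + (a + k * b) / b * b    ≡⟨ cong (_+ (a + k * b) / b * b) (digit-% k a<b) ⟩
    a + (a + k * b) / b * b                  ∎)))
    where open ≡-Reasoning

-- Structured programs for the control, and their compilation into machines.

module Structured where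

  -- The simulation of a circuit writes, copies and negates under `M₁`; the head `M₂` enters only as
  -- the second head of a comparison.
  data IOp : Set where
    noop copy₁ negate₁ sort₁₂ : IOp
    write₁ : Bool → IOp

  toOp : IOp → Op
  toOp noop       = noop
  toOp copy₁      = copy M₁
  toOp negate₁    = negate M₁
  toOp sort₁₂     = sort
  toOp (write₁ b) = write M₁ b

  record Instr (γ : ℕ) : Set where
    constructor instr
    field
      rewriteSym : Fin (3 + γ) → Fin (3 + γ)
      mW mI mM₁ mM₂ : Move
      iop : IOp
  open Instr

  data SP (γ : ℕ) : Set where
    act   : Instr γ → SP γ
    seq   : SP γ → SP γ → SP γ
    ite   : (Fin (3 + γ) → Bool) → SP γ → SP γ → SP γ
    while : (Fin (3 + γ) → Bool) → SP γ → SP γ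

  idle : ∀ {γ} → Instr γ
  idle = instr (λ s → s) stay stay stay stay noop

  record IO : Set where
    constructor mkIO
    field
      ipos pos₁ pos₂ : ℕ
      comp : ℕ → Maybe Bool

  record TC (γ : ℕ) : Set where
    constructor mkTC
    field
      work : ℕ → Fin (3 + γ)
      wpos : ℕ
      io   : IO
  open TC

  scanned : ∀ {γ} → TC γ → Fin (3 + γ)
  scanned c = work c (wpos c)

  conf : ∀ {q γ} → Fin q → TC γ → Config q γ
  conf s (mkTC w p (mkIO i p₁ p₂ t)) = record
    { state = s ; work = w ; wpos = p ; ipos = i ; pos₁ = p₁ ; pos₂ = p₂ ; comp = t }

  applyIOp : List Bool → IOp → IO → (ℕ → Maybe Bool)
  applyIOp x noop       (mkIO i p₁ p₂ t) = t
  applyIOp x copy₁      (mkIO i p₁ p₂ t) = writeIfBlank t p₁ (nth x i)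
  applyIOp x negate₁    (mkIO i p₁ p₂ t) = upd t p₁ (Maybe.map not (t p₁))
  applyIOp x sort₁₂     (mkIO i p₁ p₂ t) = sortCells t p₁ p₂
  applyIOp x (write₁ b) (mkIO i p₁ p₂ t) = writeIfBlank t p₁ (just b)

  actIO : ∀ {γ} → List Bool → Instr γ → IO → IO
  actIO x a io@(mkIO i p₁ p₂ t) =
    mkIO (move (mI a) i) (move (mM₁ a) p₁) (move (mM₂ a) p₂) (applyIOp x (iop a) io)

  actTC : ∀ {γ} → List Bool → Instr γ → TC γ → TC γ
  actTC x a c = mkTC (upd (work c) (wpos c) (rewriteSym a (scanned c)))
                     (move (mW a) (wpos c)) (actIO x a (io c))

  -- The space bound is checked at each machine step, hence also at the tests: a test costs one
  -- `idle` step.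
  data Exec {γ : ℕ} (x : List Bool) (S : ℕ) : SP γ → TC γ → TC γ → Set where
    act    : ∀ {a c} → wpos c < S → Exec x S (act a) c (actTC x a c)
    seq    : ∀ {P Q c c' c''} → Exec x S P c c' → Exec x S Q c' c'' → Exec x S (seq P Q) c c''
    ite-t  : ∀ {p P Q c c'} → wpos c < S → p (scanned c) ≡ true →
             Exec x S P (actTC x idle c) c' → Exec x S (ite p P Q) c c'
    ite-f  : ∀ {p P Q c c'} → wpos c < S → p (scanned c) ≡ false →
             Exec x S Q (actTC x idle c) c' → Exec x S (ite p P Q) c c'
    stop   : ∀ {p P c} → wpos c < S → p (scanned c) ≡ false → Exec x S (while p P) c (actTC x idle c)
    again  : ∀ {p P c c' c''} → wpos c < S → p (scanned c) ≡ true →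
             Exec x S P (actTC x idle c) c' → Exec x S (while p P) c' c'' → Exec x S (while p P) c c''

  points : ∀ {γ} → SP γ → ℕ
  points (act a)     = 1
  points (seq P Q)   = points P + points Q
  points (ite p P Q) = suc (points P + points Q)
  points (while p P) = suc (points P)

  entry : ∀ {γ} (P : SP γ) → Fin (points P)
  entry (act a)     = zero
  entry (seq P Q)   = entry P ↑ˡ points Q
  entry (ite p P Q) = zero
  entry (while p P) = zero

  pick : {A : Set} → Bool → A → A → A
  pick true  a b = a
  pick false a b = b

  -- `nothing` is the exit. The surrounding construct decides where it leads: to the second part of
  -- a `seq`, or back to the test of a `while`.
  trans-at : ∀ {γ} (P : SP γ) → Fin (points P) → Fin (3 + γ) → Instr γ × Maybe (Fin (points P))
  trans-at (act a) i s = a , nothing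
  trans-at (seq P Q) i s with splitAt (points P) i
  ... | inj₁ j = proj₁ (trans-at P j s) ,
                 just (maybe′ (_↑ˡ points Q) (points P ↑ʳ entry Q) (proj₂ (trans-at P j s)))
  ... | inj₂ j = proj₁ (trans-at Q j s) , Maybe.map (points P ↑ʳ_) (proj₂ (trans-at Q j s))
  trans-at (ite p P Q) zero s =
    idle , just (suc (pick (p s) (entry P ↑ˡ points Q) (points P ↑ʳ entry Q)))
  trans-at (ite p P Q) (suc i) s with splitAt (points P) i
  ... | inj₁ j = proj₁ (trans-at P j s) , Maybe.map (λ k → suc (k ↑ˡ points Q)) (proj₂ (trans-at P j s))
  ... | inj₂ j = proj₁ (trans-at Q j s) , Maybe.map (λ k → suc (points P ↑ʳ k)) (proj₂ (trans-at Q j s))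
  trans-at (while p P) zero s = idle , pick (p s) (just (suc (entry P))) nothing
  trans-at (while p P) (suc i) s =
    proj₁ (trans-at P i s) , just (maybe′ suc zero (proj₂ (trans-at P i s)))

  mkAction : ∀ {q γ} → Instr γ → Fin (3 + γ) → Fin q → Action q γ
  mkAction a s t = record
    { next = t ; wsym = rewriteSym a s ; dW = mW a ; dI = mI a ; dM₁ = mM₁ a ; dM₂ = mM₂ a
    ; op = toOp (iop a) }

  haltAction : ∀ {q γ} → Fin (3 + γ) → Action (suc q) γ
  haltAction s = record
    { next = zero ; wsym = s ; dW = stay ; dI = stay ; dM₁ = stay ; dM₂ = stay ; op = halt M₁ }

  compile : ∀ {γ} → SP γ → Machine
  compile {γ} P = record
    { q = suc (points P) ; γ = γ ; start = suc (entry P)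
    ; δ = λ { zero s → haltAction s
            ; (suc i) s → mkAction (proj₁ (trans-at P i s)) s (maybe′ suc zero (proj₂ (trans-at P i s))) } }

  data Steps (M : Machine) (x : List Bool) (S : ℕ) :
       Config (Machine.q M) (Machine.γ M) → Config (Machine.q M) (Machine.γ M) → Set where
    here : ∀ {c} → Steps M x S c c
    next : ∀ {c c' c''} → Config.wpos c < S → step M x c ≡ inj₁ c' → Steps M x S c' c'' → Steps M x S c c''

  _++ₛ_ : ∀ {M x S c c' c''} → Steps M x S c c' → Steps M x S c' c'' → Steps M x S c c''
  here         ++ₛ q = q
  next b e p   ++ₛ q = next b e (p ++ₛ q)

  doAction-mkAction : ∀ {q γ} x (a : Instr γ) (s t : Fin q) (c : TC γ) →
    doAction x (conf s c) (mkAction a (scanned c) t) (toOp (iop a)) ≡ inj₁ (conf t (actTC x a c))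
  doAction-mkAction x (instr f w i m₁ m₂ noop) s t c = refl
  doAction-mkAction x (instr f w i m₁ m₂ copy₁) s t c = refl
  doAction-mkAction x (instr f w i m₁ m₂ negate₁) s t c = refl
  doAction-mkAction x (instr f w i m₁ m₂ sort₁₂) s t c = refl
  doAction-mkAction x (instr f w i m₁ m₂ (write₁ b)) s t c = refl

  -- P occurs inside M at the states ι, and is left towards the state e.
  Embeds : (M : Machine) (P : SP (Machine.γ M)) → (Fin (points P) → Fin (Machine.q M)) → Fin (Machine.q M) → Set
  Embeds M P ι e = ∀ i s → Machine.δ M (ι i) s ≡
    mkAction (proj₁ (trans-at P i s)) s (maybe′ ι e (proj₂ (trans-at P i s)))

  step-Embeds : ∀ {M P ι e} → Embeds M P ι e → ∀ x i c →
    step M x (conf (ι i) c) ≡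
    inj₁ (conf (maybe′ ι e (proj₂ (trans-at P i (scanned c)))) (actTC x (proj₁ (trans-at P i (scanned c))) c))
  step-Embeds {M} {P} {ι} {e} E x i c rewrite E i (scanned c) =
    doAction-mkAction x (proj₁ (trans-at P i (scanned c))) (ι i) _ c

  maybe-map : {A B C : Set} (f : B → C) (g : A → B) (d : C) (m : Maybe A) →
    maybe′ f d (Maybe.map g m) ≡ maybe′ (λ a → f (g a)) d m
  maybe-map f g d (just a) = refl
  maybe-map f g d nothing  = refl

  maybe-comm : {A B C : Set} (f : B → C) (g : A → B) (d : B) (m : Maybe A) →
    f (maybe′ g d m) ≡ maybe′ (λ a → f (g a)) (f d) m
  maybe-comm f g d (just a) = refl
  maybe-comm f g d nothing  = refl

  module _ {M : Machine} where

    private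
      γ = Machine.γ M
      Q = Machine.q M

    embeds-seqˡ : ∀ {P P' : SP γ} {ι : Fin (points P + points P') → Fin Q} {e} →
      Embeds M (seq P P') ι e → Embeds M P (λ i → ι (i ↑ˡ points P')) (ι (points P ↑ʳ entry P'))
    embeds-seqˡ {P} {P'} {ι} E i s with E (i ↑ˡ points P') s
    ... | eq rewrite splitAt-↑ˡ (points P) i (points P') =
      trans eq (cong (mkAction (proj₁ (trans-at P i s)) s) (maybe-comm ι _ _ (proj₂ (trans-at P i s))))

    embeds-seqʳ : ∀ {P P' : SP γ} {ι : Fin (points P + points P') → Fin Q} {e} →
      Embeds M (seq P P') ι e → Embeds M P' (λ i → ι (points P ↑ʳ i)) e
    embeds-seqʳ {P} {P'} {ι} E i s with E (points P ↑ʳ i) s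
    ... | eq rewrite splitAt-↑ʳ (points P) (points P') i =
      trans eq (cong (mkAction (proj₁ (trans-at P' i s)) s) (maybe-map ι _ _ (proj₂ (trans-at P' i s))))

    embeds-iteˡ : ∀ {p} {P P' : SP γ} {ι : Fin (suc (points P + points P')) → Fin Q} {e} →
      Embeds M (ite p P P') ι e → Embeds M P (λ i → ι (suc (i ↑ˡ points P'))) e
    embeds-iteˡ {p} {P} {P'} {ι} E i s with E (suc (i ↑ˡ points P')) s
    ... | eq rewrite splitAt-↑ˡ (points P) i (points P') =
      trans eq (cong (mkAction (proj₁ (trans-at P i s)) s) (maybe-map ι _ _ (proj₂ (trans-at P i s))))

    embeds-iteʳ : ∀ {p} {P P' : SP γ} {ι : Fin (suc (points P + points P')) → Fin Q} {e} →
      Embeds M (ite p P P') ι e → Embeds M P' (λ i → ι (suc (points P ↑ʳ i))) e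
    embeds-iteʳ {p} {P} {P'} {ι} E i s with E (suc (points P ↑ʳ i)) s
    ... | eq rewrite splitAt-↑ʳ (points P) (points P') i =
      trans eq (cong (mkAction (proj₁ (trans-at P' i s)) s) (maybe-map ι _ _ (proj₂ (trans-at P' i s))))

    embeds-while : ∀ {p} {P : SP γ} {ι : Fin (suc (points P)) → Fin Q} {e} →
      Embeds M (while p P) ι e → Embeds M P (λ i → ι (suc i)) (ι zero)
    embeds-while {p} {P} {ι} E i s =
      trans (E (suc i) s) (cong (mkAction (proj₁ (trans-at P i s)) s) (maybe-comm ι _ _ (proj₂ (trans-at P i s))))

    exec⇒steps : ∀ {x S} {P : SP γ} {c c'} → Exec x S P c c' →
      ∀ {ι e} → Embeds M P ι e → Steps M x S (conf (ι (entry P)) c) (conf e c')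
    exec⇒steps {x} (act {a = a} {c = c} b) E = next b (step-Embeds {M} {act a} E x zero c) here
    exec⇒steps (seq {P = P} {Q = Q} p q) E =
      exec⇒steps p (embeds-seqˡ {P} {Q} E) ++ₛ exec⇒steps q (embeds-seqʳ {P} {Q} E)
    exec⇒steps {x} (ite-t {p = π} {P = P} {Q} {c} b t p) {ι} E =
      next b (trans (step-Embeds {M} {ite π P Q} E x zero c)
                    (cong (λ z → inj₁ (conf (ι (suc (pick z (entry P ↑ˡ points Q) (points P ↑ʳ entry Q)))) (actTC x idle c))) t))
           (exec⇒steps p (embeds-iteˡ {π} {P} {Q} E))
    exec⇒steps {x} (ite-f {p = π} {P = P} {Q} {c} b t p) {ι} E =
      next b (trans (step-Embeds {M} {ite π P Q} E x zero c)
                    (cong (λ z → inj₁ (conf (ι (suc (pick z (entry P ↑ˡ points Q) (points P ↑ʳ entry Q)))) (actTC x idle c))) t))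
           (exec⇒steps p (embeds-iteʳ {π} {P} {Q} E))
    exec⇒steps {x} (stop {p = π} {P = P} {c} b t) {ι} {e} E =
      next b (trans (step-Embeds {M} {while π P} E x zero c)
                    (cong (λ z → inj₁ (conf (maybe′ ι e (pick z (just (suc (entry P))) nothing)) (actTC x idle c))) t))
           here
    exec⇒steps {x} (again {p = π} {P = P} {c} b t p q) {ι} {e} E =
      next b (trans (step-Embeds {M} {while π P} E x zero c)
                    (cong (λ z → inj₁ (conf (maybe′ ι e (pick z (just (suc (entry P))) nothing)) (actTC x idle c))) t))
           (exec⇒steps p (embeds-while {π} {P} E) ++ₛ exec⇒steps q E)

  module _ {M : Machine} {x : List Bool} {S : ℕ} where

    Halts : Config (Machine.q M) (Machine.γ M) → Maybe Bool → Set
    Halts c o = step M x c ≡ inj₂ o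

    run-halted : ∀ t k {o} → run M x t ≡ inj₂ o → run M x (k + t) ≡ inj₂ o
    run-halted t zero    e = e
    run-halted t (suc k) e rewrite run-halted t k e = refl

    -- The space bound is demanded at all times, so the induction carries it as `past` for the times
    -- before `t₀`. After the halt no configuration is left for which it could fail.
    steps⇒run : ∀ {c c' o} t₀ → run M x t₀ ≡ inj₁ c → Steps M x S c c' →
      Config.wpos c' < S → Halts c' o →
      (∀ t cfg → t < t₀ → run M x t ≡ inj₁ cfg → Config.wpos cfg < S) →
      (∀ t cfg → run M x t ≡ inj₁ cfg → Config.wpos cfg < S) × Σ ℕ λ t → run M x t ≡ inj₂ o
    steps⇒run {c} {o = o} t₀ r here b h past = bound , suc t₀ , end
      where
      end : run M x (suc t₀) ≡ inj₂ o
      end rewrite r = h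
      bound : ∀ t cfg → run M x t ≡ inj₁ cfg → Config.wpos cfg < S
      bound t cfg e with <-cmp t t₀
      ... | tri< t<t₀ _ _ = past t cfg t<t₀ e
      ... | tri≈ _ refl _ with refl ← trans (sym r) e = b
      ... | tri> _ _ t>t₀ with trans (sym e) (trans (cong (run M x) (sym (m∸n+n≡m t>t₀))) (run-halted (suc t₀) (t ∸ suc t₀) end))
      ...   | ()
    steps⇒run {c} t₀ r (next {c' = c₁} b e p) b' h past = steps⇒run (suc t₀) r' p b' h past'
      where
      r' : run M x (suc t₀) ≡ inj₁ c₁
      r' rewrite r = e
      past' : ∀ t cfg → t < suc t₀ → run M x t ≡ inj₁ cfg → Config.wpos cfg < S
      past' t cfg t<s e' with m<1+n⇒m<n∨m≡n t<s
      ... | inj₁ t<t₀ = past t cfg t<t₀ e'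
      ... | inj₂ refl with refl ← trans (sym r) e' = b

-- Bounded formulas over a small basis, with bounds for evaluating them.

module CoreFormulas where

  open Preliminaries

  wkTm : ∀ {k} → Tm k → Tm (suc k)
  wkTm (var i) = var (suc i)
  wkTm 𝟘       = 𝟘
  wkTm 𝟙       = 𝟙
  wkTm (s ⊕ t) = wkTm s ⊕ wkTm t
  wkTm (s ⊗ t) = wkTm s ⊗ wkTm t

  ⟦wkTm⟧ : ∀ {k} (t : Tm k) x ρ → ⟦ wkTm t ⟧t (x ∷ ρ) ≡ ⟦ t ⟧t ρ
  ⟦wkTm⟧ (var i) x ρ = refl
  ⟦wkTm⟧ 𝟘 x ρ       = refl
  ⟦wkTm⟧ 𝟙 x ρ       = refl
  ⟦wkTm⟧ (s ⊕ t) x ρ = cong₂ _+_ (⟦wkTm⟧ s x ρ) (⟦wkTm⟧ t x ρ)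
  ⟦wkTm⟧ (s ⊗ t) x ρ = cong₂ _*_ (⟦wkTm⟧ s x ρ) (⟦wkTm⟧ t x ρ)

  -- One atomic formula, one connective and one quantifier leave the machine with three evaluation
  -- routines. The order is expressed by search: s ≤ t holds when some x ≤ t equals s.
  data CF (k : ℕ) : Set where
    eqᶜ   : Tm k → Tm k → CF k
    nandᶜ : CF k → CF k → CF k
    exᶜ   : Tm k → CF (suc k) → CF k

  any< : ℕ → (ℕ → Bool) → Bool
  any< zero    p = false
  any< (suc k) p = any< k p ∨ p k

  any<-intro : ∀ {n} p {k} → k < n → p k ≡ true → any< n p ≡ true
  any<-intro {suc n} p {k} k<n e with m<1+n⇒m<n∨m≡n k<n
  ... | inj₁ k<n' rewrite any<-intro p k<n' e = refl
  ... | inj₂ refl rewrite e = ∨-zeroʳ (any< n p)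

  any<-elim : ∀ n p → any< n p ≡ true → Σ ℕ λ k → k < n × p k ≡ true
  any<-elim (suc n) p e with any< n p in eq
  ... | true  = let k , k<n , e' = any<-elim n p eq in k , m<n⇒m<1+n k<n , e'
  ... | false = n , ≤-refl , e

  truth : ∀ {k} → CF k → Vec ℕ k → Bool
  truth (eqᶜ s t) ρ   = ⟦ s ⟧t ρ ≡ᵇ ⟦ t ⟧t ρ
  truth (nandᶜ φ ψ) ρ = not (truth φ ρ ∧ truth ψ ρ)
  truth (exᶜ t φ) ρ   = any< (suc (⟦ t ⟧t ρ)) (λ x → truth φ (x ∷ ρ))

  notᶜ : ∀ {k} → CF k → CF k
  notᶜ φ = nandᶜ φ φ

  core : ∀ {k} → Fm k → CF k
  core (s ≐ t)  = eqᶜ s t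
  core (s ≼ t)  = exᶜ t (eqᶜ (var zero) (wkTm s))
  core (¬' φ)   = notᶜ (core φ)
  core (φ ∧' ψ) = notᶜ (nandᶜ (core φ) (core ψ))
  core (φ ∨' ψ) = nandᶜ (notᶜ (core φ)) (notᶜ (core ψ))
  core (∀≤ t φ) = notᶜ (exᶜ t (notᶜ (core φ)))
  core (∃≤ t φ) = exᶜ t (core φ)

  reflects-true : ∀ {P : Set} {b} → Reflects P b → b ≡ true → P
  reflects-true (ofʸ p) _ = p

  true-reflects : ∀ {P : Set} {b} → Reflects P b → P → b ≡ true
  true-reflects (ofʸ _)  _ = refl
  true-reflects (ofⁿ np) p = ⊥-elim (np p)

  reflects-not : ∀ {P : Set} {b} → Reflects P b → Reflects (¬ P) (not (b ∧ b))
  reflects-not (ofʸ p)  = ofⁿ λ np → np p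
  reflects-not (ofⁿ np) = ofʸ np

  reflects-any< : ∀ {P : ℕ → Set} n p → (∀ k → Reflects (P k) (p k)) →
    Reflects (Σ ℕ λ k → k ≤ n × P k) (any< (suc n) p)
  reflects-any< {P} n p r with any< (suc n) p in eq
  ... | true  = let k , k<n , e = any<-elim (suc n) p eq in ofʸ (k , s≤s⁻¹ k<n , reflects-true (r k) e)
  ... | false = ofⁿ λ { (k , k≤n , pk) → true≢false (trans (sym (any<-intro p (s≤s k≤n) (true-reflects (r k) pk))) eq) }
    where
    true≢false : true ≢ false
    true≢false ()

  reflects-≡ᵇ : ∀ m n → Reflects (m ≡ n) (m ≡ᵇ n)
  reflects-≡ᵇ m n with m ≟ n
  ... | yes refl rewrite ≡ᵇ-refl m = ofʸ refl
  ... | no ne rewrite ≢⇒≡ᵇ-false ne = ofⁿ ne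

  reflects-⇔ : ∀ {P Q : Set} {b} → (P → Q) → (Q → P) → Reflects P b → Reflects Q b
  reflects-⇔ f g (ofʸ p)  = ofʸ (f p)
  reflects-⇔ f g (ofⁿ np) = ofⁿ λ q → np (g q)

  -- All quantifiers are bounded, so truth is decidable, and replacing ∀ by ¬∃¬ or ∨ by a nand is
  -- constructively sound.
  core-correct : ∀ {k} (φ : Fm k) ρ → Reflects (⟦ φ ⟧f ρ) (truth (core φ) ρ)
  core-correct (s ≐ t) ρ = reflects-≡ᵇ (⟦ s ⟧t ρ) (⟦ t ⟧t ρ)
  core-correct (s ≼ t) ρ = reflects-⇔
    (λ { (k , k≤ , e) → subst (_≤ ⟦ t ⟧t ρ) e k≤ }) (λ le → ⟦ s ⟧t ρ , le , refl)
    (reflects-any< (⟦ t ⟧t ρ) _ (λ k → subst (λ z → Reflects (k ≡ z) (k ≡ᵇ ⟦ wkTm s ⟧t (k ∷ ρ))) (⟦wkTm⟧ s k ρ)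
                                         (reflects-≡ᵇ k (⟦ wkTm s ⟧t (k ∷ ρ)))))
  core-correct (¬' φ) ρ = reflects-not (core-correct φ ρ)
  core-correct (φ ∧' ψ) ρ with truth (core φ) ρ | truth (core ψ) ρ | core-correct φ ρ | core-correct ψ ρ
  ... | true  | true  | ofʸ p | ofʸ q = ofʸ (p , q)
  ... | true  | false | _     | ofⁿ q = ofⁿ λ pq → q (proj₂ pq)
  ... | false | _     | ofⁿ p | _     = ofⁿ λ pq → p (proj₁ pq)
  core-correct (φ ∨' ψ) ρ with truth (core φ) ρ | truth (core ψ) ρ | core-correct φ ρ | core-correct ψ ρ
  ... | true  | true  | ofʸ p | _     = ofʸ (inj₁ p)
  ... | true  | false | ofʸ p | _     = ofʸ (inj₁ p)
  ... | false | true  | _     | ofʸ q = ofʸ (inj₂ q)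
  ... | false | false | ofⁿ p | ofⁿ q = ofⁿ λ { (inj₁ a) → p a ; (inj₂ b) → q b }
  core-correct (∀≤ t φ) ρ = reflects-⇔
    (λ nex k k≤ → decide k k≤ nex) (λ all ex → proj₂ (proj₂ ex) (all (proj₁ ex) (proj₁ (proj₂ ex))))
    (reflects-not (reflects-any< (⟦ t ⟧t ρ) _ (λ k → reflects-not (core-correct φ (k ∷ ρ)))))
    where
    decide : ∀ k → k ≤ ⟦ t ⟧t ρ → ¬ (Σ ℕ λ k → k ≤ ⟦ t ⟧t ρ × ¬ ⟦ φ ⟧f (k ∷ ρ)) → ⟦ φ ⟧f (k ∷ ρ)
    decide k k≤ nex with truth (core φ) (k ∷ ρ) | core-correct φ (k ∷ ρ)
    ... | true  | ofʸ p  = p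
    ... | false | ofⁿ np = ⊥-elim (nex (k , k≤ , np))
  core-correct (∃≤ t φ) ρ = reflects-any< (⟦ t ⟧t ρ) _ (λ k → core-correct φ (k ∷ ρ))

  -- Bounds on every number met while evaluating, when all variables are ≤ b.
  termBound : ∀ {k} → Tm k → ℕ → ℕ
  termBound (var i) b = b
  termBound 𝟘 b       = 0
  termBound 𝟙 b       = 1
  termBound (s ⊕ t) b = termBound s b + termBound t b
  termBound (s ⊗ t) b = termBound s b + termBound t b + termBound s b * termBound t b

  coreBound : ∀ {k} → CF k → ℕ → ℕ
  coreBound (eqᶜ s t) b   = termBound s b + termBound t b
  coreBound (nandᶜ φ ψ) b = coreBound φ b + coreBound ψ b
  coreBound (exᶜ t φ) b   = termBound t b + coreBound φ (b + termBound t b)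

  _≤ᵛ_ : ∀ {k} → Vec ℕ k → ℕ → Set
  ρ ≤ᵛ b = ∀ i → lookup ρ i ≤ b

  -- In a product the bound also contains those of the factors. The factors are computed on their
  -- own, and one of them may be large while the other is 0.
  term≤termBound : ∀ {k} (t : Tm k) {ρ b} → ρ ≤ᵛ b → ⟦ t ⟧t ρ ≤ termBound t b
  term≤termBound (var i) le = le i
  term≤termBound 𝟘 le = z≤n
  term≤termBound 𝟙 le = ≤-refl
  term≤termBound (s ⊕ t) le = +-mono-≤ (term≤termBound s le) (term≤termBound t le)
  term≤termBound (s ⊗ t) le = ≤-trans (*-mono-≤ (term≤termBound s le) (term≤termBound t le)) (m≤n+m _ _)

  -- Scratch registers above the destination. Subterms are counted additively although they are
  -- evaluated one after the other; the count depends on the formula only, so it is a constant.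
  termRegs : ∀ {k} → Tm k → ℕ
  termRegs (s ⊕ t) = 2 + (termRegs s + termRegs t)
  termRegs (s ⊗ t) = 4 + (termRegs s + termRegs t)
  termRegs _       = 0

  coreRegs : ∀ {k} → CF k → ℕ
  coreRegs (eqᶜ s t)   = 2 + (termRegs s + termRegs t)
  coreRegs (nandᶜ φ ψ) = 3 + (coreRegs φ + coreRegs ψ)
  coreRegs (exᶜ t φ)   = 4 + (termRegs t + coreRegs φ)

  module _ {k : ℕ} {f : Vec ℕ k → ℕ} where

    facBound : FAC⁰Num k f → ℕ → ℕ
    facBound ((t , _) , (φ , _)) b = termBound t b + coreBound (core φ) (b + termBound t b)

    facRegs : FAC⁰Num k f → ℕ
    facRegs ((t , _) , (φ , _)) = 4 + (termRegs t + coreRegs (core φ))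

-- Polynomial bounds, and the binary notation of the input length.

module Polynomials where

  open Preliminaries
  open CoreFormulas

  -- The base `2 + n` is at least 2 even at n = 0, so that constants, sums and compositions are
  -- absorbed by raising the exponent alone.
  PolyBounded : (ℕ → ℕ) → Set
  PolyBounded f = Σ ℕ λ c → ∀ n → f n ≤ (2 + n) ^ c

  poly-id : PolyBounded (λ n → n)
  poly-id = 1 , λ n → subst (n ≤_) (sym (*-identityʳ (2 + n))) (m≤n+m n 2)

  k≤2^k : ∀ k → k ≤ 2 ^ k
  k≤2^k zero    = z≤n
  k≤2^k (suc k) = ≤-trans (+-mono-≤ (m^n>0 2 k) (k≤2^k k)) (≤-reflexive (cong (2 ^ k +_) (sym (+-identityʳ (2 ^ k)))))

  poly-const : ∀ k → PolyBounded (λ _ → k)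
  poly-const k = k , λ n → ≤-trans (k≤2^k k) (^-monoˡ-≤ k (m≤m+n 2 n))

  2*^≤ : ∀ n c → (2 + n) ^ c + (2 + n) ^ c ≤ (2 + n) ^ suc c
  2*^≤ n c = ≤-trans (≤-reflexive (cong ((2 + n) ^ c +_) (sym (+-identityʳ _)))) (*-monoˡ-≤ ((2 + n) ^ c) (m≤m+n 2 n))

  poly-+ : ∀ {f g} → PolyBounded f → PolyBounded g → PolyBounded (λ n → f n + g n)
  poly-+ (c , p) (d , q) = suc (c + d) , λ n → ≤-trans
    (+-mono-≤ (≤-trans (p n) (^-monoʳ-≤ (2 + n) (m≤m+n c d))) (≤-trans (q n) (^-monoʳ-≤ (2 + n) (m≤n+m d c))))
    (2*^≤ n (c + d))

  poly-* : ∀ {f g} → PolyBounded f → PolyBounded g → PolyBounded (λ n → f n * g n)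
  poly-* (c , p) (d , q) = c + d , λ n →
    ≤-trans (*-mono-≤ (p n) (q n)) (≤-reflexive (sym (^-distribˡ-+-* (2 + n) c d)))

  poly-∘ : ∀ {f g} → PolyBounded f → PolyBounded g → PolyBounded (λ n → f (g n))
  poly-∘ {f} {g} (c , p) (d , q) = suc (suc d) * c , λ n → begin
    f (g n)                       ≤⟨ p (g n) ⟩
    (2 + g n) ^ c                 ≤⟨ ^-monoˡ-≤ c (bound n) ⟩
    ((2 + n) ^ suc (suc d)) ^ c   ≡⟨ ^-*-assoc (2 + n) (suc (suc d)) c ⟩
    (2 + n) ^ (suc (suc d) * c)   ∎
    where
    open ≤-Reasoning
    bound : ∀ n → 2 + g n ≤ (2 + n) ^ suc (suc d)
    bound n = ≤-trans (+-mono-≤ (≤-trans (m≤m*n 2 ((2 + n) ^ d) {{>-nonZero (m^n>0 (2 + n) d)}}) (*-monoˡ-≤ ((2 + n) ^ d) (m≤m+n 2 n)))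
                                (≤-trans (q n) (^-monoʳ-≤ (2 + n) (n≤1+n d))))
                      (2*^≤ n (suc d))

  poly-^ : ∀ {f} → PolyBounded f → ∀ k → PolyBounded (λ n → f n ^ k)
  poly-^ pf zero    = poly-const 1
  poly-^ pf (suc k) = poly-* pf (poly-^ pf k)

  poly-≤ : ∀ {f g} → (∀ n → f n ≤ g n) → PolyBounded g → PolyBounded f
  poly-≤ le (c , p) = c , λ n → ≤-trans (le n) (p n)

  poly-termBound : ∀ {k} (t : Tm k) → PolyBounded (termBound t)
  poly-termBound (var i) = poly-id
  poly-termBound 𝟘       = poly-const 0
  poly-termBound 𝟙       = poly-const 1
  poly-termBound (s ⊕ t) = poly-+ (poly-termBound s) (poly-termBound t)
  poly-termBound (s ⊗ t) = poly-+ (poly-+ (poly-termBound s) (poly-termBound t)) (poly-* (poly-termBound s) (poly-termBound t))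

  poly-coreBound : ∀ {k} (φ : CF k) → PolyBounded (coreBound φ)
  poly-coreBound (eqᶜ s t)   = poly-+ (poly-termBound s) (poly-termBound t)
  poly-coreBound (nandᶜ φ ψ) = poly-+ (poly-coreBound φ) (poly-coreBound ψ)
  poly-coreBound (exᶜ t φ)   = poly-+ (poly-termBound t) (poly-∘ (poly-coreBound φ) (poly-+ poly-id (poly-termBound t)))

  poly-facBound : ∀ {k f} (u : FAC⁰Num k f) → PolyBounded (facBound u)
  poly-facBound ((t , _) , (φ , _)) =
    poly-+ (poly-termBound t) (poly-∘ (poly-coreBound (core φ)) (poly-+ poly-id (poly-termBound t)))

  bitValue : List Bool → ℕ
  bitValue []           = 0
  bitValue (true ∷ bs)  = 1 + bitValue bs * 2
  bitValue (false ∷ bs) = bitValue bs * 2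

  half≤ : ∀ m f → suc m ≤ suc f → suc m / 2 ≤ f
  half≤ m f (s≤s m≤f) = ≤-trans (s≤s⁻¹ (m/n<m (suc m) 2 (s≤s (s≤s z≤n)))) m≤f

  bitValue-bitsAux : ∀ f m → m ≤ f → bitValue (bitsAux f m) ≡ m
  bitValue-bitsAux zero    zero    _  = refl
  bitValue-bitsAux (suc f) zero    _  = refl
  bitValue-bitsAux (suc f) (suc m) le
    with suc m % 2 | m%n<n (suc m) 2 | m≡m%n+[m/n]*n (suc m) 2 | bitValue-bitsAux f (suc m / 2) (half≤ m f le)
  ... | 0 | _ | e | ih = trans (cong (_* 2) ih) (sym e)
  ... | 1 | _ | e | ih = trans (cong (λ z → 1 + z * 2) ih) (sym e)
  ... | suc (suc _) | s≤s (s≤s ()) | _ | _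

  bitValue-binary : ∀ n → bitValue (binary n) ≡ n
  bitValue-binary zero    = refl
  bitValue-binary (suc m) = bitValue-bitsAux (suc m) (suc m) ≤-refl

  -- Every bit after the first halves m, and the leading bit is 1; so k bits require m to be at
  -- least half of 2^k.
  2^length-bitsAux : ∀ f m → suc m ≤ f → 2 ^ length (bitsAux f (suc m)) ≤ 2 * suc m
  2^length-bitsAux (suc f) m le with suc m / 2 in eq
  ... | zero  = *-monoʳ-≤ 2 (subst (_≤ suc m) (sym (cong (λ bs → 2 ^ length bs) (empty f))) (s≤s z≤n))
    where
    empty : ∀ f → bitsAux f 0 ≡ []
    empty zero    = refl
    empty (suc f) = refl
  ... | suc h = *-monoʳ-≤ 2 (≤-trans (2^length-bitsAux f h (subst (_≤ f) eq (half≤ m f le)))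
                   (subst (λ z → 2 * z ≤ suc m) eq (subst (_≤ suc m) (*-comm (suc m / 2) 2) (m/n*n≤m (suc m) 2))))

  length-binary : ∀ n → length (binary n) ≤ suc ⌊log₂ n ⌋
  length-binary zero    = s≤s z≤n
  length-binary (suc m) = s≤s (subst (_≤ ⌊log₂ suc m ⌋) (⌊log₂[2^n]⌋≡n _)
    (⌊log₂⌋-mono-≤ {2 ^ length (bitsAux m (suc m / 2))} {suc m} (*-cancelˡ-≤ 2 (2^length-bitsAux (suc m) m ≤-refl))))

  length-binary>0 : ∀ n → Σ ℕ λ ℓ' → length (binary n) ≡ suc ℓ'
  length-binary>0 zero    = 0 , refl
  length-binary>0 (suc m) = _ , refl

-- Registers as tracks of the work tape: counters and their Hoare triples.

module Tracks (K' B' : ℕ) where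

  open Preliminaries
  open Structured
  open TC
  open Instr

  -- Beyond blank, '0' and '1' a symbol consists of one of four marks and of a digit below `B` on
  -- each of `K` tracks. The marks tell the first cell, with a flag, and the end from the cells in
  -- between.
  K B γ : ℕ
  K = suc K'
  B = suc (suc B')
  γ = 4 * B ^ K

  Sym : Set
  Sym = Fin (3 + γ)

  pattern mid   = zero
  pattern homeᶠ = suc zero
  pattern homeᵗ = suc (suc zero)
  pattern end   = suc (suc (suc zero))

  finToFun-funToFin : ∀ {m n} (f : Fin m → Fin n) i → finToFun (funToFin f) i ≡ f i
  finToFun-funToFin {suc m} f zero = cong proj₁ (remQuot-combine (f zero) (funToFin (λ j → f (suc j))))
  finToFun-funToFin {suc m} {n} f (suc i) =
    trans (cong (λ z → finToFun (proj₂ z) i) (remQuot-combine (f zero) (funToFin (λ j → f (suc j)))))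
          (finToFun-funToFin (λ j → f (suc j)) i)

  cell : Fin 4 → (Fin K → Fin B) → Sym
  cell m d = 3 ↑ʳ combine m (funToFin d)

  -- The symbols '0' and '1' of the initial tape are read as digits of track 0.
  mark : Sym → Fin 4
  mark (suc (suc (suc i))) = proj₁ (remQuot {4} (B ^ K) i)
  mark _                   = mid

  track : Sym → Fin K → Fin B
  track (suc (suc zero))    zero = suc zero
  track (suc (suc (suc i))) r    = finToFun (proj₂ (remQuot {4} (B ^ K) i)) r
  track _                   _    = zero

  mark-cell : ∀ m d → mark (cell m d) ≡ m
  mark-cell m d = cong proj₁ (remQuot-combine {4} {B ^ K} m (funToFin d))

  track-cell : ∀ m d r → track (cell m d) r ≡ d r
  track-cell m d r = trans (cong (λ z → finToFun (proj₂ z) r) (remQuot-combine {4} {B ^ K} m (funToFin d)))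
                           (finToFun-funToFin d r)

  digit : ℕ → Sym → ℕ
  digit r s = toℕ (track s (r mod K))

  setMark : Fin 4 → Sym → Sym
  setMark m s = cell m (track s)

  setTrack : Fin K → Fin B → (Fin K → Fin B) → Fin K → Fin B
  setTrack r v d r' with r' Fin.≟ r
  ... | yes _ = v
  ... | no _  = d r'

  setDigit : ℕ → ℕ → Sym → Sym
  setDigit r v s = cell (mark s) (setTrack (r mod K) (v mod B) (track s))

  mark-setMark : ∀ m s → mark (setMark m s) ≡ m
  mark-setMark m s = mark-cell m (track s)

  digit-setMark : ∀ r m s → digit r (setMark m s) ≡ digit r s
  digit-setMark r m s = cong toℕ (track-cell m (track s) (r mod K))

  mark-setDigit : ∀ r v s → mark (setDigit r v s) ≡ mark s
  mark-setDigit r v s = mark-cell (mark s) (setTrack (r mod K) (v mod B) (track s))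

  toℕ-mod : ∀ {m n} .{{_ : NonZero n}} → m < n → toℕ (m mod n) ≡ m
  toℕ-mod {m} {n} m<n = trans (toℕ-fromℕ< (m%n<n m n)) (m<n⇒m%n≡m m<n)

  digit-setDigit : ∀ r {v} s → v < B → digit r (setDigit r v s) ≡ v
  digit-setDigit r {v} s v<B rewrite track-cell (mark s) (setTrack (r mod K) (v mod B) (track s)) (r mod K)
    with (r mod K) Fin.≟ (r mod K)
  ... | yes _ = toℕ-mod v<B
  ... | no ne = ⊥-elim (ne refl)

  digit-setDigit-other : ∀ {r r'} v s → r < K → r' < K → r' ≢ r → digit r' (setDigit r v s) ≡ digit r' s
  digit-setDigit-other {r} {r'} v s r<K r'<K ne
    rewrite track-cell (mark s) (setTrack (r mod K) (v mod B) (track s)) (r' mod K)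
    with (r' mod K) Fin.≟ (r mod K)
  ... | yes e = ⊥-elim (ne (trans (sym (toℕ-mod r'<K)) (trans (cong toℕ e) (toℕ-mod r<K))))
  ... | no _  = refl

  -- The least significant digit is at cell 0, as in `binary`, so that a carry travels to the right.
  num : ℕ → (ℕ → ℕ) → ℕ → ℕ
  num β d zero    = 0
  num β d (suc m) = d 0 + num β (λ i → d (suc i)) m * β

  num-cong : ∀ β {d d'} m → (∀ i → i < m → d i ≡ d' i) → num β d m ≡ num β d' m
  num-cong β zero    e = refl
  num-cong β (suc m) e = cong₂ (λ a b → a + b * β) (e 0 z<s) (num-cong β m (λ i i<m → e (suc i) (s<s i<m)))

  num-zero : ∀ β {d} m → (∀ i → i < m → d i ≡ 0) → num β d m ≡ 0
  num-zero β zero    z = refl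
  num-zero β (suc m) z = cong₂ (λ a b → a + b * β) (z 0 z<s) (num-zero β m (λ i i<m → z (suc i) (s<s i<m)))

  first-diff : ∀ (d d' : ℕ → ℕ) m →
    (∀ i → i < m → d i ≡ d' i) ⊎ Σ ℕ λ k → k < m × (∀ i → i < k → d i ≡ d' i) × d k ≢ d' k
  first-diff d d' zero    = inj₁ λ i ()
  first-diff d d' (suc m) with d 0 ≟ d' 0
  ... | no ne = inj₂ (0 , z<s , (λ i ()) , ne)
  ... | yes e with first-diff (λ i → d (suc i)) (λ i → d' (suc i)) m
  ...   | inj₁ all = inj₁ λ { zero _ → e ; (suc i) (s≤s i<m) → all i i<m }
  ...   | inj₂ (k , k<m , same , ne) =
    inj₂ (suc k , s<s k<m , (λ { zero _ → e ; (suc i) (s≤s i<k) → same i i<k }) , ne)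

  num-injective : ∀ β .{{_ : NonZero β}} {d d'} m → (∀ i → i < m → d i < β) → (∀ i → i < m → d' i < β) →
    num β d m ≡ num β d' m → ∀ i → i < m → d i ≡ d' i
  num-injective β {d} {d'} (suc m) b b' e i i<m = go i i<m
    where
    low : d 0 ≡ d' 0
    low = trans (sym (digit-% (num β (λ i → d (suc i)) m) (b 0 z<s))) (trans (cong (_% β) e) (digit-% (num β (λ i → d' (suc i)) m) (b' 0 z<s)))
    high : num β (λ i → d (suc i)) m ≡ num β (λ i → d' (suc i)) m
    high = trans (sym (digit-/ (num β (λ i → d (suc i)) m) (b 0 z<s))) (trans (cong (_/ β) e) (digit-/ (num β (λ i → d' (suc i)) m) (b' 0 z<s)))
    go : ∀ i → i < suc m → d i ≡ d' i
    go zero    _         = low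
    go (suc i) (s≤s i<m) = num-injective β m (λ i i<m → b (suc i) (s<s i<m)) (λ i i<m → b' (suc i) (s<s i<m)) high i i<m

  -- Here k is the place where the carry stops. A number whose successor still has m digits cannot
  -- consist of maximal digits only, so this place exists.
  num-suc : ∀ β (d : ℕ → ℕ) m → suc (num (suc β) d m) < suc β ^ m →
    Σ ℕ λ k → k < m × (∀ i → i < k → d i ≡ β) × d k ≢ β ×
    (∀ d' → (∀ i → i < k → d' i ≡ 0) → d' k ≡ suc (d k) → (∀ i → k < i → i < m → d' i ≡ d i) →
     num (suc β) d' m ≡ suc (num (suc β) d m))
  num-suc β d zero    (s≤s ())
  num-suc β d (suc m) lt with d 0 ≟ β
  ... | no ne = 0 , z<s , (λ i ()) , ne , λ d' z s r →
    cong₂ (λ a b → a + b * suc β) s (num-cong (suc β) m (λ i i<m → r (suc i) z<s (s<s i<m)))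
  ... | yes e with num-suc β (λ i → d (suc i)) m
       (*-cancelʳ-< (suc β) _ _ (subst₂ _<_ (cong (λ z → suc (z + num (suc β) (λ i → d (suc i)) m * suc β)) e)
                                          (*-comm (suc β) (suc β ^ m)) lt))
  ...   | k , k<m , full , ne , res = suc k , s<s k<m , full' , ne , λ d' z s r →
    let h = res (λ i → d' (suc i)) (λ i i<k → z (suc i) (s<s i<k)) s
                (λ i k<i i<m → r (suc i) (s<s k<i) (s<s i<m))
    in trans (cong₂ (λ a b → a + b * suc β) (z 0 z<s) h)
             (cong (λ z → suc (z + num (suc β) (λ i → d (suc i)) m * suc β)) (sym e))
    where
    full' : ∀ i → i < suc k → d i ≡ β
    full' zero    _         = e
    full' (suc i) (s≤s i<k) = full i i<k

  scanR : (Sym → Bool) → (Sym → Sym) → SP γ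
  scanR p f = while p (act (instr f right stay stay stay noop))

  notHome : Sym → Bool
  notHome s with mark s
  ... | homeᶠ = false
  ... | homeᵗ = false
  ... | mid   = true
  ... | end   = true

  goHome : SP γ
  goHome = while notHome (act (instr (λ s → s) left stay stay stay noop))

  module _ {x : List Bool} {S : ℕ} where

    exec-scanR : ∀ p f m (c : TC γ) → wpos c + m < S →
      (∀ i → wpos c ≤ i → i < wpos c + m → p (work c i) ≡ true) → p (work c (wpos c + m)) ≡ false →
      Σ (TC γ) λ c' → Exec x S (scanR p f) c c' × wpos c' ≡ wpos c + m × io c' ≡ io c ×
        (∀ i → wpos c ≤ i → i < wpos c + m → work c' i ≡ f (work c i)) ×
        (∀ i → i < wpos c ⊎ wpos c + m ≤ i → work c' i ≡ work c i)
    exec-scanR p f zero c b t e rewrite +-identityʳ (wpos c) =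
      _ , stop b e , refl , refl , (λ i l r → ⊥-elim (<⇒≱ r l)) , (λ i _ → upd-self (work c) (wpos c) i)
    exec-scanR p f (suc m) c b t e
      with exec-scanR p f m c₁ (subst (_< S) (+-suc (wpos c) m) b)
             (λ i l r → trans (cong p (far i (>⇒≢ l))) (t i (<⇒≤ l) (subst (i <_) (sym (+-suc (wpos c) m)) r)))
             (trans (cong p (far _ (>⇒≢ (s≤s (m≤m+n (wpos c) m)))))
                    (trans (cong (λ z → p (work c z)) (sym (+-suc (wpos c) m))) e))
      where
      a = instr f right stay stay stay noop
      c₁ = actTC x a (actTC x idle c)
      far : ∀ i → i ≢ wpos c → work c₁ i ≡ work c i
      far i ne = trans (upd-other _ _ ne) (upd-other _ _ ne)
    ... | c' , ex , ps , same , done , rest =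
      c' , again (≤-<-trans (m≤m+n _ _) b) (t (wpos c) ≤-refl (m<m+n (wpos c) z<s)) (act (≤-<-trans (m≤m+n _ _) b)) ex
         , trans ps (sym (+-suc (wpos c) m)) , same
         , done' , rest'
      where
      w₀ = upd (work c) (wpos c) (work c (wpos c))
      done' : ∀ i → wpos c ≤ i → i < wpos c + suc m → work c' i ≡ f (work c i)
      done' i l r with m≤n⇒m<n∨m≡n l
      ... | inj₁ l' = trans (done i l' (subst (i <_) (+-suc (wpos c) m) r))
                            (cong f (trans (upd-other _ _ (>⇒≢ l')) (upd-other _ _ (>⇒≢ l'))))
      ... | inj₂ refl = trans (rest i (inj₁ ≤-refl))
                              (trans (upd-same w₀ (wpos c) _) (cong f (upd-same (work c) (wpos c) _)))
      rest' : ∀ i → i < wpos c ⊎ wpos c + suc m ≤ i → work c' i ≡ work c i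
      rest' i (inj₁ l) = trans (rest i (inj₁ (m<n⇒m<1+n l))) (trans (upd-other _ _ (<⇒≢ l)) (upd-other _ _ (<⇒≢ l)))
      rest' i (inj₂ r) = trans (rest i (inj₂ (subst (_≤ i) (+-suc (wpos c) m) r)))
                               (trans (upd-other _ _ (>⇒≢ l)) (upd-other _ _ (>⇒≢ l)))
        where
        l : wpos c < i
        l = ≤-trans (s≤s (m≤m+n (wpos c) m)) (subst (_≤ i) (+-suc (wpos c) m) r)

    exec-goHome : ∀ m (c : TC γ) → wpos c ≡ m → m < S →
      (∀ i → 0 < i → i ≤ m → notHome (work c i) ≡ true) → notHome (work c 0) ≡ false →
      Σ (TC γ) λ c' → Exec x S goHome c c' × wpos c' ≡ 0 × io c' ≡ io c × (∀ i → work c' i ≡ work c i)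
    exec-goHome zero (mkTC w .0 o) refl b t e = _ , stop b e , refl , refl , upd-self w 0
    exec-goHome (suc m) c@(mkTC w .(suc m) o) refl b t e
      with exec-goHome m c₁ refl (<⇒≤ b) (λ i l r → trans (cong notHome (same i)) (t i l (m≤n⇒m≤1+n r)))
                         (trans (cong notHome (same 0)) e)
      where
      c₁ = actTC x (instr (λ s → s) left stay stay stay noop) (actTC x idle c)
      same : ∀ i → work c₁ i ≡ w i
      same i = trans (upd-self (upd w (suc m) (w (suc m))) (suc m) i) (upd-self w (suc m) i)
    ... | c' , ex , ps , io= , same' =
      c' , again b (t (suc m) z<s ≤-refl) (act b) ex , ps , io= ,
      λ i → trans (same' i) (trans (upd-self (upd w (suc m) (w (suc m))) (suc m) i) (upd-self w (suc m) i))

  -- Tracks 0 and 1 are binary because track 0 takes over the digits found on the initial tape, and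
  -- track 1 is compared with it. Going through the predecessor makes every base positive by
  -- definition.
  pbase base : ℕ → ℕ
  pbase 0             = 1
  pbase 1             = 1
  pbase (suc (suc _)) = suc B'
  base r = suc (pbase r)

  base≤B : ∀ r → base r ≤ B
  base≤B 0             = s≤s (s≤s z≤n)
  base≤B 1             = s≤s (s≤s z≤n)
  base≤B (suc (suc _)) = ≤-refl

  -- The answer to a test is kept in the mark of the first cell, where `ifEq` and `whileNe` look it
  -- up.
  homeMark : Bool → Fin 4
  homeMark false = homeᶠ
  homeMark true  = homeᵗ

  notEnd : Sym → Bool
  notEnd s with mark s
  ... | end = false
  ... | _   = true

  flagged : Sym → Bool
  flagged s with mark s
  ... | homeᵗ = true
  ... | _     = false

  clear inc : ℕ → SP γ
  clear r = seq (scanR notEnd (setDigit r 0)) goHome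
  inc r = seq (scanR (λ s → digit r s ≡ᵇ pbase r) (setDigit r 0))
              (seq (act (instr (λ s → setDigit r (suc (digit r s)) s) stay stay stay stay noop)) goHome)

  setFlag : Bool → SP γ
  setFlag b = seq goHome (act (instr (setMark (homeMark b)) stay stay stay stay noop))

  -- The scan stops at the first difference or at the end; the mark of the cell where it stopped
  -- tells which of the two happened.
  test : ℕ → ℕ → SP γ
  test r s = seq (scanR (λ a → notEnd a ∧ (digit r a ≡ᵇ digit s a)) (λ a → a))
                 (ite notEnd (setFlag false) (setFlag true))

  -- Opaque, so that the unifier can read off the arguments of an assignment.
  opaque
    assign : (ℕ → ℕ) → ℕ → ℕ → (ℕ → ℕ)
    assign = upd

    assign-same : ∀ f i a → assign f i a i ≡ a
    assign-same = upd-same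

    assign-other : ∀ f {i j} a → j ≢ i → assign f i a j ≡ f j
    assign-other f = upd-other f

  assign-below : ∀ f {i j} a → j < i → assign f i a j ≡ f j
  assign-below f a j<i = assign-other f a (<⇒≢ j<i)

  record HState : Set where
    constructor mkH
    field
      regs : ℕ → ℕ
      flag : Bool
      hio  : IO
  open HState

  module Triples (x : List Bool) (ℓ' : ℕ) where

    ℓ : ℕ
    ℓ = suc ℓ'

    -- Inside a routine the head may be anywhere; between routines `p` is 0. The field `small` makes
    -- the digits of a register unique, which `tr-test` relies on when it infers unequal values from
    -- unequal digits.
    record RepAt (p : ℕ) (h : HState) (c : TC γ) : Set where
      constructor mkRep
      field
        at    : wpos c ≡ p
        m0    : mark (work c 0) ≡ homeMark (flag h)
        mids  : ∀ i → 0 < i → i < ℓ → mark (work c i) ≡ mid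
        mend  : mark (work c ℓ) ≡ end
        small : ∀ r → r < K → ∀ i → i < ℓ → digit r (work c i) < base r
        vals  : ∀ r → r < K → num (base r) (λ i → digit r (work c i)) ℓ ≡ regs h r
        io≡   : io c ≡ hio h

    Exc : SP γ → TC γ → TC γ → Set
    Exc = Exec x (suc ℓ)

    rep-cong : ∀ {p p' h c c'} → RepAt p h c → wpos c' ≡ p' → io c' ≡ io c → (∀ i → work c' i ≡ work c i) →
      RepAt p' h c'
    rep-cong (mkRep at m0 mids mend small vals io≡) p io' w = mkRep p
      (trans (cong mark (w 0)) m0)
      (λ i l r → trans (cong mark (w i)) (mids i l r))
      (trans (cong mark (w ℓ)) mend)
      (λ r r<K i i<ℓ → subst (_< base r) (cong (digit r) (sym (w i))) (small r r<K i i<ℓ))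
      (λ r r<K → trans (num-cong (base r) ℓ (λ i i<ℓ → cong (digit r) (w i))) (vals r r<K))
      (trans io' io≡)

    notEnd-true : ∀ s → mark s ≢ end → notEnd s ≡ true
    notEnd-true s ne with mark s
    ... | mid   = refl
    ... | homeᶠ = refl
    ... | homeᵗ = refl
    ... | end   = ⊥-elim (ne refl)

    notEnd-false : ∀ s → mark s ≡ end → notEnd s ≡ false
    notEnd-false s e rewrite e = refl

    rep-notEnd : ∀ {p h c} → RepAt p h c → ∀ i → i < ℓ → notEnd (work c i) ≡ true
    rep-notEnd {h = h} {c} R zero i<ℓ = notEnd-true (work c 0) λ e → home≢end (flag h) (trans (sym (RepAt.m0 R)) e)
      where
      home≢end : ∀ b → homeMark b ≢ end
      home≢end false ()
      home≢end true ()
    rep-notEnd {c = c} R (suc i) i<ℓ = notEnd-true (work c (suc i)) λ e → mid≢end (trans (sym (RepAt.mids R (suc i) z<s i<ℓ)) e)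
      where
      mid≢end : _≢_ {A = Fin 4} mid end
      mid≢end ()

    rep-goHome : ∀ {p h c} → RepAt p h c → p ≤ ℓ → Σ (TC γ) λ c' → Exc goHome c c' × RepAt 0 h c'
    rep-goHome {p} {h} {c} R p≤ℓ with exec-goHome p c (RepAt.at R) (s≤s p≤ℓ) away home
      where
      away : ∀ i → 0 < i → i ≤ p → notHome (work c i) ≡ true
      away i l r with m≤n⇒m<n∨m≡n (≤-trans r p≤ℓ)
      ... | inj₁ i<ℓ rewrite RepAt.mids R i l i<ℓ = refl
      ... | inj₂ refl rewrite RepAt.mend R = refl
      home : notHome (work c 0) ≡ false
      home with flag h | RepAt.m0 R
      ... | false | e rewrite e = refl
      ... | true  | e rewrite e = refl
    ... | c' , ex , ps , io' , w = c' , ex , rep-cong R ps io' w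

    setReg : ℕ → ℕ → HState → HState
    setReg r v h = mkH (assign (regs h) r v) (flag h) (hio h)

    rep-setReg : ∀ {p p' r v h c c'} → r < K → RepAt p h c → wpos c' ≡ p' → io c' ≡ io c →
      (∀ i → mark (work c' i) ≡ mark (work c i)) →
      (∀ r' → r' < K → r' ≢ r → ∀ i → digit r' (work c' i) ≡ digit r' (work c i)) →
      (∀ i → i < ℓ → digit r (work c' i) < base r) →
      num (base r) (λ i → digit r (work c' i)) ℓ ≡ v → RepAt p' (setReg r v h) c'
    rep-setReg {r = r} {v} {h} {c} {c'} r<K R ps io' ms others sm val = mkRep ps
      (trans (ms 0) (RepAt.m0 R)) (λ i l u → trans (ms i) (RepAt.mids R i l u)) (trans (ms ℓ) (RepAt.mend R))
      sm' vals' (trans io' (RepAt.io≡ R))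
      where
      sm' : ∀ r' → r' < K → ∀ i → i < ℓ → digit r' (work c' i) < base r'
      sm' r' r'<K i i<ℓ with r' ≟ r
      ... | yes refl = sm i i<ℓ
      ... | no ne = subst (_< base r') (sym (others r' r'<K ne i)) (RepAt.small R r' r'<K i i<ℓ)
      vals' : ∀ r' → r' < K → num (base r') (λ i → digit r' (work c' i)) ℓ ≡ assign (regs h) r v r'
      vals' r' r'<K with r' ≟ r
      ... | yes refl = trans val (sym (assign-same (regs h) r v))
      ... | no ne = trans (num-cong (base r') ℓ (λ i _ → others r' r'<K ne i))
                          (trans (RepAt.vals R r' r'<K) (sym (assign-other (regs h) v ne)))

    -- Total correctness in the style of weakest preconditions: a triple for `seq` is a triple whose
    -- postcondition is again a triple, so a correctness proof has the shape of its program.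
    Tr : SP γ → HState → (HState → Set) → Set
    Tr P h Φ = ∀ c → RepAt 0 h c → Σ (TC γ) λ c' → Σ HState λ h' → Exc P c c' × RepAt 0 h' c' × Φ h'

    tr-seq : ∀ {P Q h Φ} → Tr P h (λ h' → Tr Q h' Φ) → Tr (seq P Q) h Φ
    tr-seq tP c R with tP c R
    ... | c₁ , h₁ , ex , R₁ , tQ with tQ c₁ R₁
    ... | c₂ , h₂ , ex' , R₂ , φ = c₂ , h₂ , seq ex ex' , R₂ , φ

    tr-post : ∀ {P h Φ Ψ} → Tr P h Φ → (∀ h' → Φ h' → Ψ h') → Tr P h Ψ
    tr-post t f c R with t c R
    ... | c₁ , h₁ , ex , R₁ , φ = c₁ , h₁ , ex , R₁ , f h₁ φ

    tr-clear : ∀ r h (Φ : HState → Set) → r < K → Φ (setReg r 0 h) → Tr (clear r) h Φ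
    tr-clear r h Φ r<K φ c R@(mkRep refl _ _ mend small _ _)
      with exec-scanR {x} {suc ℓ} notEnd (setDigit r 0) ℓ c ≤-refl
             (λ i _ i<ℓ → rep-notEnd R i i<ℓ) (notEnd-false (work c ℓ) mend)
    ... | c₁ , ex , ps , io' , done , rest
      with rep-goHome {h = setReg r 0 h} (rep-setReg r<K R ps io' marks others sm zs) ≤-refl
      where
      marks : ∀ i → mark (work c₁ i) ≡ mark (work c i)
      marks i with i <? ℓ
      ... | yes i<ℓ = trans (cong mark (done i z≤n i<ℓ)) (mark-setDigit r 0 (work c i))
      ... | no i≮ℓ = cong mark (rest i (inj₂ (≮⇒≥ i≮ℓ)))
      others : ∀ r' → r' < K → r' ≢ r → ∀ i → digit r' (work c₁ i) ≡ digit r' (work c i)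
      others r' r'<K ne i with i <? ℓ
      ... | yes i<ℓ = trans (cong (digit r') (done i z≤n i<ℓ)) (digit-setDigit-other 0 (work c i) r<K r'<K ne)
      ... | no i≮ℓ = cong (digit r') (rest i (inj₂ (≮⇒≥ i≮ℓ)))
      z : ∀ i → i < ℓ → digit r (work c₁ i) ≡ 0
      z i i<ℓ = trans (cong (digit r) (done i z≤n i<ℓ)) (digit-setDigit r (work c i) z<s)
      sm : ∀ i → i < ℓ → digit r (work c₁ i) < base r
      sm i i<ℓ = subst (_< base r) (sym (z i i<ℓ)) z<s
      zs = num-zero (base r) ℓ z
    ... | c₂ , ex' , R₂ = c₂ , _ , seq ex ex' , R₂ , φ

    -- That the successor fits into ℓ digits keeps the carry from running into the end mark.
    tr-inc : ∀ r h (Φ : HState → Set) → r < K → suc (regs h r) < base r ^ ℓ →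
      Φ (setReg r (suc (regs h r)) h) → Tr (inc r) h Φ
    tr-inc r h Φ r<K fits φ c R@(mkRep refl _ _ mend small vals _)
      with num-suc (pbase r) (λ i → digit r (work c i)) ℓ
             (subst (λ z → suc z < base r ^ ℓ) (sym (vals r r<K)) fits)
    ... | k , k<ℓ , full , ne , next-num
      with exec-scanR {x} {suc ℓ} (λ s → digit r s ≡ᵇ pbase r) (setDigit r 0) k c (m<n⇒m<1+n k<ℓ)
             (λ i _ i<k → trans (cong (_≡ᵇ pbase r) (full i i<k)) (≡ᵇ-refl (pbase r))) (≢⇒≡ᵇ-false ne)
    ... | c₁ , ex , ps , io' , done , rest =
      let c₃ , ex' , R₃ = rep-goHome {h = setReg r (suc (regs h r)) h}
             (rep-setReg {c' = c₂} r<K R ps io' marks others sm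
               (trans (next-num (λ i → digit r (work c₂ i)) low atk high) (cong suc (vals r r<K))))
             (<⇒≤ k<ℓ)
      in c₃ , _ , seq ex (seq (act (subst (_< suc ℓ) (sym ps) (m<n⇒m<1+n k<ℓ))) ex') , R₃ , φ
      where
      f = λ s → setDigit r (suc (digit r s)) s
      c₂ = actTC x (instr f stay stay stay stay noop) c₁
      w-k : work c₂ k ≡ f (work c k)
      w-k = trans (cong (work c₂) (sym ps)) (trans (upd-same (work c₁) (wpos c₁) _)
                  (cong f (trans (cong (work c₁) ps) (rest k (inj₂ ≤-refl)))))
      w-lo : ∀ i → i < k → work c₂ i ≡ setDigit r 0 (work c i)
      w-lo i i<k = trans (upd-other (work c₁) _ (λ e → <⇒≢ i<k (trans e ps))) (done i z≤n i<k)
      w-hi : ∀ i → k < i → work c₂ i ≡ work c i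
      w-hi i k<i = trans (upd-other (work c₁) _ (λ e → >⇒≢ k<i (trans e ps))) (rest i (inj₂ (<⇒≤ k<i)))
      dk<pb : digit r (work c k) < pbase r
      dk<pb = ≤∧≢⇒< (s≤s⁻¹ (small r r<K k k<ℓ)) ne
      marks : ∀ i → mark (work c₂ i) ≡ mark (work c i)
      marks i with <-cmp i k
      ... | tri< l _ _ = trans (cong mark (w-lo i l)) (mark-setDigit r 0 (work c i))
      ... | tri≈ _ refl _ = trans (cong mark w-k) (mark-setDigit r (suc (digit r (work c k))) (work c k))
      ... | tri> _ _ g = cong mark (w-hi i g)
      others : ∀ r' → r' < K → r' ≢ r → ∀ i → digit r' (work c₂ i) ≡ digit r' (work c i)
      others r' r'<K ne i with <-cmp i k
      ... | tri< l _ _ = trans (cong (digit r') (w-lo i l)) (digit-setDigit-other 0 (work c i) r<K r'<K ne)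
      ... | tri≈ _ refl _ = trans (cong (digit r') w-k) (digit-setDigit-other (suc (digit r (work c k))) (work c k) r<K r'<K ne)
      ... | tri> _ _ g = cong (digit r') (w-hi i g)
      low : ∀ i → i < k → digit r (work c₂ i) ≡ 0
      low i i<k = trans (cong (digit r) (w-lo i i<k)) (digit-setDigit r (work c i) z<s)
      atk : digit r (work c₂ k) ≡ suc (digit r (work c k))
      atk = trans (cong (digit r) w-k) (digit-setDigit r (work c k) (≤-trans (s≤s dk<pb) (base≤B r)))
      high : ∀ i → k < i → i < ℓ → digit r (work c₂ i) ≡ digit r (work c i)
      high i k<i _ = cong (digit r) (w-hi i k<i)
      sm : ∀ i → i < ℓ → digit r (work c₂ i) < base r
      sm i i<ℓ with <-cmp i k
      ... | tri< l _ _ = subst (_< base r) (sym (low i l)) z<s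
      ... | tri≈ _ refl _ = subst (_< base r) (sym atk) (s≤s dk<pb)
      ... | tri> _ _ g = subst (_< base r) (sym (high i g i<ℓ)) (small r r<K i i<ℓ)

    setFl : Bool → HState → HState
    setFl b h = mkH (regs h) b (hio h)

    exec-setFlag : ∀ {p h c} b → RepAt p h c → p ≤ ℓ → Σ (TC γ) λ c' → Exc (setFlag b) c c' × RepAt 0 (setFl b h) c'
    exec-setFlag {p} {h} {c} b R p≤ℓ with rep-goHome R p≤ℓ
    ... | c₁@(mkTC w .0 o) , ex , mkRep refl m0 mids mend small vals io≡ = c₂ , seq ex (act z<s) , mkRep refl
      (trans (cong mark w0) (mark-setMark (homeMark b) (w 0)))
      (λ { (suc i) l r → mids (suc i) l r }) mend
      (λ r r<K i i<ℓ → subst (_< base r) (sym (same r i)) (small r r<K i i<ℓ))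
      (λ r r<K → trans (num-cong (base r) ℓ (λ i _ → same r i)) (vals r r<K)) io≡
      where
      c₂ = actTC x (instr (setMark (homeMark b)) stay stay stay stay noop) c₁
      w0 : work c₂ 0 ≡ setMark (homeMark b) (w 0)
      w0 = refl
      same : ∀ r i → digit r (work c₂ i) ≡ digit r (w i)
      same r zero = digit-setMark r (homeMark b) (w 0)
      same r (suc i) = refl

    -- Digits are compared, not values, hence the requirement that both tracks have the same base.
    tr-test : ∀ r s h (Φ : HState → Set) → r < K → s < K → base r ≡ base s →
      (regs h r ≡ regs h s → Φ (setFl true h)) → (regs h r ≢ regs h s → Φ (setFl false h)) → Tr (test r s) h Φ
    tr-test r s h Φ r<K s<K b= eq neq c R@(mkRep refl _ _ mend small vals _)
      with first-diff (λ i → digit r (work c i)) (λ i → digit s (work c i)) ℓ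
    ... | inj₁ all
      with exec-scanR {x} {suc ℓ} (λ a → notEnd a ∧ (digit r a ≡ᵇ digit s a)) (λ a → a) ℓ c ≤-refl
             (λ i _ i<ℓ → cong₂ _∧_ (rep-notEnd R i i<ℓ)
                            (trans (cong (digit r (work c i) ≡ᵇ_) (sym (all i i<ℓ))) (≡ᵇ-refl (digit r (work c i)))))
             (cong (_∧ (digit r (work c ℓ) ≡ᵇ digit s (work c ℓ))) (notEnd-false (work c ℓ) mend))
    ...   | c₁ , ex , ps , io' , done , rest =
      let c₂ , ex' , R₂ = exec-setFlag true (rep-cong {p' = ℓ} {c' = actTC x idle c₁} R ps io'
               (λ i → trans (upd-self (work c₁) (wpos c₁) i) (same i))) ≤-refl
      in c₂ , _ , seq ex (ite-f (subst (_< suc ℓ) (sym ps) ≤-refl)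
                             (trans (cong notEnd (trans (cong (work c₁) ps) (rest ℓ (inj₂ ≤-refl)))) (notEnd-false (work c ℓ) mend)) ex')
         , R₂ , eq (trans (sym (vals r r<K)) (trans (num-cong (base r) ℓ all)
                     (trans (cong (λ z → num z (λ i → digit s (work c i)) ℓ) b=) (vals s s<K))))
      where
      same : ∀ i → work c₁ i ≡ work c i
      same i with i <? ℓ
      ... | yes i<ℓ = done i z≤n i<ℓ
      ... | no i≮ℓ = rest i (inj₂ (≮⇒≥ i≮ℓ))
    tr-test r s h Φ r<K s<K b= eq neq c R@(mkRep refl _ _ mend small vals _)
        | inj₂ (k , k<ℓ , all , ne)
      with exec-scanR {x} {suc ℓ} (λ a → notEnd a ∧ (digit r a ≡ᵇ digit s a)) (λ a → a) k c (m<n⇒m<1+n k<ℓ)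
             (λ i _ i<k → cong₂ _∧_ (rep-notEnd R i (<-trans i<k k<ℓ))
                            (trans (cong (digit r (work c i) ≡ᵇ_) (sym (all i i<k))) (≡ᵇ-refl (digit r (work c i)))))
             (cong₂ _∧_ (rep-notEnd R k k<ℓ) (≢⇒≡ᵇ-false ne))
    ... | c₁ , ex , ps , io' , done , rest =
      let c₂ , ex' , R₂ = exec-setFlag false (rep-cong {p' = k} {c' = actTC x idle c₁} R ps io'
               (λ i → trans (upd-self (work c₁) (wpos c₁) i) (same i))) (<⇒≤ k<ℓ)
      in c₂ , _ , seq ex (ite-t (subst (_< suc ℓ) (sym ps) (m<n⇒m<1+n k<ℓ))
                             (trans (cong notEnd (trans (cong (work c₁) ps) (rest k (inj₂ ≤-refl)))) (rep-notEnd R k k<ℓ)) ex')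
         , R₂ , neq (λ e → ne (num-injective (base r) ℓ (small r r<K)
                       (λ i i<ℓ → subst (digit s (work c i) <_) (sym b=) (small s s<K i i<ℓ))
                       (trans (vals r r<K) (trans e (trans (sym (vals s s<K)) (cong (λ z → num z (λ i → digit s (work c i)) ℓ) (sym b=))))) k k<ℓ))
      where
      same : ∀ i → work c₁ i ≡ work c i
      same i with i <? k
      ... | yes i<k = done i z≤n i<k
      ... | no i≮k = rest i (inj₂ (≮⇒≥ i≮k))

  -- Evaluating terms and formulas by counting and exhaustive search.

  open CoreFormulas

  skip : SP γ
  skip = act idle

  device : Move → Move → Move → IOp → SP γ
  device i m₁ m₂ o = act (instr (λ s → s) stay i m₁ m₂ o)

  whileNe : ℕ → ℕ → SP γ → SP γ
  whileNe r s P = seq (test r s) (while (λ a → not (flagged a)) (seq P (test r s)))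

  ifEq : ℕ → ℕ → SP γ → SP γ → SP γ
  ifEq r s P Q = seq (test r s) (ite flagged P Q)

  for : ℕ → ℕ → SP γ → SP γ
  for i s P = seq (clear i) (whileNe i s (seq P (inc i)))

  -- Tracks 0 and 1 hold binary numbers, so the register with index r is track 2 + r.
  R : ℕ → ℕ
  R r = suc (suc r)

  -- Counting is the only arithmetic available: a sum is an iterated successor, a product a nested
  -- iteration. The variables live in registers below d, the result goes to d, and everything above
  -- d is scratch space.
  evalTerm : ∀ {k} → Tm k → Vec ℕ k → ℕ → SP γ
  -- The counter of a loop with empty body ends at the value of the limit, which makes it a copy.
  evalTerm (var i) env d = for (R d) (R (lookup env i)) skip
  evalTerm 𝟘 env d       = clear (R d)
  evalTerm 𝟙 env d       = seq (clear (R d)) (inc (R d))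
  evalTerm (s ⊕ t) env d =
    seq (evalTerm s env d) (seq (evalTerm t env (1 + d)) (for (R (2 + d)) (R (1 + d)) (inc (R d))))
  evalTerm (s ⊗ t) env d =
    seq (evalTerm s env (1 + d)) (seq (evalTerm t env (2 + d)) (seq (clear (R d))
      (for (R (3 + d)) (R (1 + d)) (for (R (4 + d)) (R (2 + d)) (inc (R d))))))

  setOne : ℕ → SP γ
  setOne d = seq (clear (R d)) (inc (R d))

  -- Register 1 + d holds the limit, 2 + d the candidate, 3 + d the truth value and 4 + d a zero to
  -- compare it with. The limit is increased once because `for` excludes its limit, whereas a
  -- bounded quantifier includes it.
  search : ∀ {k} → Tm k → (Vec ℕ (suc k) → ℕ → SP γ) → Vec ℕ k → ℕ → SP γ → SP γ
  search t P env d hit =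
    seq (evalTerm t env (1 + d)) (seq (inc (R (1 + d))) (seq (clear (R d))
      (for (R (2 + d)) (R (1 + d))
        (seq (P ((2 + d) ∷ env) (3 + d)) (seq (clear (R (4 + d))) (ifEq (R (3 + d)) (R (4 + d)) skip hit))))))

  evalCore : ∀ {k} → CF k → Vec ℕ k → ℕ → SP γ
  evalCore (eqᶜ s t) env d =
    seq (evalTerm s env (1 + d)) (seq (evalTerm t env (2 + d)) (seq (clear (R d))
      (ifEq (R (1 + d)) (R (2 + d)) (inc (R d)) skip)))
  evalCore (nandᶜ φ ψ) env d =
    seq (evalCore φ env (1 + d)) (seq (evalCore ψ env (2 + d)) (seq (clear (R (3 + d))) (seq (clear (R d))
      (ifEq (R (1 + d)) (R (3 + d)) (inc (R d)) (ifEq (R (2 + d)) (R (3 + d)) (inc (R d)) skip)))))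
  evalCore (exᶜ t φ) env d = search t (evalCore φ) env d (setOne d)

  evalFun : ∀ {k} → Tm k → CF (suc k) → Vec ℕ k → ℕ → SP γ
  evalFun t φ env d = search t (evalCore φ) env d (for (R d) (R (2 + d)) skip)

  num<^ : ∀ β (d : ℕ → ℕ) m → (∀ i → i < m → d i < suc β) → num (suc β) d m < suc β ^ m
  num<^ β d zero    b = z<s
  num<^ β d (suc m) b = begin-strict
    d 0 + n * suc β       <⟨ +-monoˡ-< (n * suc β) (b 0 z<s) ⟩
    suc n * suc β         ≤⟨ *-monoˡ-≤ (suc β) (num<^ β (λ i → d (suc i)) m (λ i i<m → b (suc i) (s<s i<m))) ⟩
    suc β ^ m * suc β     ≡⟨ *-comm (suc β ^ m) (suc β) ⟩
    suc β ^ suc m         ∎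
    where
    open ≤-Reasoning
    n = num (suc β) (λ i → d (suc i)) m

  module Rules (x : List Bool) (ℓ' : ℕ) where

    open Triples x ℓ' public

    flagged-home : ∀ {h c} → RepAt 0 h c → flagged (scanned c) ≡ flag h
    flagged-home {h} {c} (mkRep refl m0 _ _ _ _ _) with flag h
    ... | false rewrite m0 = refl
    ... | true  rewrite m0 = refl

    rep-idle : ∀ {h c} → RepAt 0 h c → RepAt 0 h (actTC x idle c)
    rep-idle {c = c} r = rep-cong r (RepAt.at r) refl (λ i → upd-self (work c) (wpos c) i)

    wpos-ok : ∀ {h c} → RepAt 0 h c → wpos c < suc ℓ
    wpos-ok (mkRep refl _ _ _ _ _ _) = z<s

    reg< : ∀ {h c r} → RepAt 0 h c → r < K → regs h r < base r ^ ℓ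
    reg< {r = r} rep r<K = subst (_< base r ^ ℓ) (RepAt.vals rep r r<K)
                                 (num<^ (pbase r) _ ℓ (RepAt.small rep r r<K))

    tr-device : ∀ i m₁ m₂ o h (Φ : HState → Set) →
      Φ (mkH (regs h) (flag h) (actIO x (instr {γ} (λ s → s) stay i m₁ m₂ o) (hio h))) → Tr (device i m₁ m₂ o) h Φ
    tr-device i m₁ m₂ o h Φ φ c rep@(mkRep at m0 mids mend small vals refl) =
      _ , _ , act (wpos-ok rep) ,
      mkRep at (trans (cong mark (same 0)) m0) (λ i l r → trans (cong mark (same i)) (mids i l r))
            (trans (cong mark (same ℓ)) mend)
            (λ r r<K i i<ℓ → subst (_< base r) (cong (digit r) (sym (same i))) (small r r<K i i<ℓ))
            (λ r r<K → trans (num-cong (base r) ℓ (λ i i<ℓ → cong (digit r) (same i))) (vals r r<K))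
            refl , φ
      where
      same : ∀ i → upd (work c) (wpos c) (scanned c) i ≡ work c i
      same = upd-self (work c) (wpos c)

    tr-skip : ∀ h (Φ : HState → Set) → Φ h → Tr skip h Φ
    tr-skip h Φ φ c rep = _ , h , act (wpos-ok rep) , rep-idle rep , φ

    tr-ite : ∀ {P Q h Φ} → (flag h ≡ true → Tr P h Φ) → (flag h ≡ false → Tr Q h Φ) → Tr (ite flagged P Q) h Φ
    tr-ite {h = h} tP tQ c rep with flag h in eq
    ... | true  = let c' , h' , ex , rest = tP refl _ (rep-idle rep)
                  in c' , h' , ite-t (wpos-ok rep) (trans (flagged-home rep) eq) ex , rest
    ... | false = let c' , h' , ex , rest = tQ refl _ (rep-idle rep)
                  in c' , h' , ite-f (wpos-ok rep) (trans (flagged-home rep) eq) ex , rest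

    tr-ifEq : ∀ {r s P Q h Φ} → r < K → s < K → base r ≡ base s →
      (regs h r ≡ regs h s → Tr P (setFl true h) Φ) → (regs h r ≢ regs h s → Tr Q (setFl false h) Φ) →
      Tr (ifEq r s P Q) h Φ
    tr-ifEq {r} {s} {P} {Q} {h} {Φ} r<K s<K b tP tQ = tr-seq (tr-test r s h _ r<K s<K b
      (λ e → tr-ite {P} {Q} {setFl true h} {Φ} (λ _ → tP e) (λ ()))
      (λ e → tr-ite {P} {Q} {setFl false h} {Φ} (λ ()) (λ _ → tQ e)))

    module _ {r s : ℕ} {P : SP γ} (r<K : r < K) (s<K : s < K) (b : base r ≡ base s)
             (I : ℕ → (ℕ → ℕ) → IO → Set)
             (done : ∀ ρ o → I 0 ρ o → ρ r ≡ ρ s)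
             (body : ∀ k h → I (suc k) (regs h) (hio h) →
                     regs h r ≢ regs h s × Tr P h (λ h' → I k (regs h') (hio h'))) where

      private
        Tested : ℕ → HState → Set
        Tested k h = I k (regs h) (hio h) × (flag h ≡ true → regs h r ≡ regs h s) × (flag h ≡ false → regs h r ≢ regs h s)

        tr-test' : ∀ k h → I k (regs h) (hio h) → Tr (test r s) h (Tested k)
        tr-test' k h i = tr-test r s h (Tested k) r<K s<K b
          (λ e → i , (λ _ → e) , (λ ())) (λ ne → i , (λ ()) , (λ _ → ne))

        loop : ∀ k h → Tested k h →
          Tr (while (λ a → not (flagged a)) (seq P (test r s))) h (λ h' → I 0 (regs h') (hio h'))
        loop zero h (i , _ , f) c rep with flag h in eq
        ... | true  = _ , h , stop (wpos-ok rep) (cong not (trans (flagged-home rep) eq)) , rep-idle rep , i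
        ... | false = ⊥-elim (f refl (done _ _ i))
        loop (suc k) h (i , t , _) c rep with flag h in eq
        ... | true  = ⊥-elim (proj₁ (body k h i) (t refl))
        ... | false =
          let c₁ , h₁ , ex₁ , rep₁ , φ₁ = tr-seq {P} {test r s} {h} {Tested k} (tr-post (proj₂ (body k h i)) (λ h' i' → tr-test' k h' i')) _ (rep-idle rep)
              c₂ , h₂ , ex₂ , rest = loop k h₁ φ₁ c₁ rep₁
          in c₂ , h₂ , again (wpos-ok rep) (cong not (trans (flagged-home rep) eq)) ex₁ ex₂ , rest

      -- The index of `I` counts the rounds still to come, so that termination and correctness are
      -- one induction. While rounds remain the body has to know that the registers differ; at index
      -- 0 `done` makes them equal.
      tr-whileNe : ∀ k h → I k (regs h) (hio h) → Tr (whileNe r s P) h (λ h' → I 0 (regs h') (hio h'))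
      tr-whileNe k h i = tr-seq (tr-post (tr-test' k h i) (λ h' t → loop k h' t))

    -- The invariant speaks of the registers after the counter has been set, so it may mention the
    -- counter. The body has to leave counter and limit as they were.
    tr-for : ∀ {i s P h} n (J : ℕ → (ℕ → ℕ) → IO → Set) → i < K → s < K → i ≢ s → base i ≡ base s →
      regs h s ≡ n → J 0 (assign (regs h) i 0) (hio h) →
      (∀ k h → k < n → regs h i ≡ k → regs h s ≡ n → J k (regs h) (hio h) →
        Tr P h (λ h' → regs h' i ≡ k × regs h' s ≡ n × J (suc k) (assign (regs h') i (suc k)) (hio h'))) →
      Tr (for i s P) h (λ h' → regs h' i ≡ n × regs h' s ≡ n × J n (regs h') (hio h'))
    tr-for {i} {s} {P} {h} n J i<K s<K i≢s b sn init body c rep =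
      finish (tr-seq {clear i} {whileNe i s (seq P (inc i))} {h} {λ h' → Inv 0 (regs h') (hio h')}
        (tr-clear i h _ i<K (tr-whileNe i<K s<K b Inv done iter n (setReg i 0 h) start)) c rep)
      where
      Inv : ℕ → (ℕ → ℕ) → IO → Set
      Inv m ρ o = Σ ℕ λ k → k + m ≡ n × ρ i ≡ k × ρ s ≡ n × J k ρ o
      finish : (Σ (TC γ) λ c' → Σ HState λ h' → Exc (for i s P) c c' × RepAt 0 h' c' × Inv 0 (regs h') (hio h')) →
        Σ (TC γ) λ c' → Σ HState λ h' → Exc (for i s P) c c' × RepAt 0 h' c' ×
          (regs h' i ≡ n × regs h' s ≡ n × J n (regs h') (hio h'))
      finish (c' , h' , ex , rep' , k , e , ik , sk , j) with trans (sym (+-identityʳ k)) e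
      ... | refl = c' , h' , ex , rep' , ik , sk , j
      -- The counter never exceeds the limit, and the limit fits into a track of the same base; so
      -- loops need no capacity condition of their own.
      fits : n < base i ^ ℓ
      fits = subst₂ (λ u v → u < v ^ ℓ) sn (sym b) (reg< rep s<K)
      start : Inv n (assign (regs h) i 0) (hio h)
      start = 0 , refl , assign-same (regs h) i 0 , trans (assign-other (regs h) 0 (λ e → i≢s (sym e))) sn , init
      done : ∀ ρ o → Inv 0 ρ o → ρ i ≡ ρ s
      done ρ o (k , e , ik , sk , _) = trans ik (trans (sym (+-identityʳ k)) (trans e (sym sk)))
      iter : ∀ m h → Inv (suc m) (regs h) (hio h) →
        regs h i ≢ regs h s × Tr (seq P (inc i)) h (λ h' → Inv m (regs h') (hio h'))
      iter m h (k , e , ik , sk , j) =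
        (λ q → <⇒≢ k<n (trans (sym ik) (trans q sk))) ,
        tr-seq (tr-post (body k h k<n ik sk j) λ { h' (ik' , sk' , j') →
          tr-inc i h' _ i<K (≤-<-trans (subst (λ z → suc z ≤ n) (sym ik') k<n) fits)
            (suc k , trans (sym (+-suc k m)) e , trans (assign-same (regs h') i _) (cong suc ik')
            , trans (assign-other (regs h') _ (λ z → i≢s (sym z))) sk'
            , subst (λ z → J (suc k) (assign (regs h') i (suc z)) (hio h')) (sym ik') j') })
        where
        k<n : k < n
        k<n = subst (k <_) e (m<m+n k z<s)

  bit : Bool → ℕ
  bit true  = 1
  bit false = 0

  record Env {k : ℕ} (env : Vec ℕ k) (d : ℕ) (ρ : Vec ℕ k) (g : ℕ → ℕ) : Set where
    constructor mkEnv
    field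
      below  : ∀ i → lookup env i < d
      holds  : ∀ i → g (R (lookup env i)) ≡ lookup ρ i

  env-frame : ∀ {k d} {env ρ : Vec ℕ k} {g g'} → Env env d ρ g → (∀ r → r < R d → g' r ≡ g r) → Env env d ρ g'
  env-frame (mkEnv lt eq) same = mkEnv lt (λ i → trans (same _ (s≤s (s≤s (lt i)))) (eq i))

  env-weaken : ∀ {k d} j {env ρ : Vec ℕ k} {g} → Env env d ρ g → Env env (j + d) ρ g
  env-weaken {d = d} j (mkEnv lt eq) = mkEnv (λ i → ≤-trans (lt i) (m≤n+m d j)) eq

  fitReg : ∀ {d m} j → j ≤ m → R (d + m) < K → R (j + d) < K
  fitReg {d} {m} j j≤m = ≤-<-trans (s≤s (s≤s (subst (_≤ d + m) (+-comm d j) (+-monoʳ-≤ d j≤m))))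

  fitSub : ∀ {d m} j a → j + a ≤ m → R (d + m) < K → R ((j + d) + a) < K
  fitSub {d} {m} j a le = ≤-<-trans (s≤s (s≤s (subst (_≤ d + m) eq (+-monoʳ-≤ d le))))
    where
    eq : d + (j + a) ≡ (j + d) + a
    eq = trans (sym (+-assoc d j a)) (cong (_+ a) (+-comm d j))

  module Evaluation (x : List Bool) (ℓ' : ℕ) where

    open Rules x ℓ' public

    Res : ℕ → ℕ → HState → HState → Set
    Res d v h h' = regs h' (R d) ≡ v × (∀ r → r < R d → regs h' r ≡ regs h r) × hio h' ≡ hio h

    tr-copy : ∀ {d e h} → R d < K → R e < K → e ≢ d →
      Tr (for (R d) (R e) skip) h
         (λ h' → regs h' (R d) ≡ regs h (R e) × (∀ r → r ≢ R d → regs h' r ≡ regs h r) × hio h' ≡ hio h)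
    tr-copy {d} {e} {h} d<K e<K ne = tr-post
      (tr-for (regs h (R e)) Inv₁ d<K e<K (λ q → ne (sym (suc-injective (suc-injective q)))) refl refl
        ((λ r r≢ → assign-other (regs h) 0 r≢) , refl)
        (λ k h' _ ik sk (j , o) → tr-skip h' _ (ik , sk , (λ r r≢ → trans (assign-other (regs h') _ r≢) (j r r≢)) , o)))
      (λ h' (v , _ , j , o) → v , j , o)
      where
      Inv₁ : ℕ → (ℕ → ℕ) → IO → Set
      Inv₁ k ρ o = (∀ r → r ≢ R d → ρ r ≡ regs h r) × o ≡ hio h

    tr-evalTerm : ∀ {k} (t : Tm k) env d ρ b h → Env env d ρ (regs h) → ρ ≤ᵛ b → R (d + termRegs t) < K →
      suc (termBound t b) < B ^ ℓ → Tr (evalTerm t env d) h (Res d (⟦ t ⟧t ρ) h)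
    tr-evalTerm (var i) env d ρ b h E le dK cap =
      tr-post (tr-copy (fitReg 0 z≤n dK) (≤-<-trans (s≤s (s≤s (<⇒≤ (Env.below E i)))) (fitReg 0 z≤n dK)) (<⇒≢ (Env.below E i)))
        (λ h' (v , same , o) → trans v (Env.holds E i) , (λ r l → same r (<⇒≢ l)) , o)
    tr-evalTerm 𝟘 env d ρ b h E le dK cap =
      tr-clear (R d) h _ (fitReg 0 z≤n dK) (assign-same (regs h) (R d) 0 , (λ r l → assign-below (regs h) 0 l) , refl)
    tr-evalTerm 𝟙 env d ρ b h E le dK cap =
      tr-seq (tr-clear (R d) h _ (fitReg 0 z≤n dK) (tr-inc (R d) _ _ (fitReg 0 z≤n dK)
        (subst (λ z → suc z < B ^ ℓ) (sym (assign-same (regs h) (R d) 0)) (≤-trans (s≤s (s≤s z≤n)) cap))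
        (trans (assign-same _ (R d) _) (cong suc (assign-same (regs h) (R d) 0)) ,
         (λ r l → trans (assign-below _ _ l) (assign-below (regs h) 0 l)) , refl)))
    tr-evalTerm (s ⊕ t) env d ρ b h E le dK cap =
      tr-seq (tr-post (tr-evalTerm s env d ρ b h E le
                         (subst (λ z → R (d + z) < K) refl (fitSub 0 (termRegs s) (≤-trans (m≤m+n _ _) (m≤n+m _ 2)) dK))
                         (≤-<-trans (s≤s (m≤m+n _ _)) cap))
        λ h₁ (v₁ , f₁ , o₁) →
      tr-seq (tr-post (tr-evalTerm t env (1 + d) ρ b h₁ (env-weaken 1 (env-frame E f₁)) le
                         (fitSub 1 (termRegs t) (+-mono-≤ {1} {2} (s≤s z≤n) (m≤n+m _ (termRegs s))) dK)
                         (≤-<-trans (s≤s (m≤n+m _ _)) cap))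
        λ h₂ (v₂ , f₂ , o₂) →
      tr-post (tr-for (⟦ t ⟧t ρ) Inv₁ (fitReg 2 (m≤m+n 2 _) dK) (fitReg 1 (s≤s z≤n) dK) (>⇒≢ ≤-refl) refl v₂
        (trans (assign-below _ 0 (n≤1+n _)) (trans (f₂ (R d) ≤-refl) (trans v₁ (sym (+-identityʳ _)))) ,
         (λ r l → trans (assign-below _ 0 (≤-trans l (m≤n+m _ 2))) (trans (f₂ r (≤-trans l (n≤1+n _))) (f₁ r l))) ,
         trans o₂ o₁)
        (λ k h₃ k< ik sk (v₃ , f₃ , o₃) → tr-inc (R d) h₃ _ (fitReg 0 z≤n dK)
          (≤-<-trans (s≤s (≤-trans (≤-reflexive v₃) (≤-trans (+-monoʳ-≤ _ (<⇒≤ k<)) (total)))) cap)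
          (trans (assign-other (regs h₃) _ (>⇒≢ (n≤1+n _))) ik ,
           trans (assign-other (regs h₃) _ (>⇒≢ ≤-refl)) sk ,
           trans (assign-below _ (suc k) (n≤1+n _)) (trans (assign-same (regs h₃) (R d) _) (trans (cong suc v₃) (sym (+-suc _ k)))) ,
           (λ r l → trans (assign-below _ (suc k) (≤-trans l (m≤n+m _ 2))) (trans (assign-below (regs h₃) _ l) (f₃ r l))) ,
           o₃)))
        (λ h' (_ , _ , j) → j)))
      where
      Inv₁ : ℕ → (ℕ → ℕ) → IO → Set
      Inv₁ k g o = g (R d) ≡ ⟦ s ⟧t ρ + k × (∀ r → r < R d → g r ≡ regs h r) × o ≡ hio h
      total = term≤termBound (s ⊕ t) le
    tr-evalTerm (s ⊗ t) env d ρ b h E le dK cap =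
      tr-seq (tr-post (tr-evalTerm s env (1 + d) ρ b h (env-weaken 1 E) le
                         (fitSub 1 (termRegs s) (+-mono-≤ {1} {4} (s≤s z≤n) (m≤m+n (termRegs s) _)) dK)
                         (≤-<-trans (s≤s (≤-trans (m≤m+n _ _) (m≤m+n (termBound s b + termBound t b) _))) cap))
        λ h₁ (v₁ , f₁ , o₁) →
      tr-seq (tr-post (tr-evalTerm t env (2 + d) ρ b h₁ (env-weaken 2 (env-frame E (λ r l → f₁ r (≤-trans l (n≤1+n _))))) le
                         (fitSub 2 (termRegs t) (+-mono-≤ {2} {4} (s≤s (s≤s z≤n)) (m≤n+m _ (termRegs s))) dK)
                         (≤-<-trans (s≤s (≤-trans (m≤n+m _ (termBound s b)) (m≤m+n (termBound s b + termBound t b) _))) cap))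
        λ h₂ (v₂ , f₂ , o₂) →
      tr-seq (tr-clear (R d) h₂ _ (fitReg 0 z≤n dK)
      (tr-post (tr-for (⟦ s ⟧t ρ) Inv₁ (fitReg 3 (m≤m+n 3 _) dK) (fitReg 1 (s≤s z≤n) dK) (>⇒≢ (n≤1+n _)) refl
        (trans (assign-other (regs h₂) 0 (>⇒≢ ≤-refl)) (trans (f₂ (R (1 + d)) ≤-refl) v₁))
        (trans (assign-below _ 0 (m≤n+m _ 2)) (assign-same (regs h₂) (R d) 0) ,
         trans (assign-below _ 0 ≤-refl) (trans (assign-other (regs h₂) 0 (>⇒≢ (n≤1+n _))) v₂) ,
         (λ r l → trans (assign-below _ 0 (≤-trans l (m≤n+m _ 3))) (trans (assign-below (regs h₂) 0 l)
                   (trans (f₂ r (≤-trans l (m≤n+m _ 2))) (f₁ r (≤-trans l (n≤1+n _)))))) ,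
         trans o₂ o₁)
        (λ k h₃ k< ik sk (v₃ , w₃ , f₃ , o₃) →
          tr-post (tr-for (⟦ t ⟧t ρ) (Inv₂ k) (fitReg 4 (m≤m+n 4 _) dK) (fitReg 2 (s≤s (s≤s z≤n)) dK) (>⇒≢ (n≤1+n _)) refl w₃
            (trans (assign-below _ 0 (m≤n+m _ 3)) (trans v₃ (sym (+-identityʳ _))) ,
             trans (assign-below _ 0 (m≤n+m _ 2)) sk ,
             trans (assign-below _ 0 ≤-refl) ik ,
             (λ r l → trans (assign-below _ 0 (≤-trans l (m≤n+m _ 4))) (f₃ r l)) , o₃)
            (λ j h₄ j< ij sj (v₄ , w₄ , u₄ , f₄ , o₄) → tr-inc (R d) h₄ _ (fitReg 0 z≤n dK)
              (≤-<-trans (s≤s (≤-trans (≤-reflexive v₄) (≤-trans (below k j k< j<) total))) cap)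
              (trans (assign-other (regs h₄) _ (>⇒≢ (m≤n+m _ 3))) ij ,
               trans (assign-other (regs h₄) _ (>⇒≢ (n≤1+n _))) sj ,
               trans (assign-below _ (suc j) (m≤n+m _ 3)) (trans (assign-same (regs h₄) (R d) _) (trans (cong suc v₄) (sym (+-suc _ j)))) ,
               trans (assign-below _ (suc j) (m≤n+m _ 2)) (trans (assign-other (regs h₄) _ (>⇒≢ ≤-refl)) w₄) ,
               trans (assign-below _ (suc j) ≤-refl) (trans (assign-other (regs h₄) _ (>⇒≢ (m≤n+m _ 2))) u₄) ,
               (λ r l → trans (assign-below _ (suc j) (≤-trans l (m≤n+m _ 4))) (trans (assign-below (regs h₄) _ l) (f₄ r l))) ,
               o₄)))
            (λ h₅ (_ , t₅ , v₅ , w₅ , u₅ , f₅ , o₅) →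
              u₅ , w₅ ,
              trans (assign-below _ (suc k) (m≤n+m _ 2)) (trans v₅ (+-comm (k * ⟦ t ⟧t ρ) _)) ,
              trans (assign-below _ (suc k) ≤-refl) t₅ ,
              (λ r l → trans (assign-below _ (suc k) (≤-trans l (m≤n+m _ 3))) (f₅ r l)) , o₅)))
        (λ h' (_ , _ , v , _ , f , o) → v , f , o)))))
      where
      Inv₁ : ℕ → (ℕ → ℕ) → IO → Set
      Inv₁ k g o = g (R d) ≡ k * ⟦ t ⟧t ρ × g (R (2 + d)) ≡ ⟦ t ⟧t ρ × (∀ r → r < R d → g r ≡ regs h r) × o ≡ hio h
      Inv₂ : ℕ → ℕ → (ℕ → ℕ) → IO → Set
      Inv₂ k j g o = g (R d) ≡ k * ⟦ t ⟧t ρ + j × g (R (1 + d)) ≡ ⟦ s ⟧t ρ × g (R (3 + d)) ≡ k ×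
                   (∀ r → r < R d → g r ≡ regs h r) × o ≡ hio h
      total = term≤termBound (s ⊗ t) le
      below : ∀ k j → k < ⟦ s ⟧t ρ → j < ⟦ t ⟧t ρ → k * ⟦ t ⟧t ρ + j ≤ ⟦ s ⟧t ρ * ⟦ t ⟧t ρ
      below k j k< j< = ≤-trans (+-monoʳ-≤ (k * ⟦ t ⟧t ρ) (<⇒≤ j<))
                          (≤-trans (≤-reflexive (+-comm (k * ⟦ t ⟧t ρ) _)) (*-monoˡ-≤ (⟦ t ⟧t ρ) k<))

    module _ {k : ℕ} (t : Tm k) (env : Vec ℕ k) (d : ℕ) (ρ : Vec ℕ k) (b : ℕ) (P : Vec ℕ (suc k) → ℕ → SP γ) (hit : SP γ)
      (p : ℕ → Bool) (V : ℕ → ℕ → Set) (a : ℕ) (dK : R (d + (4 + (termRegs t + a))) < K)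
      (cap : 2 + termBound t b < B ^ ℓ) (le : ρ ≤ᵛ b)
      (trP : ∀ x h → x ≤ ⟦ t ⟧t ρ → Env ((2 + d) ∷ env) (3 + d) (x ∷ ρ) (regs h) →
             Tr (P ((2 + d) ∷ env) (3 + d)) h (Res (3 + d) (bit (p x)) h))
      (V0 : V 0 0) (miss : ∀ k v → p k ≡ false → V k v → V (suc k) v)
      (trHit : ∀ k h → k ≤ ⟦ t ⟧t ρ → p k ≡ true → V k (regs h (R d)) → regs h (R (2 + d)) ≡ k →
        Tr hit h (λ h' → V (suc k) (regs h' (R d)) × (∀ r → r ≢ R d → regs h' r ≡ regs h r) × hio h' ≡ hio h)) where

      -- `V k v` relates the number k of candidates tried to the contents v of register d.
      -- Quantifiers and functions differ only in `V` and in what they do at a hit.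
      tr-search : ∀ h → Env env d ρ (regs h) → Tr (search t P env d hit) h
        (λ h' → V (suc (⟦ t ⟧t ρ)) (regs h' (R d)) × (∀ r → r < R d → regs h' r ≡ regs h r) × hio h' ≡ hio h)
      tr-search h E =
        tr-seq (tr-post (tr-evalTerm t env (1 + d) ρ b h (env-weaken 1 E) le
                          (fitSub 1 (termRegs t) (+-mono-≤ {1} {4} (s≤s z≤n) (m≤m+n (termRegs t) a)) dK)
                          (<⇒≤ cap))
          λ h₁ (v₁ , f₁ , o₁) →
        tr-seq (tr-inc (R (1 + d)) h₁ _ (fitReg 1 (s≤s z≤n) dK)
                  (≤-<-trans (s≤s (≤-trans (≤-reflexive v₁) (term≤termBound t le))) (<⇒≤ cap))
        (tr-seq (tr-clear (R d) _ _ (fitReg 0 z≤n dK)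
        (tr-post (tr-for (suc (⟦ t ⟧t ρ)) Inv₁ (fitReg 2 (s≤s (s≤s z≤n)) dK) (fitReg 1 (s≤s z≤n) dK) (>⇒≢ ≤-refl) refl
          (trans (assign-other _ 0 (>⇒≢ ≤-refl)) (trans (assign-same (regs h₁) (R (1 + d)) _) (cong suc v₁)))
          (subst (V 0) (sym (trans (assign-below _ 0 (n≤1+n _)) (assign-same _ (R d) 0))) V0 ,
           (λ r l → trans (assign-below _ 0 (≤-trans l (m≤n+m _ 2))) (trans (assign-below _ 0 l)
                     (trans (assign-below (regs h₁) _ (≤-trans l (n≤1+n _))) (f₁ r (≤-trans l (n≤1+n _)))))) ,
           o₁)
          (λ k h₂ k< ik sk (v₂ , f₂ , o₂) →
            tr-seq (tr-post (trP k h₂ (s≤s⁻¹ k<) (env₂ h₂ ik f₂))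
              λ h₃ (v₃ , f₃ , o₃) →
            tr-seq (tr-clear (R (4 + d)) h₃ _ (fitReg 4 (m≤m+n 4 _) dK)
            (tr-ifEq (fitReg 3 (m≤m+n 3 _) dK) (fitReg 4 (m≤m+n 4 _) dK) refl
              (λ e → tr-skip _ _
                (trans (assign-below (regs h₃) 0 (n≤1+n _)) (trans (f₃ _ ≤-refl) ik) ,
                 trans (assign-below (regs h₃) 0 (m≤n+m _ 2)) (trans (f₃ _ (n≤1+n _)) sk) ,
                 subst (V (suc k)) (sym (trans (assign-below _ (suc k) (n≤1+n _)) (trans (assign-below (regs h₃) 0 (m≤n+m _ 3)) (f₃ _ (m≤n+m _ 2)))))
                   (miss k _ (isFalse h₃ v₃ e) v₂) ,
                 (λ r l → trans (assign-below _ (suc k) (≤-trans l (m≤n+m _ 2))) (trans (assign-below (regs h₃) 0 (≤-trans l (m≤n+m _ 4)))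
                            (trans (f₃ r (≤-trans l (m≤n+m _ 3))) (f₂ r l)))) ,
                 trans o₃ o₂))
              (λ ne → tr-post (trHit k (setFl false (setReg (R (4 + d)) 0 h₃)) (s≤s⁻¹ k<) (isTrue h₃ v₃ ne)
                  (subst (V k) (sym (trans (assign-below (regs h₃) 0 (m≤n+m _ 3)) (f₃ _ (m≤n+m _ 2)))) v₂)
                  (trans (assign-below (regs h₃) 0 (n≤1+n _)) (trans (f₃ _ ≤-refl) ik)))
                (λ h₄ (v₄ , f₄ , o₄) →
                  trans (f₄ _ (>⇒≢ (n≤1+n _))) (trans (assign-below (regs h₃) 0 (n≤1+n _)) (trans (f₃ _ ≤-refl) ik)) ,
                  trans (f₄ _ (>⇒≢ ≤-refl)) (trans (assign-below (regs h₃) 0 (m≤n+m _ 2)) (trans (f₃ _ (n≤1+n _)) sk)) ,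
                  subst (V (suc k)) (sym (assign-below _ (suc k) (n≤1+n _))) v₄ ,
                  (λ r l → trans (assign-below _ (suc k) (≤-trans l (m≤n+m _ 2))) (trans (f₄ r (<⇒≢ l)) (trans (assign-below (regs h₃) 0 (≤-trans l (m≤n+m _ 4)))
                             (trans (f₃ r (≤-trans l (m≤n+m _ 3))) (f₂ r l))))) ,
                  trans o₄ (trans o₃ o₂)))))))
          ) (λ h' (_ , _ , j) → j))))))
        where
        Inv₁ : ℕ → (ℕ → ℕ) → IO → Set
        Inv₁ k g o = V k (g (R d)) × (∀ r → r < R d → g r ≡ regs h r) × o ≡ hio h
        env₂ : ∀ {k} h₂ → regs h₂ (R (2 + d)) ≡ k → (∀ r → r < R d → regs h₂ r ≡ regs h r) →
               Env ((2 + d) ∷ env) (3 + d) (k ∷ ρ) (regs h₂)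
        env₂ h₂ ik f₂ = mkEnv (λ { zero → ≤-refl ; (suc i) → Env.below E' i }) (λ { zero → ik ; (suc i) → Env.holds E' i })
          where E' = env-weaken 3 (env-frame E f₂)
        isFalse : ∀ {k} h₃ → regs h₃ (R (3 + d)) ≡ bit (p k) →
          assign (regs h₃) (R (4 + d)) 0 (R (3 + d)) ≡ assign (regs h₃) (R (4 + d)) 0 (R (4 + d)) → p k ≡ false
        isFalse {k} h₃ v₃ e = bit-zero (p k) (trans (sym v₃) (trans (sym (assign-below (regs h₃) 0 ≤-refl)) (trans e (assign-same (regs h₃) (R (4 + d)) 0))))
          where
          bit-zero : ∀ c → bit c ≡ 0 → c ≡ false
          bit-zero false _ = refl
        isTrue : ∀ {k} h₃ → regs h₃ (R (3 + d)) ≡ bit (p k) →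
          assign (regs h₃) (R (4 + d)) 0 (R (3 + d)) ≢ assign (regs h₃) (R (4 + d)) 0 (R (4 + d)) → p k ≡ true
        isTrue {k} h₃ v₃ ne with p k
        ... | true  = refl
        ... | false = ⊥-elim (ne (trans (assign-below (regs h₃) 0 ≤-refl) (trans v₃ (sym (assign-same (regs h₃) (R (4 + d)) 0)))))

  -- Evaluating the description of a circuit and applying its gates.

  evalFAC : ∀ {k f} → FAC⁰Num k f → Vec ℕ k → ℕ → SP γ
  evalFAC ((t , _) , (φ , _)) = evalFun t (core φ)

  moves : Move → ℕ → ℕ → ℕ
  moves m zero    p = p
  moves m (suc k) p = move m (moves m k p)

  moves-right : ∀ k p → moves right k p ≡ k + p
  moves-right zero    p = refl
  moves-right (suc k) p = cong suc (moves-right k p)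

  moves-stay : ∀ k p → moves stay k p ≡ p
  moves-stay zero    p = refl
  moves-stay (suc k) p = moves-stay k p

  moves-left : ∀ k p → moves left k (k + p) ≡ p
  moves-left zero    p = refl
  moves-left (suc k) p = trans (cong (move left) (trans (cong (moves left k) (sym (+-suc k p))) (moves-left k (suc p)))) refl

  module Programs (x : List Bool) (ℓ' : ℕ) where

    open Evaluation x ℓ' public

    ∷≤ᵛ : ∀ {k} {ρ : Vec ℕ k} {v b} → v ≤ b → ρ ≤ᵛ b → (v ∷ ρ) ≤ᵛ b
    ∷≤ᵛ v≤ ρ≤ zero    = v≤
    ∷≤ᵛ v≤ ρ≤ (suc i) = ρ≤ i

    ≤ᵛ-weaken : ∀ {k} {ρ : Vec ℕ k} {b b'} → b ≤ b' → ρ ≤ᵛ b → ρ ≤ᵛ b'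
    ≤ᵛ-weaken b≤ ρ≤ i = ≤-trans (ρ≤ i) b≤

    tr-setOne : ∀ {d h} → R d < K → 2 < B ^ ℓ →
      Tr (setOne d) h (λ h' → regs h' (R d) ≡ 1 × (∀ r → r ≢ R d → regs h' r ≡ regs h r) × hio h' ≡ hio h)
    tr-setOne {d} {h} dK cap =
      tr-seq (tr-clear (R d) h _ dK (tr-inc (R d) _ _ dK
        (subst (λ z → suc z < B ^ ℓ) (sym (assign-same (regs h) (R d) 0)) (<⇒≤ cap))
        (trans (assign-same _ (R d) _) (cong suc (assign-same (regs h) (R d) 0)) ,
         (λ r ne → trans (assign-other _ _ ne) (assign-other (regs h) 0 ne)) , refl)))

    tr-evalCore : ∀ {k} (φ : CF k) env d ρ b h → Env env d ρ (regs h) → ρ ≤ᵛ b → R (d + coreRegs φ) < K →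
      2 + coreBound φ b < B ^ ℓ → Tr (evalCore φ env d) h (Res d (bit (truth φ ρ)) h)
    tr-evalCore (eqᶜ s t) env d ρ b h E le dK cap =
      tr-seq (tr-post (tr-evalTerm s env (1 + d) ρ b h (env-weaken 1 E) le
                         (fitSub 1 (termRegs s) (+-mono-≤ {1} {2} (s≤s z≤n) (m≤m+n (termRegs s) _)) dK)
                         (≤-<-trans (s≤s (≤-trans (m≤m+n _ _) (n≤1+n _))) cap))
        λ h₁ (v₁ , f₁ , o₁) →
      tr-seq (tr-post (tr-evalTerm t env (2 + d) ρ b h₁ (env-weaken 2 (env-frame E (λ r l → f₁ r (≤-trans l (n≤1+n _))))) le
                         (fitSub 2 (termRegs t) (+-mono-≤ {2} {2} ≤-refl (m≤n+m _ (termRegs s))) dK)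
                         (≤-<-trans (s≤s (≤-trans (m≤n+m _ _) (n≤1+n _))) cap))
        λ h₂ (v₂ , f₂ , o₂) →
      tr-seq (tr-clear (R d) h₂ _ (fitReg 0 z≤n dK)
        (tr-ifEq (fitReg 1 (s≤s z≤n) dK) (fitReg 2 (s≤s (s≤s z≤n)) dK) refl
          (λ e → tr-inc (R d) _ _ (fitReg 0 z≤n dK)
            (subst (λ z → suc z < B ^ ℓ) (sym (assign-same (regs h₂) (R d) 0)) (≤-trans (s≤s (s≤s z≤n)) cap))
            (trans (assign-same _ (R d) _) (trans (cong suc (assign-same (regs h₂) (R d) 0))
               (cong bit (sym (trans (cong (_≡ᵇ ⟦ t ⟧t ρ) (val= h₁ h₂ v₁ v₂ f₂ e)) (≡ᵇ-refl (⟦ t ⟧t ρ)))))) ,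
             (λ r l → trans (assign-below _ _ l) (frame h₁ h₂ f₁ f₂ r l)) , trans o₂ o₁))
          (λ ne → tr-skip _ _
            (trans (assign-same (regs h₂) (R d) 0) (cong bit (sym (≢⇒≡ᵇ-false (λ e → ne (regs= h₁ h₂ v₁ v₂ f₂ e))))) ,
             frame h₁ h₂ f₁ f₂ , trans o₂ o₁))))))
      where
      frame : ∀ h₁ h₂ → (∀ r → r < R (1 + d) → regs h₁ r ≡ regs h r) → (∀ r → r < R (2 + d) → regs h₂ r ≡ regs h₁ r) →
              ∀ r → r < R d → assign (regs h₂) (R d) 0 r ≡ regs h r
      frame h₁ h₂ f₁ f₂ r l = trans (assign-below (regs h₂) 0 l) (trans (f₂ r (≤-trans l (m≤n+m _ 2))) (f₁ r (≤-trans l (n≤1+n _))))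
      module _ (h₁ h₂ : HState) (v₁ : regs h₁ (R (1 + d)) ≡ ⟦ s ⟧t ρ) (v₂ : regs h₂ (R (2 + d)) ≡ ⟦ t ⟧t ρ)
               (f₂ : ∀ r → r < R (2 + d) → regs h₂ r ≡ regs h₁ r) where
        lhs : assign (regs h₂) (R d) 0 (R (1 + d)) ≡ ⟦ s ⟧t ρ
        lhs = trans (assign-other (regs h₂) 0 (>⇒≢ ≤-refl)) (trans (f₂ _ ≤-refl) v₁)
        rhs : assign (regs h₂) (R d) 0 (R (2 + d)) ≡ ⟦ t ⟧t ρ
        rhs = trans (assign-other (regs h₂) 0 (>⇒≢ (n≤1+n _))) v₂
        val= : assign (regs h₂) (R d) 0 (R (1 + d)) ≡ assign (regs h₂) (R d) 0 (R (2 + d)) → ⟦ s ⟧t ρ ≡ ⟦ t ⟧t ρ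
        val= e = trans (sym lhs) (trans e rhs)
        regs= : ⟦ s ⟧t ρ ≡ ⟦ t ⟧t ρ → assign (regs h₂) (R d) 0 (R (1 + d)) ≡ assign (regs h₂) (R d) 0 (R (2 + d))
        regs= e = trans lhs (trans e (sym rhs))
    tr-evalCore (nandᶜ φ ψ) env d ρ b h E le dK cap =
      tr-seq (tr-post (tr-evalCore φ env (1 + d) ρ b h (env-weaken 1 E) le
                         (fitSub 1 (coreRegs φ) (+-mono-≤ {1} {3} (s≤s z≤n) (m≤m+n (coreRegs φ) _)) dK)
                         (≤-<-trans (s≤s (s≤s (m≤m+n _ _))) cap))
        λ h₁ (v₁ , f₁ , o₁) →
      tr-seq (tr-post (tr-evalCore ψ env (2 + d) ρ b h₁ (env-weaken 2 (env-frame E (λ r l → f₁ r (≤-trans l (n≤1+n _))))) le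
                         (fitSub 2 (coreRegs ψ) (+-mono-≤ {2} {3} (s≤s (s≤s z≤n)) (m≤n+m _ (coreRegs φ))) dK)
                         (≤-<-trans (s≤s (s≤s (m≤n+m _ _))) cap))
        λ h₂ (v₂ , f₂ , o₂) →
      tr-seq (tr-clear (R (3 + d)) h₂ _ (fitReg 3 (m≤m+n 3 _) dK)
      (tr-seq (tr-clear (R d) _ _ (fitReg 0 z≤n dK)
        (finish h₁ h₂ v₁ v₂ f₁ f₂ (trans o₂ o₁)))))))
      where
      module _ (h₁ h₂ : HState) (v₁ : regs h₁ (R (1 + d)) ≡ bit (truth φ ρ)) (v₂ : regs h₂ (R (2 + d)) ≡ bit (truth ψ ρ))
               (f₁ : ∀ r → r < R (1 + d) → regs h₁ r ≡ regs h r)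
               (f₂ : ∀ r → r < R (2 + d) → regs h₂ r ≡ regs h₁ r) (o : hio h₂ ≡ hio h) where
        h₃ = setReg (R d) 0 (setReg (R (3 + d)) 0 h₂)
        a₁ : regs h₃ (R (1 + d)) ≡ bit (truth φ ρ)
        a₁ = trans (assign-other _ 0 (>⇒≢ ≤-refl)) (trans (assign-below (regs h₂) 0 (n≤1+n _)) (trans (f₂ _ ≤-refl) v₁))
        a₂ : regs h₃ (R (2 + d)) ≡ bit (truth ψ ρ)
        a₂ = trans (assign-other _ 0 (>⇒≢ (n≤1+n _))) (trans (assign-below (regs h₂) 0 ≤-refl) v₂)
        a₃ : regs h₃ (R (3 + d)) ≡ 0
        a₃ = trans (assign-other _ 0 (>⇒≢ (m≤n+m _ 2))) (assign-same (regs h₂) (R (3 + d)) 0)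
        a₀ : regs h₃ (R d) ≡ 0
        a₀ = assign-same _ (R d) 0
        frame : ∀ r → r < R d → regs h₃ r ≡ regs h r
        frame r l = trans (assign-below _ 0 l) (trans (assign-below (regs h₂) 0 (≤-trans l (m≤n+m _ 3)))
                      (trans (f₂ r (≤-trans l (m≤n+m _ 2))) (f₁ r (≤-trans l (n≤1+n _)))))
        one : ∀ {fl} → truth φ ρ ≡ false ⊎ truth ψ ρ ≡ false → Tr (inc (R d)) (setFl fl h₃) (Res d (bit (not (truth φ ρ ∧ truth ψ ρ))) h)
        one {fl} z = tr-inc (R d) (setFl fl h₃) _ (fitReg 0 z≤n dK)
          (subst (λ z → suc z < B ^ ℓ) (sym a₀) (≤-trans (s≤s (s≤s z≤n)) cap))
          (trans (assign-same _ (R d) _) (trans (cong suc a₀) (cong bit (sym (nand z)))) ,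
           (λ r l → trans (assign-below _ _ l) (frame r l)) , o)
          where
          nand : truth φ ρ ≡ false ⊎ truth ψ ρ ≡ false → not (truth φ ρ ∧ truth ψ ρ) ≡ true
          nand (inj₁ e) rewrite e = refl
          nand (inj₂ e) rewrite e with truth φ ρ
          ... | true = refl
          ... | false = refl
        bit0 : ∀ c → bit c ≡ 0 → c ≡ false
        bit0 false _ = refl
        bit≠0 : ∀ c → bit c ≢ 0 → c ≡ true
        bit≠0 true _ = refl
        bit≠0 false n = ⊥-elim (n refl)
        finish : Tr (ifEq (R (1 + d)) (R (3 + d)) (inc (R d)) (ifEq (R (2 + d)) (R (3 + d)) (inc (R d)) skip)) h₃
                    (Res d (bit (not (truth φ ρ ∧ truth ψ ρ))) h)
        finish = tr-ifEq (fitReg 1 (s≤s z≤n) dK) (fitReg 3 (m≤m+n 3 _) dK) refl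
          (λ e → one (inj₁ (bit0 _ (trans (sym a₁) (trans e a₃)))))
          (λ ne → tr-ifEq (fitReg 2 (s≤s (s≤s z≤n)) dK) (fitReg 3 (m≤m+n 3 _) dK) refl
            (λ e → one (inj₂ (bit0 _ (trans (sym a₂) (trans e a₃)))))
            (λ ne' → tr-skip _ _
              (trans a₀ (sym (cong₂ (λ c c' → bit (not (c ∧ c')))
                 (bit≠0 _ (λ e → ne (trans a₁ (trans e (sym a₃))))) (bit≠0 _ (λ e → ne' (trans a₂ (trans e (sym a₃))))))) ,
               frame , o)))
    tr-evalCore (exᶜ t φ) env d ρ b h E le dK cap =
      tr-search t env d ρ b (evalCore φ) (setOne d) p (λ k v → v ≡ bit (any< k p)) (coreRegs φ) dK
        (≤-<-trans (s≤s (s≤s (m≤m+n _ _))) cap) le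
        (λ x h x≤ E → tr-evalCore φ ((2 + d) ∷ env) (3 + d) (x ∷ ρ) (b + termBound t b) h E
          (∷≤ᵛ (≤-trans x≤ (≤-trans (term≤termBound t le) (m≤n+m _ b))) (≤ᵛ-weaken {ρ = ρ} (m≤m+n b _) le))
          (fitSub 3 (coreRegs φ) (+-mono-≤ {3} {4} (n≤1+n 3) (m≤n+m _ (termRegs t))) dK)
          (≤-<-trans (s≤s (s≤s (m≤n+m _ _))) cap))
        refl
        (λ k v pk e → trans e (cong bit (sym (trans (cong (any< k p ∨_) pk) (∨-identityʳ _)))))
        (λ k h k≤ pk _ _ → tr-post (tr-setOne (fitReg 0 z≤n dK) (≤-trans (s≤s (s≤s (s≤s z≤n))) cap))
          (λ h' (v , f , o) → trans v (cong bit (sym (trans (cong (any< k p ∨_) pk) (∨-zeroʳ _)))) , f , o))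
        h E
      where
      p = λ x → truth φ (x ∷ ρ)

    -- The invariant claims nothing until the candidate f ρ has passed. Afterwards the result stays,
    -- since the formula defines the graph of a function and no other candidate can hit.
    tr-evalFAC : ∀ {k f} (u : FAC⁰Num k f) env d ρ b h → Env env d ρ (regs h) → ρ ≤ᵛ b → R (d + facRegs u) < K →
      2 + facBound u b < B ^ ℓ → Tr (evalFAC u env d) h (Res d (f ρ) h)
    tr-evalFAC {f = f} ((t , f≤) , (φ , φ⇔)) env d ρ b h E le dK cap = tr-post
      (tr-search t env d ρ b (evalCore (core φ)) (for (R d) (R (2 + d)) skip) p (λ k w → f ρ < k → w ≡ f ρ) (coreRegs (core φ)) dK
        (≤-<-trans (s≤s (s≤s (m≤m+n _ _))) cap) le
        (λ x h x≤ E → tr-evalCore (core φ) ((2 + d) ∷ env) (3 + d) (x ∷ ρ) (b + termBound t b) h E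
          (∷≤ᵛ (≤-trans x≤ (≤-trans (term≤termBound t le) (m≤n+m _ b))) (≤ᵛ-weaken {ρ = ρ} (m≤m+n b _) le))
          (fitSub 3 (coreRegs (core φ)) (+-mono-≤ {3} {4} (n≤1+n 3) (m≤n+m _ (termRegs t))) dK)
          (≤-<-trans (s≤s (s≤s (m≤n+m _ _))) cap))
        (λ ())
        (λ k v pk V f<sk → V (≤∧≢⇒< (s≤s⁻¹ f<sk) λ e → false≢true (trans (sym pk) (trans (cong p (sym e)) pf))))
        (λ k h k≤ pk _ ik → tr-post (tr-copy (fitReg 0 z≤n dK) (fitReg 2 (s≤s (s≤s z≤n)) dK) (>⇒≢ (n≤1+n _)))
          (λ h' (v , f , o) → (λ _ → trans v (trans ik (Equivalence.to (φ⇔ (k ∷ ρ)) (reflects-true (core-correct φ (k ∷ ρ)) pk)))) , f , o))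
        h E)
      (λ h' (v , f , o) → v (s≤s (f≤ ρ)) , f , o)
      where
      p = λ x → truth (core φ) (x ∷ ρ)
      pf : p (f ρ) ≡ true
      pf = true-reflects (core-correct φ (f ρ ∷ ρ)) (Equivalence.from (φ⇔ (f ρ ∷ ρ)) refl)
      false≢true : false ≢ true
      false≢true ()

    moveIO : Move → Move → Move → ℕ → IO → IO
    moveIO i m₁ m₂ n o = mkIO (moves i n (IO.ipos o)) (moves m₁ n (IO.pos₁ o)) (moves m₂ n (IO.pos₂ o)) (IO.comp o)

    tr-moves : ∀ {i s h} mI m₁ m₂ → R i < K → R s < K → i ≢ s → Tr (for (R i) (R s) (device mI m₁ m₂ noop)) h
      (λ h' → (∀ r → r ≢ R i → regs h' r ≡ regs h r) × hio h' ≡ moveIO mI m₁ m₂ (regs h (R s)) (hio h))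
    tr-moves {i} {s} {h} mI m₁ m₂ iK sK ne = tr-post
      (tr-for (regs h (R s)) Inv iK sK (λ q → ne (suc-injective (suc-injective q))) refl refl
        ((λ r r≢ → assign-other (regs h) 0 r≢) , refl)
        (λ k h' _ ik sk (j , o) → tr-device mI m₁ m₂ noop h' _
          (ik , sk , (λ r r≢ → trans (assign-other (regs h') _ r≢) (j r r≢)) ,
           cong (λ z → mkIO (move mI (IO.ipos z)) (move m₁ (IO.pos₁ z)) (move m₂ (IO.pos₂ z)) (IO.comp z)) o)))
      (λ h' (_ , _ , j) → j)
      where
      Inv : ℕ → (ℕ → ℕ) → IO → Set
      Inv k ρ o = (∀ r → r ≢ R i → ρ r ≡ regs h r) × o ≡ moveIO mI m₁ m₂ k (hio h)

  nth-toList : {A : Set} {m : ℕ} (v : Vec A m) (i : Fin m) → nth (toList v) (toℕ i) ≡ just (lookup v i)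
  nth-toList (a ∷ v) zero    = refl
  nth-toList (a ∷ v) (suc i) = nth-toList v i

  nth-fromList : {A : Set} (xs : List A) (i : Fin (length xs)) → nth xs (toℕ i) ≡ just (lookup (fromList xs) i)
  nth-fromList (a ∷ xs) zero    = refl
  nth-fromList (a ∷ xs) (suc i) = nth-fromList xs i

  nth-just : {A : Set} (xs : List A) {k : ℕ} → k < length xs → Σ A λ a → nth xs k ≡ just a
  nth-just (a ∷ xs) {zero}  _         = a , refl
  nth-just (a ∷ xs) {suc k} (s≤s k<n) = nth-just xs k<n

  copyBit negateBit sortBits : SP γ
  copyBit   = device stay stay stay copy₁
  negateBit = device stay stay stay negate₁
  sortBits  = device stay stay stay sort₁₂

  writeBit : Bool → SP γ
  writeBit b = device stay stay stay (write₁ b)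

  select : {A : Set} → A → A → A → A → ℕ → A
  select P₀ P₁ P₂ P₃ 0 = P₀
  select P₀ P₁ P₂ P₃ 1 = P₁
  select P₀ P₁ P₂ P₃ 2 = P₂
  select P₀ P₁ P₂ P₃ _ = P₃

  -- Selects by the value of register 3; register 6 counts through the candidates.
  dispatch : SP γ → SP γ → SP γ → SP γ → SP γ
  dispatch P₀ P₁ P₂ P₃ = seq (clear (R 6)) (ifEq (R 3) (R 6) P₀
    (seq (inc (R 6)) (ifEq (R 3) (R 6) P₁ (seq (inc (R 6)) (ifEq (R 3) (R 6) P₂ P₃)))))

  annotate : SP γ
  annotate = dispatch copyBit (seq copyBit negateBit) (writeBit false) (writeBit true)

  module Simulator (F : Family) (U : AC⁰Uniform F) where

    uW = proj₁ U
    uG = proj₁ (proj₂ U)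
    uO = proj₁ (proj₂ (proj₂ U))
    uMin = proj₁ (proj₂ (proj₂ (proj₂ U)))
    uMax = proj₁ (proj₂ (proj₂ (proj₂ (proj₂ U))))
    uKind = proj₁ (proj₂ (proj₂ (proj₂ (proj₂ (proj₂ U)))))
    uIdx = proj₂ (proj₂ (proj₂ (proj₂ (proj₂ (proj₂ U)))))

    -- Register 0 holds n, 1 the limit of the current main loop, 2 its counter, 3 and 4 values
    -- computed from the family, and 5 counts head moves. Heads return to cell 0 after each use, by
    -- the same count that took them away; only `M₁` advances through the cells while the wires are
    -- loaded, until `rewind`, and it ends on the output wire, where the machine halts.
    loadWire applyOneGate loadWires rewind applyGates seekOutput simulate : SP γ
    loadWire = seq (evalFAC uKind (0 ∷ 2 ∷ []) 3) (seq (evalFAC uIdx (0 ∷ 2 ∷ []) 4)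
      (seq (for (R 5) (R 4) (device right stay stay noop)) (seq annotate
      (seq (for (R 5) (R 4) (device left stay stay noop)) (device stay right stay noop)))))
    loadWires = seq (evalFAC uW (0 ∷ []) 1) (for (R 2) (R 1) loadWire)
    rewind = for (R 2) (R 1) (device stay left stay noop)
    applyOneGate = seq (evalFAC uMin (0 ∷ 2 ∷ []) 3) (seq (evalFAC uMax (0 ∷ 2 ∷ []) 4)
      (seq (for (R 5) (R 3) (device stay right stay noop)) (seq (for (R 5) (R 4) (device stay stay right noop))
      (seq sortBits
      (seq (for (R 5) (R 3) (device stay left stay noop)) (for (R 5) (R 4) (device stay stay left noop)))))))
    applyGates = seq (evalFAC uG (0 ∷ []) 1) (for (R 2) (R 1) applyOneGate)
    seekOutput = seq (evalFAC uO (0 ∷ []) 1) (for (R 2) (R 1) (device stay right stay noop))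
    simulate = seq loadWires (seq rewind (seq applyGates seekOutput))

    module _ (x : List Bool) (ℓ' : ℕ) where
      open Programs x ℓ'

      n : ℕ
      n = length x
      C : Circuit n
      C = F n
      W = wires C
      G = length (gates C)
      -- A common bound for all arguments of the describing functions: the length, the wire numbers
      -- and the gate numbers.
      b = n + W + G
      v₀ : Vec Bool W
      v₀ = V.map (annVal (fromList x)) (annot C)

      module _ (reg : 7 + 7 < K)
               (kW : R (1 + facRegs uW) < K) (kG : R (1 + facRegs uG) < K) (kO : R (1 + facRegs uO) < K)
               (kMin : R (3 + facRegs uMin) < K) (kMax : R (4 + facRegs uMax) < K)
               (kKind : R (3 + facRegs uKind) < K) (kIdx : R (4 + facRegs uIdx) < K)
               (cW : 2 + facBound uW b < B ^ ℓ) (cG : 2 + facBound uG b < B ^ ℓ) (cO : 2 + facBound uO b < B ^ ℓ)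
               (cMin : 2 + facBound uMin b < B ^ ℓ) (cMax : 2 + facBound uMax b < B ^ ℓ)
               (cKind : 2 + facBound uKind b < B ^ ℓ) (cIdx : 2 + facBound uIdx b < B ^ ℓ) where

        r< : ∀ r → r ≤ 6 → R r < K
        r< r r≤ = ≤-trans (s≤s (s≤s (s≤s r≤))) (≤-trans (m≤n+m 9 6) reg)

        n≤b : n ≤ b
        n≤b = ≤-trans (m≤m+n n W) (m≤m+n _ G)

        W≤b : W ≤ b
        W≤b = ≤-trans (m≤n+m W n) (m≤m+n _ G)

        G≤b : G ≤ b
        G≤b = m≤n+m G _

        env₁ : ∀ {h} → regs h (R 0) ≡ n → Env (0 ∷ []) 1 (n ∷ []) (regs h)
        env₁ e = mkEnv (λ { zero → s≤s z≤n }) (λ { zero → e })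

        env₂ : ∀ {h k} d → 3 ≤ d → regs h (R 0) ≡ n → regs h (R 2) ≡ k → Env (0 ∷ 2 ∷ []) d (n ∷ k ∷ []) (regs h)
        env₂ d d≥ e e' = mkEnv (λ { zero → ≤-trans (s≤s z≤n) d≥ ; (suc zero) → d≥ }) (λ { zero → e ; (suc zero) → e' })

        le₁ : (n ∷ []) ≤ᵛ b
        le₁ zero = n≤b

        le₂ : ∀ {k} → k ≤ b → (n ∷ k ∷ []) ≤ᵛ b
        le₂ k≤ zero       = n≤b
        le₂ k≤ (suc zero) = k≤

        tr-write : ∀ {h o} i p t v → hio h ≡ mkIO i p 0 t → t p ≡ nothing → applyIOp x o (mkIO i p 0 t) ≡ writeIfBlank t p (just v) →
          Tr (device stay stay stay o) h (λ h' → regs h' ≡ regs h × hio h' ≡ mkIO i p 0 (upd t p (just v)))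
        tr-write {h} {o} i p t v e blank w = tr-device stay stay stay o h _ (refl , (begin
          actIO {γ} x (instr (λ s → s) stay stay stay stay o) (hio h) ≡⟨ cong (actIO {γ} x (instr (λ s → s) stay stay stay stay o)) e ⟩
          mkIO i p 0 (applyIOp x o (mkIO i p 0 t)) ≡⟨ cong (mkIO i p 0) w ⟩
          mkIO i p 0 (writeIfBlank t p (just v)) ≡⟨ cong (mkIO i p 0) (blank-write blank) ⟩
          mkIO i p 0 (upd t p (just v)) ∎))
          where
          open ≡-Reasoning
          blank-write : t p ≡ nothing → writeIfBlank t p (just v) ≡ upd t p (just v)
          blank-write q rewrite q = refl

        Annotated : Annot n → ℕ → ℕ → (ℕ → Maybe Bool) → HState → HState → Set
        Annotated a i p t h h' = (∀ r → r < R 6 → regs h' r ≡ regs h r) ×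
          Σ (ℕ → Maybe Bool) λ t' → hio h' ≡ mkIO i p 0 t' × t' p ≡ just (annVal (fromList x) a) × (∀ q → q ≢ p → t' q ≡ t q)

        tr-dispatch : ∀ {h Φ} P₀ P₁ P₂ P₃ →
          (∀ h' → (∀ r → r < R 6 → regs h' r ≡ regs h r) → hio h' ≡ hio h → Tr (select P₀ P₁ P₂ P₃ (regs h (R 3))) h' Φ) →
          Tr (dispatch P₀ P₁ P₂ P₃) h Φ
        tr-dispatch {h} {Φ} P₀ P₁ P₂ P₃ branch =
          tr-seq (tr-clear (R 6) h _ k6 (tr-ifEq k3 k6 refl
            (λ q → go 0 (trans (sym (fr0 _ 3<6)) (trans q at0)) _ fr0 refl)
          (λ n0 → tr-seq (tr-inc (R 6) _ _ k6 (subst (λ z → suc z < B ^ ℓ) (sym at0) (<⇒≤ big)) (tr-ifEq k3 k6 refl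
            (λ q → go 1 (trans (sym (fr1 _ 3<6)) (trans q at1)) _ fr1 refl)
          (λ n1 → tr-seq (tr-inc (R 6) _ _ k6 (subst (λ z → suc z < B ^ ℓ) (sym at1) big) (tr-ifEq k3 k6 refl
            (λ q → go 2 (trans (sym (fr2 _ 3<6)) (trans q at2)) _ fr2 refl)
            (λ n2 → subst (λ P → Tr P (mkH s₂ false (hio h)) Φ)
                      (last (regs h (R 3)) (λ z → n0 (trans (fr0 _ 3<6) (trans z (sym at0))))
                         (λ z → n1 (trans (fr1 _ 3<6) (trans z (sym at1)))) (λ z → n2 (trans (fr2 _ 3<6) (trans z (sym at2))))) (branch _ fr2 refl))))))))))
          where
          k3 = r< 3 (m≤m+n 3 3)
          k6 = r< 6 ≤-refl
          ρ = regs h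
          3<6 : R 3 < R 6
          3<6 = m≤m+n 6 2
          big : 2 < B ^ ℓ
          big = ≤-trans (s≤s (s≤s (s≤s z≤n))) cKind
          s₁ s₂ : ℕ → ℕ
          s₁ = assign (assign ρ (R 6) 0) (R 6) (suc (assign ρ (R 6) 0 (R 6)))
          s₂ = assign s₁ (R 6) (suc (s₁ (R 6)))
          at0 : assign ρ (R 6) 0 (R 6) ≡ 0
          at0 = assign-same ρ (R 6) 0
          at1 : s₁ (R 6) ≡ 1
          at1 = trans (assign-same _ (R 6) _) (cong suc at0)
          at2 : s₂ (R 6) ≡ 2
          at2 = trans (assign-same _ (R 6) _) (cong suc at1)
          fr0 : ∀ r → r < R 6 → assign ρ (R 6) 0 r ≡ ρ r
          fr0 r l = assign-below ρ 0 l
          fr1 : ∀ r → r < R 6 → s₁ r ≡ ρ r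
          fr1 r l = trans (assign-below _ _ l) (fr0 r l)
          fr2 : ∀ r → r < R 6 → s₂ r ≡ ρ r
          fr2 r l = trans (assign-below _ _ l) (fr1 r l)
          go : ∀ k → ρ (R 3) ≡ k → ∀ h' → (∀ r → r < R 6 → regs h' r ≡ ρ r) → hio h' ≡ hio h → Tr (select P₀ P₁ P₂ P₃ k) h' Φ
          go k e h' fr o = subst (λ z → Tr (select P₀ P₁ P₂ P₃ z) h' Φ) e (branch h' fr o)
          last : ∀ k → k ≢ 0 → k ≢ 1 → k ≢ 2 → select P₀ P₁ P₂ P₃ k ≡ P₃
          last 0 a b c = ⊥-elim (a refl)
          last 1 a b c = ⊥-elim (b refl)
          last 2 a b c = ⊥-elim (c refl)
          last (suc (suc (suc k))) a b c = refl

        tr-annotate : ∀ {h} a p t → regs h (R 3) ≡ annKind a → hio h ≡ mkIO (annIdx a) p 0 t → t p ≡ nothing →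
          Tr annotate h (Annotated a (annIdx a) p t h)
        tr-annotate {h} a p t kind e blank = tr-dispatch copyBit (seq copyBit negateBit) (writeBit false) (writeBit true)
          λ h' fr o → subst (λ z → Tr (select copyBit (seq copyBit negateBit) (writeBit false) (writeBit true) z) h' (Annotated a (annIdx a) p t h))
                            (sym kind) (branch a refl h' fr (trans o e))
          where
          written : ∀ a → ∀ h' h'' → (∀ r → r < R 6 → regs h' r ≡ regs h r) → regs h'' ≡ regs h' →
            hio h'' ≡ mkIO (annIdx a) p 0 (upd t p (just (annVal (fromList x) a))) → Annotated a (annIdx a) p t h h''
          written a h' h'' fr re o =
            (λ r l → trans (cong (λ g → g r) re) (fr r l)) , _ , o , upd-same t p _ , λ q ne → upd-other t _ ne
          branch : ∀ a' → a ≡ a' → ∀ h' → (∀ r → r < R 6 → regs h' r ≡ regs h r) → hio h' ≡ mkIO (annIdx a) p 0 t →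
            Tr (select copyBit (seq copyBit negateBit) (writeBit false) (writeBit true) (annKind a')) h' (Annotated a (annIdx a) p t h)
          branch (pos i) refl h' fr o = tr-post (tr-write {o = copy₁} (toℕ i) p t _ o blank
              (cong (writeIfBlank t p) (nth-fromList x i))) (λ h'' (re , o') → written a h' h'' fr re o')
          branch (negl i) refl h' fr o = tr-seq (tr-post (tr-write {o = copy₁} (toℕ i) p t _ o blank
              (cong (writeIfBlank t p) (nth-fromList x i))) (λ h'' (re , o') →
                tr-device stay stay stay negate₁ h'' _
                  ((λ r l → trans (cong (λ g → g r) re) (fr r l)) , _ ,
                   cong (actIO {γ} x (instr (λ s → s) stay stay stay stay negate₁)) o' ,
                   trans (upd-same _ p _) (cong (Maybe.map not) (upd-same t p _)) ,
                   (λ q ne → trans (upd-other _ _ ne) (upd-other t _ ne)))))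
          branch (const false) refl h' fr o = tr-post (tr-write {o = write₁ false} 0 p t _ o blank refl)
            (λ h'' (re , o') → written a h' h'' fr re o')
          branch (const true) refl h' fr o = tr-post (tr-write {o = write₁ true} 0 p t _ o blank refl)
            (λ h'' (re , o') → written a h' h'' fr re o')

        annVals : ∀ {w} (w<W : w < W) → let a = lookup (annot C) (fromℕ< w<W) in
          fAnnKind F (n ∷ w ∷ []) ≡ annKind a × fAnnIdx F (n ∷ w ∷ []) ≡ annIdx a ×
          annVal (fromList x) a ≡ lookup v₀ (fromℕ< w<W)
        annVals {w} w<W = cong (maybe annKind 0) e , cong (maybe annIdx 0) e , sym (VP.lookup-map i (annVal (fromList x)) (annot C))
          where
          i = fromℕ< w<W
          e : nth (toList (annot C)) w ≡ just (lookup (annot C) i)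
          e = trans (cong (nth (toList (annot C))) (sym (toℕ-fromℕ< w<W))) (nth-toList (annot C) i)

        tr-loadWire : ∀ {w h t} (w<W : w < W) → regs h (R 0) ≡ n → regs h (R 2) ≡ w → hio h ≡ mkIO 0 w 0 t → t w ≡ nothing →
          Tr loadWire h (λ h' → (∀ r → r < R 3 → regs h' r ≡ regs h r) × Σ (ℕ → Maybe Bool) λ t' →
            hio h' ≡ mkIO 0 (suc w) 0 t' × t' w ≡ just (lookup v₀ (fromℕ< w<W)) × (∀ q → q ≢ w → t' q ≡ t q))
        tr-loadWire {w} {h} {t} w<W e0 e2 eo blank =
          tr-seq (tr-post (tr-evalFAC uKind (0 ∷ 2 ∷ []) 3 (n ∷ w ∷ []) b h (env₂ {h} 3 ≤-refl e0 e2) (le₂ w≤b) kKind cKind)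
            λ h₁ (v₁ , f₁ , o₁) →
          tr-seq (tr-post (tr-evalFAC uIdx (0 ∷ 2 ∷ []) 4 (n ∷ w ∷ []) b h₁
                            (env₂ {h₁} 4 (n≤1+n 3) (trans (f₁ _ (m≤m+n 3 2)) e0) (trans (f₁ _ ≤-refl) e2)) (le₂ w≤b) kIdx cIdx)
            λ h₂ (v₂ , f₂ , o₂) →
          tr-seq (tr-post (tr-moves {5} {4} right stay stay (r< 5 (n≤1+n 5)) (r< 4 (m≤m+n 4 2)) (λ ()))
            λ h₃ (f₃ , o₃) →
          tr-seq (tr-post (tr-annotate a w t (trans (f₃ _ (λ ())) (trans (f₂ _ ≤-refl) (trans v₁ kind)))
                            (trans o₃ (trans (cong₂ (moveIO right stay stay) (trans v₂ idx) (trans o₂ (trans o₁ eo))) (there (annIdx a)))) blank)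
            λ h₄ (f₄ , t' , o₄ , hit , rest) →
          tr-seq (tr-post (tr-moves {5} {4} left stay stay (r< 5 (n≤1+n 5)) (r< 4 (m≤m+n 4 2)) (λ ()))
            λ h₅ (f₅ , o₅) →
          tr-device stay right stay noop h₅ _
            ((λ r l → trans (f₅ r (λ { refl → <-asym l (m≤m+n 6 1) })) (trans (f₄ r (≤-trans l (m≤m+n 5 3)))
                        (trans (f₃ r (λ { refl → <-asym l (m≤m+n 6 1) })) (trans (f₂ r (≤-trans l (n≤1+n 5))) (f₁ r l))))) ,
             t' , cong (λ o → mkIO (IO.ipos o) (suc (IO.pos₁ o)) (IO.pos₂ o) (IO.comp o))
                    (trans o₅ (trans (cong₂ (moveIO left stay stay) (trans (f₄ _ (m≤m+n 7 1)) (trans (f₃ _ (λ ())) (trans v₂ idx))) o₄) (back (annIdx a)))) ,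
             trans hit (cong just val) , rest))))))
          where
          i = fromℕ< w<W
          a = lookup (annot C) i
          w≤b = ≤-trans (<⇒≤ w<W) W≤b
          kind = proj₁ (annVals w<W)
          idx = proj₁ (proj₂ (annVals w<W))
          val = proj₂ (proj₂ (annVals w<W))
          there : ∀ k → moveIO right stay stay k (mkIO 0 w 0 t) ≡ mkIO k w 0 t
          there k rewrite moves-stay k w | moves-stay k 0 | moves-right k 0 | +-identityʳ k = refl
          back : ∀ k {t'} → moveIO left stay stay k (mkIO k w 0 t') ≡ mkIO 0 w 0 t'
          back k rewrite moves-stay k w | moves-stay k 0 =
            cong (λ z → mkIO z w 0 _) (trans (cong (moves left k) (sym (+-identityʳ k))) (moves-left k 0))

        tr-loadWires : ∀ {h} → regs h (R 0) ≡ n → hio h ≡ mkIO 0 0 0 blankTape →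
          Tr loadWires h (λ h' → regs h' (R 0) ≡ n × regs h' (R 1) ≡ W × Σ (ℕ → Maybe Bool) λ t →
            hio h' ≡ mkIO 0 W 0 t × (∀ i → t (toℕ i) ≡ just (lookup v₀ i)))
        tr-loadWires {h} e0 eo =
          tr-seq (tr-post (tr-evalFAC uW (0 ∷ []) 1 (n ∷ []) b h (env₁ {h} e0) le₁ kW cW)
            λ h₁ (v₁ , f₁ , o₁) →
          tr-post (tr-for W Inv (r< 2 (m≤m+n 2 4)) (r< 1 (m≤m+n 1 5)) (λ ()) refl v₁
            (trans (assign-other _ 0 (λ ())) (trans (f₁ _ ≤-refl) e0) ,
             blankTape , trans o₁ eo , (λ i ()) , (λ q _ → refl))
            (λ k h₂ k<W ik sk (e , t , o , done , todo) → tr-post (tr-loadWire {k} {h₂} {t} k<W e ik o (todo k ≤-refl))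
              λ h₃ (f₃ , t' , o₃ , hit , rest) →
                trans (f₃ _ ≤-refl) ik , trans (f₃ _ (n≤1+n 4)) sk ,
                trans (assign-other _ _ (λ ())) (trans (f₃ _ (m≤m+n 3 2)) e) ,
                t' , o₃ , loaded k k<W t t' hit rest done ,
                (λ q k<q → trans (rest q (>⇒≢ k<q)) (todo q (<⇒≤ k<q)))))
            (λ h' (_ , s , e , t , o , done , _) → e , s , t , o , (λ i → done i (toℕ<n i))))
          where
          Inv : ℕ → (ℕ → ℕ) → IO → Set
          Inv k ρ o = ρ (R 0) ≡ n × Σ (ℕ → Maybe Bool) λ t → o ≡ mkIO 0 k 0 t ×
            (∀ (i : Fin W) → toℕ i < k → t (toℕ i) ≡ just (lookup v₀ i)) × (∀ q → k ≤ q → t q ≡ nothing)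
          loaded : ∀ k (k<W : k < W) (t t' : ℕ → Maybe Bool) → t' k ≡ just (lookup v₀ (fromℕ< k<W)) → (∀ q → q ≢ k → t' q ≡ t q) →
            (∀ (i : Fin W) → toℕ i < k → t (toℕ i) ≡ just (lookup v₀ i)) →
            ∀ (i : Fin W) → toℕ i < suc k → t' (toℕ i) ≡ just (lookup v₀ i)
          loaded k k<W t t' hit rest done i i< with m<1+n⇒m<n∨m≡n i<
          ... | inj₁ i<k = trans (rest _ (<⇒≢ i<k)) (done i i<k)
          ... | inj₂ refl = trans hit (cong (λ j → just (lookup v₀ j)) (fromℕ<-toℕ i k<W))

        Agrees : (ℕ → Maybe Bool) → Vec Bool W → Set
        Agrees t v = ∀ i → t (toℕ i) ≡ just (lookup v i)

        -- This includes i = j: tape and circuit both write the minimum first and then the maximum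
        -- over it.
        sortCells-agrees : ∀ {t v} i j → Agrees t v → Agrees (sortCells t (toℕ i) (toℕ j)) (applyGate v (i , j))
        sortCells-agrees {t} {v} i j A k rewrite A i | A j with k Fin.≟ j
        ... | yes refl = trans (upd-same _ (toℕ k) _) (cong just (sym (VP.lookup∘update k (v [ i ]≔ _) _)))
        ... | no k≢j with k Fin.≟ i
        ...   | yes refl = trans (upd-other _ _ (λ e → k≢j (toℕ-injective e))) (trans (upd-same t (toℕ k) _)
                  (cong just (sym (trans (VP.lookup∘update′ k≢j (v [ k ]≔ _) _) (VP.lookup∘update k v _)))))
        ...   | no k≢i = trans (upd-other _ _ (λ e → k≢j (toℕ-injective e))) (trans (upd-other t _ (λ e → k≢i (toℕ-injective e)))
                  (trans (A k) (cong just (sym (trans (VP.lookup∘update′ k≢j (v [ i ]≔ _) _) (VP.lookup∘update′ k≢i v _))))))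

        drop-nth : {A : Set} (gs : List A) {k : ℕ} {g : A} → nth gs k ≡ just g → drop k gs ≡ g ∷ drop (suc k) gs
        drop-nth (g ∷ gs) {zero}  refl = refl
        drop-nth (g ∷ gs) {suc k} e    = drop-nth gs e

        tr-applyOneGate : ∀ {k h t v} g → k < G → nth (gates C) k ≡ just g → regs h (R 0) ≡ n → regs h (R 2) ≡ k →
          hio h ≡ mkIO 0 0 0 t → Agrees t v →
          Tr applyOneGate h (λ h' → (∀ r → r < R 3 → regs h' r ≡ regs h r) × Σ (ℕ → Maybe Bool) λ t' →
            hio h' ≡ mkIO 0 0 0 t' × Agrees t' (applyGate v g))
        tr-applyOneGate {k} {h} {t} {v} (i , j) k<G gk e0 e2 eo A =
          tr-seq (tr-post (tr-evalFAC uMin (0 ∷ 2 ∷ []) 3 (n ∷ k ∷ []) b h (env₂ {h} 3 ≤-refl e0 e2) (le₂ k≤b) kMin cMin)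
            λ h₁ (v₁ , f₁ , o₁) →
          tr-seq (tr-post (tr-evalFAC uMax (0 ∷ 2 ∷ []) 4 (n ∷ k ∷ []) b h₁
                            (env₂ {h₁} 4 (n≤1+n 3) (trans (f₁ _ (m≤m+n 3 2)) e0) (trans (f₁ _ ≤-refl) e2)) (le₂ k≤b) kMax cMax)
            λ h₂ (v₂ , f₂ , o₂) →
          tr-seq (tr-post (tr-moves {5} {3} stay right stay (r< 5 (n≤1+n 5)) (r< 3 (m≤m+n 3 3)) (λ ()))
            λ h₃ (f₃ , o₃) →
          tr-seq (tr-post (tr-moves {5} {4} stay stay right (r< 5 (n≤1+n 5)) (r< 4 (m≤m+n 4 2)) (λ ()))
            λ h₄ (f₄ , o₄) →
          tr-seq (tr-device stay stay stay sort₁₂ h₄ _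
          (tr-seq (tr-post (tr-moves {5} {3} stay left stay (r< 5 (n≤1+n 5)) (r< 3 (m≤m+n 3 3)) (λ ()))
            λ h₅ (f₅ , o₅) →
          tr-post (tr-moves {5} {4} stay stay left (r< 5 (n≤1+n 5)) (r< 4 (m≤m+n 4 2)) (λ ()))
            λ h₆ (f₆ , o₆) → let
              a₃ : regs h₂ (R 3) ≡ toℕ i
              a₃ = trans (f₂ _ ≤-refl) (trans v₁ (cong (maybe (λ g → toℕ (proj₁ g)) 0) gk))
              b₃ : regs h₃ (R 4) ≡ toℕ j
              b₃ = trans (f₃ _ (λ ())) (trans v₂ (cong (maybe (λ g → toℕ (proj₂ g)) 0) gk))
              a₅ : regs h₄ (R 3) ≡ toℕ i
              a₅ = trans (f₄ _ (λ ())) (trans (f₃ _ (λ ())) a₃)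
              b₅ : regs h₅ (R 4) ≡ toℕ j
              b₅ = trans (f₅ _ (λ ())) (trans (f₄ _ (λ ())) b₃)
              io₄ : hio h₄ ≡ mkIO 0 (toℕ i) (toℕ j) t
              io₄ = trans o₄ (trans (cong₂ (moveIO stay stay right) b₃ (trans o₃ (trans (cong₂ (moveIO stay right stay) a₃ (trans o₂ (trans o₁ eo))) (go₁ (toℕ i))))) (go₂ (toℕ i) (toℕ j)))
              io₆ : hio h₆ ≡ mkIO 0 0 0 (sortCells t (toℕ i) (toℕ j))
              io₆ = trans o₆ (trans (cong₂ (moveIO stay stay left) b₅ (trans o₅ (trans (cong₂ (moveIO stay left stay) a₅
                      (cong (actIO {γ} x (instr (λ s → s) stay stay stay stay sort₁₂)) io₄)) (back₁ (toℕ i) (toℕ j))))) (back₂ (toℕ j)))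
            in (λ r l → trans (f₆ r (≢5 l)) (trans (f₅ r (≢5 l)) (trans (f₄ r (≢5 l)) (trans (f₃ r (≢5 l)) (trans (f₂ r (≤-trans l (n≤1+n 5))) (f₁ r l)))))) ,
               _ , io₆ , sortCells-agrees {t} {v} i j A)))))))
          where
          k≤b = ≤-trans (<⇒≤ k<G) G≤b
          ≢5 : ∀ {r} → r < R 3 → r ≢ R 5
          ≢5 l refl = <-asym l (m≤m+n 6 1)
          go₁ : ∀ i → moveIO stay right stay i (mkIO 0 0 0 t) ≡ mkIO 0 i 0 t
          go₁ i rewrite moves-stay i 0 | moves-right i 0 | +-identityʳ i = refl
          go₂ : ∀ i j → moveIO stay stay right j (mkIO 0 i 0 t) ≡ mkIO 0 i j t
          go₂ i j rewrite moves-stay j 0 | moves-stay j i | moves-right j 0 | +-identityʳ j = refl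
          back₁ : ∀ i j {t} → moveIO stay left stay i (mkIO 0 i j t) ≡ mkIO 0 0 j t
          back₁ i j rewrite moves-stay i 0 | moves-stay i j =
            cong (λ z → mkIO 0 z j _) (trans (cong (moves left i) (sym (+-identityʳ i))) (moves-left i 0))
          back₂ : ∀ j {t} → moveIO stay stay left j (mkIO 0 0 j t) ≡ mkIO 0 0 0 t
          back₂ j rewrite moves-stay j 0 =
            cong (λ z → mkIO 0 0 z _) (trans (cong (moves left j) (sym (+-identityʳ j))) (moves-left j 0))

        tr-applyGates : ∀ {h t} → regs h (R 0) ≡ n → hio h ≡ mkIO 0 0 0 t → Agrees t v₀ →
          Tr applyGates h (λ h' → regs h' (R 0) ≡ n × Σ (ℕ → Maybe Bool) λ t' →
            hio h' ≡ mkIO 0 0 0 t' × Agrees t' (runGates v₀ (gates C)))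
        tr-applyGates {h} {t} e0 eo A =
          tr-seq (tr-post (tr-evalFAC uG (0 ∷ []) 1 (n ∷ []) b h (env₁ {h} e0) le₁ kG cG)
            λ h₁ (v₁ , f₁ , o₁) →
          tr-post (tr-for G Inv (r< 2 (m≤m+n 2 4)) (r< 1 (m≤m+n 1 5)) (λ ()) refl v₁
            (trans (assign-other _ 0 (λ ())) (trans (f₁ _ ≤-refl) e0) , t , v₀ , trans o₁ eo , A , refl)
            (λ k h₂ k<G ik sk (e , t , v , o , A , r) → let g , gk = nth-just (gates C) k<G in
              tr-post (tr-applyOneGate {k} {h₂} {t} {v} g k<G gk e ik o A)
              λ h₃ (f₃ , t' , o₃ , A') →
                trans (f₃ _ ≤-refl) ik , trans (f₃ _ (n≤1+n 4)) sk ,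
                trans (assign-other _ _ (λ ())) (trans (f₃ _ (m≤m+n 3 2)) e) ,
                t' , applyGate v g , o₃ , A' , trans (cong (runGates v) (sym (drop-nth (gates C) gk))) r))
            (λ h' (_ , s , e , t , v , o , A , r) → e , t , o , λ i → trans (A i) (cong (λ u → just (lookup u i)) (trans (sym (cong (runGates v) (drop-all (gates C)))) r))))
          where
          Inv : ℕ → (ℕ → ℕ) → IO → Set
          Inv k ρ o = ρ (R 0) ≡ n × Σ (ℕ → Maybe Bool) λ t → Σ (Vec Bool W) λ v → o ≡ mkIO 0 0 0 t × Agrees t v ×
            runGates v (drop k (gates C)) ≡ runGates v₀ (gates C)
          drop-all : {A : Set} (as : List A) → drop (length as) as ≡ []
          drop-all []       = refl
          drop-all (a ∷ as) = drop-all as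

        tr-simulate : ∀ {h} → regs h (R 0) ≡ n → hio h ≡ mkIO 0 0 0 blankTape →
          Tr simulate h (λ h' → IO.comp (hio h') (IO.pos₁ (hio h')) ≡ just (evalC C (fromList x)))
        tr-simulate {h} e0 eo =
          tr-seq (tr-post (tr-loadWires {h} e0 eo)
            λ h₁ (e₁ , w₁ , t₁ , o₁ , A₁) →
          tr-seq (tr-post (tr-moves {2} {1} stay left stay (r< 2 (m≤m+n 2 4)) (r< 1 (m≤m+n 1 5)) (λ ()))
            λ h₂ (f₂ , o₂) →
          tr-seq (tr-post (tr-applyGates {h₂} {t₁} (trans (f₂ _ (λ ())) e₁)
                            (trans o₂ (trans (cong₂ (moveIO stay left stay) w₁ o₁) (back W))) A₁)
            λ h₃ (e₃ , t₃ , o₃ , A₃) →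
          tr-seq (tr-post (tr-evalFAC uO (0 ∷ []) 1 (n ∷ []) b h₃ (env₁ {h₃} e₃) le₁ kO cO)
            λ h₄ (v₄ , f₄ , o₄) →
          tr-post (tr-moves {2} {1} stay right stay (r< 2 (m≤m+n 2 4)) (r< 1 (m≤m+n 1 5)) (λ ()))
            λ h₅ (f₅ , o₅) →
              trans (cong (λ o → IO.comp o (IO.pos₁ o))
                      (trans o₅ (trans (cong₂ (moveIO stay right stay) v₄ (trans o₄ o₃)) (go (toℕ (output C))))))
                    (A₃ (output C))))))
          where
          go : ∀ i {t} → moveIO stay right stay i (mkIO 0 0 0 t) ≡ mkIO 0 i 0 t
          go i rewrite moves-stay i 0 | moves-right i 0 | +-identityʳ i = refl
          back : ∀ i {t} → moveIO stay left stay i (mkIO 0 i 0 t) ≡ mkIO 0 0 0 t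
          back i rewrite moves-stay i 0 =
            cong (λ z → mkIO 0 z 0 _) (trans (cong (moves left i) (sym (+-identityʳ i))) (moves-left i 0))

  -- From the initial work tape to registers.

  open Polynomials

  nonBlank : Sym → Bool
  nonBlank zero    = false
  nonBlank (suc _) = true

  -- The initial symbols already count as cells with digit 0 on every track except track 0, so
  -- `delimit` only adds the marks of the first cell and of the first blank. `convert` changes the
  -- base of n by counting: track 1 and register 0 grow together until track 1 agrees with track 0.
  delimit convert : SP γ
  delimit = seq (act (instr (setMark homeᶠ) right stay stay stay noop))
           (seq (scanR nonBlank (λ s → s)) (seq (act (instr (setMark end) stay stay stay stay noop)) goHome))
  convert = whileNe 0 1 (seq (inc 1) (inc (R 0)))

  nth-nothing : {A : Set} (as : List A) {i : ℕ} → length as ≤ i → nth as i ≡ nothing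
  nth-nothing []       le        = refl
  nth-nothing (a ∷ as) (s≤s le) = nth-nothing as le

  initTape : List Bool → ℕ → Sym
  initTape bs i = symOf (nth bs i)

  initTape-inside : ∀ bs {i} → i < length bs → nonBlank (initTape bs i) ≡ true × mark (initTape bs i) ≡ mid ×
    (∀ r → 0 < r → r < K → digit r (initTape bs i) ≡ 0) × digit 0 (initTape bs i) < 2
  initTape-inside (b ∷ bs) {suc i} (s≤s i<) = initTape-inside bs i<
  initTape-inside (false ∷ bs) {zero} _ = refl , refl , (λ r _ _ → refl) , z<s
  initTape-inside (true ∷ bs) {zero} _ = refl , refl , other , ≤-refl
    where
    other : ∀ r → 0 < r → r < K → digit r (initTape (true ∷ bs) 0) ≡ 0
    other r 0<r r<K with r mod K | toℕ-mod {r} {K} r<K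
    ... | zero  | e = ⊥-elim (<⇒≢ 0<r e)
    ... | suc _ | _ = refl

  num-initTape : ∀ bs → num 2 (λ i → digit 0 (initTape bs i)) (length bs) ≡ bitValue bs
  num-initTape []           = refl
  num-initTape (true ∷ bs)  = cong (λ z → 1 + z * 2) (num-initTape bs)
  num-initTape (false ∷ bs) = cong (_* 2) (num-initTape bs)

  module Start (x : List Bool) (ℓ' : ℕ) (bs : List Bool) (len : length bs ≡ suc ℓ') where

    open Rules x ℓ'

    h₀ : HState
    h₀ = mkH (λ { zero → bitValue bs ; (suc _) → 0 }) false (mkIO 0 0 0 blankTape)

    c₀ : TC γ
    c₀ = mkTC (initTape bs) 0 (mkIO 0 0 0 blankTape)

    exec-delimit : Σ (TC γ) λ c → Exc delimit c₀ c × RepAt 0 h₀ c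
    exec-delimit =
      let c₂ , ex₂ , ps , io₂ , done , rest = exec-scanR {x} {suc ℓ} nonBlank (λ s → s) ℓ' c₁ ≤-refl
            (λ { (suc i) _ i<ℓ → proj₁ (in< (suc i) i<ℓ) }) (cong nonBlank (cong symOf (nth-nothing bs (≤-reflexive len))))
          c₃ = actTC x (instr (setMark end) stay stay stay stay noop) c₂
          c₄ , ex₄ , rep = rep-goHome {ℓ} {h₀} {c₃} (rep₃ c₂ ps io₂ done rest) ≤-refl
      in c₄ , seq (act z<s) (seq ex₂ (seq (act (subst (_< suc ℓ) (sym ps) ≤-refl)) ex₄)) , rep
      where
      c₁ = actTC x (instr (setMark homeᶠ) right stay stay stay noop) c₀
      in< : ∀ i → i < ℓ → _
      in< i i<ℓ = initTape-inside bs (subst (i <_) (sym len) i<ℓ)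
      module _ (c₂ : TC γ) (ps : wpos c₂ ≡ ℓ) (io₂ : io c₂ ≡ io c₁)
               (done : ∀ i → 1 ≤ i → i < ℓ → work c₂ i ≡ work c₁ i)
               (rest : ∀ i → i < 1 ⊎ ℓ ≤ i → work c₂ i ≡ work c₁ i) where
        c₃ = actTC x (instr (setMark end) stay stay stay stay noop) c₂
        same : ∀ i → work c₂ i ≡ work c₁ i
        same i with i <? ℓ
        same zero    | _ = rest 0 (inj₁ ≤-refl)
        same (suc i) | yes i<ℓ = done (suc i) (s≤s z≤n) i<ℓ
        same (suc i) | no i≮ℓ = rest (suc i) (inj₂ (≮⇒≥ i≮ℓ))
        low : ∀ i → i < ℓ → work c₃ i ≡ work c₁ i
        low i i<ℓ = trans (upd-other (work c₂) _ (λ e → <⇒≢ i<ℓ (trans e ps))) (same i)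
        dig : ∀ r i → i < ℓ → digit r (work c₃ i) ≡ digit r (initTape bs i)
        dig r zero i<ℓ = trans (cong (digit r) (low 0 i<ℓ)) (digit-setMark r homeᶠ (initTape bs 0))
        dig r (suc i) i<ℓ = cong (digit r) (low (suc i) i<ℓ)
        rep₃ : RepAt ℓ h₀ c₃
        rep₃ = mkRep ps
          (trans (cong mark (low 0 z<s)) (mark-setMark homeᶠ (initTape bs 0)))
          (λ { (suc i) l i<ℓ → trans (cong mark (low (suc i) i<ℓ)) (proj₁ (proj₂ (in< (suc i) i<ℓ))) })
          (trans (cong mark (trans (cong (work c₃) (sym ps)) (upd-same (work c₂) (wpos c₂) _))) (mark-setMark end (scanned c₂)))
          (λ { zero r<K i i<ℓ → subst (_< 2) (sym (dig 0 i i<ℓ)) (proj₂ (proj₂ (proj₂ (in< i i<ℓ))))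
             ; (suc r) r<K i i<ℓ → subst (_< base (suc r)) (sym (zeros r r<K i i<ℓ)) z<s })
          (λ { zero r<K → trans (num-cong 2 ℓ (λ i i<ℓ → dig 0 i i<ℓ))
                            (subst (λ m → num 2 (λ i → digit 0 (initTape bs i)) m ≡ bitValue bs) len (num-initTape bs))
             ; (suc r) r<K → num-zero (base (suc r)) ℓ (zeros r r<K) })
          io₂
          where
          zeros : ∀ r → suc r < K → ∀ i → i < ℓ → digit (suc r) (work c₃ i) ≡ 0
          zeros r r<K i i<ℓ = trans (dig (suc r) i i<ℓ) (proj₁ (proj₂ (proj₂ (in< i i<ℓ))) (suc r) z<s r<K)

    module _ (2<K : 2 < K) where

      private
        n = bitValue bs

      tr-convert : Tr convert h₀ (λ h' → regs h' (R 0) ≡ n × hio h' ≡ hio h₀)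
      tr-convert c rep = tr-post (tr-whileNe {0} {1} z<s (<⇒≤ 2<K) refl Inv done body n h₀
          (0 , refl , refl , refl , refl , refl))
        (λ h' (j , e , _ , _ , e₂ , o) → trans e₂ (trans (sym (+-identityʳ j)) e) , o) c rep
        where
        n<2^ : n < 2 ^ ℓ
        n<2^ = reg< rep z<s
        n<B^ : n < B ^ ℓ
        n<B^ = ≤-trans n<2^ (^-monoˡ-≤ ℓ (s≤s (s≤s z≤n)))
        Inv : ℕ → (ℕ → ℕ) → IO → Set
        Inv k ρ o = Σ ℕ λ j → j + k ≡ n × ρ 0 ≡ n × ρ 1 ≡ j × ρ 2 ≡ j × o ≡ hio h₀
        done : ∀ ρ o → Inv 0 ρ o → ρ 0 ≡ ρ 1
        done ρ o (j , e , e₀ , e₁ , _) = trans e₀ (trans (sym e) (trans (+-identityʳ j) (sym e₁)))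
        body : ∀ k h → Inv (suc k) (regs h) (hio h) →
          regs h 0 ≢ regs h 1 × Tr (seq (inc 1) (inc (R 0))) h (λ h' → Inv k (regs h') (hio h'))
        body k h (j , e , e₀ , e₁ , e₂ , o) =
          (λ q → <⇒≢ j<n (trans (sym e₁) (trans (sym q) e₀))) ,
          tr-seq (tr-inc 1 h _ (<⇒≤ 2<K) (≤-<-trans (subst (λ z → suc z ≤ n) (sym e₁) j<n) n<2^)
            (tr-inc 2 (setReg 1 (suc (regs h 1)) h) _ 2<K
              (≤-<-trans (subst (λ z → suc z ≤ n) (sym (trans (assign-other (regs h) _ (λ ())) e₂)) j<n) n<B^)
              (suc j , trans (sym (+-suc j k)) e ,
               trans (assign-other _ _ (λ ())) (trans (assign-other (regs h) _ (λ ())) e₀) ,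
               trans (assign-other _ _ (λ ())) (trans (assign-same (regs h) 1 _) (cong suc e₁)) ,
               trans (assign-same _ 2 _) (cong suc (trans (assign-other (regs h) _ (λ ())) e₂)) , o)))
          where
          j<n : j < n
          j<n = subst (j <_) e (m<m+n j z<s)

-- The machine of a uniform circuit family.

module FromCircuits where

  open Preliminaries
  open Structured
  open CoreFormulas
  open Polynomials

  compile-halts : ∀ {γ} {x : List Bool} {S o} (P : SP γ) (c : TC γ) →
    initConfig (compile P) x ≡ conf (suc (entry P)) c →
    Σ (TC γ) (λ c' → Exec x S P c c' × TC.wpos c' < S × IO.comp (TC.io c') (IO.pos₁ (TC.io c')) ≡ o) →
    (∀ t cfg → run (compile P) x t ≡ inj₁ cfg → Config.wpos cfg < S) × Σ ℕ λ t → run (compile P) x t ≡ inj₂ o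
  compile-halts {x = x} P c e (c' , ex , b , out) =
    steps⇒run {compile P} {x} 0 (cong inj₁ e)
      (exec⇒steps {compile P} ex {ι = suc} {e = zero} (λ i s → refl)) b (cong inj₂ out) (λ t cfg ())

  module Bounds (F : Family) (U : AC⁰Uniform F) where

    uW = proj₁ U
    uG = proj₁ (proj₂ U)
    uO = proj₁ (proj₂ (proj₂ U))
    uMin = proj₁ (proj₂ (proj₂ (proj₂ U)))
    uMax = proj₁ (proj₂ (proj₂ (proj₂ (proj₂ U))))
    uKind = proj₁ (proj₂ (proj₂ (proj₂ (proj₂ (proj₂ U)))))
    uIdx = proj₂ (proj₂ (proj₂ (proj₂ (proj₂ (proj₂ U)))))

    sizeB : ℕ → ℕ
    sizeB n = n + wires (F n) + length (gates (F n))

    bounds : ℕ → ℕ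
    bounds b = facBound uW b + (facBound uG b + (facBound uO b + (facBound uMin b + (facBound uMax b + (facBound uKind b + facBound uIdx b)))))

    registers : ℕ
    registers = facRegs uW + (facRegs uG + (facRegs uO + (facRegs uMin + (facRegs uMax + (facRegs uKind + facRegs uIdx)))))

  module Assembled (F : Family) (U : AC⁰Uniform F) (K' B' : ℕ) (enough : 20 + Bounds.registers F U ≤ K')
    (cap : ∀ n ℓ' → n < 2 ^ suc ℓ' → 3 + Bounds.bounds F U (Bounds.sizeB F U n) ≤ (2 + B') ^ suc ℓ') where

    open Bounds F U
    open Tracks K' B' using (module Simulator)
    open Tracks K' B' using (delimit; convert; module Start)

    program : SP (Tracks.γ K' B')
    program = seq delimit (seq convert (Simulator.simulate F U))

    program-correct : ∀ x → let ℓ' = proj₁ (length-binary>0 (length x)) in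
      Σ (TC (Tracks.γ K' B')) λ c' →
        Exec x (2 + ℓ') program (Start.c₀ x ℓ' (binary (length x)) (proj₂ (length-binary>0 (length x)))) c' ×
        TC.wpos c' < 2 + ℓ' × IO.comp (TC.io c') (IO.pos₁ (TC.io c')) ≡ just (evalC (F (length x)) (fromList x))
    program-correct x = finish exec-delimit (tr-seq (tr-post (tr-convert (s≤s (≤-trans (m≤m+n 2 _) enough)))
        λ h₂ (v , o) → Simulator.tr-simulate F U x ℓ' (s≤s (≤-trans (m≤m+n 14 _) enough))
               (k 1 (m≤m+n 1 3) wW) (k 1 (m≤m+n 1 3) wG) (k 1 (m≤m+n 1 3) wO) (k 3 (m≤m+n 3 1) wMin) (k 4 ≤-refl wMax) (k 3 (m≤m+n 3 1) wKind) (k 4 ≤-refl wIdx)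
               (f bW) (f bG) (f bO) (f bMin) (f bMax) (f bKind) (f bIdx)
               {h₂} (trans v (bitValue-binary n)) o))
      where
      n = length x
      ℓ' = proj₁ (length-binary>0 n)
      open Tracks K' B' using (γ; module HState)
      open Tracks.Triples K' B' x ℓ'
      open Start x ℓ' (binary n) (proj₂ (length-binary>0 n))
      out : Maybe Bool
      out = just (evalC (F (length x)) (fromList x))
      finish : ∀ {Q} → Σ (TC γ) (λ c → Exc delimit c₀ c × RepAt 0 h₀ c) →
        Tr Q h₀ (λ h' → IO.comp (HState.hio h') (IO.pos₁ (HState.hio h')) ≡ out) →
        Σ (TC γ) λ c' → Exc (seq delimit Q) c₀ c' × TC.wpos c' < 2 + ℓ' × IO.comp (TC.io c') (IO.pos₁ (TC.io c')) ≡ out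
      finish (c₁ , ex₁ , rep₁) tr with tr c₁ rep₁
      ... | c₂ , h₂ , ex₂ , mkRep refl _ _ _ _ _ refl , o = c₂ , seq ex₁ ex₂ , z<s , o
      b = sizeB n
      -- Read off the prepared tape, whose track 0 holds n in base 2 with ℓ digits.
      n< : n < 2 ^ suc ℓ'
      n< = small exec-delimit
        where
        small : Σ (TC γ) (λ c → Exc delimit c₀ c × RepAt 0 h₀ c) → n < 2 ^ suc ℓ'
        small (_ , _ , rep₁) = subst (_< 2 ^ suc ℓ') (bitValue-binary n) (Tracks.Rules.reg< K' B' x ℓ' rep₁ z<s)
      f : ∀ {m} → m ≤ bounds b → 2 + m < (2 + B') ^ suc ℓ'
      f le = ≤-trans (+-monoʳ-≤ 3 le) (cap n ℓ' n<)
      k : ∀ d {m} → d ≤ 4 → 20 + m ≤ 20 + registers → suc (suc (suc (d + m))) ≤ suc K'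
      k d {m} d≤ le = ≤-trans (s≤s (s≤s (s≤s (+-monoˡ-≤ m d≤)))) (≤-trans (≤-trans (+-monoˡ-≤ m (m≤m+n 7 13)) (≤-trans le enough)) (n≤1+n K'))
      infixr 5 _›_
      _›_ : ∀ {a b} m → a ≤ b → a ≤ m + b
      m › le = ≤-trans le (m≤n+m _ m)
      bW = m≤m+n (facBound uW b) _
      bG = facBound uW b › m≤m+n (facBound uG b) _
      bO = facBound uW b › facBound uG b › m≤m+n (facBound uO b) _
      bMin = facBound uW b › facBound uG b › facBound uO b › m≤m+n (facBound uMin b) _
      bMax = facBound uW b › facBound uG b › facBound uO b › facBound uMin b › m≤m+n (facBound uMax b) _
      bKind = facBound uW b › facBound uG b › facBound uO b › facBound uMin b › facBound uMax b › m≤m+n (facBound uKind b) _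
      bIdx = facBound uW b › facBound uG b › facBound uO b › facBound uMin b › facBound uMax b › m≤n+m (facBound uIdx b) (facBound uKind b)
      wW = +-monoʳ-≤ 20 (m≤m+n (facRegs uW) _)
      wG = +-monoʳ-≤ 20 (facRegs uW › m≤m+n (facRegs uG) _)
      wO = +-monoʳ-≤ 20 (facRegs uW › facRegs uG › m≤m+n (facRegs uO) _)
      wMin = +-monoʳ-≤ 20 (facRegs uW › facRegs uG › facRegs uO › m≤m+n (facRegs uMin) _)
      wMax = +-monoʳ-≤ 20 (facRegs uW › facRegs uG › facRegs uO › facRegs uMin › m≤m+n (facRegs uMax) _)
      wKind = +-monoʳ-≤ 20 (facRegs uW › facRegs uG › facRegs uO › facRegs uMin › facRegs uMax › m≤m+n (facRegs uKind) _)
      wIdx = +-monoʳ-≤ 20 (facRegs uW › facRegs uG › facRegs uO › facRegs uMin › facRegs uMax › m≤n+m (facRegs uIdx) (facRegs uKind))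

    computes : ∀ {R} → FamilyComputes F R → MachineComputes (compile program) R
    computes fc = 2 , λ x →
      let space , t , halted = compile-halts {x = x} program _ refl (program-correct x) in
      (λ t cfg e → ≤-trans (space t cfg e) (small x)) , t , evalC (F (length x)) (fromList x) , halted , fc x
      where
      small : ∀ x → 2 + proj₁ (length-binary>0 (length x)) ≤ 2 * (⌊log₂ length x ⌋ + 1)
      small x = begin
        2 + ℓ'                    ≡⟨ cong suc (sym len) ⟩
        1 + length (binary n)     ≤⟨ s≤s (length-binary n) ⟩
        1 + suc ⌊log₂ n ⌋         ≤⟨ +-monoˡ-≤ (suc ⌊log₂ n ⌋) (s≤s z≤n) ⟩
        suc ⌊log₂ n ⌋ + suc ⌊log₂ n ⌋ ≡⟨ cong₂ _+_ (+-comm 1 ⌊log₂ n ⌋) (trans (+-comm 1 ⌊log₂ n ⌋) (sym (+-identityʳ _))) ⟩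
        2 * (⌊log₂ n ⌋ + 1)       ∎
        where
        open ≤-Reasoning
        n = length x
        ℓ' = proj₁ (length-binary>0 n)
        len = proj₂ (length-binary>0 n)

  -- A track has as many cells as n has binary digits, so 2 + n is at most 4^ℓ, and the c-th power
  -- of n becomes a power of the base with exponent ℓ. One more factor 4 keeps the base at least 2
  -- when c is 0.
  capacity : ∀ {f : ℕ → ℕ} c → (∀ n → f n ≤ (2 + n) ^ c) → ∀ n ℓ' → n < 2 ^ suc ℓ' → f n ≤ (2 + (4 ^ suc c ∸ 2)) ^ suc ℓ'
  capacity {f} c f≤ n ℓ' n< = begin
    f n                       ≤⟨ f≤ n ⟩
    (2 + n) ^ c               ≤⟨ ^-monoˡ-≤ c (s≤s n<) ⟩
    (1 + 2 ^ ℓ) ^ c           ≤⟨ ^-monoˡ-≤ c (+-monoˡ-≤ (2 ^ ℓ) (m^n>0 2 ℓ)) ⟩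
    (2 ^ ℓ + 2 ^ ℓ) ^ c       ≡⟨ cong (λ z → (2 ^ ℓ + z) ^ c) (sym (+-identityʳ (2 ^ ℓ))) ⟩
    (2 * 2 ^ ℓ) ^ c           ≤⟨ ^-monoˡ-≤ c (*-monoˡ-≤ (2 ^ ℓ) (m≤m*n 2 (2 ^ ℓ') {{>-nonZero (m^n>0 2 ℓ')}})) ⟩
    (2 ^ ℓ * 2 ^ ℓ) ^ c       ≡⟨ cong (_^ c) (sym (^-distribʳ-* ℓ 2 2)) ⟩
    (4 ^ ℓ) ^ c               ≡⟨ trans (^-*-assoc 4 ℓ c) (trans (cong (4 ^_) (*-comm ℓ c)) (sym (^-*-assoc 4 c ℓ))) ⟩
    (4 ^ c) ^ ℓ               ≤⟨ ^-monoˡ-≤ ℓ (^-monoʳ-≤ 4 (n≤1+n c)) ⟩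
    (4 ^ suc c) ^ ℓ           ≡⟨ cong (_^ ℓ) (sym B≡) ⟩
    (2 + (4 ^ suc c ∸ 2)) ^ ℓ ∎
    where
    open ≤-Reasoning
    ℓ = suc ℓ'
    ^-distribʳ-* : ∀ k a b → (a * b) ^ k ≡ a ^ k * b ^ k
    ^-distribʳ-* zero    a b = refl
    ^-distribʳ-* (suc k) a b = trans (cong ((a * b) *_) (^-distribʳ-* k a b)) ([m*n]*[o*p]≡[m*o]*[n*p] a b (a ^ k) (b ^ k))
    B≡ : 2 + (4 ^ suc c ∸ 2) ≡ 4 ^ suc c
    B≡ = m+[n∸m]≡n (≤-trans (s≤s (s≤s z≤n)) (m≤m*n 4 (4 ^ c) {{>-nonZero (m^n>0 4 c)}}))

  module _ (F : Family) (ps : PolySize F) (U : AC⁰Uniform F) where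

    open Bounds F U

    poly-sizeB : PolyBounded sizeB
    poly-sizeB = poly-≤ (λ n → subst (_≤ n + (proj₁ ps * n ^ proj₁ ps + proj₁ ps)) (sym (+-assoc n _ _)) (+-monoʳ-≤ n (proj₂ ps n)))
      (poly-+ poly-id (poly-+ (poly-* (poly-const (proj₁ ps)) (poly-^ poly-id (proj₁ ps))) (poly-const (proj₁ ps))))

    poly-total : PolyBounded (λ n → 3 + bounds (sizeB n))
    poly-total = poly-+ (poly-const 3) (poly-∘
      (poly-+ (poly-facBound uW) (poly-+ (poly-facBound uG) (poly-+ (poly-facBound uO) (poly-+ (poly-facBound uMin)
      (poly-+ (poly-facBound uMax) (poly-+ (poly-facBound uKind) (poly-facBound uIdx))))))) poly-sizeB)

    circuits⇒machine : ∀ {R} → FamilyComputes F R → Σ Machine λ M → MachineComputes M R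
    circuits⇒machine {R} fc = machine poly-total
      where
      machine : PolyBounded (λ n → 3 + bounds (sizeB n)) → Σ Machine λ M → MachineComputes M R
      machine (c , le) = compile program , computes fc
        -- The 20 generously covers the two binary tracks, the registers with a fixed purpose and
        -- the offsets at which the evaluation routines start.
        where open Assembled F U (20 + registers) (4 ^ suc c ∸ 2) ≤-refl (capacity c le)

-- A language of number functions whose graphs are bounded formulas.

module Expressions where

  open Preliminaries
  open CoreFormulas using (wkTm; ⟦wkTm⟧)

  -- The exponent of `power` is fixed, so powers remain terms; `table` makes any finite function,
  -- such as the transition function of a machine, definable by cases.
  data Bin : Set where
    add mul sub quo rem leq : Bin
    table : ℕ → (ℕ → ℕ) → Bin
    power : ℕ → Bin

  cond : ℕ → ℕ → ℕ → ℕ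
  cond zero    a b = b
  cond (suc _) a b = a

  opaque
    leqℕ : ℕ → ℕ → ℕ
    leqℕ a b with a ≤ᵇ b
    ... | true  = 1
    ... | false = 0

  opaque
    tableℕ : ℕ → (ℕ → ℕ) → ℕ → ℕ
    tableℕ zero    f a = 0
    tableℕ (suc m) f a with a ≟ m
    ... | yes _ = f m
    ... | no _  = tableℕ m f a

  opaque
    unfolding tableℕ

    table-lookup : ∀ {m} f {a} → a < m → tableℕ m f a ≡ f a
    table-lookup {suc m} f {a} a<m with a ≟ m
    ... | yes refl = refl
    ... | no ne    = table-lookup f (≤∧≢⇒< (s≤s⁻¹ a<m) ne)

  -- Division is by the successor of the second argument; tables and powers ignore it.
  bin : Bin → ℕ → ℕ → ℕ
  bin add a b = a + b
  bin mul a b = a * b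
  bin sub a b = a ∸ b
  bin quo a b = a / suc b
  bin rem a b = a % suc b
  bin leq a b = leqℕ a b
  bin (table m f) a b = tableℕ m f a
  bin (power c) a b   = a ^ c

  data Exp (k : ℕ) : Set where
    arg  : Fin k → Exp k
    lit  : ℕ → Exp k
    op₂  : Bin → Exp k → Exp k → Exp k
    if   : Exp k → Exp k → Exp k → Exp k

  ⟦_⟧e : ∀ {k} → Exp k → Vec ℕ k → ℕ
  ⟦ arg i ⟧e ρ     = lookup ρ i
  ⟦ lit n ⟧e ρ     = n
  ⟦ op₂ o a b ⟧e ρ = bin o (⟦ a ⟧e ρ) (⟦ b ⟧e ρ)
  ⟦ if c a b ⟧e ρ  = cond (⟦ c ⟧e ρ) (⟦ a ⟧e ρ) (⟦ b ⟧e ρ)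

  numeral : ∀ {m} → ℕ → Tm m
  numeral zero    = 𝟘
  numeral (suc n) = 𝟙 ⊕ numeral n

  ⟦numeral⟧ : ∀ {m} n (ρ : Vec ℕ m) → ⟦ numeral n ⟧t ρ ≡ n
  ⟦numeral⟧ zero    ρ = refl
  ⟦numeral⟧ (suc n) ρ = cong suc (⟦numeral⟧ n ρ)

  tableBound : ℕ → (ℕ → ℕ) → ℕ
  tableBound zero    f = 0
  tableBound (suc m) f = f m + tableBound m f

  opaque
    unfolding tableℕ

    table≤ : ∀ m f a → tableℕ m f a ≤ tableBound m f
    table≤ zero    f a = z≤n
    table≤ (suc m) f a with a ≟ m
    ... | yes _ = m≤m+n _ _
    ... | no _  = ≤-trans (table≤ m f a) (m≤n+m _ _)

  powerTm : ∀ {m} → ℕ → Tm m → Tm m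
  powerTm zero    a = 𝟙
  powerTm (suc c) a = a ⊗ powerTm c a

  ⟦powerTm⟧ : ∀ {m} c (a : Tm m) ρ → ⟦ powerTm c a ⟧t ρ ≡ ⟦ a ⟧t ρ ^ c
  ⟦powerTm⟧ zero    a ρ = refl
  ⟦powerTm⟧ (suc c) a ρ = cong (⟦ a ⟧t ρ *_) (⟦powerTm⟧ c a ρ)

  binBound : ∀ {m} → Bin → Tm m → Tm m → Tm m
  binBound add a b = a ⊕ b
  binBound mul a b = a ⊗ b
  binBound sub a b = a
  binBound quo a b = a
  binBound rem a b = a
  binBound leq a b = 𝟙
  binBound (table m f) a b = numeral (tableBound m f)
  binBound (power c) a b   = powerTm c a

  -- The values of subexpressions are to be guessed by bounded quantifiers, and such a bound has to
  -- be a term.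
  expBound : ∀ {k m} → Exp k → Vec (Tm m) k → Tm m
  expBound (arg i) σ     = lookup σ i
  expBound (lit n) σ     = numeral n
  expBound (op₂ o a b) σ = binBound o (expBound a σ) (expBound b σ)
  expBound (if c a b) σ  = expBound a σ ⊕ expBound b σ

  values : ∀ {k m} → Vec (Tm m) k → Vec ℕ m → Vec ℕ k
  values σ ρ = map (λ t → ⟦ t ⟧t ρ) σ

  opaque
    unfolding leqℕ

    leq≤1 : ∀ a b → leqℕ a b ≤ 1
    leq≤1 a b with a ≤ᵇ b
    ... | true  = ≤-refl
    ... | false = z≤n

  bin≤bound : ∀ {m} o {a b} {s t : Tm m} {ρ} → a ≤ ⟦ s ⟧t ρ → b ≤ ⟦ t ⟧t ρ → bin o a b ≤ ⟦ binBound o s t ⟧t ρ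
  bin≤bound add p q = +-mono-≤ p q
  bin≤bound mul p q = *-mono-≤ p q
  bin≤bound sub {a} {b} p q = ≤-trans (m∸n≤m a b) p
  bin≤bound quo {a} {b} p q = ≤-trans (m/n≤m a (suc b)) p
  bin≤bound rem {a} {b} p q = ≤-trans (m%n≤m a (suc b)) p
  bin≤bound leq {a} {b} p q = leq≤1 a b
  bin≤bound (table m f) {a} {ρ = ρ} p q = ≤-trans (table≤ m f a) (≤-reflexive (sym (⟦numeral⟧ (tableBound m f) ρ)))
  bin≤bound (power c) {s = s} {ρ = ρ} p q = ≤-trans (^-monoˡ-≤ c p) (≤-reflexive (sym (⟦powerTm⟧ c s ρ)))

  cond≤ : ∀ c a b → cond c a b ≤ a + b
  cond≤ zero    a b = m≤n+m b a
  cond≤ (suc _) a b = m≤m+n a b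

  exp≤bound : ∀ {k m} (e : Exp k) (σ : Vec (Tm m) k) ρ → ⟦ e ⟧e (values σ ρ) ≤ ⟦ expBound e σ ⟧t ρ
  exp≤bound (arg i) σ ρ     = ≤-reflexive (lookup-map i _ σ)
  exp≤bound (lit n) σ ρ     = ≤-reflexive (sym (⟦numeral⟧ n ρ))
  exp≤bound (op₂ o a b) σ ρ = bin≤bound o {s = expBound a σ} {expBound b σ} {ρ} (exp≤bound a σ ρ) (exp≤bound b σ ρ)
  exp≤bound (if c a b) σ ρ  = ≤-trans (cond≤ (⟦ c ⟧e (values σ ρ)) _ _) (+-mono-≤ (exp≤bound a σ ρ) (exp≤bound b σ ρ))

  tableGraph : ∀ {m} → ℕ → (ℕ → ℕ) → Tm m → Tm m → Fm m
  tableGraph zero    f a y = y ≐ 𝟘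
  tableGraph (suc c) f a y = ((a ≐ numeral c) ∧' (y ≐ numeral (f c))) ∨' (¬' (a ≐ numeral c) ∧' tableGraph c f a y)

  -- The quantified witness is the remainder in the graph of the quotient, and the quotient in the
  -- graph of the remainder.
  binGraph : ∀ {m} → Bin → Tm m → Tm m → Tm m → Fm m
  binGraph add a b y = y ≐ (a ⊕ b)
  binGraph mul a b y = y ≐ (a ⊗ b)
  binGraph sub a b y = ((a ≼ b) ∧' (y ≐ 𝟘)) ∨' ((b ≼ a) ∧' ((y ⊕ b) ≐ a))
  binGraph quo a b y = ∃≤ b (wkTm a ≐ (var zero ⊕ (wkTm y ⊗ (𝟙 ⊕ wkTm b))))
  binGraph rem a b y = (y ≼ b) ∧' ∃≤ a (wkTm a ≐ (wkTm y ⊕ (var zero ⊗ (𝟙 ⊕ wkTm b))))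
  binGraph leq a b y = ((a ≼ b) ∧' (y ≐ 𝟙)) ∨' (¬' (a ≼ b) ∧' (y ≐ 𝟘))
  binGraph (table c f) a b y = tableGraph c f a y
  binGraph (power c) a b y   = y ≐ powerTm c a

  condGraph : ∀ {m} → Tm m → Tm m → Tm m → Tm m → Fm m
  condGraph c a b y = ((c ≐ 𝟘) ∧' (y ≐ b)) ∨' ((𝟙 ≼ c) ∧' (y ≐ a))

  opaque
    unfolding leqℕ

    leq-yes : ∀ {a b} → a ≤ b → leqℕ a b ≡ 1
    leq-yes {a} {b} le with a ≤ᵇ b in eq
    ... | true  = refl
    ... | false = ⊥-elim (subst Bool.T eq (≤⇒≤ᵇ le))

  opaque
    unfolding leqℕ

    leq-no : ∀ {a b} → ¬ a ≤ b → leqℕ a b ≡ 0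
    leq-no {a} {b} nle with a ≤ᵇ b in eq
    ... | true  = ⊥-elim (nle (≤ᵇ⇒≤ a b (subst Bool.T (sym eq) tt)))
    ... | false = refl

  wk= : ∀ {m} (t : Tm m) {x ρ a} → ⟦ t ⟧t ρ ≡ a → ⟦ wkTm t ⟧t (x ∷ ρ) ≡ a
  wk= t {x} {ρ} e = trans (⟦wkTm⟧ t x ρ) e

  opaque
    unfolding tableℕ

    tableGraph-correct : ∀ {m} c f (a y : Tm m) ρ → ⟦ tableGraph c f a y ⟧f ρ ⇔ (⟦ y ⟧t ρ ≡ tableℕ c f (⟦ a ⟧t ρ))
    tableGraph-correct zero f a y ρ = mk⇔ (λ e → e) (λ e → e)
    tableGraph-correct (suc c) f a y ρ with ⟦ a ⟧t ρ ≟ c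
    ... | yes e = mk⇔
      (λ { (inj₁ (_ , q)) → trans q (⟦numeral⟧ (f c) ρ) ; (inj₂ (ne , _)) → ⊥-elim (ne (trans e (sym (⟦numeral⟧ c ρ)))) })
      (λ q → inj₁ (trans e (sym (⟦numeral⟧ c ρ)) , trans q (sym (⟦numeral⟧ (f c) ρ))))
    ... | no ne = mk⇔
      (λ { (inj₁ (e , _)) → ⊥-elim (ne (trans e (⟦numeral⟧ c ρ))) ; (inj₂ (_ , g)) → Equivalence.to (tableGraph-correct c f a y ρ) g })
      (λ q → inj₂ ((λ e → ne (trans e (⟦numeral⟧ c ρ))) , Equivalence.from (tableGraph-correct c f a y ρ) q))

  binGraph-correct : ∀ {m} o (a b y : Tm m) ρ → ⟦ binGraph o a b y ⟧f ρ ⇔ (⟦ y ⟧t ρ ≡ bin o (⟦ a ⟧t ρ) (⟦ b ⟧t ρ))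
  binGraph-correct add a b y ρ = mk⇔ (λ e → e) (λ e → e)
  binGraph-correct mul a b y ρ = mk⇔ (λ e → e) (λ e → e)
  binGraph-correct sub a b y ρ = mk⇔
    (λ { (inj₁ (le , e)) → trans e (sym (m≤n⇒m∸n≡0 le))
       ; (inj₂ (le , e)) → trans (sym (m+n∸n≡m (⟦ y ⟧t ρ) (⟦ b ⟧t ρ))) (cong (_∸ ⟦ b ⟧t ρ) e) })
    from
    where
    from : ⟦ y ⟧t ρ ≡ ⟦ a ⟧t ρ ∸ ⟦ b ⟧t ρ → ⟦ binGraph sub a b y ⟧f ρ
    from e with ≤-total (⟦ a ⟧t ρ) (⟦ b ⟧t ρ)
    ... | inj₁ le = inj₁ (le , trans e (m≤n⇒m∸n≡0 le))
    ... | inj₂ le = inj₂ (le , trans (cong (_+ ⟦ b ⟧t ρ) e) (m∸n+n≡m le))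
  binGraph-correct quo a b y ρ = mk⇔ to from
    where
    A = ⟦ a ⟧t ρ
    D = ⟦ b ⟧t ρ
    to : ⟦ binGraph quo a b y ⟧f ρ → ⟦ y ⟧t ρ ≡ A / suc D
    to (r , r≤ , e) rewrite ⟦wkTm⟧ a r ρ | ⟦wkTm⟧ b r ρ | ⟦wkTm⟧ y r ρ | e = sym (digit-/ (⟦ y ⟧t ρ) (s≤s r≤))
    from : ⟦ y ⟧t ρ ≡ A / suc D → ⟦ binGraph quo a b y ⟧f ρ
    from e = A % suc D , s≤s⁻¹ (m%n<n A (suc D)) ,
      trans (⟦wkTm⟧ a _ ρ) (trans (m≡m%n+[m/n]*n A (suc D))
        (sym (cong₂ (λ u v → A % suc D + u * suc v) (wk= y e) (⟦wkTm⟧ b _ ρ))))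
  binGraph-correct rem a b y ρ = mk⇔ to from
    where
    A = ⟦ a ⟧t ρ
    D = ⟦ b ⟧t ρ
    to : ⟦ binGraph rem a b y ⟧f ρ → ⟦ y ⟧t ρ ≡ A % suc D
    to (y≤ , q , q≤ , e) rewrite ⟦wkTm⟧ a q ρ | ⟦wkTm⟧ b q ρ | ⟦wkTm⟧ y q ρ | e = sym (digit-% q (s≤s y≤))
    from : ⟦ y ⟧t ρ ≡ A % suc D → ⟦ binGraph rem a b y ⟧f ρ
    from e = subst (_≤ D) (sym e) (s≤s⁻¹ (m%n<n A (suc D))) , A / suc D , m/n≤m A (suc D) ,
      trans (⟦wkTm⟧ a _ ρ) (trans (m≡m%n+[m/n]*n A (suc D))
        (sym (cong₂ (λ u v → u + A / suc D * suc v) (wk= y e) (⟦wkTm⟧ b _ ρ))))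
  binGraph-correct leq a b y ρ = mk⇔
    (λ { (inj₁ (le , e)) → trans e (sym (leq-yes le)) ; (inj₂ (nle , e)) → trans e (sym (leq-no nle)) }) from
    where
    from : ⟦ y ⟧t ρ ≡ leqℕ (⟦ a ⟧t ρ) (⟦ b ⟧t ρ) → ⟦ binGraph leq a b y ⟧f ρ
    from e with ⟦ a ⟧t ρ ≤? ⟦ b ⟧t ρ
    ... | yes le = inj₁ (le , trans e (leq-yes le))
    ... | no nle = inj₂ (nle , trans e (leq-no nle))

  binGraph-correct (table c f) a b y ρ = tableGraph-correct c f a y ρ
  binGraph-correct (power c) a b y ρ = mk⇔ (λ e → trans e (⟦powerTm⟧ c a ρ)) (λ e → trans e (sym (⟦powerTm⟧ c a ρ)))

  condGraph-correct : ∀ {m} (c a b y : Tm m) ρ →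
    ⟦ condGraph c a b y ⟧f ρ ⇔ (⟦ y ⟧t ρ ≡ cond (⟦ c ⟧t ρ) (⟦ a ⟧t ρ) (⟦ b ⟧t ρ))
  condGraph-correct c a b y ρ with ⟦ c ⟧t ρ
  ... | zero  = mk⇔ (λ { (inj₁ (_ , e)) → e ; (inj₂ (() , _)) }) (λ e → inj₁ (refl , e))
  ... | suc _ = mk⇔ (λ { (inj₁ (() , _)) ; (inj₂ (_ , e)) → e }) (λ e → inj₂ (s≤s z≤n , e))

  wkSub : ∀ {k m} → Vec (Tm m) k → Vec (Tm (suc m)) k
  wkSub = map wkTm

  values-wk : ∀ {k m} (σ : Vec (Tm m) k) x ρ → values (wkSub σ) (x ∷ ρ) ≡ values σ ρ
  values-wk σ x ρ = trans (sym (map-∘ _ wkTm σ)) (map-cong (λ t → ⟦wkTm⟧ t x ρ) σ)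

  -- The graph of e, with its arguments replaced by the terms σ, as a formula in the value y.
  expGraph : ∀ {k m} → Exp k → Vec (Tm m) k → Tm m → Fm m
  expGraph (arg i) σ y     = y ≐ lookup σ i
  expGraph (lit n) σ y     = y ≐ numeral n
  expGraph (op₂ o a b) σ y =
    ∃≤ (expBound a σ) (∃≤ (expBound b σ₁)
      (expGraph a σ₂ (var (suc zero)) ∧' (expGraph b σ₂ (var zero) ∧' binGraph o (var (suc zero)) (var zero) (wkTm (wkTm y)))))
    where
    σ₁ = wkSub σ
    σ₂ = wkSub σ₁
  expGraph (if c a b) σ y =
    ∃≤ (expBound c σ) (∃≤ (expBound a σ₁) (∃≤ (expBound b σ₂)
      (expGraph c σ₃ (var (suc (suc zero))) ∧' (expGraph a σ₃ (var (suc zero)) ∧' (expGraph b σ₃ (var zero) ∧'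
        condGraph (var (suc (suc zero))) (var (suc zero)) (var zero) (wkTm (wkTm (wkTm y))))))))
    where
    σ₁ = wkSub σ
    σ₂ = wkSub σ₁
    σ₃ = wkSub σ₂

  module _ {k m : ℕ} (σ : Vec (Tm m) k) (ρ : Vec ℕ m) where

    values-wk₂ : ∀ x₁ x₂ → values (wkSub (wkSub σ)) (x₂ ∷ x₁ ∷ ρ) ≡ values σ ρ
    values-wk₂ x₁ x₂ = trans (values-wk (wkSub σ) x₂ (x₁ ∷ ρ)) (values-wk σ x₁ ρ)

    values-wk₃ : ∀ x₁ x₂ x₃ → values (wkSub (wkSub (wkSub σ))) (x₃ ∷ x₂ ∷ x₁ ∷ ρ) ≡ values σ ρ
    values-wk₃ x₁ x₂ x₃ = trans (values-wk (wkSub (wkSub σ)) x₃ (x₂ ∷ x₁ ∷ ρ)) (values-wk₂ x₁ x₂)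

  expGraph-correct : ∀ {k m} (e : Exp k) (σ : Vec (Tm m) k) y ρ → ⟦ expGraph e σ y ⟧f ρ ⇔ (⟦ y ⟧t ρ ≡ ⟦ e ⟧e (values σ ρ))
  expGraph-correct (arg i) σ y ρ = mk⇔ (λ e → trans e (sym (lookup-map i _ σ))) (λ e → trans e (lookup-map i _ σ))
  expGraph-correct (lit n) σ y ρ = mk⇔ (λ e → trans e (⟦numeral⟧ n ρ)) (λ e → trans e (sym (⟦numeral⟧ n ρ)))
  expGraph-correct (op₂ o a b) σ y ρ = mk⇔ to from
    where
    V₀ = values σ ρ
    yw : ∀ x₁ x₂ → ⟦ wkTm (wkTm y) ⟧t (x₂ ∷ x₁ ∷ ρ) ≡ ⟦ y ⟧t ρ
    yw x₁ x₂ = wk= (wkTm y) (⟦wkTm⟧ y x₁ ρ)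
    to : ⟦ expGraph (op₂ o a b) σ y ⟧f ρ → ⟦ y ⟧t ρ ≡ bin o (⟦ a ⟧e V₀) (⟦ b ⟧e V₀)
    to (x₁ , _ , x₂ , _ , ga , gb , g) = trans (sym (yw x₁ x₂))
      (trans (Equivalence.to (binGraph-correct o (var (suc zero)) (var zero) (wkTm (wkTm y)) (x₂ ∷ x₁ ∷ ρ)) g)
        (cong₂ (bin o) (trans (Equivalence.to (expGraph-correct a _ _ _) ga) (cong ⟦ a ⟧e (values-wk₂ σ ρ x₁ x₂)))
                       (trans (Equivalence.to (expGraph-correct b _ _ _) gb) (cong ⟦ b ⟧e (values-wk₂ σ ρ x₁ x₂)))))
    from : ⟦ y ⟧t ρ ≡ bin o (⟦ a ⟧e V₀) (⟦ b ⟧e V₀) → ⟦ expGraph (op₂ o a b) σ y ⟧f ρ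
    from e = x₁ , exp≤bound a σ ρ , x₂ ,
      subst (_≤ ⟦ expBound b (wkSub σ) ⟧t (x₁ ∷ ρ)) (cong ⟦ b ⟧e (values-wk σ x₁ ρ)) (exp≤bound b (wkSub σ) (x₁ ∷ ρ)) ,
      Equivalence.from (expGraph-correct a _ _ _) (cong ⟦ a ⟧e (sym (values-wk₂ σ ρ x₁ x₂))) ,
      Equivalence.from (expGraph-correct b _ _ _) (cong ⟦ b ⟧e (sym (values-wk₂ σ ρ x₁ x₂))) ,
      Equivalence.from (binGraph-correct o (var (suc zero)) (var zero) (wkTm (wkTm y)) (x₂ ∷ x₁ ∷ ρ)) (trans (yw x₁ x₂) e)
      where
      x₁ = ⟦ a ⟧e V₀
      x₂ = ⟦ b ⟧e V₀
  expGraph-correct (if c a b) σ y ρ = mk⇔ to from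
    where
    V₀ = values σ ρ
    yw : ∀ x₁ x₂ x₃ → ⟦ wkTm (wkTm (wkTm y)) ⟧t (x₃ ∷ x₂ ∷ x₁ ∷ ρ) ≡ ⟦ y ⟧t ρ
    yw x₁ x₂ x₃ = wk= (wkTm (wkTm y)) (wk= (wkTm y) (⟦wkTm⟧ y x₁ ρ))
    to : ⟦ expGraph (if c a b) σ y ⟧f ρ → ⟦ y ⟧t ρ ≡ cond (⟦ c ⟧e V₀) (⟦ a ⟧e V₀) (⟦ b ⟧e V₀)
    to (x₁ , _ , x₂ , _ , x₃ , _ , gc , ga , gb , g)
      with trans (Equivalence.to (expGraph-correct c _ _ _) gc) (cong ⟦ c ⟧e (values-wk₃ σ ρ x₁ x₂ x₃))
         | trans (Equivalence.to (expGraph-correct a _ _ _) ga) (cong ⟦ a ⟧e (values-wk₃ σ ρ x₁ x₂ x₃))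
         | trans (Equivalence.to (expGraph-correct b _ _ _) gb) (cong ⟦ b ⟧e (values-wk₃ σ ρ x₁ x₂ x₃))
    ... | refl | refl | refl = trans (sym (yw x₁ x₂ x₃))
      (Equivalence.to (condGraph-correct (var (suc (suc zero))) (var (suc zero)) (var zero) (wkTm (wkTm (wkTm y))) (x₃ ∷ x₂ ∷ x₁ ∷ ρ)) g)
    from : ⟦ y ⟧t ρ ≡ cond (⟦ c ⟧e V₀) (⟦ a ⟧e V₀) (⟦ b ⟧e V₀) → ⟦ expGraph (if c a b) σ y ⟧f ρ
    from e = x₁ , exp≤bound c σ ρ , x₂ ,
      subst (_≤ ⟦ expBound a (wkSub σ) ⟧t (x₁ ∷ ρ)) (cong ⟦ a ⟧e (values-wk σ x₁ ρ)) (exp≤bound a (wkSub σ) (x₁ ∷ ρ)) , x₃ ,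
      subst (_≤ ⟦ expBound b (wkSub (wkSub σ)) ⟧t (x₂ ∷ x₁ ∷ ρ)) (cong ⟦ b ⟧e (values-wk₂ σ ρ x₁ x₂)) (exp≤bound b (wkSub (wkSub σ)) (x₂ ∷ x₁ ∷ ρ)) ,
      Equivalence.from (expGraph-correct c _ _ _) (cong ⟦ c ⟧e (sym (values-wk₃ σ ρ x₁ x₂ x₃))) ,
      Equivalence.from (expGraph-correct a _ _ _) (cong ⟦ a ⟧e (sym (values-wk₃ σ ρ x₁ x₂ x₃))) ,
      Equivalence.from (expGraph-correct b _ _ _) (cong ⟦ b ⟧e (sym (values-wk₃ σ ρ x₁ x₂ x₃))) ,
      Equivalence.from (condGraph-correct (var (suc (suc zero))) (var (suc zero)) (var zero) (wkTm (wkTm (wkTm y))) (x₃ ∷ x₂ ∷ x₁ ∷ ρ))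
        (trans (yw x₁ x₂ x₃) e)
      where
      x₁ = ⟦ c ⟧e V₀
      x₂ = ⟦ a ⟧e V₀
      x₃ = ⟦ b ⟧e V₀

  values-vars : ∀ {k} (ρ : Vec ℕ k) → values (tabulate var) ρ ≡ ρ
  values-vars ρ = trans (tab (λ t → ⟦ t ⟧t ρ) var) (tabulate∘lookup ρ)
    where
    tab : ∀ {A B : Set} {n} (f : A → B) (g : Fin n → A) → map f (tabulate g) ≡ tabulate (λ i → f (g i))
    tab {n = zero}  f g = refl
    tab {n = suc n} f g = cong (f (g zero) ∷_) (tab f (λ i → g (suc i)))

  -- Uniformity of the token circuits is obtained from this alone, by writing an expression for each
  -- of the seven functions that describe the family.
  fac-exp : ∀ {k} (e : Exp k) {f : Vec ℕ k → ℕ} → (∀ ρ → f ρ ≡ ⟦ e ⟧e ρ) → FAC⁰Num k f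
  fac-exp {k} e {f} f≡ =
    (expBound e (tabulate var) , λ ρ → subst (_≤ ⟦ expBound e (tabulate var) ⟧t ρ)
       (trans (cong ⟦ e ⟧e (values-vars ρ)) (sym (f≡ ρ))) (exp≤bound e (tabulate var) ρ)) ,
    expGraph e (wkSub (tabulate var)) (var zero) , correct
    where
    vals : ∀ y ρ → values (wkSub (tabulate var)) (y ∷ ρ) ≡ ρ
    vals y ρ = trans (values-wk (tabulate var) y ρ) (values-vars ρ)
    correct : ∀ ρ → ⟦ expGraph e (wkSub (tabulate var)) (var zero) ⟧f ρ ⇔ graph f ρ
    correct (y ∷ ρ) = mk⇔
      (λ g → trans (Equivalence.to (expGraph-correct e _ _ _) g) (trans (cong ⟦ e ⟧e (vals y ρ)) (sym (f≡ ρ))))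
      (λ q → Equivalence.from (expGraph-correct e _ _ _) (trans q (trans (f≡ ρ) (sym (cong ⟦ e ⟧e (vals y ρ))))))

-- Arithmetic of the token circuit: nodes, wires, gates and annotations.

module NodeCode where

  open Preliminaries
  open Expressions

  -- Numeric code is written once and read both over ℕ and over expressions.
  record Alg : Set₁ where
    field
      N     : Set
      lit'  : ℕ → N
      bin'  : Bin → N → N → N
      cond' : N → N → N → N

  natAlg : Alg
  natAlg = record { N = ℕ ; lit' = λ n → n ; bin' = bin ; cond' = cond }

  expAlg : ℕ → Alg
  expAlg k = record { N = Exp k ; lit' = lit ; bin' = op₂ ; cond' = if }

  record Row : Set where
    constructor mkRow
    field
      nextQ sym′ mvW mvI mv₁ mv₂ : ℕ
      rowOp : Op
  open Row public

  data Field : Set where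
    fNext fSym fW fI f₁ f₂ fWrite₁ fWrite₂ fVal fNeg₁ fNeg₂ fSort fHalt₁ fHalt₂ : Field

  moveCode : Move → ℕ
  moveCode left  = 0
  moveCode stay  = 1
  moveCode right = 2

  onHead : CHead → ℕ × ℕ
  onHead M₁ = 1 , 0
  onHead M₂ = 0 , 1

  writes negates halts : Op → ℕ × ℕ
  writes (write h b) = onHead h
  writes (copy h)    = onHead h
  writes _           = 0 , 0
  negates (negate h) = onHead h
  negates _          = 0 , 0
  halts (halt h) = onHead h
  halts _        = 0 , 0

  written sorts : Op → ℕ
  written (write h false) = 1
  written (write h true)  = 2
  written (copy h)        = 3
  written _               = 0
  sorts sort = 1
  sorts _    = 0

  field′ : Field → Row → ℕ
  field′ fNext r   = nextQ r
  field′ fSym r    = sym′ r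
  field′ fW r      = mvW r
  field′ fI r      = mvI r
  field′ f₁ r      = mv₁ r
  field′ f₂ r      = mv₂ r
  field′ fWrite₁ r = proj₁ (writes (rowOp r))
  field′ fWrite₂ r = proj₂ (writes (rowOp r))
  field′ fVal r    = written (rowOp r)
  field′ fNeg₁ r   = proj₁ (negates (rowOp r))
  field′ fNeg₂ r   = proj₂ (negates (rowOp r))
  field′ fSort r   = sorts (rowOp r)
  field′ fHalt₁ r  = proj₁ (halts (rowOp r))
  field′ fHalt₂ r  = proj₂ (halts (rowOp r))

  module Sim (M : Machine) (E : ℕ) where

    open Machine M

    -- The work tape is kept as two stacks in base `b`. A symbol s is the digit s on the right
    -- stack, where blank is 0 and the untouched part of the tape costs nothing; on the left stack
    -- it is 1 + s, so that 0 means that the head is at cell 0. Hence one digit more than there are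
    -- symbols.
    b : ℕ
    b = 4 + γ

    -- Halting freezes tape and heads and leads to the dead state 2 + q; the operation itself stays
    -- visible for that one step.
    actRow : Action q γ → ℕ → Op → Row
    actRow a s (halt h) = mkRow (2 + q) s 1 1 1 1 (halt h)
    actRow a s o = mkRow (2 + toℕ (Action.next a)) (toℕ (Action.wsym a)) (moveCode (Action.dW a))
                         (moveCode (Action.dI a)) (moveCode (Action.dM₁ a)) (moveCode (Action.dM₂ a)) o

    -- Control state 0 pushes the binary digits of n on the left stack, state 1 moves them to the
    -- right stack, 2 + i is state i of the machine, and 2 + q is reached by halting.
    row : ℕ → ℕ → Row
    row 0 s = mkRow 0 s 1 1 1 1 noop
    row 1 s = mkRow 1 s 0 1 1 1 noop
    row (suc (suc i)) s with i <? q | s <? 3 + γ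
    ... | yes i<q | yes s<γ = actRow (δ (fromℕ< i<q) (fromℕ< s<γ)) s (Action.op (δ (fromℕ< i<q) (fromℕ< s<γ)))
    ... | _       | _       = mkRow (suc (suc i)) s 1 1 1 1 noop

    rowTable : Field → ℕ → ℕ
    rowTable f i = field′ f (row (i / b) (i % b))

    module Code (A : Alg) where
      open Alg A

      infixl 6 _+ᴺ_ _-ᴺ_
      infixl 7 _*ᴺ_
      _+ᴺ_ _-ᴺ_ _*ᴺ_ _÷ᴺ_ _%ᴺ_ le lt eq : N → N → N
      _+ᴺ_ = bin' add
      _-ᴺ_ = bin' sub
      _*ᴺ_ = bin' mul
      _÷ᴺ_ = bin' quo
      _%ᴺ_ = bin' rem
      le = bin' leq
      lt x y = le (lit' 1 +ᴺ x) y
      eq x y = le x y *ᴺ le y x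

      sel : N → N → N → N → N → N
      sel i x₀ x₁ x₂ x₃ = cond' i (cond' (i -ᴺ lit' 1) (cond' (i -ᴺ lit' 2) x₃ x₂) x₁) x₀

      enc : ∀ {m} → N → Vec N m → N
      enc D' []       = lit' 0
      enc D' (d ∷ ds) = d +ᴺ enc D' ds *ᴺ (lit' 1 +ᴺ D')

      digs : ∀ m → N → N → Vec N m
      digs zero    D' u = []
      digs (suc m) D' u = (u %ᴺ D') ∷ digs m D' (u ÷ᴺ D')

      opaque
        power13 : N → N
        power13 x = bin' (power 13) x (lit' 0)

      -- With D = (2 + n)^E, `Dp` is D - 1 and `Vn` is D^13, since a node has thirteen digits. Three
      -- wires per node are followed by two rails for each of D cells, and the wire numbered `Wp` is
      -- the output. There are four gates per node.
      Dp Vn Wp Gn : N → N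
      Vn n = power13 (lit' 1 +ᴺ Dp n)
      Dp n = bin' (power E) (lit' 2 +ᴺ n) (lit' 0) -ᴺ lit' 1
      Wp n = lit' 3 *ᴺ Vn n +ᴺ lit' 2 *ᴺ (lit' 1 +ᴺ Dp n)
      Gn n = Vn n *ᴺ lit' 4

      get : Field → N → N → N
      get f c s = bin' (table ((3 + q) * b) (rowTable f)) (s +ᴺ c *ᴺ lit' b) (lit' 0)

      -- The top of the right stack. As a divisor, `lit' (3 + γ)` stands for its successor `b`.
      scan : N → N
      scan R = R %ᴺ lit' (3 + γ)

      nextCtl nextL nextR : N → N → N → N
      nextCtl c L R =
        cond' c (cond' (c -ᴺ lit' 1) (get fNext c (scan R)) (cond' L (lit' 1) (lit' (2 + toℕ start))))
                (cond' R (lit' 0) (lit' 1))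
      nextL c L R = cond' c
        (cond' m (cond' (m -ᴺ lit' 1) (lit' 1 +ᴺ get fSym c (scan R) +ᴺ L *ᴺ lit' b) L) (L ÷ᴺ lit' (3 + γ)))
        -- The next bit of n, coded as one more than its symbol. If n is 0, nothing has been pushed
        -- when R is exhausted, and the single digit of `binary 0` is supplied.
        (cond' R (lit' 2 +ᴺ R %ᴺ lit' 1 +ᴺ L *ᴺ lit' b) (cond' L L (lit' 2)))
        where
        m : N
        m = get fW c (scan R)
      nextR c L R = cond' c
        (cond' m (cond' (m -ᴺ lit' 1) (R ÷ᴺ lit' (3 + γ)) R₁)
                 (cond' L (L %ᴺ lit' (3 + γ) -ᴺ lit' 1 +ᴺ R₁ *ᴺ lit' b) R₁))
        (R ÷ᴺ lit' 1)
        where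
        m R₁ : N
        m = get fW c (scan R)
        R₁ = get fSym c (scan R) +ᴺ (R ÷ᴺ lit' (3 + γ)) *ᴺ lit' b

      -- Moves are coded as 0, 1, 2. Truncated subtraction keeps a head at cell 0 when it is told to
      -- go left, which is the convention of `move`.
      shift : N → N → N
      shift p m = p +ᴺ m -ᴺ lit' 1

      -- The status of cell p: 0 blank, 1 stored plainly, 2 stored negated.
      nextStatus : (n c R ip h₁ h₂ p σ : N) → N
      nextStatus n c R ip h₁ h₂ p σ =
        cond' ((get fWrite₁ c s *ᴺ eq h₁ p +ᴺ get fWrite₂ c s *ᴺ eq h₂ p) *ᴺ cond' (get fVal c s -ᴺ lit' 2) (lt ip n) (lit' 1))
          (cond' σ σ (lit' 1))
          (cond' (get fNeg₁ c s *ᴺ eq h₁ p +ᴺ get fNeg₂ c s *ᴺ eq h₂ p) (cond' σ (lit' 3 -ᴺ σ) (lit' 0)) σ)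
        where
        s : N
        s = scan R

      opaque
        -- The least significant digit comes first. The digits κ, p₂, p₁, t name a walk and never
        -- change along it; l grows and outranks the eight digits that vary freely.
        nextDigits startDigits : N → Vec N 13 → Vec N 13
        nextDigits n (R ∷ L ∷ c ∷ h₂ ∷ h₁ ∷ ip ∷ σ₂ ∷ σ₁ ∷ l ∷ κ ∷ p₂ ∷ p₁ ∷ t ∷ []) =
           nextR c L R ∷ nextL c L R ∷ nextCtl c L R ∷ shift h₂ (get f₂ c s) ∷ shift h₁ (get f₁ c s) ∷ shift ip (get fI c s) ∷
           nextStatus n c R ip h₁ h₂ p₂ σ₂ ∷ nextStatus n c R ip h₁ h₂ p₁ σ₁ ∷ lit' 1 +ᴺ l ∷ κ ∷ p₂ ∷ p₁ ∷ t ∷ []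
          where
          s : N
          s = scan R

        startDigits n (R ∷ L ∷ c ∷ h₂ ∷ h₁ ∷ ip ∷ σ₂ ∷ σ₁ ∷ l ∷ κ ∷ p₂ ∷ p₁ ∷ t ∷ []) =
          n ∷ lit' 0 ∷ lit' 0 ∷ lit' 0 ∷ lit' 0 ∷ lit' 0 ∷ lit' 0 ∷ lit' 0 ∷ lit' 0 ∷ κ ∷ p₂ ∷ p₁ ∷ t ∷ []

      nextNode startNode : N → Vec N 13 → N
      nextNode n v  = enc (Dp n) (nextDigits n v)
      startNode n v = enc (Dp n) (startDigits n v)

      onWire offWire inWire : N → N
      onWire u  = lit' 3 *ᴺ u
      offWire u = lit' 1 +ᴺ lit' 3 *ᴺ u
      inWire u  = lit' 2 +ᴺ lit' 3 *ᴺ u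

      rail : N → N → N → N
      rail V p r = r +ᴺ lit' 2 *ᴺ p +ᴺ lit' 3 *ᴺ V

      outRail : N → N → N
      outRail V D' = lit' 2 *ᴺ (lit' 1 +ᴺ D') +ᴺ lit' 3 *ᴺ V

      outWire : N → N
      outWire n = outRail (Vn n) (Dp n)

      sg : N → N
      sg x = cond' x (lit' 1) (lit' 0)

      -- Modes: 0 inert, 1 or-into, 2 conditional comparator, 3 pass the token on.
      opaque
        mode : N → Vec N 13 → N
        mode n (R ∷ L ∷ c ∷ h₂ ∷ h₁ ∷ ip ∷ σ₂ ∷ σ₁ ∷ l ∷ κ ∷ p₂ ∷ p₁ ∷ t ∷ []) =
          cond' (lt l t) (lit' 3)
            (cond' (eq l t *ᴺ eq h₁ p₁ *ᴺ eq h₂ p₂ *ᴺ lt κ (lit' 2))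
              (cond' (get fSort c s *ᴺ sg σ₁ *ᴺ sg σ₂ *ᴺ (lit' 1 -ᴺ eq p₁ p₂)) (lit' 2)
                (cond' (get fWrite₁ c s *ᴺ (lit' 1 -ᴺ σ₁) +ᴺ get fWrite₂ c s *ᴺ (lit' 1 -ᴺ σ₂) +ᴺ
                        (get fHalt₁ c s +ᴺ get fHalt₂ c s) *ᴺ (lit' 1 -ᴺ κ))
                  (lit' 1) (lit' 0)))
              (lit' 0))
          where
          s : N
          s = scan R

      opaque
        -- A value with status σ is on rail σ - 1 and its complement on rail 2 - σ. In a sort, κ = 0
        -- compares the value rails; κ = 1 compares the complements with the cells exchanged,
        -- because negation swaps minimum and maximum.
        wireA wireB : N → N → N → Vec N 13 → N
        wireA V D' u (R ∷ L ∷ c ∷ h₂ ∷ h₁ ∷ ip ∷ σ₂ ∷ σ₁ ∷ l ∷ κ ∷ p₂ ∷ p₁ ∷ t ∷ []) =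
          cond' (get fSort c s) (cond' κ (rail V p₂ (lit' 2 -ᴺ σ₂)) (rail V p₁ (σ₁ -ᴺ lit' 1)))
            (cond' (get fHalt₁ c s) (rail V p₁ (σ₁ -ᴺ lit' 1)) (cond' (get fHalt₂ c s) (rail V p₂ (σ₂ -ᴺ lit' 1)) (inWire u)))
          where
          s : N
          s = scan R
        wireB V D' u (R ∷ L ∷ c ∷ h₂ ∷ h₁ ∷ ip ∷ σ₂ ∷ σ₁ ∷ l ∷ κ ∷ p₂ ∷ p₁ ∷ t ∷ []) =
          cond' (get fSort c s) (cond' κ (rail V p₁ (lit' 2 -ᴺ σ₁)) (rail V p₂ (σ₂ -ᴺ lit' 1)))
            (cond' (get fHalt₁ c s +ᴺ get fHalt₂ c s) (outRail V D') (cond' (get fWrite₁ c s) (rail V p₁ κ) (rail V p₂ κ)))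
          where
          s : N
          s = scan R

      opaque
        -- `i` is the place of the gate among the four of its node and `m` the mode. A place without
        -- work holds the gate (e, e), which changes nothing.
        gateMin gateMax : (i m e ē a b nx : N) → N
        gateMin i m e ē a b nx = sel i (sel m e e b e) (sel m e e a (offWire nx)) (sel m e e ē e) (sel m e e ē e)
        gateMax i m e ē a b nx = sel i (sel m e a ē (onWire nx)) (sel m e b ē ē) e (sel m e e b e)

      opaque
        node : N → N → Vec N 13
        node n u = digs 13 (Dp n) u

      nodeGate : ((i m e ē a b nx : N) → N) → (n i u : N) → Vec N 13 → N
      nodeGate g n i u v = g i (mode n v) (onWire u) (offWire u) (wireA (Vn n) (Dp n) u v) (wireB (Vn n) (Dp n) u v) (nextNode n v)

      gate : ((i m e ē a b nx : N) → N) → N → N → N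
      gate g n k = nodeGate g n (k %ᴺ lit' 3) (k ÷ᴺ lit' 3) (node n (k ÷ᴺ lit' 3))

      -- Decoding u, resetting all digits but those that name the walk and encoding again gives back
      -- u exactly when a walk begins there.
      isStart : N → N → N
      isStart n u = eq u (startNode n (node n u))

      opaque
        -- The bit that a write or copy at this node would store, negated for κ = 1, which fills the
        -- other rail. A copy beyond the end of the input gets constant 0 for both κ, so the cell
        -- keeps the two zero rails of a blank.
        inKind inIdx : N → Vec N 13 → N
        inKind n (R ∷ L ∷ c ∷ h₂ ∷ h₁ ∷ ip ∷ σ₂ ∷ σ₁ ∷ l ∷ κ ∷ p₂ ∷ p₁ ∷ t ∷ []) =
          sel (get fVal c (scan R)) (lit' 2) (cond' κ (lit' 3) (lit' 2)) (cond' κ (lit' 2) (lit' 3))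
            (cond' (lt ip n) (cond' κ (lit' 1) (lit' 0)) (lit' 2))
        inIdx n (R ∷ L ∷ c ∷ h₂ ∷ h₁ ∷ ip ∷ σ₂ ∷ σ₁ ∷ l ∷ κ ∷ p₂ ∷ p₁ ∷ t ∷ []) =
          sel (get fVal c (scan R)) (lit' 0) (lit' 0) (lit' 0) (cond' (lt ip n) ip (lit' 0))

      opaque
        kindWith : (a i st k : N) → N
        kindWith a i st k = cond' a (sel i (cond' st (lit' 3) (lit' 2)) (cond' st (lit' 2) (lit' 3)) k (lit' 2)) (lit' 2)

      opaque
        idxWith : (a i k : N) → N
        idxWith a i k = cond' a (sel i (lit' 0) (lit' 0) k (lit' 0)) (lit' 0)

      kind idx : N → N → N
      kind n w = kindWith (lt w (lit' 3 *ᴺ Vn n)) (w %ᴺ lit' 2) (isStart n (w ÷ᴺ lit' 2)) (inKind n (node n (w ÷ᴺ lit' 2)))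
      idx n w = idxWith (lt w (lit' 3 *ᴺ Vn n)) (w %ᴺ lit' 2) (inIdx n (node n (w ÷ᴺ lit' 2)))

    open Code natAlg public

    module Hom {k : ℕ} (ρ : Vec ℕ k) where

      module C = Code (expAlg k)

      ev : Exp k → ℕ
      ev e = ⟦ e ⟧e ρ

      opaque
        unfolding power13

        hom-Vn : ∀ n → ev (C.Vn n) ≡ Vn (ev n)
        hom-Vn n = refl

      hom-digs : ∀ m D' u → map ev (C.digs m D' u) ≡ digs m (ev D') (ev u)
      hom-digs zero    D' u = refl
      hom-digs (suc m) D' u = cong (bin rem (ev u) (ev D') ∷_) (hom-digs m D' (op₂ quo u D'))

      hom-enc : ∀ {m} D' (v : Vec (Exp k) m) → ev (C.enc D' v) ≡ enc (ev D') (map ev v)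
      hom-enc D' []      = refl
      hom-enc D' (d ∷ v) = cong (λ z → ev d + z * (1 + ev D')) (hom-enc D' v)

      opaque
        unfolding nextDigits

        hom-nextDigits : ∀ n v → map ev (C.nextDigits n v) ≡ nextDigits (ev n) (map ev v)
        hom-nextDigits n (R ∷ L ∷ c ∷ h₂ ∷ h₁ ∷ ip ∷ σ₂ ∷ σ₁ ∷ l ∷ κ ∷ p₂ ∷ p₁ ∷ t ∷ []) = refl

      opaque
        unfolding startDigits

        hom-startDigits : ∀ n v → map ev (C.startDigits n v) ≡ startDigits (ev n) (map ev v)
        hom-startDigits n (R ∷ L ∷ c ∷ h₂ ∷ h₁ ∷ ip ∷ σ₂ ∷ σ₁ ∷ l ∷ κ ∷ p₂ ∷ p₁ ∷ t ∷ []) = refl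

      hom-nextNode : ∀ n v → ev (C.nextNode n v) ≡ nextNode (ev n) (map ev v)
      hom-nextNode n v = trans (hom-enc (C.Dp n) (C.nextDigits n v)) (cong (enc (Dp (ev n))) (hom-nextDigits n v))

      hom-startNode : ∀ n v → ev (C.startNode n v) ≡ startNode (ev n) (map ev v)
      hom-startNode n v = trans (hom-enc (C.Dp n) (C.startDigits n v)) (cong (enc (Dp (ev n))) (hom-startDigits n v))

      opaque
        unfolding mode

        hom-mode : ∀ n v → ev (C.mode n v) ≡ mode (ev n) (map ev v)
        hom-mode n (R ∷ L ∷ c ∷ h₂ ∷ h₁ ∷ ip ∷ σ₂ ∷ σ₁ ∷ l ∷ κ ∷ p₂ ∷ p₁ ∷ t ∷ []) = refl

      opaque
        unfolding wireA

        hom-wireA : ∀ V D' u v → ev (C.wireA V D' u v) ≡ wireA (ev V) (ev D') (ev u) (map ev v)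
        hom-wireA V D' u (R ∷ L ∷ c ∷ h₂ ∷ h₁ ∷ ip ∷ σ₂ ∷ σ₁ ∷ l ∷ κ ∷ p₂ ∷ p₁ ∷ t ∷ []) = refl

      opaque
        unfolding wireB

        hom-wireB : ∀ V D' u v → ev (C.wireB V D' u v) ≡ wireB (ev V) (ev D') (ev u) (map ev v)
        hom-wireB V D' u (R ∷ L ∷ c ∷ h₂ ∷ h₁ ∷ ip ∷ σ₂ ∷ σ₁ ∷ l ∷ κ ∷ p₂ ∷ p₁ ∷ t ∷ []) = refl

      opaque
        unfolding inKind

        hom-inKind : ∀ n v → ev (C.inKind n v) ≡ inKind (ev n) (map ev v)
        hom-inKind n (R ∷ L ∷ c ∷ h₂ ∷ h₁ ∷ ip ∷ σ₂ ∷ σ₁ ∷ l ∷ κ ∷ p₂ ∷ p₁ ∷ t ∷ []) = refl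

      opaque
        unfolding inIdx

        hom-inIdx : ∀ n v → ev (C.inIdx n v) ≡ inIdx (ev n) (map ev v)
        hom-inIdx n (R ∷ L ∷ c ∷ h₂ ∷ h₁ ∷ ip ∷ σ₂ ∷ σ₁ ∷ l ∷ κ ∷ p₂ ∷ p₁ ∷ t ∷ []) = refl

      opaque
        unfolding node

        hom-node : ∀ n u → map ev (C.node n u) ≡ node (ev n) (ev u)
        hom-node n u = hom-digs 13 (C.Dp n) u

      opaque
        unfolding gateMin

        hom-gateMin : ∀ i m e ē a b nx → ev (C.gateMin i m e ē a b nx) ≡ gateMin (ev i) (ev m) (ev e) (ev ē) (ev a) (ev b) (ev nx)
        hom-gateMin i m e ē a b nx = refl

      opaque
        unfolding gateMax

        hom-gateMax : ∀ i m e ē a b nx → ev (C.gateMax i m e ē a b nx) ≡ gateMax (ev i) (ev m) (ev e) (ev ē) (ev a) (ev b) (ev nx)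
        hom-gateMax i m e ē a b nx = refl

      opaque
        unfolding kindWith

        hom-kindWith : ∀ a i st x → ev (C.kindWith a i st x) ≡ kindWith (ev a) (ev i) (ev st) (ev x)
        hom-kindWith a i st x = refl

      opaque
        unfolding idxWith

        hom-idxWith : ∀ a i x → ev (C.idxWith a i x) ≡ idxWith (ev a) (ev i) (ev x)
        hom-idxWith a i x = refl

      cong₄ : ∀ {A B C D F : Set} (f : A → B → C → D → F) {a a' b b' c c' d d'} →
        a ≡ a' → b ≡ b' → c ≡ c' → d ≡ d' → f a b c d ≡ f a' b' c' d'
      cong₄ f refl refl refl refl = refl

      cong₃ : ∀ {A B C D : Set} (f : A → B → C → D) {a a' b b' c c'} → a ≡ a' → b ≡ b' → c ≡ c' → f a b c ≡ f a' b' c'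
      cong₃ f refl refl refl = refl

      hom-gate : ∀ (gᴱ : (i m e ē a b nx : Exp k) → Exp k) (g : (i m e ē a b nx : ℕ) → ℕ) →
        (∀ i m e ē a b nx → ev (gᴱ i m e ē a b nx) ≡ g (ev i) (ev m) (ev e) (ev ē) (ev a) (ev b) (ev nx)) →
        ∀ n j → ev (C.gate gᴱ n j) ≡ gate g (ev n) (ev j)
      hom-gate gᴱ g hg n j = trans
        (hg (op₂ rem j (lit 3)) (C.mode n v) (C.onWire u) (C.offWire u) (C.wireA (C.Vn n) (C.Dp n) u v) (C.wireB (C.Vn n) (C.Dp n) u v) (C.nextNode n v))
        (trans (cong₄ (λ m a b nx → g (ev j % 4) m (onWire (ev u)) (offWire (ev u)) a b nx)
                  (hom-mode n v)
                  (trans (hom-wireA (C.Vn n) (C.Dp n) u v) (cong (λ V → wireA V (Dp (ev n)) (ev u) (map ev v)) (hom-Vn n)))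
                  (trans (hom-wireB (C.Vn n) (C.Dp n) u v) (cong (λ V → wireB V (Dp (ev n)) (ev u) (map ev v)) (hom-Vn n)))
                  (hom-nextNode n v))
               (cong (nodeGate g (ev n) (ev j % 4) (ev j / 4)) (hom-node n u)))
        where
        u = op₂ quo j (lit 3)
        v = C.node n u

      hom-isStart : ∀ n u → ev (C.isStart n u) ≡ isStart (ev n) (ev u)
      hom-isStart n u = cong (eq (ev u)) (trans (hom-startNode n (C.node n u)) (cong (startNode (ev n)) (hom-node n u)))

      hom-kind : ∀ n w → ev (C.kind n w) ≡ kind (ev n) (ev w)
      hom-kind n w = trans
        (hom-kindWith (C.lt w (op₂ mul (lit 3) (C.Vn n))) (op₂ rem w (lit 2)) (C.isStart n u) (C.inKind n (C.node n u)))
        (cong₃ (λ V → kindWith (lt (ev w) (3 * V)) (ev w % 3)) (hom-Vn n) (hom-isStart n u)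
          (trans (hom-inKind n (C.node n u)) (cong (inKind (ev n)) (hom-node n u))))
        where u = op₂ quo w (lit 2)

      hom-idx : ∀ n w → ev (C.idx n w) ≡ idx (ev n) (ev w)
      hom-idx n w = trans
        (hom-idxWith (C.lt w (op₂ mul (lit 3) (C.Vn n))) (op₂ rem w (lit 2)) (C.inIdx n (C.node n u)))
        (cong₂ (λ V → idxWith (lt (ev w) (3 * V)) (ev w % 3)) (hom-Vn n)
          (trans (hom-inIdx n (C.node n u)) (cong (inIdx (ev n)) (hom-node n u))))
        where u = op₂ quo w (lit 2)

      hom-Wp : ∀ n → ev (C.Wp n) ≡ Wp (ev n)
      hom-Wp n = cong (λ V → 3 * V + 2 * (1 + Dp (ev n))) (hom-Vn n)

      hom-Gn : ∀ n → ev (C.Gn n) ≡ Gn (ev n)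
      hom-Gn n = cong (_* 4) (hom-Vn n)

      hom-outWire : ∀ n → ev (C.outWire n) ≡ outWire (ev n)
      hom-outWire n = cong (λ V → outRail V (Dp (ev n))) (hom-Vn n)

-- Circuit families given by number functions.

module NumericFamilies where

  open Preliminaries
  open Polynomials
  open Expressions

  -- Indexing by all numbers lets the gates be studied by plain arithmetic; `Matches` returns to
  -- vectors.
  Store : Set
  Store = ℕ → Bool

  gateS : ℕ → ℕ → Store → Store
  gateS i j s = upd (upd s i (s i ∧ s j)) j (s i ∨ s j)

  Matches : ∀ {m} → Vec Bool m → Store → Set
  Matches v s = ∀ i → lookup v i ≡ s (toℕ i)

  matches-gate : ∀ {m} {v : Vec Bool m} {s} i j → Matches v s → Matches (applyGate v (i , j)) (gateS (toℕ i) (toℕ j) s)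
  matches-gate {v = v} {s} i j A k rewrite A i | A j with k Fin.≟ j
  ... | yes refl = trans (VP.lookup∘update k (v [ i ]≔ _) _) (sym (upd-same _ (toℕ k) _))
  ... | no k≢j with k Fin.≟ i
  ...   | yes refl = trans (VP.lookup∘update′ k≢j (v [ k ]≔ _) _) (trans (VP.lookup∘update k v _)
            (sym (trans (upd-other _ _ (λ e → k≢j (toℕ-injective e))) (upd-same s (toℕ k) _))))
  ...   | no k≢i = trans (VP.lookup∘update′ k≢j (v [ i ]≔ _) _) (trans (VP.lookup∘update′ k≢i v _)
            (trans (A k) (sym (trans (upd-other _ _ (λ e → k≢j (toℕ-injective e))) (upd-other s _ (λ e → k≢i (toℕ-injective e)))))))

  storeAfter : (ℕ → ℕ) → (ℕ → ℕ) → Store → ℕ → Store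
  storeAfter gmin gmax s zero    = s
  storeAfter gmin gmax s (suc k) = gateS (gmin k) (gmax k) (storeAfter gmin gmax s k)

  runGates-upTo : ∀ {m} (g g' : ℕ → Fin m) (v : Vec Bool m) s k → Matches v s →
    Matches (runGates v (applyUpTo (λ i → g i , g' i) k)) (storeAfter (λ i → toℕ (g i)) (λ i → toℕ (g' i)) s k)
  runGates-upTo g g' v s zero A = A
  runGates-upTo g g' v s (suc k) A i = trans (runGates-upTo (λ i → g (suc i)) (λ i → g' (suc i)) (applyGate v (g 0 , g' 0)) (gateS (toℕ (g 0)) (toℕ (g' 0)) s) k
      (matches-gate {v = v} {s} (g 0) (g' 0) A) i)
    (cong (λ f → f (toℕ i)) (shift k))
    where
    γ₁ = λ i → toℕ (g i)
    γ₂ = λ i → toℕ (g' i)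
    shift : ∀ k → storeAfter (λ i → γ₁ (suc i)) (λ i → γ₂ (suc i)) (gateS (γ₁ 0) (γ₂ 0) s) k ≡ storeAfter γ₁ γ₂ s (suc k)
    shift zero    = refl
    shift (suc k) = cong (gateS (γ₁ (suc k)) (γ₂ (suc k))) (shift k)

  nth-applyUpTo : {A : Set} (f : ℕ → A) (m : ℕ) {k : ℕ} → k < m → nth (applyUpTo f m) k ≡ just (f k)
  nth-applyUpTo f (suc m) {zero}  _         = refl
  nth-applyUpTo f (suc m) {suc k} (s≤s k<m) = nth-applyUpTo (λ i → f (suc i)) m k<m

  nth-applyUpTo-≥ : {A : Set} (f : ℕ → A) (m : ℕ) {k : ℕ} → m ≤ k → nth (applyUpTo f m) k ≡ nothing
  nth-applyUpTo-≥ f zero    _         = refl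
  nth-applyUpTo-≥ f (suc m) (s≤s m≤k) = nth-applyUpTo-≥ (λ i → f (suc i)) m m≤k

  nth-tabulate : {A : Set} (m : ℕ) (f : ℕ → A) {k : ℕ} → k < m → nth (toList (tabulate {n = m} (λ i → f (toℕ i)))) k ≡ just (f k)
  nth-tabulate (suc m) f {zero}  _         = refl
  nth-tabulate (suc m) f {suc k} (s≤s k<m) = nth-tabulate m (λ i → f (suc i)) k<m

  nth-tabulate-≥ : {A : Set} (m : ℕ) (f : ℕ → A) {k : ℕ} → m ≤ k → nth (toList (tabulate {n = m} (λ i → f (toℕ i)))) k ≡ nothing
  nth-tabulate-≥ zero    f _         = refl
  nth-tabulate-≥ (suc m) f (s≤s m≤k) = nth-tabulate-≥ m (λ i → f (suc i)) m≤k

  mkAnnot : ∀ n → ℕ → ℕ → Annot n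
  mkAnnot n k i with i <? n
  mkAnnot n 0 i | yes i<n = pos (fromℕ< i<n)
  mkAnnot n 1 i | yes i<n = negl (fromℕ< i<n)
  mkAnnot n 3 i | _       = const true
  mkAnnot n _ i | _       = const false

  -- The pairs from which `mkAnnot` can be read back. Constants carry index 0 since `annIdx` reports
  -- 0 for them.
  data ValidAnnot (n : ℕ) : ℕ → ℕ → Set where
    input   : ∀ {i} → i < n → ValidAnnot n 0 i
    negated : ∀ {i} → i < n → ValidAnnot n 1 i
    const₀  : ValidAnnot n 2 0
    const₁  : ValidAnnot n 3 0

  mkAnnot-kind : ∀ {n k i} → ValidAnnot n k i → annKind (mkAnnot n k i) ≡ k
  mkAnnot-kind {n} {i = i} (input i<n) with i <? n
  ... | yes _ = refl
  ... | no ne = ⊥-elim (ne i<n)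
  mkAnnot-kind {n} {i = i} (negated i<n) with i <? n
  ... | yes _ = refl
  ... | no ne = ⊥-elim (ne i<n)
  mkAnnot-kind {n} const₀ with 0 <? n
  ... | yes _ = refl
  ... | no _  = refl
  mkAnnot-kind {n} const₁ with 0 <? n
  ... | yes _ = refl
  ... | no _  = refl

  mkAnnot-idx : ∀ {n k i} → ValidAnnot n k i → annIdx (mkAnnot n k i) ≡ i
  mkAnnot-idx {n} {i = i} (input i<n) with i <? n
  ... | yes _ = toℕ-fromℕ< i<n
  ... | no ne = ⊥-elim (ne i<n)
  mkAnnot-idx {n} {i = i} (negated i<n) with i <? n
  ... | yes _ = toℕ-fromℕ< i<n
  ... | no ne = ⊥-elim (ne i<n)
  mkAnnot-idx {n} const₀ with 0 <? n
  ... | yes _ = refl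
  ... | no _  = refl
  mkAnnot-idx {n} const₁ with 0 <? n
  ... | yes _ = refl
  ... | no _  = refl

  -- The numeric description of a circuit is 0 out of range, and the expressions have to be cut off
  -- in the same way.
  within : ℕ → ℕ → ℕ → ℕ
  within k m x = cond (leqℕ (suc k) m) x 0

  within-yes : ∀ {k m} x → k < m → within k m x ≡ x
  within-yes x k<m rewrite leq-yes k<m = refl

  within-no : ∀ {k m} x → m ≤ k → within k m x ≡ 0
  within-no x m≤k rewrite leq-no (<⇒≱ (s≤s m≤k)) = refl

  record Numeric : Set where
    field
      lastWire gateCount outputWire : ℕ → ℕ
      minWire maxWire kindAt idxAt  : ℕ → ℕ → ℕ
      valid : ∀ n w → ValidAnnot n (kindAt n w) (idxAt n w)

  module Realise (Z : Numeric) where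
    open Numeric Z

    -- Reduction modulo the number of wires lets every number name a wire, as nodes outside all
    -- walks may compute anything.
    wireMin wireMax : ∀ n → ℕ → Fin (suc (lastWire n))
    wireMin n k = fromℕ< (m%n<n (minWire n k) (suc (lastWire n)))
    wireMax n k = fromℕ< (m%n<n (maxWire n k) (suc (lastWire n)))

    gateAt : ∀ n → ℕ → Fin (suc (lastWire n)) × Fin (suc (lastWire n))
    gateAt n k = wireMin n k , wireMax n k

    annotAt : ∀ n → ℕ → Annot n
    annotAt n w = mkAnnot n (kindAt n w) (idxAt n w)

    family : Family
    family n = record
      { wires  = suc (lastWire n)
      ; gates  = applyUpTo (gateAt n) (gateCount n)
      ; output = fromℕ< (m%n<n (outputWire n) (suc (lastWire n)))
      ; annot  = tabulate (λ i → annotAt n (toℕ i)) }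

    initialStore : ∀ {n} → Vec Bool n → Store
    initialStore {n} x w = annVal x (mkAnnot n (kindAt n w) (idxAt n w))

    evalC-family : ∀ {n} (x : Vec Bool n) → evalC (family n) x ≡
      storeAfter (λ k → minWire n k % suc (lastWire n)) (λ k → maxWire n k % suc (lastWire n)) (initialStore x) (gateCount n)
                 (outputWire n % suc (lastWire n))
    evalC-family {n} x = trans
      (runGates-upTo (wireMin n) (wireMax n) _ (initialStore x) (gateCount n)
        (λ i → trans (VP.lookup-map i (annVal x) (annot (family n))) (cong (annVal x) (VP.lookup∘tabulate (λ i → mkAnnot n (kindAt n (toℕ i)) (idxAt n (toℕ i))) i))) (output (family n)))
      (trans (cong (storeAfter _ _ (initialStore x) (gateCount n)) (toℕ-fromℕ< (m%n<n (outputWire n) (suc (lastWire n)))))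
             (cong (λ f → f _) (cong₂′ (gateCount n) (λ k → toℕ-fromℕ< (m%n<n (minWire n k) (suc (lastWire n))))
                                       (λ k → toℕ-fromℕ< (m%n<n (maxWire n k) (suc (lastWire n)))))))
      where
      cong₂′ : ∀ {f f' g g' : ℕ → ℕ} {s} k → (∀ i → f i ≡ f' i) → (∀ i → g i ≡ g' i) → storeAfter f g s k ≡ storeAfter f' g' s k
      cong₂′ zero    p q = refl
      cong₂′ {f} {f'} {g} {g'} {s} (suc k) p q
        rewrite cong₂′ {f} {f'} {g} {g'} {s} k p q | p k | q k = refl

    polySize : PolyBounded (λ n → suc (lastWire n) + gateCount n) → PolySize family
    polySize (e , p) = c , λ n → subst (_≤ c * n ^ c + c) (cong (suc (lastWire n) +_) (sym (length-applyUpTo (gateAt n) (gateCount n))))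
                                 (≤-trans (p n) (bound n))
      where
      -- For n ≥ 1 the inequality 2 + n ≤ 3 n yields the factor 3^e; at n = 0 the additive constant
      -- covers 2^e.
      c = 3 ^ e + e
      bound : ∀ n → (2 + n) ^ e ≤ c * n ^ c + c
      bound zero    = ≤-trans (^-monoˡ-≤ e (s≤s (s≤s z≤n))) (≤-trans (m≤m+n (3 ^ e) e) (m≤n+m c (c * 0 ^ c)))
      bound (suc n) = begin
        (3 + n) ^ e               ≤⟨ ^-monoˡ-≤ e (subst (3 + n ≤_) (*-comm (suc n) 3) (+-monoʳ-≤ 3 (m≤m*n n 3))) ⟩
        (3 * suc n) ^ e           ≡⟨ ^-dist 3 (suc n) e ⟩
        3 ^ e * suc n ^ e         ≤⟨ *-mono-≤ (m≤m+n (3 ^ e) e) (^-monoʳ-≤ (suc n) (m≤n+m e (3 ^ e))) ⟩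
        c * suc n ^ c             ≤⟨ m≤m+n _ c ⟩
        c * suc n ^ c + c         ∎
        where
        open ≤-Reasoning
        ^-dist : ∀ a b k → (a * b) ^ k ≡ a ^ k * b ^ k
        ^-dist a b zero    = refl
        ^-dist a b (suc k) = trans (cong ((a * b) *_) (^-dist a b k)) ([m*n]*[o*p]≡[m*o]*[n*p] a b (a ^ k) (b ^ k))

    module _ (eW eG eO : Exp 1) (eMin eMax eKind eIdx : Exp 2)
      (W≡ : ∀ n → ⟦ eW ⟧e (n ∷ []) ≡ lastWire n) (G≡ : ∀ n → ⟦ eG ⟧e (n ∷ []) ≡ gateCount n)
      (O≡ : ∀ n → ⟦ eO ⟧e (n ∷ []) ≡ outputWire n)
      (Min≡ : ∀ n k → ⟦ eMin ⟧e (n ∷ k ∷ []) ≡ minWire n k) (Max≡ : ∀ n k → ⟦ eMax ⟧e (n ∷ k ∷ []) ≡ maxWire n k)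
      (Kind≡ : ∀ n w → ⟦ eKind ⟧e (n ∷ w ∷ []) ≡ kindAt n w) (Idx≡ : ∀ n w → ⟦ eIdx ⟧e (n ∷ w ∷ []) ≡ idxAt n w) where

      private
        up : Exp 1 → Exp 2
        up (arg i)     = arg zero
        up (lit n)     = lit n
        up (op₂ o a b) = op₂ o (up a) (up b)
        up (if c a b)  = if (up c) (up a) (up b)

        ⟦up⟧ : ∀ e n k → ⟦ up e ⟧e (n ∷ k ∷ []) ≡ ⟦ e ⟧e (n ∷ [])
        ⟦up⟧ (arg zero) n k  = refl
        ⟦up⟧ (lit m) n k     = refl
        ⟦up⟧ (op₂ o a b) n k = cong₂ (bin o) (⟦up⟧ a n k) (⟦up⟧ b n k)
        ⟦up⟧ (if c a b) n k rewrite ⟦up⟧ c n k | ⟦up⟧ a n k | ⟦up⟧ b n k = refl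

        S : ∀ {k} → Exp k → Exp k
        S = op₂ add (lit 1)

        withinE : Exp 2 → Exp 2 → Exp 2
        withinE m x = if (op₂ leq (S (arg (suc zero))) m) x (lit 0)

        clamp : Exp 2 → Exp 2
        clamp e = withinE (up eG) (op₂ rem e (up eW))

        clamp≡ : ∀ e (f : ℕ → ℕ → ℕ) → (∀ n k → ⟦ e ⟧e (n ∷ k ∷ []) ≡ f n k) → ∀ n k →
          ⟦ clamp e ⟧e (n ∷ k ∷ []) ≡ within k (gateCount n) (f n k % suc (lastWire n))
        clamp≡ e f e≡ n k rewrite ⟦up⟧ eG n k | G≡ n | ⟦up⟧ eW n k | W≡ n | e≡ n k = refl

        gateNum : (g : ∀ {m} → Fin m × Fin m → ℕ) (f : ℕ → ℕ → ℕ) →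
          (∀ n k → g (wireMin n k , wireMax n k) ≡ f n k % suc (lastWire n)) → ∀ n k →
          maybe (λ p → g p) 0 (nth (gates (family n)) k) ≡ within k (gateCount n) (f n k % suc (lastWire n))
        gateNum g f gf n k with k <? gateCount n
        ... | yes k<G = trans (cong (maybe (λ p → g p) 0) (nth-applyUpTo (gateAt n) (gateCount n) k<G))
                              (trans (gf n k) (sym (within-yes (f n k % suc (lastWire n)) k<G)))
        ... | no k≮G = trans (cong (maybe (λ p → g p) 0) (nth-applyUpTo-≥ (gateAt n) (gateCount n) (≮⇒≥ k≮G)))
                             (sym (within-no (f n k % suc (lastWire n)) (≮⇒≥ k≮G)))

        annNum : (g : ∀ {m} → Annot m → ℕ) (f : ℕ → ℕ → ℕ) →
          (∀ n w → g (mkAnnot n (kindAt n w) (idxAt n w)) ≡ f n w) → ∀ n w →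
          maybe (λ a → g a) 0 (nth (toList (annot (family n))) w) ≡ within w (suc (lastWire n)) (f n w)
        annNum g f gf n w with w <? suc (lastWire n)
        ... | yes w<W = trans (cong (maybe (λ a → g a) 0) (nth-tabulate (suc (lastWire n)) (annotAt n) w<W))
                              (trans (gf n w) (sym (within-yes (f n w) w<W)))
        ... | no w≮W = trans (cong (maybe (λ a → g a) 0) (nth-tabulate-≥ (suc (lastWire n)) (annotAt n) (≮⇒≥ w≮W)))
                             (sym (within-no (f n w) (≮⇒≥ w≮W)))

        onWires : Exp 2 → Exp 2
        onWires e = withinE (S (up eW)) e

        onWires≡ : ∀ e (f : ℕ → ℕ → ℕ) → (∀ n k → ⟦ e ⟧e (n ∷ k ∷ []) ≡ f n k) → ∀ n w →
          ⟦ onWires e ⟧e (n ∷ w ∷ []) ≡ within w (suc (lastWire n)) (f n w)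
        onWires≡ e f e≡ n w rewrite ⟦up⟧ eW n w | W≡ n | e≡ n w = refl

      uniform : AC⁰Uniform family
      uniform =
        fac-exp (S eW) (λ { (n ∷ []) → cong suc (sym (W≡ n)) }) ,
        fac-exp eG (λ { (n ∷ []) → trans (length-applyUpTo (gateAt n) (gateCount n)) (sym (G≡ n)) }) ,
        fac-exp (op₂ rem eO eW) (λ { (n ∷ []) → trans (toℕ-fromℕ< (m%n<n (outputWire n) (suc (lastWire n)))) (sym (cong₂ (λ a b → a % suc b) (O≡ n) (W≡ n))) }) ,
        fac-exp (clamp eMin) (λ { (n ∷ k ∷ []) → trans (gateNum (λ p → toℕ (proj₁ p)) minWire (λ n k → toℕ-fromℕ< (m%n<n (minWire n k) (suc (lastWire n)))) n k) (sym (clamp≡ eMin minWire Min≡ n k)) }) ,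
        fac-exp (clamp eMax) (λ { (n ∷ k ∷ []) → trans (gateNum (λ p → toℕ (proj₂ p)) maxWire (λ n k → toℕ-fromℕ< (m%n<n (maxWire n k) (suc (lastWire n)))) n k) (sym (clamp≡ eMax maxWire Max≡ n k)) }) ,
        fac-exp (onWires eKind) (λ { (n ∷ w ∷ []) → trans (annNum annKind kindAt (λ n w → mkAnnot-kind (valid n w)) n w) (sym (onWires≡ eKind kindAt Kind≡ n w)) }) ,
        fac-exp (onWires eIdx) (λ { (n ∷ w ∷ []) → trans (annNum annIdx idxAt (λ n w → mkAnnot-idx (valid n w)) n w) (sym (onWires≡ eIdx idxAt Idx≡ n w)) })

-- The family of token circuits and its uniformity.

module TokenFamily (M : Machine) (E : ℕ) where

  open Preliminaries
  open Polynomials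
  open Expressions
  open NodeCode
  open NumericFamilies
  open Sim M E

  valid-written : ∀ n v κ ip → ValidAnnot n
    (sel v 2 (cond κ 3 2) (cond κ 2 3) (cond (leqℕ (suc ip) n) (cond κ 1 0) 2)) (sel v 0 0 0 (cond (leqℕ (suc ip) n) ip 0))
  valid-written n 0 κ ip = const₀
  valid-written n 1 0 ip = const₀
  valid-written n 1 (suc _) ip = const₁
  valid-written n 2 0 ip = const₁
  valid-written n 2 (suc _) ip = const₀
  valid-written n (suc (suc (suc _))) κ ip with suc ip ≤? n
  valid-written n (suc (suc (suc _))) 0 ip | yes lt rewrite leq-yes lt = input lt
  valid-written n (suc (suc (suc _))) (suc _) ip | yes lt rewrite leq-yes lt = negated lt
  ... | no nlt rewrite leq-no nlt = const₀

  opaque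
    unfolding inKind inIdx

    valid-in : ∀ n v → ValidAnnot n (inKind n v) (inIdx n v)
    valid-in n (R ∷ L ∷ c ∷ h₂ ∷ h₁ ∷ ip ∷ σ₂ ∷ σ₁ ∷ l ∷ κ ∷ p₂ ∷ p₁ ∷ t ∷ []) = valid-written n (get fVal c (scan R)) κ ip

  valid-wire : ∀ {n K I} a i st → ValidAnnot n K I →
    ValidAnnot n (cond a (sel i (cond st 3 2) (cond st 2 3) K 2) 2) (cond a (sel i 0 0 I 0) 0)
  valid-wire 0 i st V = const₀
  valid-wire (suc _) 0 0 V = const₀
  valid-wire (suc _) 0 (suc _) V = const₁
  valid-wire (suc _) 1 0 V = const₁
  valid-wire (suc _) 1 (suc _) V = const₀
  valid-wire (suc _) 2 st V = V
  valid-wire (suc _) (suc (suc (suc _))) st V = const₀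

  opaque
    unfolding kindWith idxWith

    valid-annot : ∀ n w → ValidAnnot n (kind n w) (idx n w)
    valid-annot n w = valid-wire (leqℕ (suc w) (3 * Vn n)) (w % 3) (isStart n (w / 3)) (valid-in n (node n (w / 3)))

  numeric : Numeric
  numeric = record
    { lastWire = Wp ; gateCount = Gn ; outputWire = outWire ; minWire = gate gateMin ; maxWire = gate gateMax
    ; kindAt = kind ; idxAt = idx ; valid = valid-annot }

  open Realise numeric public

  family-uniform : AC⁰Uniform family
  family-uniform = uniform (C₁.Wp n₁) (C₁.Gn n₁) (C₁.outWire n₁)
    (C₂.gate C₂.gateMin n₂ k₂) (C₂.gate C₂.gateMax n₂ k₂) (C₂.kind n₂ k₂) (C₂.idx n₂ k₂)
    (λ n → Hom.hom-Wp (n ∷ []) n₁) (λ n → Hom.hom-Gn (n ∷ []) n₁) (λ n → Hom.hom-outWire (n ∷ []) n₁)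
    (λ n k → let open Hom (n ∷ k ∷ []) in hom-gate C.gateMin gateMin hom-gateMin n₂ k₂)
    (λ n k → let open Hom (n ∷ k ∷ []) in hom-gate C.gateMax gateMax hom-gateMax n₂ k₂)
    (λ n w → Hom.hom-kind (n ∷ w ∷ []) n₂ k₂)
    (λ n w → Hom.hom-idx (n ∷ w ∷ []) n₂ k₂)
    where
    module C₁ = Code (expAlg 1)
    module C₂ = Code (expAlg 2)
    n₁ = arg {1} zero
    n₂ = arg {2} zero
    k₂ = arg {2} (suc zero)

-- The four gates of a node, with and without a token.

module GateBlocks where

  open Preliminaries
  open Expressions
  open NodeCode
  open NumericFamilies

  gate-max : ∀ i j s → gateS i j s j ≡ s i ∨ s j
  gate-max i j s = upd-same _ j _

  gate-min : ∀ {i j} s → i ≢ j → gateS i j s i ≡ s i ∧ s j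
  gate-min {i} {j} s ne = trans (upd-other _ _ ne) (upd-same s i _)

  gate-other : ∀ {i j w} s → w ≢ i → w ≢ j → gateS i j s w ≡ s w
  gate-other s ni nj = trans (upd-other _ _ nj) (upd-other s _ ni)

  -- A comparator finds its inputs already in order if its minimum wire carries 0, or, as in
  -- `gate-true`, if its maximum wire carries 1. These two facts are the switches of the
  -- construction.
  gate-false : ∀ i j s → s i ≡ false → ∀ w → gateS i j s w ≡ s w
  gate-false i j s e w with w ≟ j
  ... | yes refl = trans (gate-max i w s) (cong (_∨ s w) e)
  ... | no nj with w ≟ i
  ...   | yes refl = trans (gate-min s nj) (trans (cong (_∧ s j) e) (sym e))
  ...   | no ni = gate-other s ni nj

  gate-true : ∀ i j s → s j ≡ true → ∀ w → gateS i j s w ≡ s w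
  gate-true i j s e w with w ≟ j
  ... | yes refl = trans (gate-max i w s) (trans (cong (s i ∨_) e) (trans (∨-zeroʳ (s i)) (sym e)))
  ... | no nj with w ≟ i
  ...   | yes refl = trans (gate-min s nj) (trans (cong (s w ∧_) e) (∧-identityʳ (s w)))
  ...   | no ni = gate-other s ni nj

  gate-self : ∀ i s w → gateS i i s w ≡ s w
  gate-self i s w with w ≟ i
  ... | yes refl = trans (gate-max w w s) (∨-idem (s w))
  ... | no ni = gate-other s ni ni

  block : ℕ → (e ē a b w w' : ℕ) → Store → Store
  block 0 e ē a b w w' s = gateS e e (gateS e e (gateS e e (gateS e e s)))
  block 1 e ē a b w w' s = gateS e e (gateS e e (gateS e b (gateS e a s)))
  block 2 e ē a b w w' s = gateS ē b (gateS ē e (gateS a ē (gateS b ē s)))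
  block _ e ē a b w w' s = gateS e e (gateS e e (gateS w' ē (gateS e w s)))

  module _ {e ē a b w w' : ℕ} (s : Store) where

    block-idle : ∀ v → block 0 e ē a b w w' s v ≡ s v
    block-idle v = trans (gate-self e _ v) (trans (gate-self e _ v) (trans (gate-self e _ v) (gate-self e s v)))

    -- Nothing is assumed about a, b, w, w', which may even be the node's own wires: this is what
    -- makes nodes without a token harmless. In mode 2 the third gate drives ē to 0 and so disables
    -- the fourth.
    block-off : ∀ m → e ≢ ē → s e ≡ false → s ē ≡ true → ∀ v → v ≢ e → v ≢ ē → block m e ē a b w w' s v ≡ s v
    block-off 0 ne se sē v v≢e v≢ē = block-idle v
    block-off 1 ne se sē v v≢e v≢ē = trans (gate-self e _ v) (trans (gate-self e _ v)
      (trans (gate-false e b _ (trans (gate-false e a s se e) se) v) (gate-false e a s se v)))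
    block-off 2 ne se sē v v≢e v≢ē = trans (gate-false ē b s₃ off v) (trans (gate-other s₂ v≢ē v≢e)
      (trans (gate-true a ē s₁ sē₁ v) (gate-true b ē s sē v)))
      where
      s₁ = gateS b ē s
      s₂ = gateS a ē s₁
      s₃ = gateS ē e s₂
      sē₁ : s₁ ē ≡ true
      sē₁ = trans (gate-true b ē s sē ē) sē
      se₂ : s₂ e ≡ false
      se₂ = trans (gate-true a ē s₁ sē₁ e) (trans (gate-true b ē s sē e) se)
      off : s₃ ē ≡ false
      off = trans (gate-min s₂ (λ q → ne (sym q))) (trans (cong (s₂ ē ∧_) se₂) (∧-zeroʳ (s₂ ē)))
    block-off (suc (suc (suc _))) ne se sē v v≢e v≢ē = trans (gate-self e _ v) (trans (gate-self e _ v)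
      (trans (gate-true w' ē _ (trans (gate-false e w s se ē) sē) v) (gate-false e w s se v)))

    module _ (se : s e ≡ true) where

      module _ (e≢a : e ≢ a) (e≢b : e ≢ b) (a≢b : a ≢ b) where

        private
          s₁ = gateS e a s
          s₂ = gateS e b s₁

        -- The first gate leaves e ∧ a = a on wire e and sets a to 1. The source is lost, which is
        -- why a rail is a source only at the halt and otherwise an input wire is.
        block-or-dst : block 1 e ē a b w w' s b ≡ s a ∨ s b
        block-or-dst = trans (gate-self e _ b) (trans (gate-self e _ b) (trans (gate-max e b s₁)
          (cong₂ _∨_ (trans (gate-min s e≢a) (cong (_∧ s a) se)) (gate-other s (λ q → e≢b (sym q)) (λ q → a≢b (sym q))))))

        block-or-other : ∀ v → v ≢ e → v ≢ a → v ≢ b → block 1 e ē a b w w' s v ≡ s v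
        block-or-other v v≢e v≢a v≢b = trans (gate-self e _ v) (trans (gate-self e _ v)
          (trans (gate-other s₁ v≢e v≢b) (gate-other s v≢e v≢a)))

      module _ (sē : s ē ≡ false) (e≢ē : e ≢ ē) where

        module _ (e≢a : e ≢ a) (e≢b : e ≢ b) (ē≢a : ē ≢ a) (ē≢b : ē ≢ b) (a≢b : a ≢ b) where

          private
            s₁ = gateS b ē s
            s₂ = gateS a ē s₁
            s₃ = gateS ē e s₂
            ē₁ : s₁ ē ≡ s b
            ē₁ = trans (gate-max b ē s) (trans (cong (s b ∨_) sē) (∨-identityʳ (s b)))
            a₁ : s₁ a ≡ s a
            a₁ = gate-other s a≢b (λ q → ē≢a (sym q))
            b₁ : s₁ b ≡ false
            b₁ = trans (gate-min s (λ q → ē≢b (sym q))) (trans (cong (s b ∧_) sē) (∧-zeroʳ (s b)))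
            e₁ : s₁ e ≡ true
            e₁ = trans (gate-other s e≢b e≢ē) se
            ē₃ : s₃ ē ≡ s a ∨ s b
            ē₃ = trans (gate-min s₂ (λ q → e≢ē (sym q))) (trans (cong₂ _∧_ (trans (gate-max a ē s₁) (cong₂ _∨_ a₁ ē₁))
                   (trans (gate-other s₁ e≢a e≢ē) e₁)) (∧-identityʳ _))
            b₃ : s₃ b ≡ false
            b₃ = trans (gate-other s₂ (λ q → ē≢b (sym q)) (λ q → e≢b (sym q)))
                   (trans (gate-other s₁ (λ q → a≢b (sym q)) (λ q → ē≢b (sym q))) b₁)

          -- With a token ē is 0 and serves as a spare cell: b moves to ē, is compared there with a,
          -- and the maximum returns to the emptied b. The gate (ē, e) is neutral for e = 1; it is
          -- there for the case of no token.
          block-sort-min : block 2 e ē a b w w' s a ≡ s a ∧ s b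
          block-sort-min = trans (gate-other s₃ (λ q → ē≢a (sym q)) a≢b)
            (trans (gate-other s₂ (λ q → ē≢a (sym q)) (λ q → e≢a (sym q)))
            (trans (gate-min s₁ (λ q → ē≢a (sym q))) (cong₂ _∧_ a₁ ē₁)))

          block-sort-max : block 2 e ē a b w w' s b ≡ s a ∨ s b
          block-sort-max = trans (gate-max ē b s₃) (trans (cong₂ _∨_ ē₃ b₃) (∨-identityʳ _))

          block-sort-other : ∀ v → v ≢ e → v ≢ ē → v ≢ a → v ≢ b → block 2 e ē a b w w' s v ≡ s v
          block-sort-other v v≢e v≢ē v≢a v≢b = trans (gate-other s₃ v≢ē v≢b) (trans (gate-other s₂ v≢ē v≢e)
            (trans (gate-other s₁ v≢a v≢ē) (gate-other s v≢b v≢ē)))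

        module _ (e≢w : e ≢ w) (ē≢w : ē ≢ w) (ē≢w' : ē ≢ w') (e≢w' : e ≢ w') (w≢w' : w ≢ w') where

          private
            s₁ = gateS e w s
            ē₁ : s₁ ē ≡ false
            ē₁ = trans (gate-other s (λ q → e≢ē (sym q)) ē≢w) sē

          block-move-on : block 3 e ē a b w w' s w ≡ true
          block-move-on = trans (gate-self e _ w) (trans (gate-self e _ w)
            (trans (gate-other s₁ w≢w' (λ q → ē≢w (sym q))) (trans (gate-max e w s) (cong (_∨ s w) se))))

          block-move-off : block 3 e ē a b w w' s w' ≡ false
          block-move-off = trans (gate-self e _ w') (trans (gate-self e _ w')
            (trans (gate-min s₁ (λ q → ē≢w' (sym q))) (trans (cong (s₁ w' ∧_) ē₁) (∧-zeroʳ _))))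

          block-move-other : ∀ v → v ≢ e → v ≢ ē → v ≢ w → v ≢ w' → block 3 e ē a b w w' s v ≡ s v
          block-move-other v v≢e v≢ē v≢w v≢w' = trans (gate-self e _ v) (trans (gate-self e _ v)
            (trans (gate-other s₁ v≢w' v≢ē) (gate-other s v≢e v≢w)))

  module Digits (M : Machine) (E : ℕ) where
    open Sim M E

    digs-enc : ∀ {m} D' (ds : Vec ℕ m) → All (_< suc D') ds → digs m D' (enc D' ds) ≡ ds
    digs-enc D' []       []       = refl
    digs-enc D' (d ∷ ds) (p ∷ ps) = cong₂ _∷_ (digit-% (enc D' ds) p)
      (trans (cong (digs _ D') (digit-/ (enc D' ds) p)) (digs-enc D' ds ps))

    digs< : ∀ m D' u → All (_< suc D') (digs m D' u)
    digs< zero    D' u = []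
    digs< (suc m) D' u = m%n<n u (suc D') ∷ digs< m D' (u / suc D')

    enc< : ∀ {m} D' (ds : Vec ℕ m) → All (_< suc D') ds → enc D' ds < suc D' ^ m
    enc< D' []       []       = s≤s z≤n
    enc< {suc m} D' (d ∷ ds) (p ∷ ps) = begin-strict
      d + enc D' ds * suc D'      <⟨ +-monoˡ-< (enc D' ds * suc D') p ⟩
      suc (enc D' ds) * suc D'    ≤⟨ *-monoˡ-≤ (suc D') (enc< D' ds ps) ⟩
      suc D' ^ m * suc D'         ≡⟨ *-comm (suc D' ^ m) (suc D') ⟩
      suc D' ^ suc m              ∎
      where open ≤-Reasoning

    cons-< : ∀ {D' d d' a a'} → d < suc D' → a < a' → d + a * suc D' < d' + a' * suc D'
    cons-< {D'} {d} {d'} {a} {a'} d<D a<a' = begin-strict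
      d + a * suc D'      <⟨ +-monoˡ-< (a * suc D') d<D ⟩
      suc a * suc D'      ≤⟨ *-monoˡ-≤ (suc D') a<a' ⟩
      a' * suc D'         ≤⟨ m≤n+m _ d' ⟩
      d' + a' * suc D'    ∎
      where open ≤-Reasoning

    -- The order is decided by the more significant digits, which stand last in the vector.
    enc-prefix : ∀ {k m D'} (as bs : Vec ℕ k) (us vs : Vec ℕ m) → All (_< suc D') as → enc D' us < enc D' vs →
      enc D' (as ++ us) < enc D' (bs ++ vs)
    enc-prefix []       []       us vs []       lt = lt
    enc-prefix (a ∷ as) (b ∷ bs) us vs (p ∷ ps) lt = cons-< {d' = b} p (enc-prefix as bs us vs ps lt)

    opaque
      unfolding gateMin gateMax

      nodeGates-block : ∀ n u v (cl : ℕ → ℕ) (s : Store) →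
        let G = λ i → gateS (cl (nodeGate gateMin n i u v)) (cl (nodeGate gateMax n i u v)) in
        G 3 (G 2 (G 1 (G 0 s))) ≡
        block (mode n v) (cl (onWire u)) (cl (offWire u)) (cl (wireA (Vn n) (Dp n) u v)) (cl (wireB (Vn n) (Dp n) u v))
              (cl (onWire (nextNode n v))) (cl (offWire (nextNode n v))) s
      nodeGates-block n u v cl s with mode n v
      ... | 0 = refl
      ... | 1 = refl
      ... | 2 = refl
      ... | suc (suc (suc _)) = refl

    get-row : ∀ f c s → c < 3 + Machine.q M → s < b → get f c s ≡ field′ f (row c s)
    get-row f c s c< s< = trans (table-lookup (rowTable f) idx<)
      (cong₂ (λ i j → field′ f (row i j)) (digit-/ c s<) (digit-% c s<))
      where
      idx< : s + c * b < (3 + Machine.q M) * b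
      idx< = <-≤-trans (+-monoˡ-< (c * b) s<) (*-monoˡ-≤ b c<)

-- The trajectory of the control, and the nodes that lie on it.

module Trajectories (M : Machine) (E : ℕ) (n : ℕ) where

  open Preliminaries
  open Expressions
  open NodeCode
  open NumericFamilies
  open GateBlocks
  open Sim M E
  open Digits M E
  open Machine M using (q; γ)

  record Ctl : Set where
    constructor mkCtl
    field
      ctl stL stR hI hd₁ hd₂ : ℕ
  open Ctl public

  stepCtl : Ctl → Ctl
  stepCtl (mkCtl c L R i h₁ h₂) = mkCtl (nextCtl c L R) (nextL c L R) (nextR c L R)
    (shift i (get fI c (scan R))) (shift h₁ (get f₁ c (scan R))) (shift h₂ (get f₂ c (scan R)))

  -- It begins with n itself as the right stack; the loading states turn it into the initial work
  -- tape.
  X : ℕ → Ctl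
  X zero    = mkCtl 0 0 n 0 0 0
  X (suc l) = stepCtl (X l)

  rowAt : ℕ → Row
  rowAt l = row (ctl (X l)) (scan (stR (X l)))

  statusStep : Ctl → ℕ → ℕ → ℕ
  statusStep (mkCtl c L R i h₁ h₂) p σ = nextStatus n c R i h₁ h₂ p σ

  -- Whether a cell is blank and which rail holds its value depend on the trajectory but not on the
  -- data, so a node can carry this information.
  status : ℕ → ℕ → ℕ
  status zero    p = 0
  status (suc l) p = statusStep (X l) p (status l p)

  D' D V : ℕ
  D' = Dp n
  D = suc D'
  V = Vn n

  opaque
    unfolding power13

    V≡ : V ≡ D ^ 13
    V≡ = refl

  low : (l p₂ p₁ : ℕ) → Vec ℕ 8
  low l p₂ p₁ = stR (X l) ∷ stL (X l) ∷ ctl (X l) ∷ hd₂ (X l) ∷ hd₁ (X l) ∷ hI (X l) ∷ status l p₂ ∷ status l p₁ ∷ []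

  digitsAt : (t p₁ p₂ κ l : ℕ) → Vec ℕ 13
  digitsAt t p₁ p₂ κ l = low l p₂ p₁ ++ (l ∷ κ ∷ p₂ ∷ p₁ ∷ t ∷ [])

  opaque
    path : (t p₁ p₂ κ l : ℕ) → ℕ
    path t p₁ p₂ κ l = enc D' (digitsAt t p₁ p₂ κ l)

  opaque
    unfolding path nextDigits startDigits

    nextNode-path : ∀ t p₁ p₂ κ l → nextNode n (digitsAt t p₁ p₂ κ l) ≡ path t p₁ p₂ κ (suc l)
    nextNode-path t p₁ p₂ κ l = refl

    startNode-path : ∀ {R L c h₂ h₁ ip σ₂ σ₁ l} κ p₂ p₁ t →
      startNode n (R ∷ L ∷ c ∷ h₂ ∷ h₁ ∷ ip ∷ σ₂ ∷ σ₁ ∷ l ∷ κ ∷ p₂ ∷ p₁ ∷ t ∷ []) ≡ path t p₁ p₂ κ 0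
    startNode-path κ p₂ p₁ t = refl

  eq-refl : ∀ a → eq a a ≡ 1
  eq-refl a rewrite leq-yes (≤-refl {a}) = refl

  eq-no : ∀ {a b} → a ≢ b → eq a b ≡ 0
  eq-no {a} {b} ne with a ≤? b
  ... | no nle rewrite leq-no nle = refl
  ... | yes le rewrite leq-no {b} {a} (λ ge → ne (≤-antisym le ge)) = *-zeroʳ (leqℕ a b)

  eq-1⇒≡ : ∀ {a b k} → eq a b ≡ suc k → a ≡ b
  eq-1⇒≡ {a} {b} e with a ≟ b
  ... | yes p = p
  ... | no ne with trans (sym e) (eq-no ne)
  ...   | ()

  lt-yes : ∀ {a b} → a < b → lt a b ≡ 1
  lt-yes = leq-yes

  lt-no : ∀ {a b} → ¬ a < b → lt a b ≡ 0
  lt-no = leq-no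

  -- What the trajectory has to satisfy for its numbers to be digits of nodes; for a halting machine
  -- it will follow from the space bound.
  record Bounded : Set where
    field
      3≤D : 3 ≤ D
      cOK : ∀ l → ctl (X l) < 3 + q
      cD  : ∀ l → ctl (X l) < D
      LD  : ∀ l → stL (X l) < D
      RD  : ∀ l → stR (X l) < D

  -- What a node with a token does at the time of its query: nothing, or its input into a rail,
  -- or a rail into the output, or compare two rails.
  data Eff : Set where
    idle  : Eff
    store : (p κ : ℕ) → Eff
    emit  : (p r : ℕ) → Eff
    cmp   : (p r p' r' : ℕ) → Eff

  effOf : Op → (p₁ p₂ σ₁ σ₂ κ : ℕ) → Eff
  effOf (write M₁ b) p₁ p₂ 0 σ₂ κ = store p₁ κ
  effOf (write M₂ b) p₁ p₂ σ₁ 0 κ = store p₂ κ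
  effOf (copy M₁)    p₁ p₂ 0 σ₂ κ = store p₁ κ
  effOf (copy M₂)    p₁ p₂ σ₁ 0 κ = store p₂ κ
  effOf sort p₁ p₂ (suc σ₁) (suc σ₂) κ with p₁ ≟ p₂
  ... | yes _ = idle
  ... | no _ = cond′ κ
    where
    cond′ : ℕ → Eff
    cond′ 0       = cmp p₁ σ₁ p₂ σ₂
    cond′ (suc _) = cmp p₂ (1 ∸ σ₂) p₁ (1 ∸ σ₁)
  effOf (halt M₁) p₁ p₂ σ₁ σ₂ 0 = emit p₁ (σ₁ ∸ 1)
  effOf (halt M₂) p₁ p₂ σ₁ σ₂ 0 = emit p₂ (σ₂ ∸ 1)
  effOf _ p₁ p₂ σ₁ σ₂ κ = idle

  rl : ℕ → ℕ → ℕ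
  rl p r = rail V p r

  Realises : (m a b u : ℕ) → Eff → Set
  Realises m a b u idle            = m ≡ 0
  Realises m a b u (store p κ)     = m ≡ 1 × a ≡ inWire u × b ≡ rl p κ
  Realises m a b u (emit p r)      = m ≡ 1 × a ≡ rl p r × b ≡ outWire n
  Realises m a b u (cmp p r p' r') = m ≡ 2 × a ≡ rl p r × b ≡ rl p' r'

  module _ (B : Bounded) where
    open Bounded B

    scan<b : ∀ R → scan R < b
    scan<b R = m%n<n R b

    getAt : ∀ f l → get f (ctl (X l)) (scan (stR (X l))) ≡ field′ f (rowAt l)
    getAt f l = get-row f (ctl (X l)) (scan (stR (X l))) (cOK l) (scan<b (stR (X l)))

    moveCode≤2 : ∀ m → moveCode m ≤ 2
    moveCode≤2 left  = z≤n
    moveCode≤2 stay  = s≤s z≤n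
    moveCode≤2 right = ≤-refl

    row-moves : ∀ c s → mvI (row c s) ≤ 2 × mv₁ (row c s) ≤ 2 × mv₂ (row c s) ≤ 2
    row-moves 0 s = s≤s z≤n , s≤s z≤n , s≤s z≤n
    row-moves 1 s = s≤s z≤n , s≤s z≤n , s≤s z≤n
    row-moves (suc (suc i)) s with i <? q | s <? 3 + γ
    ... | no _  | _ = s≤s z≤n , s≤s z≤n , s≤s z≤n
    ... | yes _ | no _ = s≤s z≤n , s≤s z≤n , s≤s z≤n
    ... | yes i< | yes s< = act (Action.op (Machine.δ M _ _))
      where
      a = Machine.δ M (fromℕ< i<) (fromℕ< s<)
      act : ∀ o → mvI (actRow a s o) ≤ 2 × mv₁ (actRow a s o) ≤ 2 × mv₂ (actRow a s o) ≤ 2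
      act (halt h)    = s≤s z≤n , s≤s z≤n , s≤s z≤n
      act noop        = moveCode≤2 (Action.dI a) , moveCode≤2 (Action.dM₁ a) , moveCode≤2 (Action.dM₂ a)
      act (write h v) = moveCode≤2 (Action.dI a) , moveCode≤2 (Action.dM₁ a) , moveCode≤2 (Action.dM₂ a)
      act (copy h)    = moveCode≤2 (Action.dI a) , moveCode≤2 (Action.dM₁ a) , moveCode≤2 (Action.dM₂ a)
      act (negate h)  = moveCode≤2 (Action.dI a) , moveCode≤2 (Action.dM₁ a) , moveCode≤2 (Action.dM₂ a)
      act sort        = moveCode≤2 (Action.dI a) , moveCode≤2 (Action.dM₁ a) , moveCode≤2 (Action.dM₂ a)

    shift≤ : ∀ {p l} m → m ≤ 2 → p ≤ l → shift p m ≤ suc l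
    shift≤ {p} {l} m m≤2 p≤l = ∸-monoˡ-≤ 1 (≤-trans (+-mono-≤ p≤l m≤2) (≤-reflexive (+-comm l 2)))

    -- Heads move at most one cell per step, so that up to time t < D their positions are digits.
    heads≤ : ∀ l → hI (X l) ≤ l × hd₁ (X l) ≤ l × hd₂ (X l) ≤ l
    heads≤ zero    = z≤n , z≤n , z≤n
    heads≤ (suc l) =
      let i , h₁ , h₂ = heads≤ l
          mi , m₁ , m₂ = row-moves (ctl (X l)) (scan (stR (X l)))
      in shift≤ _ (≤-trans (≤-reflexive (getAt fI l)) mi) i ,
         shift≤ _ (≤-trans (≤-reflexive (getAt f₁ l)) m₁) h₁ ,
         shift≤ _ (≤-trans (≤-reflexive (getAt f₂ l)) m₂) h₂

    status≤2 : ∀ l p → status l p ≤ 2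
    status≤2 zero    p = z≤n
    status≤2 (suc l) p = bound
      ((get fWrite₁ c s * eq (hd₁ (X l)) p + get fWrite₂ c s * eq (hd₂ (X l)) p) * cond (get fVal c s ∸ 2) (lt (hI (X l)) n) 1)
      (get fNeg₁ c s * eq (hd₁ (X l)) p + get fNeg₂ c s * eq (hd₂ (X l)) p) (status l p) (status≤2 l p)
      where
      c s : ℕ
      c = ctl (X l)
      s = scan (stR (X l))
      bound : ∀ w g σ → σ ≤ 2 → cond w (cond σ σ 1) (cond g (cond σ (3 ∸ σ) 0) σ) ≤ 2
      bound 0 0 σ le = le
      bound 0 (suc _) 0 le = z≤n
      bound 0 (suc _) (suc σ) le = m∸n≤m 2 σ
      bound (suc _) g 0 le = s≤s z≤n
      bound (suc _) g (suc σ) le = le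

    -- κ may be any digit, as in an arbitrary node; a walk with κ ≥ 2 ends without an effect.
    record Query (t p₁ p₂ κ l : ℕ) : Set where
      constructor mkQuery
      field
        t< : t < D
        p₁< : p₁ < D
        p₂< : p₂ < D
        κ< : κ < D
        l≤t : l ≤ t

    digits< : ∀ {t p₁ p₂ κ l} → Query t p₁ p₂ κ l → All (_< D) (digitsAt t p₁ p₂ κ l)
    digits< {t} {p₁} {p₂} {κ} {l} (mkQuery t< p₁< p₂< κ< l≤t) =
      let l< = ≤-<-trans l≤t t<
          i , h₁ , h₂ = heads≤ l
      in RD l ∷ LD l ∷ cD l ∷ ≤-<-trans h₂ l< ∷ ≤-<-trans h₁ l< ∷ ≤-<-trans i l< ∷
         ≤-trans (s≤s (status≤2 l p₂)) 3≤D ∷ ≤-trans (s≤s (status≤2 l p₁)) 3≤D ∷ l< ∷ κ< ∷ p₂< ∷ p₁< ∷ t< ∷ []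

    opaque
      unfolding node path

      node-path : ∀ {t p₁ p₂ κ l} → Query t p₁ p₂ κ l → node n (path t p₁ p₂ κ l) ≡ digitsAt t p₁ p₂ κ l
      node-path Q = digs-enc D' _ (digits< Q)

      node< : ∀ u → All (_< D) (node n u)
      node< u = digs< 13 D' u

      path<V : ∀ {t p₁ p₂ κ l} → Query t p₁ p₂ κ l → path t p₁ p₂ κ l < V
      path<V {t} {p₁} {p₂} {κ} {l} Q = subst (path t p₁ p₂ κ l <_) (sym V≡) (enc< D' _ (digits< Q))

      path-mono : ∀ {t p₁ p₂ κ l} → Query t p₁ p₂ κ l → path t p₁ p₂ κ l < path t p₁ p₂ κ (suc l)
      path-mono {t} {p₁} {p₂} {κ} {l} Q with digits< Q
      ... | a ∷ b ∷ c ∷ d ∷ e ∷ f ∷ g ∷ h ∷ _ =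
        enc-prefix (low l p₂ p₁) (low (suc l) p₂ p₁) (l ∷ κ ∷ p₂ ∷ p₁ ∷ t ∷ []) (suc l ∷ κ ∷ p₂ ∷ p₁ ∷ t ∷ [])
          (a ∷ b ∷ c ∷ d ∷ e ∷ f ∷ g ∷ h ∷ []) ≤-refl

      path-κ : ∀ {t p₁ p₂ κ κ' l} → Query t p₁ p₂ κ l → κ < κ' → path t p₁ p₂ κ l < path t p₁ p₂ κ' l
      path-κ {t} {p₁} {p₂} {κ} {κ'} {l} Q lt with digits< Q
      ... | a ∷ b ∷ c ∷ d ∷ e ∷ f ∷ g ∷ h ∷ i ∷ _ =
        enc-prefix (low l p₂ p₁) (low l p₂ p₁) (l ∷ κ ∷ p₂ ∷ p₁ ∷ t ∷ []) (l ∷ κ' ∷ p₂ ∷ p₁ ∷ t ∷ [])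
          (a ∷ b ∷ c ∷ d ∷ e ∷ f ∷ g ∷ h ∷ [])
          (enc-prefix (l ∷ []) (l ∷ []) (κ ∷ p₂ ∷ p₁ ∷ t ∷ []) (κ' ∷ p₂ ∷ p₁ ∷ t ∷ []) (i ∷ [])
            (+-monoˡ-< (enc D' (p₂ ∷ p₁ ∷ t ∷ []) * suc D') lt))

      path-t : ∀ {t t' p₁ p₁' p₂ p₂' κ κ' l l'} → Query t p₁ p₂ κ l → t < t' → path t p₁ p₂ κ l < path t' p₁' p₂' κ' l'
      path-t {t} {t'} {p₁} {p₁'} {p₂} {p₂'} {κ} {κ'} {l} {l'} Q lt with digits< Q
      ... | a ∷ b ∷ c ∷ d ∷ e ∷ f ∷ g ∷ h ∷ i ∷ j ∷ k ∷ m ∷ _ =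
        enc-prefix (low l p₂ p₁) (low l' p₂' p₁') (l ∷ κ ∷ p₂ ∷ p₁ ∷ t ∷ []) (l' ∷ κ' ∷ p₂' ∷ p₁' ∷ t' ∷ [])
          (a ∷ b ∷ c ∷ d ∷ e ∷ f ∷ g ∷ h ∷ [])
          (enc-prefix (l ∷ κ ∷ p₂ ∷ p₁ ∷ []) (l' ∷ κ' ∷ p₂' ∷ p₁' ∷ []) (t ∷ []) (t' ∷ []) (i ∷ j ∷ k ∷ m ∷ [])
            (subst₂ _<_ (sym (+-identityʳ t)) (sym (+-identityʳ t')) lt))

    record OnPath (w : ℕ) : Set where
      constructor mkOn
      field
        {t p₁ p₂ κ l} : ℕ
        query : Query t p₁ p₂ κ l
        isPath : w ≡ path t p₁ p₂ κ l

    same-digits : ∀ {t p₁ p₂ κ l t' p₁' p₂' κ' l'} → Query t p₁ p₂ κ l → Query t' p₁' p₂' κ' l' →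
      path t p₁ p₂ κ l ≡ path t' p₁' p₂' κ' l' → digitsAt t p₁ p₂ κ l ≡ digitsAt t' p₁' p₂' κ' l'
    same-digits Q Q' e = trans (sym (node-path Q)) (trans (cong (node n) e) (node-path Q'))

    tail-digits : ∀ {v : Vec ℕ 13} {R L c h₂ h₁ ip σ₂ σ₁ l κ p₂ p₁ t t' p₁' p₂' κ' l'} →
      v ≡ R ∷ L ∷ c ∷ h₂ ∷ h₁ ∷ ip ∷ σ₂ ∷ σ₁ ∷ l ∷ κ ∷ p₂ ∷ p₁ ∷ t ∷ [] → v ≡ digitsAt t' p₁' p₂' κ' l' →
      (l ≡ l' × κ ≡ κ') × (p₂ ≡ p₂' × p₁ ≡ p₁' × t ≡ t')
    tail-digits refl refl = (refl , refl) , refl , refl , refl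

    -- The digits l, κ, p₂, p₁, t of w determine the only node of a walk that w can be, so one
    -- comparison decides.
    onPath? : ∀ w → Dec (OnPath w)
    onPath? w with node n w in eq | node< w
    ... | R ∷ L ∷ c ∷ h₂ ∷ h₁ ∷ ip ∷ σ₂ ∷ σ₁ ∷ l ∷ κ ∷ p₂ ∷ p₁ ∷ t ∷ []
        | _ ∷ _ ∷ _ ∷ _ ∷ _ ∷ _ ∷ _ ∷ _ ∷ _ ∷ κ< ∷ p₂< ∷ p₁< ∷ t< ∷ [] with l ≤? t | w ≟ path t p₁ p₂ κ l
    ...   | yes l≤t | yes e = yes (mkOn (mkQuery t< p₁< p₂< κ< l≤t) e)
    ...   | no nle | _ = no λ { (mkOn Q e) → nle (ord Q (tail-digits eq (trans (cong (node n) e) (node-path Q)))) }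
      where
      ord : ∀ {t' p₁' p₂' κ' l'} → Query t' p₁' p₂' κ' l' → (l ≡ l' × κ ≡ κ') × (p₂ ≡ p₂' × p₁ ≡ p₁' × t ≡ t') → l ≤ t
      ord Q ((refl , refl) , refl , refl , refl) = Query.l≤t Q
    ...   | yes _ | no ne = no λ { (mkOn Q e) → ne (trans e (same (tail-digits eq (trans (cong (node n) e) (node-path Q))))) }
      where
      same : ∀ {t' p₁' p₂' κ' l'} → (l ≡ l' × κ ≡ κ') × (p₂ ≡ p₂' × p₁ ≡ p₁' × t ≡ t') →
        path t' p₁' p₂' κ' l' ≡ path t p₁ p₂ κ l
      same ((refl , refl) , refl , refl , refl) = refl

    opaque
      unfolding mode

      mode-move : ∀ t p₁ p₂ κ l → l < t → mode n (digitsAt t p₁ p₂ κ l) ≡ 3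
      mode-move t p₁ p₂ κ l l<t rewrite lt-yes l<t = refl

      mode-idle : ∀ t p₁ p₂ κ → ¬ (hd₁ (X t) ≡ p₁ × hd₂ (X t) ≡ p₂ × κ < 2) → mode n (digitsAt t p₁ p₂ κ t) ≡ 0
      mode-idle t p₁ p₂ κ no-eff rewrite lt-no {t} {t} (<-irrefl refl) =
        guard (eq t t * eq (hd₁ (X t)) p₁ * eq (hd₂ (X t)) p₂ * lt κ 2) refl
        where
        three : ∀ a b c d {k} → a * b * c * d ≡ suc k → (Σ ℕ λ i → b ≡ suc i) × (Σ ℕ λ i → c ≡ suc i) × (Σ ℕ λ i → d ≡ suc i)
        three (suc a) (suc b) (suc c) (suc d) e = (b , refl) , (c , refl) , (d , refl)
        three (suc a) (suc b) (suc c) 0 e with trans (sym (*-zeroʳ (suc a * suc b * suc c))) e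
        ... | ()
        three (suc a) (suc b) 0 d e rewrite *-zeroʳ (suc a * suc b) with e
        ... | ()
        three (suc a) 0 c d e rewrite *-zeroʳ a with e
        ... | ()
        guard : ∀ {x} k → eq t t * eq (hd₁ (X t)) p₁ * eq (hd₂ (X t)) p₂ * lt κ 2 ≡ k → cond k x 0 ≡ 0
        guard 0 e = refl
        guard (suc k) e = ⊥-elim (no-eff (heads (three (eq t t) (eq (hd₁ (X t)) p₁) (eq (hd₂ (X t)) p₂) (lt κ 2) e)))
          where
          heads : (Σ ℕ λ i → eq (hd₁ (X t)) p₁ ≡ suc i) × (Σ ℕ λ i → eq (hd₂ (X t)) p₂ ≡ suc i) × (Σ ℕ λ i → lt κ 2 ≡ suc i) →
            hd₁ (X t) ≡ p₁ × hd₂ (X t) ≡ p₂ × κ < 2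
          heads ((_ , a) , (_ , b) , (_ , c)) = eq-1⇒≡ a , eq-1⇒≡ b , small c
            where
            small : ∀ {i} → lt κ 2 ≡ suc i → κ < 2
            small e with κ <? 2
            ... | yes l = l
            ... | no nl with trans (sym e) (lt-no nl)
            ...   | ()

    -- What `mode` amounts to at the end of a walk whose cells were chosen rightly, with the table
    -- entries replaced by an operation that can be split into cases.
    modeOf : Op → (p₁ p₂ σ₁ σ₂ κ : ℕ) → ℕ
    modeOf o p₁ p₂ σ₁ σ₂ κ =
      cond (sorts o * sg σ₁ * sg σ₂ * (1 ∸ eq p₁ p₂)) 2
        (cond (proj₁ (writes o) * (1 ∸ σ₁) + proj₂ (writes o) * (1 ∸ σ₂) + (proj₁ (halts o) + proj₂ (halts o)) * (1 ∸ κ)) 1 0)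

    wireAOf wireBOf : Op → (u p₁ p₂ σ₁ σ₂ κ : ℕ) → ℕ
    wireAOf o u p₁ p₂ σ₁ σ₂ κ =
      cond (sorts o) (cond κ (rl p₂ (2 ∸ σ₂)) (rl p₁ (σ₁ ∸ 1)))
        (cond (proj₁ (halts o)) (rl p₁ (σ₁ ∸ 1)) (cond (proj₂ (halts o)) (rl p₂ (σ₂ ∸ 1)) (inWire u)))
    wireBOf o u p₁ p₂ σ₁ σ₂ κ =
      cond (sorts o) (cond κ (rl p₁ (2 ∸ σ₁)) (rl p₂ (σ₂ ∸ 1)))
        (cond (proj₁ (halts o) + proj₂ (halts o)) (outWire n) (cond (proj₁ (writes o)) (rl p₁ κ) (rl p₂ κ)))

    realise : ∀ o u p₁ p₂ σ₁ σ₂ κ → κ < 2 →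
      Realises (modeOf o p₁ p₂ σ₁ σ₂ κ) (wireAOf o u p₁ p₂ σ₁ σ₂ κ) (wireBOf o u p₁ p₂ σ₁ σ₂ κ) u (effOf o p₁ p₂ σ₁ σ₂ κ)
    realise noop u p₁ p₂ σ₁ σ₂ κ κ<2 = refl
    realise (write M₁ v) u p₁ p₂ 0 σ₂ κ κ<2 = refl , refl , refl
    realise (write M₁ v) u p₁ p₂ (suc σ₁) σ₂ κ κ<2 rewrite 0∸n≡0 σ₁ = refl
    realise (write M₂ v) u p₁ p₂ σ₁ 0 κ κ<2 = refl , refl , refl
    realise (write M₂ v) u p₁ p₂ σ₁ (suc σ₂) κ κ<2 rewrite 0∸n≡0 σ₂ = refl
    realise (copy M₁) u p₁ p₂ 0 σ₂ κ κ<2 = refl , refl , refl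
    realise (copy M₁) u p₁ p₂ (suc σ₁) σ₂ κ κ<2 rewrite 0∸n≡0 σ₁ = refl
    realise (copy M₂) u p₁ p₂ σ₁ 0 κ κ<2 = refl , refl , refl
    realise (copy M₂) u p₁ p₂ σ₁ (suc σ₂) κ κ<2 rewrite 0∸n≡0 σ₂ = refl
    realise (negate h) u p₁ p₂ σ₁ σ₂ κ κ<2 = refl
    realise sort u p₁ p₂ 0 σ₂ κ κ<2 = refl
    realise sort u p₁ p₂ (suc σ₁) 0 κ κ<2 = refl
    realise sort u p₁ p₂ (suc σ₁) (suc σ₂) κ κ<2 with p₁ ≟ p₂
    ... | yes refl rewrite eq-refl p₁ = refl
    realise sort u p₁ p₂ (suc σ₁) (suc σ₂) 0 κ<2 | no ne rewrite eq-no ne = refl , refl , refl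
    realise sort u p₁ p₂ (suc σ₁) (suc σ₂) (suc κ) κ<2 | no ne rewrite eq-no ne = refl , refl , refl
    realise (halt M₁) u p₁ p₂ σ₁ σ₂ 0 κ<2 = refl , refl , refl
    realise (halt M₁) u p₁ p₂ σ₁ σ₂ 1 κ<2 = refl
    realise (halt M₁) u p₁ p₂ σ₁ σ₂ (suc (suc _)) (s≤s (s≤s ()))
    realise (halt M₂) u p₁ p₂ σ₁ σ₂ 0 κ<2 = refl , refl , refl
    realise (halt M₂) u p₁ p₂ σ₁ σ₂ 1 κ<2 = refl
    realise (halt M₂) u p₁ p₂ σ₁ σ₂ (suc (suc _)) (s≤s (s≤s ()))

    opAt : ℕ → Op
    opAt t = rowOp (rowAt t)

    effAt : ℕ → ℕ → Eff
    effAt t κ = effOf (opAt t) (hd₁ (X t)) (hd₂ (X t)) (status t (hd₁ (X t))) (status t (hd₂ (X t))) κ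

    activeDigits : ℕ → ℕ → Vec ℕ 13
    activeDigits t κ = digitsAt t (hd₁ (X t)) (hd₂ (X t)) κ t

    opaque
      unfolding mode wireA wireB

      active-realises : ∀ t κ u → κ < 2 →
        Realises (mode n (activeDigits t κ)) (wireA V D' u (activeDigits t κ)) (wireB V D' u (activeDigits t κ)) u (effAt t κ)
      active-realises t κ u κ<2
        rewrite lt-no {t} {t} (<-irrefl refl) | eq-refl t | eq-refl (hd₁ (X t)) | eq-refl (hd₂ (X t)) | lt-yes κ<2
              | getAt fSort t | getAt fWrite₁ t | getAt fWrite₂ t | getAt fHalt₁ t | getAt fHalt₂ t =
        realise (opAt t) u (hd₁ (X t)) (hd₂ (X t)) (status t (hd₁ (X t))) (status t (hd₂ (X t))) κ κ<2

-- The token circuit at work on an input.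

module Runs (M : Machine) (E : ℕ) (xs : List Bool) where

  open Preliminaries
  open Expressions
  open NodeCode
  open NumericFamilies
  open GateBlocks
  open Trajectories M E (length xs)
  open Sim M E
  open Digits M E
  open Machine M using (q; γ; δ)
  open TokenFamily M E using (initialStore)

  n : ℕ
  n = length xs

  s₀ : Store
  s₀ = initialStore (fromList xs)

  W : ℕ
  W = suc (Wp n)

  cl : ℕ → ℕ
  cl z = z % W

  gm gM : ℕ → ℕ
  gm k = gate gateMin n k % W
  gM k = gate gateMax n k % W

  opaque
    ns : ℕ → Store
    ns u = storeAfter gm gM s₀ (u * 4)

    ns≡ : ∀ u → ns u ≡ storeAfter gm gM s₀ (u * 4)
    ns≡ u = refl

  gate-at : ∀ g i u → i < 4 → gate g n (i + u * 4) ≡ nodeGate g n i u (node n u)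
  gate-at g i u i<4 = cong₂ (λ j w → nodeGate g n j w (node n w)) (digit-% u i<4) (digit-/ u i<4)

  blockAt : ℕ → Vec ℕ 13 → Store → Store
  blockAt u v = block (mode n v) (cl (onWire u)) (cl (offWire u)) (cl (wireA V D' u v)) (cl (wireB V D' u v))
                      (cl (onWire (nextNode n v))) (cl (offWire (nextNode n v)))

  opaque
    unfolding ns

    ns-suc : ∀ u → ns (suc u) ≡ blockAt u (node n u) (ns u)
    ns-suc u = trans
      (one 3 (one 2 (one 1 (one 0 refl z<s) (s≤s z<s)) (s≤s (s≤s z<s))) ≤-refl)
      (nodeGates-block n u (node n u) cl (ns u))
      where
      G : ℕ → Store → Store
      G i = gateS (cl (nodeGate gateMin n i u (node n u))) (cl (nodeGate gateMax n i u (node n u)))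
      one : ∀ i {s s'} → s ≡ s' → i < 4 → gateS (gm (i + u * 4)) (gM (i + u * 4)) s ≡ G i s'
      one i {s} {s'} refl i<4 = cong₂ (λ a b → gateS a b s) (cong cl (gate-at gateMin i u i<4)) (cong cl (gate-at gateMax i u i<4))

  3V<W : 3 * V < W
  3V<W = s≤s (m≤m+n (3 * V) _)

  tok<3V : ∀ {i u} → i < 3 → u < V → i + 3 * u < 3 * V
  tok<3V {i} {u} i<3 u<V = begin-strict
    i + 3 * u     <⟨ +-monoˡ-< (3 * u) i<3 ⟩
    3 + 3 * u     ≡⟨ sym (*-suc 3 u) ⟩
    3 * suc u     ≤⟨ *-monoʳ-≤ 3 u<V ⟩
    3 * V         ∎
    where open ≤-Reasoning

  cl-tok : ∀ {i u} → i < 3 → u < V → cl (i + 3 * u) ≡ i + 3 * u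
  cl-tok {i} {u} i<3 u<V = m<n⇒m%n≡m (<-trans (tok<3V i<3 u<V) 3V<W)

  tok-inj : ∀ {i j u w} → i < 3 → j < 3 → i + 3 * u ≡ j + 3 * w → i ≡ j × u ≡ w
  tok-inj {i} {j} {u} {w} i<3 j<3 e =
    trans (sym (digit-% u i<3)) (trans (cong (_% 3) e') (digit-% w j<3)) ,
    trans (sym (digit-/ u i<3)) (trans (cong (_/ 3) e') (digit-/ w j<3))
    where
    e' : i + u * 3 ≡ j + w * 3
    e' = trans (cong (i +_) (*-comm u 3)) (trans e (cong (j +_) (*-comm 3 w)))

  on≢off : ∀ u → onWire u ≢ offWire u
  on≢off u e with proj₁ (tok-inj {0} {1} {u} {u} z<s (s≤s z<s) e)
  ... | ()

  rail≥ : ∀ p r → 3 * V ≤ rl p r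
  rail≥ p r = m≤n+m (3 * V) (r + 2 * p)

  out≥ : 3 * V ≤ outWire n
  out≥ = m≤n+m (3 * V) (2 * D)

  rail<out : ∀ {p r} → p < D → r < 2 → rl p r < outWire n
  rail<out {p} {r} p< r< = +-monoˡ-< (3 * V) (begin-strict
    r + 2 * p     <⟨ +-monoˡ-< (2 * p) r< ⟩
    2 + 2 * p     ≡⟨ sym (*-suc 2 p) ⟩
    2 * suc p     ≤⟨ *-monoʳ-≤ 2 p< ⟩
    2 * D         ∎)
    where open ≤-Reasoning

  out<W : outWire n < W
  out<W = s≤s (≤-reflexive (+-comm (2 * D) (3 * V)))

  cl-out : cl (outWire n) ≡ outWire n
  cl-out = m<n⇒m%n≡m out<W

  cl-rail : ∀ {p r} → p < D → r < 2 → cl (rl p r) ≡ rl p r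
  cl-rail p< r< = m<n⇒m%n≡m (<-trans (rail<out p< r<) out<W)

  rail-inj : ∀ {p r p' r'} → r < 2 → r' < 2 → rl p r ≡ rl p' r' → p ≡ p' × r ≡ r'
  rail-inj {p} {r} {p'} {r'} r< r'< e =
    trans (sym (digit-/ p r<)) (trans (cong (_/ 2) e') (digit-/ p' r'<)) ,
    trans (sym (digit-% p r<)) (trans (cong (_% 2) e') (digit-% p' r'<))
    where
    e' : r + p * 2 ≡ r' + p' * 2
    e' = trans (cong (r +_) (*-comm p 2)) (trans (+-cancelʳ-≡ (3 * V) _ _ e) (cong (r' +_) (*-comm 2 p')))

  data≢tok : ∀ {i u w} → i < 3 → u < V → 3 * V ≤ w → w ≢ i + 3 * u
  data≢tok i<3 u<V w≥ refl = <⇒≱ (tok<3V i<3 u<V) w≥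

  module Tokens (B : Bounded) where
    open Bounded B

    -- A token has arrived at a node if the walk begins there or if the preceding node of the walk
    -- has been processed.
    Live : ℕ → ∀ {w} → OnPath B w → Set
    Live u (mkOn {t} {p₁} {p₂} {κ} {l} Q e) = l ≡ 0 ⊎ Σ ℕ λ l' → l ≡ suc l' × path t p₁ p₂ κ l' < u

    -- Only nodes from u onwards are described; processing a node may spoil its own wires, and they
    -- are not consulted again.
    record Inv (u : ℕ) (s : Store) : Set where
      field
        on  : ∀ {w} → u ≤ w → (o : OnPath B w) → Live u o → s (onWire w) ≡ true × s (offWire w) ≡ false
        off : ∀ {w} → u ≤ w → w < V → (∀ o → ¬ Live u {w} o) → s (onWire w) ≡ false × s (offWire w) ≡ true
        ins : ∀ {w} → u ≤ w → w < V → s (inWire w) ≡ s₀ (inWire w)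
    open Inv

    pred-query : ∀ {t p₁ p₂ κ l} → Query B t p₁ p₂ κ (suc l) → Query B t p₁ p₂ κ l
    pred-query (mkQuery a b c d e) = mkQuery a b c d (<⇒≤ e)

    -- Nodes are processed in increasing order and predecessors have smaller numbers, so each node
    -- of a walk has its token when its turn comes.
    live-self : ∀ {u} (o : OnPath B u) → Live u o
    live-self (mkOn {l = zero} Q refl) = inj₁ refl
    live-self (mkOn {l = suc l} Q refl) = inj₂ (l , refl , path-mono B (pred-query Q))

    module _ {u : ℕ} (u<V : u < V) (I : Inv u (ns u)) where

      private
        e ē : ℕ
        e = onWire u
        ē = offWire u
        cle : cl e ≡ e
        cle = cl-tok {0} {u} z<s u<V
        clē : cl ē ≡ ē
        clē = cl-tok {1} {u} (s≤s z<s) u<V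

      block-at : ∀ v → node n u ≡ v → ns (suc u) ≡
        block (mode n v) e ē (cl (wireA V D' u v)) (cl (wireB V D' u v)) (cl (onWire (nextNode n v))) (cl (offWire (nextNode n v))) (ns u)
      block-at v refl = trans (ns-suc u) (cong₂ (λ a b → block (mode n v) a b (cl (wireA V D' u v)) (cl (wireB V D' u v))
        (cl (onWire (nextNode n v))) (cl (offWire (nextNode n v))) (ns u)) cle clē)

      step-off : ¬ OnPath B u → ∀ w → w ≢ e → w ≢ ē → ns (suc u) w ≡ ns u w
      step-off no-path w w≢e w≢ē = trans (cong (λ f → f w) (block-at (node n u) refl))
        (block-off {a = cl (wireA V D' u (node n u))} {cl (wireB V D' u (node n u))} {cl (onWire (nextNode n (node n u)))} {cl (offWire (nextNode n (node n u)))} (ns u) (mode n (node n u)) (on≢off u) (proj₁ se) (proj₂ se) w w≢e w≢ē)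
        where
        se = off I ≤-refl u<V (λ o → ⊥-elim (no-path o))

      module _ {t p₁ p₂ κ l : ℕ} (Q : Query B t p₁ p₂ κ l) (u≡ : u ≡ path t p₁ p₂ κ l) where

        private
          v = digitsAt t p₁ p₂ κ l
          node≡ : node n u ≡ v
          node≡ = trans (cong (node n) u≡) (node-path B Q)
          se : ns u e ≡ true × ns u ē ≡ false
          se = on I ≤-refl (mkOn Q u≡) (live-self (mkOn Q u≡))
          nx = path t p₁ p₂ κ (suc l)

        step-move : l < t →
          (ns (suc u) (onWire nx) ≡ true × ns (suc u) (offWire nx) ≡ false) ×
          (∀ w → w ≢ e → w ≢ ē → w ≢ onWire nx → w ≢ offWire nx → ns (suc u) w ≡ ns u w)
        step-move l<t = (trans (cong (λ f → f (onWire nx)) moved) (block-move-on {e} {ē} {A} {B₁} {onWire nx} {offWire nx} (ns u) se₁ se₂ d₀ d₁ d₂ d₃ d₄ d₅) ,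
                         trans (cong (λ f → f (offWire nx)) moved) (block-move-off {e} {ē} {A} {B₁} {onWire nx} {offWire nx} (ns u) se₁ se₂ d₀ d₁ d₂ d₃ d₄ d₅)) ,
          λ w a b c d → trans (cong (λ f → f w) moved) (block-move-other {e} {ē} {A} {B₁} {onWire nx} {offWire nx} (ns u) se₁ se₂ d₀ d₁ d₂ d₃ d₄ d₅ w a b c d)
          where
          se₁ = proj₁ se
          se₂ = proj₂ se
          A B₁ : ℕ
          A = cl (wireA V D' u v)
          B₁ = cl (wireB V D' u v)
          Q' : Query B t p₁ p₂ κ (suc l)
          Q' = mkQuery (Query.t< Q) (Query.p₁< Q) (Query.p₂< Q) (Query.κ< Q) l<t
          nx<V : nx < V
          nx<V = path<V B Q'
          u<nx : u < nx
          u<nx = subst (_< nx) (sym u≡) (path-mono B Q)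
          moved : ns (suc u) ≡ block 3 e ē (cl (wireA V D' u v)) (cl (wireB V D' u v)) (onWire nx) (offWire nx) (ns u)
          moved = trans (block-at v node≡) (eqs (mode-move B t p₁ p₂ κ l l<t)
              (trans (cong (λ z → cl (onWire z)) (nextNode-path t p₁ p₂ κ l)) (cl-tok {0} {nx} z<s nx<V))
              (trans (cong (λ z → cl (offWire z)) (nextNode-path t p₁ p₂ κ l)) (cl-tok {1} {nx} (s≤s z<s) nx<V)))
            where
            eqs : ∀ {m m' a a' b b'} → m ≡ m' → a ≡ a' → b ≡ b' →
              block m e ē (cl (wireA V D' u v)) (cl (wireB V D' u v)) a b (ns u) ≡ block m' e ē (cl (wireA V D' u v)) (cl (wireB V D' u v)) a' b' (ns u)
            eqs refl refl refl = refl
          apart : ∀ {i j} → i < 3 → j < 3 → i + 3 * u ≢ j + 3 * nx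
          apart i< j< q = <⇒≢ u<nx (proj₂ (tok-inj i< j< q))
          1<3 : 1 < 3
          1<3 = s≤s z<s
          d₀ = on≢off u
          d₁ = apart {0} {0} z<s z<s
          d₂ = apart {1} {0} 1<3 z<s
          d₃ = apart {1} {1} 1<3 1<3
          d₄ = apart {0} {1} z<s 1<3
          d₅ = on≢off nx

      Effect : Eff → Store → Store → Set
      Effect idle s s'            = ∀ w → w ≢ e → w ≢ ē → s' w ≡ s w
      Effect (store p κ) s s'     = s' (rl p κ) ≡ s (inWire u) ∨ s (rl p κ) × (∀ w → w ≢ e → w ≢ inWire u → w ≢ rl p κ → s' w ≡ s w)
      Effect (emit p r) s s'      = s' (outWire n) ≡ s (rl p r) ∨ s (outWire n) × (∀ w → w ≢ e → w ≢ rl p r → w ≢ outWire n → s' w ≡ s w)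
      Effect (cmp p r p' r') s s' = s' (rl p r) ≡ s (rl p r) ∧ s (rl p' r') × s' (rl p' r') ≡ s (rl p r) ∨ s (rl p' r') ×
                                    (∀ w → w ≢ e → w ≢ ē → w ≢ rl p r → w ≢ rl p' r' → s' w ≡ s w)

      Ok : Eff → Set
      Ok idle            = 0 ≡ 0
      Ok (store p κ)     = p < D × κ < 2
      Ok (emit p r)      = p < D × r < 2
      Ok (cmp p r p' r') = p < D × r < 2 × p' < D × r' < 2 × p ≢ p'

      realised : ∀ {m a b w w'} eff → Realises m a b u eff → Ok eff → ns u e ≡ true → ns u ē ≡ false →
        Effect eff (ns u) (block m e ē (cl a) (cl b) w w' (ns u))
      realised {a = a} {b} {w} {w'} idle refl ok se sē = λ v _ _ → block-idle {e} {ē} {cl a} {cl b} {w} {w'} (ns u) v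
      realised {w = w} {w'} (store p κ) (refl , refl , refl) (p< , κ<) se sē =
        subst₂ (λ A B₁ → Effect (store p κ) (ns u) (block 1 e ē A B₁ w w' (ns u)))
          (sym (cl-tok {2} {u} ≤-refl u<V)) (sym (cl-rail p< κ<))
          (block-or-dst {e} {ē} {inWire u} {rl p κ} {w} {w'} (ns u) se d₁ d₂ d₃ ,
           block-or-other {e} {ē} {inWire u} {rl p κ} {w} {w'} (ns u) se d₁ d₂ d₃)
        where
        d₁ : e ≢ inWire u
        d₁ q with proj₁ (tok-inj {0} {2} {u} {u} z<s ≤-refl q)
        ... | ()
        d₂ : e ≢ rl p κ
        d₂ q = data≢tok {0} z<s u<V (rail≥ p κ) (sym q)
        d₃ : inWire u ≢ rl p κ
        d₃ q = data≢tok {2} ≤-refl u<V (rail≥ p κ) (sym q)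
      realised {w = w} {w'} (emit p r) (refl , refl , refl) (p< , r<) se sē =
        subst₂ (λ A B₁ → Effect (emit p r) (ns u) (block 1 e ē A B₁ w w' (ns u))) (sym (cl-rail p< r<)) (sym cl-out)
          (block-or-dst {e} {ē} {rl p r} {outWire n} {w} {w'} (ns u) se d₁ d₂ d₃ ,
           block-or-other {e} {ē} {rl p r} {outWire n} {w} {w'} (ns u) se d₁ d₂ d₃)
        where
        d₁ : e ≢ rl p r
        d₁ q = data≢tok {0} z<s u<V (rail≥ p r) (sym q)
        d₂ : e ≢ outWire n
        d₂ q = data≢tok {0} z<s u<V out≥ (sym q)
        d₃ : rl p r ≢ outWire n
        d₃ = <⇒≢ (rail<out p< r<)
      realised {w = w} {w'} (cmp p r p' r') (refl , refl , refl) (p< , r< , p'< , r'< , ne) se sē =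
        subst₂ (λ A B₁ → Effect (cmp p r p' r') (ns u) (block 2 e ē A B₁ w w' (ns u))) (sym (cl-rail p< r<)) (sym (cl-rail p'< r'<))
          (block-sort-min {e} {ē} {rl p r} {rl p' r'} {w} {w'} (ns u) se sē (on≢off u) d₁ d₂ d₃ d₄ d₅ ,
           block-sort-max {e} {ē} {rl p r} {rl p' r'} {w} {w'} (ns u) se sē (on≢off u) d₁ d₂ d₃ d₄ d₅ ,
           block-sort-other {e} {ē} {rl p r} {rl p' r'} {w} {w'} (ns u) se sē (on≢off u) d₁ d₂ d₃ d₄ d₅)
        where
        d₁ : e ≢ rl p r
        d₁ q = data≢tok {0} z<s u<V (rail≥ p r) (sym q)
        d₂ : e ≢ rl p' r'
        d₂ q = data≢tok {0} z<s u<V (rail≥ p' r') (sym q)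
        d₃ : ē ≢ rl p r
        d₃ q = data≢tok {1} (s≤s z<s) u<V (rail≥ p r) (sym q)
        d₄ : ē ≢ rl p' r'
        d₄ q = data≢tok {1} (s≤s z<s) u<V (rail≥ p' r') (sym q)
        d₅ : rl p r ≢ rl p' r'
        d₅ q = ne (proj₁ (rail-inj r< r'< q))

      effect-tok : ∀ eff {s s'} → Effect eff s s' → Ok eff → ∀ {i w} → i < 3 → w < V → w ≢ u → s' (i + 3 * w) ≡ s (i + 3 * w)
      effect-tok idle E _ {i} {w} i<3 w<V w≢u = E _ (λ q → w≢u (proj₂ (tok-inj {j = 0} i<3 z<s q))) (λ q → w≢u (proj₂ (tok-inj {j = 1} i<3 (s≤s z<s) q)))
      effect-tok (store p κ) (_ , E) _ {i} {w} i<3 w<V w≢u = E _ (λ q → w≢u (proj₂ (tok-inj {j = 0} i<3 z<s q))) (λ q → w≢u (proj₂ (tok-inj {j = 2} i<3 ≤-refl q)))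
        (λ q → data≢tok i<3 w<V (rail≥ p κ) (sym q))
      effect-tok (emit p r) (_ , E) _ {i} {w} i<3 w<V w≢u = E _ (λ q → w≢u (proj₂ (tok-inj {j = 0} i<3 z<s q)))
        (λ q → data≢tok i<3 w<V (rail≥ p r) (sym q)) (λ q → data≢tok i<3 w<V out≥ (sym q))
      effect-tok (cmp p r p' r') (_ , _ , E) _ {i} {w} i<3 w<V w≢u = E _ (λ q → w≢u (proj₂ (tok-inj {j = 0} i<3 z<s q))) (λ q → w≢u (proj₂ (tok-inj {j = 1} i<3 (s≤s z<s) q)))
        (λ q → data≢tok i<3 w<V (rail≥ p r) (sym q)) (λ q → data≢tok i<3 w<V (rail≥ p' r') (sym q))

      effOf-ok : ∀ o p₁ p₂ σ₁ σ₂ κ → p₁ < D → p₂ < D → σ₁ ≤ 2 → σ₂ ≤ 2 → κ < 2 → Ok (effOf o p₁ p₂ σ₁ σ₂ κ)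
      effOf-ok noop p₁ p₂ σ₁ σ₂ κ a b c d k = refl
      effOf-ok (write M₁ v) p₁ p₂ 0 σ₂ κ a b c d k = a , k
      effOf-ok (write M₁ v) p₁ p₂ (suc _) σ₂ κ a b c d k = refl
      effOf-ok (write M₂ v) p₁ p₂ σ₁ 0 κ a b c d k = b , k
      effOf-ok (write M₂ v) p₁ p₂ σ₁ (suc _) κ a b c d k = refl
      effOf-ok (copy M₁) p₁ p₂ 0 σ₂ κ a b c d k = a , k
      effOf-ok (copy M₁) p₁ p₂ (suc _) σ₂ κ a b c d k = refl
      effOf-ok (copy M₂) p₁ p₂ σ₁ 0 κ a b c d k = b , k
      effOf-ok (copy M₂) p₁ p₂ σ₁ (suc _) κ a b c d k = refl
      effOf-ok (negate h) p₁ p₂ σ₁ σ₂ κ a b c d k = refl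
      effOf-ok sort p₁ p₂ 0 σ₂ κ a b c d k = refl
      effOf-ok sort p₁ p₂ (suc σ₁) 0 κ a b c d k = refl
      effOf-ok sort p₁ p₂ (suc σ₁) (suc σ₂) κ a b c d k with p₁ ≟ p₂
      ... | yes _ = refl
      effOf-ok sort p₁ p₂ (suc σ₁) (suc σ₂) 0 a b c d k | no ne = a , c , b , d , ne
      effOf-ok sort p₁ p₂ (suc σ₁) (suc σ₂) (suc _) a b c d k | no ne =
        b , s≤s (m∸n≤m 1 σ₂) , a , s≤s (m∸n≤m 1 σ₁) , λ q → ne (sym q)
      effOf-ok (halt M₁) p₁ p₂ σ₁ σ₂ 0 a b c d k = a , s≤s (∸-monoˡ-≤ 1 c)
      effOf-ok (halt M₁) p₁ p₂ σ₁ σ₂ (suc _) a b c d k = refl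
      effOf-ok (halt M₂) p₁ p₂ σ₁ σ₂ 0 a b c d k = b , s≤s (∸-monoˡ-≤ 1 d)
      effOf-ok (halt M₂) p₁ p₂ σ₁ σ₂ (suc _) a b c d k = refl

      effAt-ok : ∀ {t κ} → t < D → κ < 2 → Ok (effAt B t κ)
      effAt-ok {t} t< κ< = let _ , h₁ , h₂ = heads≤ B t in
        effOf-ok (opAt B t) _ _ _ _ _ (≤-<-trans h₁ t<) (≤-<-trans h₂ t<) (status≤2 B t _) (status≤2 B t _) κ<

      step-active : ∀ {t κ} → t < D → κ < 2 → u ≡ path t (hd₁ (X t)) (hd₂ (X t)) κ t → Effect (effAt B t κ) (ns u) (ns (suc u))
      step-active {t} {κ} t< κ< u≡ = subst (Effect (effAt B t κ) (ns u)) (sym (block-at (activeDigits B t κ) node≡))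
        (realised (effAt B t κ) (active-realises B t κ u κ<) (effAt-ok t< κ<) (proj₁ se) (proj₂ se))
        where
        Q : Query B t (hd₁ (X t)) (hd₂ (X t)) κ t
        Q = let _ , h₁ , h₂ = heads≤ B t in
            mkQuery t< (≤-<-trans h₁ t<) (≤-<-trans h₂ t<) (≤-trans κ< (<⇒≤ 3≤D)) ≤-refl
        node≡ : node n u ≡ activeDigits B t κ
        node≡ = trans (cong (node n) u≡) (node-path B Q)
        se = on I ≤-refl (mkOn Q u≡) (live-self (mkOn Q u≡))

      step-inert : ∀ {t p₁ p₂ κ} → Query B t p₁ p₂ κ t → u ≡ path t p₁ p₂ κ t → ¬ (hd₁ (X t) ≡ p₁ × hd₂ (X t) ≡ p₂ × κ < 2) →
        ∀ w → ns (suc u) w ≡ ns u w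
      step-inert {t} {p₁} {p₂} {κ} Q u≡ no-eff w = trans (cong (λ f → f w)
        (trans (block-at (digitsAt t p₁ p₂ κ t) (trans (cong (node n) u≡) (node-path B Q)))
          (cong (λ m → block m e ē (cl (wireA V D' u v)) (cl (wireB V D' u v)) (cl (onWire (nextNode n v))) (cl (offWire (nextNode n v))) (ns u))
            (mode-idle B t p₁ p₂ κ no-eff))))
        (block-idle {e} {ē} {cl (wireA V D' u v)} {cl (wireB V D' u v)} {cl (onWire (nextNode n v))} {cl (offWire (nextNode n v))} (ns u) w)
        where v = digitsAt t p₁ p₂ κ t

  nth-fromℕ< : ∀ (xs : List Bool) {i} (i< : i < length xs) → nth xs i ≡ just (lookup (fromList xs) (fromℕ< i<))
  nth-fromℕ< (x ∷ xs) {zero}  _        = refl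
  nth-fromℕ< (x ∷ xs) {suc i} (s≤s i<) = nth-fromℕ< xs i<

  nth-≥ : ∀ (xs : List Bool) {i} → length xs ≤ i → nth xs i ≡ nothing
  nth-≥ []       _        = refl
  nth-≥ (x ∷ xs) (s≤s le) = nth-≥ xs le

  flip : ℕ → Bool → Bool
  flip 0       b = b
  flip (suc _) b = not b

  inBit : Op → ℕ → ℕ → Bool
  inBit (write h v) κ i = flip κ v
  inBit (copy h)    κ i = maybe (flip κ) false (nth xs i)
  inBit _           κ i = false

  annBit : ℕ → ℕ → Bool
  annBit k i = annVal (fromList xs) (mkAnnot n k i)

  annBit-2 : ∀ i → annBit 2 i ≡ false
  annBit-2 i with i <? n
  ... | yes _ = refl
  ... | no _  = refl

  annBit-3 : ∀ i → annBit 3 i ≡ true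
  annBit-3 i with i <? n
  ... | yes _ = refl
  ... | no _  = refl

  annBit-input : ∀ κ i → i < n → annBit (cond κ 1 0) i ≡ maybe (flip κ) false (nth xs i)
  annBit-input κ i i<n with i <? n | nth xs i | nth-fromℕ< xs i<n
  annBit-input 0 i i<n       | yes _ | _ | refl = refl
  annBit-input (suc κ) i i<n | yes _ | _ | refl = refl
  annBit-input κ i i<n       | no ne | _ | _    = ⊥-elim (ne i<n)

  writtenBit : ∀ o κ i → annBit
    (sel (written o) 2 (cond κ 3 2) (cond κ 2 3) (cond (lt i n) (cond κ 1 0) 2)) (sel (written o) 0 0 0 (cond (lt i n) i 0)) ≡ inBit o κ i
  writtenBit noop κ i = annBit-2 0
  writtenBit (write h false) 0 i = annBit-2 0
  writtenBit (write h false) (suc κ) i = annBit-3 0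
  writtenBit (write h true) 0 i = annBit-3 0
  writtenBit (write h true) (suc κ) i = annBit-2 0
  writtenBit (negate h) κ i = annBit-2 0
  writtenBit sort κ i = annBit-2 0
  writtenBit (halt h) κ i = annBit-2 0
  writtenBit (copy h) κ i with i <? n
  ... | yes i<n rewrite lt-yes i<n = annBit-input κ i i<n
  ... | no i≮n rewrite lt-no i≮n = trans (annBit-2 0) (sym (cong (maybe (flip κ) false) (nth-≥ xs (≮⇒≥ i≮n))))

  module Run (B : Bounded) where
    open Bounded B
    open Tokens B public

    U : ℕ → ℕ → ℕ
    U t κ = path t (hd₁ (X t)) (hd₂ (X t)) κ t

    activeQuery : ∀ {t κ} → t < D → κ < 2 → Query B t (hd₁ (X t)) (hd₂ (X t)) κ t
    activeQuery {t} t< κ< = let _ , h₁ , h₂ = heads≤ B t in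
      mkQuery t< (≤-<-trans h₁ t<) (≤-<-trans h₂ t<) (≤-trans κ< (<⇒≤ 3≤D)) ≤-refl

    wire-split : ∀ {i u} → i < 3 → u < V → lt (i + 3 * u) (3 * V) ≡ 1 × (i + 3 * u) % 3 ≡ i × (i + 3 * u) / 3 ≡ u
    wire-split {i} {u} i<3 u<V = lt-yes (tok<3V i<3 u<V) ,
      trans (cong (λ z → (i + z) % 3) (*-comm 3 u)) (digit-% u i<3) , trans (cong (λ z → (i + z) / 3) (*-comm 3 u)) (digit-/ u i<3)

    bool : Bool → ℕ
    bool true  = 3
    bool false = 2

    annBit-bool : ∀ b i → annBit (bool b) i ≡ b
    annBit-bool true  = annBit-3
    annBit-bool false = annBit-2

    s₀-with : ∀ {i u} → i < 3 → u < V →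
      s₀ (i + 3 * u) ≡ annBit (kindWith 1 i (isStart n u) (inKind n (node n u))) (idxWith 1 i (inIdx n (node n u)))
    s₀-with {i} {u} i<3 u<V = let a , m , d = wire-split i<3 u<V in
      cong₂ annBit (eqs kindWith a m (cong (λ z → isStart n z) d) (cong (λ z → inKind n (node n z)) d))
                   (eqs (λ a i _ → idxWith a i) a m (refl {x = 0}) (cong (λ z → inIdx n (node n z)) d))
      where
      eqs : ∀ (f : ℕ → ℕ → ℕ → ℕ → ℕ) {a a' b b' c c' d d'} → a ≡ a' → b ≡ b' → c ≡ c' → d ≡ d' → f a b c d ≡ f a' b' c' d'
      eqs f refl refl refl refl = refl

    opaque
      unfolding kindWith idxWith

      s₀-tokens : ∀ {u} st b → u < V → isStart n u ≡ st → cond st 3 2 ≡ bool b → cond st 2 3 ≡ bool (not b) →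
        s₀ (onWire u) ≡ b × s₀ (offWire u) ≡ not b
      s₀-tokens {u} st b u<V e p q =
        trans (s₀-with {0} {u} z<s u<V) (trans (cong (λ z → annBit z 0) (trans (cong (λ z → cond z 3 2) e) p)) (annBit-bool b 0)) ,
        trans (s₀-with {1} {u} (s≤s z<s) u<V) (trans (cong (λ z → annBit z 0) (trans (cong (λ z → cond z 2 3) e) q)) (annBit-bool (not b) 0))

      s₀-in : ∀ {u} → u < V → s₀ (inWire u) ≡ annBit (inKind n (node n u)) (inIdx n (node n u))
      s₀-in {u} u<V = s₀-with {2} {u} ≤-refl u<V

      s₀-data : ∀ {w} → 3 * V ≤ w → s₀ w ≡ false
      s₀-data {w} w≥ = trans (cong₂ annBit
        (cong (λ z → kindWith z (w % 3) (isStart n (w / 3)) (inKind n (node n (w / 3)))) (lt-no (≤⇒≯ w≥)))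
        (cong (λ z → idxWith z (w % 3) (inIdx n (node n (w / 3)))) (lt-no (≤⇒≯ w≥)))) (annBit-2 0)

    opaque
      unfolding inKind inIdx

      s₀-active : ∀ {t κ} → t < D → κ < 2 → s₀ (inWire (U t κ)) ≡ inBit (opAt B t) κ (hI (X t))
      s₀-active {t} {κ} t< κ< = trans (s₀-in (path<V B Q)) (trans (cong (λ v → annBit (inKind n v) (inIdx n v)) (node-path B Q))
        (trans (cong (λ z → annBit (sel z 2 (cond κ 3 2) (cond κ 2 3) (cond (lt (hI (X t)) n) (cond κ 1 0) 2))
                                   (sel z 0 0 0 (cond (lt (hI (X t)) n) (hI (X t)) 0))) (getAt B fVal t))
               (writtenBit (opAt B t) κ (hI (X t)))))
        where
        Q : Query B t (hd₁ (X t)) (hd₂ (X t)) κ t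
        Q = activeQuery t< κ<

    open Inv

    -- For `off`, a node that is annotated as a start has to be the first node of a genuine walk. It
    -- is, as all its digits are below D.
    inv-zero : Inv 0 s₀
    on inv-zero {w} _ (mkOn {t} {p₁} {p₂} {κ} Q e) (inj₁ refl) = s₀-tokens 1 true (subst (_< V) (sym e) (path<V B Q))
      (trans (cong (eq w) (trans (cong (startNode n) (trans (cong (node n) e) (node-path B Q))) (trans (startNode-path κ p₂ p₁ t) (sym e)))) (eq-refl w))
      refl refl
    on inv-zero _ (mkOn Q e) (inj₂ (_ , _ , ()))
    off inv-zero {w} _ w<V dead = s₀-tokens 0 false w<V (eq-no no-start) refl refl
      where
      no-start : w ≢ startNode n (node n w)
      no-start e with node n w | node< B w
      ... | R ∷ L ∷ c ∷ h₂ ∷ h₁ ∷ ip ∷ σ₂ ∷ σ₁ ∷ l ∷ κ ∷ p₂ ∷ p₁ ∷ t ∷ []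
          | _ ∷ _ ∷ _ ∷ _ ∷ _ ∷ _ ∷ _ ∷ _ ∷ _ ∷ κ< ∷ p₂< ∷ p₁< ∷ t< ∷ [] =
        dead (mkOn (mkQuery t< p₁< p₂< κ< z≤n) (trans e (startNode-path κ p₂ p₁ t))) (inj₁ refl)
    ins inv-zero _ _ = refl

    PredIs : ℕ → ∀ {w} → OnPath B w → Set
    PredIs u (mkOn {t} {p₁} {p₂} {κ} {l} Q e) = Σ ℕ λ l' → l ≡ suc l' × u ≡ path t p₁ p₂ κ l'

    live-back : ∀ {u w} (o : OnPath B w) → Live (suc u) o → Live u o ⊎ PredIs u o
    live-back (mkOn Q e) (inj₁ z) = inj₁ (inj₁ z)
    live-back (mkOn Q e) (inj₂ (l' , s , lt)) with m<1+n⇒m<n∨m≡n lt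
    ... | inj₁ l = inj₁ (inj₂ (l' , s , l))
    ... | inj₂ e' = inj₂ (l' , s , sym e')

    live-fwd : ∀ {u w} (o : OnPath B w) → Live u o → Live (suc u) o
    live-fwd (mkOn Q e) (inj₁ z) = inj₁ z
    live-fwd (mkOn Q e) (inj₂ (l' , s , lt)) = inj₂ (l' , s , m<n⇒m<1+n lt)

    pred-onPath : ∀ {u w} (o : OnPath B w) → PredIs u o → OnPath B u
    pred-onPath (mkOn Q e) (l' , refl , u≡) = mkOn (pred-query Q) u≡

    -- Processing u can bring a token only to nodes that have u as their predecessor. At the end of
    -- a walk and outside all walks there are none.
    inv-still : ∀ {u} → Inv u (ns u) → (∀ {w} (o : OnPath B w) → ¬ PredIs u o) →
      (∀ {i w} → i < 3 → w < V → w ≢ u → ns (suc u) (i + 3 * w) ≡ ns u (i + 3 * w)) → Inv (suc u) (ns (suc u))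
    on (inv-still I no-pred same) {w} u<w o@(mkOn Q e) live with live-back o live
    ... | inj₂ pr = ⊥-elim (no-pred o pr)
    ... | inj₁ live' = let a , b = on I (<⇒≤ u<w) o live'
                           w<V = subst (_< V) (sym e) (path<V B Q)
                       in trans (same {0} {w} z<s w<V (>⇒≢ u<w)) a , trans (same {1} {w} (s≤s z<s) w<V (>⇒≢ u<w)) b
    off (inv-still I no-pred same) {w} u<w w<V dead =
      let a , b = off I (<⇒≤ u<w) w<V (λ o live → dead o (live-fwd o live))
      in trans (same {0} {w} z<s w<V (>⇒≢ u<w)) a , trans (same {1} {w} (s≤s z<s) w<V (>⇒≢ u<w)) b
    ins (inv-still I no-pred same) {w} u<w w<V = trans (same {2} {w} ≤-refl w<V (>⇒≢ u<w)) (ins I (<⇒≤ u<w) w<V)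

    same-query : ∀ {t p₁ p₂ κ l t' p₁' p₂' κ' l'} → Query B t p₁ p₂ κ l → Query B t' p₁' p₂' κ' l' →
      path t p₁ p₂ κ l ≡ path t' p₁' p₂' κ' l' → (l ≡ l' × κ ≡ κ') × (p₂ ≡ p₂' × p₁ ≡ p₁' × t ≡ t')
    same-query Q Q' e = tail-digits B refl (same-digits B Q Q' e)

    inv-terminal : ∀ {u t p₁ p₂ κ} → Inv u (ns u) → Query B t p₁ p₂ κ t → u ≡ path t p₁ p₂ κ t →
      (∀ {i w} → i < 3 → w < V → w ≢ u → ns (suc u) (i + 3 * w) ≡ ns u (i + 3 * w)) → Inv (suc u) (ns (suc u))
    inv-terminal I Q u≡ same = inv-still I no-pred same
      where
      no-pred : ∀ {w} (o : OnPath B w) → ¬ PredIs _ o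
      no-pred (mkOn Q' e) (l' , refl , u≡') with same-query Q (pred-query Q') (trans (sym u≡) u≡')
      ... | (refl , refl) , refl , refl , refl = <-irrefl refl (Query.l≤t Q')

    -- The name of a walk is part of its nodes, so different walks share no node, and `nx` is the
    -- only node that becomes live.
    inv-move : ∀ {u t p₁ p₂ κ l} → u < V → Inv u (ns u) → Query B t p₁ p₂ κ l → u ≡ path t p₁ p₂ κ l → l < t → Inv (suc u) (ns (suc u))
    inv-move {u} {t} {p₁} {p₂} {κ} {l} u<V I Q u≡ l<t = record { on = on' ; off = off' ; ins = ins' }
      where
      nx = path t p₁ p₂ κ (suc l)
      Q' : Query B t p₁ p₂ κ (suc l)
      Q' = mkQuery (Query.t< Q) (Query.p₁< Q) (Query.p₂< Q) (Query.κ< Q) l<t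
      mv = step-move u<V I Q u≡ l<t
      same : ∀ {i w} → i < 3 → w ≢ u → w ≢ nx → ns (suc u) (i + 3 * w) ≡ ns u (i + 3 * w)
      same {i} {w} i<3 w≢u w≢nx = proj₂ mv (i + 3 * w)
        (λ e → w≢u (proj₂ (tok-inj {j = 0} i<3 z<s e))) (λ e → w≢u (proj₂ (tok-inj {j = 1} i<3 (s≤s z<s) e)))
        (λ e → w≢nx (proj₂ (tok-inj {j = 0} i<3 z<s e))) (λ e → w≢nx (proj₂ (tok-inj {j = 1} i<3 (s≤s z<s) e)))
      on' : ∀ {w} → suc u ≤ w → (o : OnPath B w) → Live (suc u) o → ns (suc u) (onWire w) ≡ true × ns (suc u) (offWire w) ≡ false
      on' {w} u<w o live with w ≟ nx
      ... | yes refl = proj₁ mv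
      ... | no w≢nx with live-back o live
      on' {w} u<w o live | no w≢nx | inj₁ live' = let a , b = on I (<⇒≤ u<w) o live' in
        trans (same {0} {w} z<s (>⇒≢ u<w) w≢nx) a , trans (same {1} {w} (s≤s z<s) (>⇒≢ u<w) w≢nx) b
      on' {w} u<w (mkOn Q'' e) live | no w≢nx | inj₂ (l' , refl , u≡') with same-query Q (pred-query Q'') (trans (sym u≡) u≡')
      ... | (refl , refl) , refl , refl , refl = ⊥-elim (w≢nx e)
      off' : ∀ {w} → suc u ≤ w → w < V → (∀ o → ¬ Live (suc u) {w} o) → ns (suc u) (onWire w) ≡ false × ns (suc u) (offWire w) ≡ true
      off' {w} u<w w<V dead with w ≟ nx
      ... | yes refl = ⊥-elim (dead (mkOn Q' refl) (inj₂ (l , refl , s≤s (≤-reflexive (sym u≡)))))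
      ... | no w≢nx = let a , b = off I (<⇒≤ u<w) w<V (λ o live → dead o (live-fwd o live)) in
        trans (same {0} {w} z<s (>⇒≢ u<w) w≢nx) a , trans (same {1} {w} (s≤s z<s) (>⇒≢ u<w) w≢nx) b
      ins' : ∀ {w} → suc u ≤ w → w < V → ns (suc u) (inWire w) ≡ s₀ (inWire w)
      ins' {w} u<w w<V = trans (proj₂ mv (inWire w) (λ e → two≢0 (proj₁ (tok-inj {2} {0} {w} {u} ≤-refl z<s e))) (λ e → two≢1 (proj₁ (tok-inj {2} {1} {w} {u} ≤-refl (s≤s z<s) e)))
          (λ e → two≢0 (proj₁ (tok-inj {2} {0} {w} {nx} ≤-refl z<s e))) (λ e → two≢1 (proj₁ (tok-inj {2} {1} {w} {nx} ≤-refl (s≤s z<s) e))))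
        (ins I (<⇒≤ u<w) w<V)
        where
        two≢0 : 2 ≢ 0
        two≢0 ()
        two≢1 : 2 ≢ 1
        two≢1 ()

    data Step (u : ℕ) : Set where
      quiet  : (∀ t κ → t < D → κ < 2 → u ≢ U t κ) → (∀ w → 3 * V ≤ w → ns (suc u) w ≡ ns u w) → Step u
      active : ∀ t κ → t < D → κ < 2 → u ≡ U t κ → Step u

    inert : ∀ {u t p₁ p₂ κ} → u < V → Inv u (ns u) → Query B t p₁ p₂ κ t → u ≡ path t p₁ p₂ κ t →
      ¬ (hd₁ (X t) ≡ p₁ × hd₂ (X t) ≡ p₂ × κ < 2) → Inv (suc u) (ns (suc u)) × Step u
    inert {u} {t} {p₁} {p₂} {κ} u<V I Q u≡ no-eff =
      inv-terminal I Q u≡ (λ {i} {w} _ _ _ → step-inert u<V I Q u≡ no-eff (i + 3 * w)) ,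
      quiet (λ t' κ' t< κ< e → no-eff (act κ< (same-query Q (activeQuery t< κ<) (trans (sym u≡) e)))) (λ w _ → step-inert u<V I Q u≡ no-eff w)
      where
      act : ∀ {t' κ'} → κ' < 2 → (t ≡ t' × κ ≡ κ') × (p₂ ≡ hd₂ (X t') × p₁ ≡ hd₁ (X t') × t ≡ t') →
        hd₁ (X t) ≡ p₁ × hd₂ (X t) ≡ p₂ × κ < 2
      act κ< ((refl , refl) , refl , refl , refl) = refl , refl , κ<

    step-inv : ∀ {u} → u < V → Inv u (ns u) → Inv (suc u) (ns (suc u)) × Step u
    step-inv {u} u<V I with onPath? B u
    ... | no np = inv-still I (λ o pr → np (pred-onPath o pr))
            (λ {i} {w} i<3 w<V w≢u → step-off u<V I np (i + 3 * w) (λ e → w≢u (proj₂ (tok-inj {j = 0} i<3 z<s e))) (λ e → w≢u (proj₂ (tok-inj {j = 1} i<3 (s≤s z<s) e)))) ,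
          quiet (λ t κ t< κ< e → np (mkOn (activeQuery t< κ<) e))
                (λ w w≥ → step-off u<V I np w (data≢tok {0} z<s u<V w≥) (data≢tok {1} (s≤s z<s) u<V w≥))
    ... | yes (mkOn {t} {p₁} {p₂} {κ} {l} Q u≡) with m≤n⇒m<n∨m≡n (Query.l≤t Q)
    ...   | inj₁ l<t = inv-move u<V I Q u≡ l<t ,
            quiet (λ t' κ' t< κ< e → other (same-query Q (activeQuery t< κ<) (trans (sym u≡) e)))
                  (λ w w≥ → proj₂ (step-move u<V I Q u≡ l<t) w (data≢tok {0} z<s u<V w≥) (data≢tok {1} (s≤s z<s) u<V w≥)
                     (data≢tok {0} z<s (path<V B Q') w≥) (data≢tok {1} (s≤s z<s) (path<V B Q') w≥))
      where
      Q' : Query B t p₁ p₂ κ (suc l)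
      Q' = mkQuery (Query.t< Q) (Query.p₁< Q) (Query.p₂< Q) (Query.κ< Q) l<t
      other : ∀ {t' κ'} {a b : ℕ} → (l ≡ t' × κ ≡ κ') × (p₂ ≡ a × p₁ ≡ b × t ≡ t') → ⊥
      other ((refl , _) , _ , _ , refl) = <-irrefl refl l<t
    ...   | inj₂ refl with hd₁ (X t) ≟ p₁ | hd₂ (X t) ≟ p₂ | κ <? 2
    ...     | yes refl | yes refl | yes κ<2 = inv-terminal I Q u≡
                (effect-tok u<V I (effAt B t κ) (step-active u<V I (Query.t< Q) κ<2 u≡) (effAt-ok u<V I (Query.t< Q) κ<2)) ,
              active t κ (Query.t< Q) κ<2 u≡
    ...     | no ne | _ | _ = inert u<V I Q u≡ λ { (e , _) → ne e }
    ...     | yes _ | no ne | _ = inert u<V I Q u≡ λ { (_ , e , _) → ne e }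
    ...     | yes _ | yes _ | no ne = inert u<V I Q u≡ λ { (_ , _ , e) → ne e }

  -- The comparator tape as pairs of rails, followed through time.

  deMorgan₁ : ∀ a b → not (a ∧ b) ≡ not a ∨ not b
  deMorgan₁ true  b = refl
  deMorgan₁ false b = refl

  deMorgan₂ : ∀ a b → not (a ∨ b) ≡ not a ∧ not b
  deMorgan₂ true  b = refl
  deMorgan₂ false b = refl

  opTape : Op → (i p₁ p₂ : ℕ) → (ℕ → Maybe Bool) → (ℕ → Maybe Bool)
  opTape o i p₁ p₂ T = applyOp {1} {0} xs o (record
    { state = zero ; work = λ _ → zero ; wpos = 0 ; ipos = i ; pos₁ = p₁ ; pos₂ = p₂ ; comp = T })

  -- The r-th rail of a cell with status suc π holds the value of the cell iff r = π.
  RailOK : ℕ → Maybe Bool → (ℕ → Bool) → Set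
  RailOK σ c ρ = (σ ≡ 0 × c ≡ nothing × ρ 0 ≡ false × ρ 1 ≡ false) ⊎
    Σ ℕ λ π → Σ Bool λ a → σ ≡ suc π × π < 2 × c ≡ just a × ρ π ≡ a × ρ (1 ∸ π) ≡ not a

  rok-cong : ∀ {σ σ' c c'} {ρ ρ' : ℕ → Bool} → σ' ≡ σ → c' ≡ c → (∀ r → r < 2 → ρ' r ≡ ρ r) → RailOK σ c ρ → RailOK σ' c' ρ'
  rok-cong refl refl e (inj₁ (z , b , r₀ , r₁)) = inj₁ (z , b , trans (e 0 z<s) r₀ , trans (e 1 (s≤s z<s)) r₁)
  rok-cong refl refl e (inj₂ (π , a , s , π< , c , r , r')) =
    inj₂ (π , a , s , π< , c , trans (e π π<) r , trans (e (1 ∸ π) (s≤s (m∸n≤m 1 π))) r')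

  statusOf : Op → (i h₁ h₂ p σ : ℕ) → ℕ
  statusOf o i h₁ h₂ p σ =
    cond ((proj₁ (writes o) * eq h₁ p + proj₂ (writes o) * eq h₂ p) * cond (written o ∸ 2) (lt i n) 1) (cond σ σ 1)
      (cond (proj₁ (negates o) * eq h₁ p + proj₂ (negates o) * eq h₂ p) (cond σ (3 ∸ σ) 0) σ)

  module Timeline (B : Bounded) where
    open Bounded B
    open Run B public

    inv-all : ∀ u → u ≤ V → Inv u (ns u)
    inv-all zero    _   = subst (Inv 0) (sym (ns≡ 0)) inv-zero
    inv-all (suc u) u<V = proj₁ (step-inv u<V (inv-all u (<⇒≤ u<V)))

    data-quiet : ∀ {a} k → a + k ≤ V → (∀ u → a ≤ u → u < a + k → ∀ t κ → t < D → κ < 2 → u ≢ U t κ) →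
      ∀ w → 3 * V ≤ w → ns (a + k) w ≡ ns a w
    data-quiet {a} zero    le q w w≥ = cong (λ z → ns z w) (+-identityʳ a)
    data-quiet {a} (suc k) le q w w≥ = trans (cong (λ z → ns z w) (+-suc a k))
      (trans (last (proj₂ (step-inv a+k<V (inv-all (a + k) (<⇒≤ a+k<V)))))
             (data-quiet k (<⇒≤ a+k<V) (λ u l r → q u l (<-trans r (subst (a + k <_) (sym (+-suc a k)) ≤-refl))) w w≥))
      where
      a+k<V : a + k < V
      a+k<V = subst (_≤ V) (+-suc a k) le
      last : Step (a + k) → ns (suc (a + k)) w ≡ ns (a + k) w
      last (quiet _ same) = same w w≥
      last (active t κ t< κ< e) = ⊥-elim (q (a + k) (m≤m+n a k) (subst (a + k <_) (sym (+-suc a k)) ≤-refl) t κ t< κ< e)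

    data-between : ∀ {a c} → a ≤ c → c ≤ V → (∀ u → a ≤ u → u < c → ∀ t κ → t < D → κ < 2 → u ≢ U t κ) →
      ∀ w → 3 * V ≤ w → ns c w ≡ ns a w
    data-between {a} {c} a≤c c≤V q w w≥ = trans (cong (λ z → ns z w) (sym (m+[n∸m]≡n a≤c)))
      (data-quiet (c ∸ a) (≤-trans (≤-reflexive (m+[n∸m]≡n a≤c)) c≤V)
        (λ u l r → q u l (subst (u <_) (m+[n∸m]≡n a≤c) r)) w w≥)

    U-t : ∀ {t t' κ κ'} → t < D → κ < 2 → t < t' → U t κ < U t' κ'
    U-t t< κ< lt = path-t B (activeQuery t< κ<) lt

    U-κ : ∀ {t} → t < D → U t 0 < U t 1
    U-κ t< = path-κ B (activeQuery t< z<s) z<s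

    U≤1 : ∀ {t κ} → t < D → κ < 2 → U t κ ≤ U t 1
    U≤1 {κ = 0} t< κ< = <⇒≤ (U-κ t<)
    U≤1 {κ = 1} t< κ< = ≤-refl
    U≤1 {κ = suc (suc _)} t< (s≤s (s≤s ()))

    -- A boundary in the order of nodes: the effects of times before t come from nodes below it,
    -- those of time t and later from nodes at or above it.
    N : ℕ → ℕ
    N zero    = 0
    N (suc t) = suc (U t 1)

    before-N : ∀ {t t' κ} → t' < t → t' < D → κ < 2 → U t' κ < N t
    before-N {suc t} {t'} (s≤s t'≤t) t'< κ< with m≤n⇒m<n∨m≡n t'≤t
    ... | inj₁ lt = m<n⇒m<1+n (U-t t'< κ< lt)
    ... | inj₂ refl = s≤s (U≤1 t'< κ<)

    N≤U : ∀ {t} → t < D → N t ≤ U t 0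
    N≤U {zero}  t< = z≤n
    N≤U {suc t} t< = U-t (<-trans ≤-refl t<) (s≤s z<s) ≤-refl

    gap₀ : ∀ {t} → t < D → ∀ u → N t ≤ u → u < U t 0 → ∀ t' κ → t' < D → κ < 2 → u ≢ U t' κ
    gap₀ {t} t< u l r t' κ t'< κ< refl with <-cmp t' t
    ... | tri< lt _ _ = <⇒≱ (before-N lt t'< κ<) l
    ... | tri> _ _ gt = <-asym r (U-t t< z<s gt)
    gap₀ t< u l r t' 0 t'< κ< refl | tri≈ _ refl _ = <-irrefl refl r
    gap₀ t< u l r t' (suc _) t'< (s≤s (s≤s z≤n)) refl | tri≈ _ refl _ = <-asym r (U-κ t<)

    gap₁ : ∀ {t} → t < D → ∀ u → suc (U t 0) ≤ u → u < U t 1 → ∀ t' κ → t' < D → κ < 2 → u ≢ U t' κ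
    gap₁ {t} t< u l r t' κ t'< κ< refl with <-cmp t' t
    ... | tri< lt _ _ = <-asym l (U-t t'< κ< lt)
    ... | tri> _ _ gt = <-asym r (U-t t< (s≤s z<s) gt)
    gap₁ t< u l r t' 0 t'< κ< refl | tri≈ _ refl _ = <-irrefl refl l
    gap₁ t< u l r t' (suc _) t'< (s≤s (s≤s z≤n)) refl | tri≈ _ refl _ = <-irrefl refl r

    -- `Effect` seen from the rails and the output wire alone, with y for the bit on the input wire
    -- of the node.
    DataEff : Eff → Bool → Store → Store → Set
    DataEff idle y s s'            = ∀ w → 3 * V ≤ w → s' w ≡ s w
    DataEff (store p κ) y s s'     = s' (rl p κ) ≡ y ∨ s (rl p κ) × (∀ w → 3 * V ≤ w → w ≢ rl p κ → s' w ≡ s w)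
    DataEff (emit p r) y s s'      = s' (outWire n) ≡ s (rl p r) ∨ s (outWire n)
    DataEff (cmp p r p' r') y s s' = s' (rl p r) ≡ s (rl p r) ∧ s (rl p' r') × s' (rl p' r') ≡ s (rl p r) ∨ s (rl p' r') ×
                                     (∀ w → 3 * V ≤ w → w ≢ rl p r → w ≢ rl p' r' → s' w ≡ s w)

    toData : ∀ {u s s' y} (u<V : u < V) (I : Inv u (ns u)) eff → Effect u<V I eff (ns u) s' → ns u (inWire u) ≡ y →
      (∀ w → 3 * V ≤ w → ns u w ≡ s w) → DataEff eff y s s'
    toData u<V I idle ef y= same w w≥ = trans (ef w (data≢tok {0} z<s u<V w≥) (data≢tok {1} (s≤s z<s) u<V w≥)) (same w w≥)
    toData u<V I (store p κ) (a , ef) y= same = trans a (cong₂ _∨_ y= (same _ (rail≥ p κ))) ,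
      λ w w≥ ne → trans (ef w (data≢tok {0} z<s u<V w≥) (data≢tok {2} ≤-refl u<V w≥) ne) (same w w≥)
    toData u<V I (emit p r) (a , ef) y= same = trans a (cong₂ _∨_ (same _ (rail≥ p r)) (same _ out≥))
    toData u<V I (cmp p r p' r') (a , b , ef) y= same =
      trans a (cong₂ _∧_ (same _ (rail≥ p r)) (same _ (rail≥ p' r'))) ,
      trans b (cong₂ _∨_ (same _ (rail≥ p r)) (same _ (rail≥ p' r'))) ,
      λ w w≥ ne ne' → trans (ef w (data≢tok {0} z<s u<V w≥) (data≢tok {1} (s≤s z<s) u<V w≥) ne ne') (same w w≥)

    -- Between consecutive active nodes the rails rest, so time t amounts to two effects, the one of
    -- κ = 0 followed by that of κ = 1.
    tick : ∀ {t κ a} → t < D → κ < 2 → a ≤ U t κ → (∀ u → a ≤ u → u < U t κ → ∀ t' κ' → t' < D → κ' < 2 → u ≢ U t' κ') →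
      DataEff (effAt B t κ) (inBit (opAt B t) κ (hI (X t))) (ns a) (ns (suc (U t κ)))
    tick {t} {κ} {a} t< κ< a≤U gap = toData U<V I (effAt B t κ) (step-active U<V I t< κ< refl)
      (trans (Inv.ins I ≤-refl U<V) (s₀-active t< κ<)) (data-between a≤U (<⇒≤ U<V) gap)
      where
      U<V : U t κ < V
      U<V = path<V B (activeQuery t< κ<)
      I = inv-all (U t κ) (<⇒≤ U<V)

    mid : ℕ → ℕ
    mid t = suc (U t 0)

    tick₀ : ∀ {t} → t < D → DataEff (effAt B t 0) (inBit (opAt B t) 0 (hI (X t))) (ns (N t)) (ns (mid t))
    tick₀ t< = tick t< z<s (N≤U t<) (gap₀ t<)

    tick₁ : ∀ {t} → t < D → DataEff (effAt B t 1) (inBit (opAt B t) 1 (hI (X t))) (ns (mid t)) (ns (N (suc t)))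
    tick₁ t< = tick t< (s≤s z<s) (U-κ t<) (gap₁ t<)

    finish : ∀ w → 3 * V ≤ w → ns V w ≡ ns (N D) w
    finish = data-between (path<V B (activeQuery ≤-refl (s≤s z<s))) ≤-refl
      (λ u l r t κ t< κ< e → <⇒≱ (subst (_< N D) (sym e) (before-N t< t< κ<)) l)

    -- The comparator tape driven by the trajectory, loading phase included. The circuit is compared
    -- with it here and the machine in `tape-follow`.
    tape : ℕ → ℕ → Maybe Bool
    tape zero    = blankTape
    tape (suc t) = opTape (opAt B t) (hI (X t)) (hd₁ (X t)) (hd₂ (X t)) (tape t)

    status-suc : ∀ t p → status (suc t) p ≡ statusOf (opAt B t) (hI (X t)) (hd₁ (X t)) (hd₂ (X t)) p (status t p)
    status-suc t p = eqs (getAt B fWrite₁ t) (getAt B fWrite₂ t) (getAt B fVal t) (getAt B fNeg₁ t) (getAt B fNeg₂ t)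
      where
      h₁ h₂ σ : ℕ
      h₁ = hd₁ (X t)
      h₂ = hd₂ (X t)
      σ = status t p
      eqs : ∀ {a a' b b' c c' d d' e e'} → a ≡ a' → b ≡ b' → c ≡ c' → d ≡ d' → e ≡ e' →
        cond ((a * eq h₁ p + b * eq h₂ p) * cond (c ∸ 2) (lt (hI (X t)) n) 1) (cond σ σ 1) (cond (d * eq h₁ p + e * eq h₂ p) (cond σ (3 ∸ σ) 0) σ) ≡
        cond ((a' * eq h₁ p + b' * eq h₂ p) * cond (c' ∸ 2) (lt (hI (X t)) n) 1) (cond σ σ 1) (cond (d' * eq h₁ p + e' * eq h₂ p) (cond σ (3 ∸ σ) 0) σ)
      eqs refl refl refl refl refl = refl

    Rails : ℕ → Set
    Rails t = ∀ p → p < D → RailOK (status t p) (tape t p) (λ r → ns (N t) (rl p r))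

    rails-zero : Rails 0
    rails-zero p p< = inj₁ (refl , refl , z 0 , z 1)
      where
      z : ∀ r → ns 0 (rl p r) ≡ false
      z r = trans (cong (λ f → f (rl p r)) (ns≡ 0)) (s₀-data (rail≥ p r))

    module AtTime (t : ℕ) (t< : t < D) (ok : Rails t) where

      h₁ h₂ i : ℕ
      h₁ = hd₁ (X t)
      h₂ = hd₂ (X t)
      i = hI (X t)
      h₁< : h₁ < D
      h₁< = ≤-<-trans (proj₁ (proj₂ (heads≤ B t))) t<
      h₂< : h₂ < D
      h₂< = ≤-<-trans (proj₂ (proj₂ (heads≤ B t))) t<
      s s₁ s₂ : Store
      s = ns (N t)
      s₁ = ns (mid t)
      s₂ = ns (N (suc t))

      Next : Op → Set
      Next o = ∀ p → p < D → RailOK (statusOf o i h₁ h₂ p (status t p)) (opTape o i h₁ h₂ (tape t) p) (λ r → s₂ (rl p r))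

      Ticks : Op → Set
      Ticks o = DataEff (effOf o h₁ h₂ (status t h₁) (status t h₂) 0) (inBit o 0 i) s s₁ ×
                DataEff (effOf o h₁ h₂ (status t h₁) (status t h₂) 1) (inBit o 1 i) s₁ s₂

      keep : ∀ {σ' c' p} → p < D → σ' ≡ status t p → c' ≡ tape t p → (∀ r → r < 2 → s₂ (rl p r) ≡ s (rl p r)) →
        RailOK σ' c' (λ r → s₂ (rl p r))
      keep {p = p} p< e e' same = rok-cong e e' same (ok p p<)

      idle₂ : (∀ w → 3 * V ≤ w → s₁ w ≡ s w) → (∀ w → 3 * V ≤ w → s₂ w ≡ s₁ w) → ∀ w → 3 * V ≤ w → s₂ w ≡ s w
      idle₂ e e' w w≥ = trans (e' w w≥) (e w w≥)

      wEff : ℕ → ℕ → ℕ → Eff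
      wEff p 0       κ = store p κ
      wEff p (suc _) κ = idle

      -- Writing mv (a bit, or nothing when copying beyond the input) on cell p₀.
      write-case : ∀ p₀ mv → p₀ < D →
        (σ' : ℕ → ℕ) → (∀ p → p ≢ p₀ → σ' p ≡ status t p) → (∀ v → mv ≡ just v → σ' p₀ ≡ cond (status t p₀) (status t p₀) 1) →
        (mv ≡ nothing → σ' p₀ ≡ status t p₀) →
        DataEff (wEff p₀ (status t p₀) 0) (maybe (flip 0) false mv) s s₁ → DataEff (wEff p₀ (status t p₀) 1) (maybe (flip 1) false mv) s₁ s₂ →
        ∀ p → p < D → RailOK (σ' p) (writeIfBlank (tape t) p₀ mv p) (λ r → s₂ (rl p r))
      write-case p₀ mv p₀< σ' far near none e₀ e₁ p p< with status t p₀ in eqσ | tape t p₀ in eqT | ok p₀ p₀<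
      ... | suc π | just a | inj₂ _ = keep p< (same p) refl (λ r r< → idle₂ e₀ e₁ (rl p r) (rail≥ p r))
        where
        same : ∀ p → σ' p ≡ status t p
        same p with p ≟ p₀
        ... | no ne = far p ne
        ... | yes refl = go mv refl
          where
          go : ∀ m → mv ≡ m → σ' p ≡ status t p
          go (just v) e = trans (near v e) (sym eqσ)
          go nothing  e = trans (none e) (sym eqσ)
      ... | suc π | nothing | inj₂ (_ , _ , _ , _ , () , _)
      ... | zero | just a | inj₁ (_ , () , _)
      ... | zero | nothing | inj₁ (_ , _ , r₀ , r₁) = outcome
        where
        d : rl p₀ 0 ≢ rl p₀ 1
        d e with proj₂ (rail-inj {p₀} {0} {p₀} {1} z<s (s≤s z<s) e)
        ... | ()
        v₀ : s₂ (rl p₀ 0) ≡ maybe (flip 0) false mv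
        v₀ = trans (proj₂ e₁ _ (rail≥ p₀ 0) d) (trans (proj₁ e₀) (trans (cong (_ ∨_) r₀) (∨-identityʳ _)))
        v₁ : s₂ (rl p₀ 1) ≡ maybe (flip 1) false mv
        v₁ = trans (proj₁ e₁) (trans (cong (_ ∨_) (trans (proj₂ e₀ _ (rail≥ p₀ 1) (λ e → d (sym e))) r₁)) (∨-identityʳ _))
        outcome : RailOK (σ' p) (upd (tape t) p₀ mv p) (λ r → s₂ (rl p r))
        outcome with p ≟ p₀
        ... | no ne = keep p< (far p ne) (upd-other (tape t) mv ne)
          (λ r r< → trans (proj₂ e₁ _ (rail≥ p r) (λ e → ne (proj₁ (rail-inj r< (s≤s z<s) e)))) (proj₂ e₀ _ (rail≥ p r) (λ e → ne (proj₁ (rail-inj r< z<s e)))))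
        ... | yes refl = go mv refl
          where
          go : ∀ m → mv ≡ m → RailOK (σ' p) (upd (tape t) p mv p) (λ r → s₂ (rl p r))
          go (just v) e = inj₂ (0 , v , near v e , z<s , trans (upd-same (tape t) p mv) e ,
            trans v₀ (cong (maybe (flip 0) false) e) , trans v₁ (cong (maybe (flip 1) false) e))
          go nothing  e = inj₁ (none e , trans (upd-same (tape t) p mv) e ,
            trans v₀ (cong (maybe (flip 0) false) e) , trans v₁ (cong (maybe (flip 1) false) e))

      write-next : ∀ h v → Ticks (write h v) → Next (write h v)
      write-next M₁ v (e₀ , e₁) = write-case h₁ (just v) h₁< (λ p → statusOf (write M₁ v) i h₁ h₂ p (status t p))
        (λ p ne → trans (cong (λ z → cond ((1 * z + 0) * cond (written (write M₁ v) ∸ 2) (lt i n) 1) (cond (status t p) (status t p) 1) (status t p)) (eq-no (λ e → ne (sym e)))) refl)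
        (λ w _ → trans (cong (λ z → cond ((1 * z + 0) * cond (written (write M₁ v) ∸ 2) (lt i n) 1) (cond (status t h₁) (status t h₁) 1) (status t h₁)) (eq-refl h₁)) (value v))
        (λ ()) (conv 0 e₀) (conv 1 e₁)
        where
        value : ∀ v → cond ((1 * 1 + 0) * cond (written (write M₁ v) ∸ 2) (lt i n) 1) (cond (status t h₁) (status t h₁) 1) (status t h₁) ≡ cond (status t h₁) (status t h₁) 1
        value true = refl
        value false = refl
        conv : ∀ κ {s s'} → DataEff (effOf (write M₁ v) h₁ h₂ (status t h₁) (status t h₂) κ) (flip κ v) s s' → DataEff (wEff h₁ (status t h₁) κ) (flip κ v) s s'
        conv κ e with status t h₁
        ... | 0 = e
        ... | suc _ = e
      write-next M₂ v (e₀ , e₁) = write-case h₂ (just v) h₂< (λ p → statusOf (write M₂ v) i h₁ h₂ p (status t p))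
        (λ p ne → trans (cong (λ z → cond ((1 * z) * cond (written (write M₂ v) ∸ 2) (lt i n) 1) (cond (status t p) (status t p) 1) (status t p)) (eq-no (λ e → ne (sym e)))) refl)
        (λ w _ → trans (cong (λ z → cond ((1 * z) * cond (written (write M₂ v) ∸ 2) (lt i n) 1) (cond (status t h₂) (status t h₂) 1) (status t h₂)) (eq-refl h₂)) (value v))
        (λ ()) (conv 0 e₀) (conv 1 e₁)
        where
        value : ∀ v → cond ((1 * 1) * cond (written (write M₂ v) ∸ 2) (lt i n) 1) (cond (status t h₂) (status t h₂) 1) (status t h₂) ≡ cond (status t h₂) (status t h₂) 1
        value true = refl
        value false = refl
        conv : ∀ κ {s s'} → DataEff (effOf (write M₂ v) h₁ h₂ (status t h₁) (status t h₂) κ) (flip κ v) s s' → DataEff (wEff h₂ (status t h₂) κ) (flip κ v) s s'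
        conv κ e with status t h₂
        ... | 0 = e
        ... | suc _ = e

      copied : ∀ σ → (∀ v → nth xs i ≡ just v → cond (1 * lt i n) (cond σ σ 1) σ ≡ cond σ σ 1) × (nth xs i ≡ nothing → cond (1 * lt i n) (cond σ σ 1) σ ≡ σ)
      copied σ with i <? n
      ... | yes i< = (λ v _ → cong (λ z → cond (1 * z) (cond σ σ 1) σ) (lt-yes i<)) ,
                     (λ e → ⊥-elim (nothing≢just (trans (sym e) (nth-fromℕ< xs i<))))
        where
        nothing≢just : ∀ {v : Bool} → nothing ≢ just v
        nothing≢just ()
      ... | no i≮ = (λ v e → ⊥-elim (nothing≢just (trans (sym (nth-≥ xs (≮⇒≥ i≮))) e))) , (λ _ → cong (λ z → cond (1 * z) (cond σ σ 1) σ) (lt-no i≮))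
        where
        nothing≢just : ∀ {v : Bool} → nothing ≢ just v
        nothing≢just ()

      copy-next : ∀ h → Ticks (copy h) → Next (copy h)
      copy-next M₁ (e₀ , e₁) = write-case h₁ (nth xs i) h₁< (λ p → statusOf (copy M₁) i h₁ h₂ p (status t p))
        (λ p ne → trans (cong (λ z → cond ((1 * z + 0) * lt i n) (cond (status t p) (status t p) 1) (status t p)) (eq-no (λ e → ne (sym e)))) refl)
        (λ v e → trans (cong (λ z → cond ((1 * z + 0) * lt i n) (cond (status t h₁) (status t h₁) 1) (status t h₁)) (eq-refl h₁)) (proj₁ (copied (status t h₁)) v e))
        (λ e → trans (cong (λ z → cond ((1 * z + 0) * lt i n) (cond (status t h₁) (status t h₁) 1) (status t h₁)) (eq-refl h₁)) (proj₂ (copied (status t h₁)) e))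
        (conv 0 e₀) (conv 1 e₁)
        where
        conv : ∀ κ {s s'} → DataEff (effOf (copy M₁) h₁ h₂ (status t h₁) (status t h₂) κ) (inBit (copy M₁) κ i) s s' →
          DataEff (wEff h₁ (status t h₁) κ) (maybe (flip κ) false (nth xs i)) s s'
        conv κ e with status t h₁
        ... | 0 = e
        ... | suc _ = e
      copy-next M₂ (e₀ , e₁) = write-case h₂ (nth xs i) h₂< (λ p → statusOf (copy M₂) i h₁ h₂ p (status t p))
        (λ p ne → trans (cong (λ z → cond ((1 * z) * lt i n) (cond (status t p) (status t p) 1) (status t p)) (eq-no (λ e → ne (sym e)))) refl)
        (λ v e → trans (cong (λ z → cond ((1 * z) * lt i n) (cond (status t h₂) (status t h₂) 1) (status t h₂)) (eq-refl h₂)) (proj₁ (copied (status t h₂)) v e))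
        (λ e → trans (cong (λ z → cond ((1 * z) * lt i n) (cond (status t h₂) (status t h₂) 1) (status t h₂)) (eq-refl h₂)) (proj₂ (copied (status t h₂)) e))
        (conv 0 e₀) (conv 1 e₁)
        where
        conv : ∀ κ {s s'} → DataEff (effOf (copy M₂) h₁ h₂ (status t h₁) (status t h₂) κ) (inBit (copy M₂) κ i) s s' →
          DataEff (wEff h₂ (status t h₂) κ) (maybe (flip κ) false (nth xs i)) s s'
        conv κ e with status t h₂
        ... | 0 = e
        ... | suc _ = e

      negate-case : ∀ h p → p < D → (∀ w → 3 * V ≤ w → s₂ w ≡ s w) → ∀ {σ'} → (p ≢ h → σ' ≡ status t p) →
        (p ≡ h → σ' ≡ cond (status t p) (3 ∸ status t p) 0) →
        RailOK σ' (upd (tape t) h (Maybe.map not (tape t h)) p) (λ r → s₂ (rl p r))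
      negate-case h p p< same far near with p ≟ h
      ... | no ne = keep p< (far ne) (upd-other (tape t) _ ne) (λ r _ → same _ (rail≥ p r))
      ... | yes refl with near refl | ok p p<
      ...   | q | inj₁ (z , b , r₀ , r₁) = inj₁ (trans q (cong (λ σ → cond σ (3 ∸ σ) 0) z) ,
                trans (upd-same (tape t) p _) (cong (Maybe.map not) b) , trans (same _ (rail≥ p 0)) r₀ , trans (same _ (rail≥ p 1)) r₁)
      ...   | q | inj₂ (0 , a , z , _ , b , r , r') = inj₂ (1 , not a , trans q (cong (λ σ → cond σ (3 ∸ σ) 0) z) , s≤s z<s ,
                trans (upd-same (tape t) p _) (cong (Maybe.map not) b) , trans (same _ (rail≥ p 1)) r' ,
                trans (same _ (rail≥ p 0)) (trans r (sym (not-involutive a))))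
      ...   | q | inj₂ (1 , a , z , _ , b , r , r') = inj₂ (0 , not a , trans q (cong (λ σ → cond σ (3 ∸ σ) 0) z) , z<s ,
                trans (upd-same (tape t) p _) (cong (Maybe.map not) b) , trans (same _ (rail≥ p 0)) r' ,
                trans (same _ (rail≥ p 1)) (trans r (sym (not-involutive a))))
      ...   | q | inj₂ (suc (suc _) , _ , _ , s≤s (s≤s ()) , _)

      negate-next : ∀ h → Ticks (negate h) → Next (negate h)
      negate-next M₁ (e₀ , e₁) p p< = negate-case h₁ p p< (idle₂ e₀ e₁)
        (λ ne → cong (λ z → cond (1 * z + 0) (cond (status t p) (3 ∸ status t p) 0) (status t p)) (eq-no (λ e → ne (sym e))))
        (λ { refl → cong (λ z → cond (1 * z + 0) (cond (status t p) (3 ∸ status t p) 0) (status t p)) (eq-refl p) })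
      negate-next M₂ (e₀ , e₁) p p< = negate-case h₂ p p< (idle₂ e₀ e₁)
        (λ ne → cong (λ z → cond (1 * z) (cond (status t p) (3 ∸ status t p) 0) (status t p)) (eq-no (λ e → ne (sym e))))
        (λ { refl → cong (λ z → cond (1 * z) (cond (status t p) (3 ∸ status t p) 0) (status t p)) (eq-refl p) })

      -- The value rails receive a ∧ b and a ∨ b. The complements, compared with the cells
      -- exchanged, give ¬b ∧ ¬a to the second cell and ¬b ∨ ¬a to the first, and by De Morgan's
      -- laws the rails are complementary again.
      sorted-rails : ∀ {π₁ π₂ a b} → π₁ < 2 → π₂ < 2 → h₁ ≢ h₂ →
        s (rl h₁ π₁) ≡ a → s (rl h₁ (1 ∸ π₁)) ≡ not a → s (rl h₂ π₂) ≡ b → s (rl h₂ (1 ∸ π₂)) ≡ not b →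
        DataEff (cmp h₁ π₁ h₂ π₂) false s s₁ → DataEff (cmp h₂ (1 ∸ π₂) h₁ (1 ∸ π₁)) false s₁ s₂ →
        (s₂ (rl h₁ π₁) ≡ a ∧ b × s₂ (rl h₁ (1 ∸ π₁)) ≡ not (a ∧ b)) × (s₂ (rl h₂ π₂) ≡ a ∨ b × s₂ (rl h₂ (1 ∸ π₂)) ≡ not (a ∨ b)) ×
        (∀ p r → r < 2 → p ≢ h₁ → p ≢ h₂ → s₂ (rl p r) ≡ s (rl p r))
      sorted-rails {π₁} {π₂} {a} {b} π₁< π₂< ne A A' B₁ B' (m₀ , x₀ , o₀) (m₁ , x₁ , o₁) =
        (trans (o₁ _ (rail≥ h₁ π₁) (λ e → ne (proj₁ (rail-inj π₁< c₂ e))) (λ e → apart π₁ π₁< (proj₂ (rail-inj {h₁} {π₁} {h₁} π₁< c₁ e)))) (trans m₀ (cong₂ _∧_ A B₁)) ,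
         trans x₁ (trans (cong₂ _∨_ n₂ n₁) (trans (∨-comm (not b) (not a)) (sym (deMorgan₁ a b))))) ,
        (trans (o₁ _ (rail≥ h₂ π₂) (λ e → apart π₂ π₂< (proj₂ (rail-inj {h₂} {π₂} {h₂} π₂< c₂ e))) (λ e → ne (sym (proj₁ (rail-inj π₂< c₁ e))))) (trans x₀ (cong₂ _∨_ A B₁)) ,
         trans m₁ (trans (cong₂ _∧_ n₂ n₁) (trans (∧-comm (not b) (not a)) (sym (deMorgan₂ a b))))) ,
        λ p r r< p≢ p≢' → trans (o₁ _ (rail≥ p r) (λ e → p≢' (proj₁ (rail-inj r< c₂ e))) (λ e → p≢ (proj₁ (rail-inj r< c₁ e))))
                                (o₀ _ (rail≥ p r) (λ e → p≢ (proj₁ (rail-inj r< π₁< e))) (λ e → p≢' (proj₁ (rail-inj r< π₂< e))))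
        where
        c₁ : 1 ∸ π₁ < 2
        c₁ = s≤s (m∸n≤m 1 π₁)
        c₂ : 1 ∸ π₂ < 2
        c₂ = s≤s (m∸n≤m 1 π₂)
        apart : ∀ π → π < 2 → π ≢ 1 ∸ π
        apart 0 _ ()
        apart 1 _ ()
        apart (suc (suc _)) (s≤s (s≤s ()))
        n₁ : s₁ (rl h₁ (1 ∸ π₁)) ≡ not a
        n₁ = trans (o₀ _ (rail≥ h₁ (1 ∸ π₁)) (λ e → apart π₁ π₁< (sym (proj₂ (rail-inj {h₁} {1 ∸ π₁} {h₁} c₁ π₁< e)))) (λ e → ne (proj₁ (rail-inj c₁ π₂< e)))) A'
        n₂ : s₁ (rl h₂ (1 ∸ π₂)) ≡ not b
        n₂ = trans (o₀ _ (rail≥ h₂ (1 ∸ π₂)) (λ e → ne (sym (proj₁ (rail-inj c₂ π₁< e)))) (λ e → apart π₂ π₂< (sym (proj₂ (rail-inj {h₂} {1 ∸ π₂} {h₂} c₂ π₂< e))))) B'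

      sort-next : Ticks sort → Next sort
      sort-next (e₀ , e₁) p p< with status t h₁ in q₁ | status t h₂ in q₂ | ok h₁ h₁< | ok h₂ h₂<
      ... | 0 | _ | inj₁ (_ , b , _) | _ = keep p< refl (blank₁ b) (λ r _ → idle₂ e₀ e₁ _ (rail≥ p r))
        where
        blank₁ : tape t h₁ ≡ nothing → sortCells (tape t) h₁ h₂ p ≡ tape t p
        blank₁ e rewrite e = refl
      ... | suc _ | 0 | _ | inj₁ (_ , b , _) = keep p< refl (blank₂ b) (λ r _ → idle₂ e₀ e₁ _ (rail≥ p r))
        where
        blank₂ : tape t h₂ ≡ nothing → sortCells (tape t) h₁ h₂ p ≡ tape t p
        blank₂ e with tape t h₁
        ... | nothing = refl
        ... | just _ rewrite e = refl
      ... | suc π₁ | suc π₂ | inj₂ (.π₁ , a , refl , π₁< , ca , A , A') | inj₂ (.π₂ , b , refl , π₂< , cb , B₁ , B') with h₁ ≟ h₂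
      -- A cell compared with itself keeps its value, in accordance with the effect `idle`.
      ...   | yes eqh = keep p< refl (same-cell ca cb) (λ r _ → idle₂ e₀ e₁ _ (rail≥ p r))
        where
        same-cell : tape t h₁ ≡ just a → tape t h₂ ≡ just b → sortCells (tape t) h₁ h₂ p ≡ tape t p
        same-cell e e' rewrite e | e' with p ≟ h₂
        ... | no ne = trans (upd-other _ _ ne) (upd-other (tape t) _ (λ z → ne (trans z eqh)))
        ... | yes refl = trans (upd-same _ p _) (trans (cong just (trans (cong (_∨ b) (just-injective (trans (sym e) (trans (cong (tape t) eqh) e')))) (∨-idem b))) (sym e'))
      ...   | no ne = outcome
        where
        S = sorted-rails π₁< π₂< ne A A' B₁ B' e₀ e₁
        T≡ : sortCells (tape t) h₁ h₂ ≡ upd (upd (tape t) h₁ (just (a ∧ b))) h₂ (just (a ∨ b))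
        T≡ rewrite ca | cb = refl
        outcome : RailOK (status t p) (sortCells (tape t) h₁ h₂ p) (λ r → s₂ (rl p r))
        outcome with p ≟ h₂
        ... | yes refl = inj₂ (π₂ , (a ∨ b) , q₂ , π₂< , trans (cong (λ f → f p) T≡) (upd-same _ p _) , proj₁ (proj₁ (proj₂ S)) , proj₂ (proj₁ (proj₂ S)))
        ... | no ne₂ with p ≟ h₁
        ...   | yes refl = inj₂ (π₁ , (a ∧ b) , q₁ , π₁< , trans (cong (λ f → f p) T≡) (trans (upd-other _ _ ne₂) (upd-same (tape t) p _)) , proj₁ (proj₁ S) , proj₂ (proj₁ S))
        ...   | no ne₁ = keep p< refl (trans (cong (λ f → f p) T≡) (trans (upd-other _ _ ne₂) (upd-other (tape t) _ ne₁))) (λ r r< → proj₂ (proj₂ S) p r r< ne₁ ne₂)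

      next : ∀ o → (∀ h → o ≢ halt h) → Ticks o → Next o
      next noop        nh (e₀ , e₁) p p< = keep p< refl refl (λ r _ → idle₂ e₀ e₁ _ (rail≥ p r))
      next (write h v) nh = write-next h v
      next (copy h)    nh = copy-next h
      next (negate h)  nh = negate-next h
      next sort        nh = sort-next
      next (halt h)    nh = ⊥-elim (nh h refl)

      rails-suc : (∀ h → opAt B t ≢ halt h) → Rails (suc t)
      rails-suc nh p p< = rok-cong (status-suc t p) refl (λ _ _ → refl)
        (next (opAt B t) nh (tick₀ t< , tick₁ t<) p p<)

    Silent : Eff → Set
    Silent (emit _ _) = ⊥
    Silent _          = 0 ≡ 0

    silent : ∀ o p₁ p₂ σ₁ σ₂ κ → (∀ h → o ≢ halt h) → Silent (effOf o p₁ p₂ σ₁ σ₂ κ)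
    silent noop p₁ p₂ σ₁ σ₂ κ nh = refl
    silent (write M₁ v) p₁ p₂ 0 σ₂ κ nh = refl
    silent (write M₁ v) p₁ p₂ (suc _) σ₂ κ nh = refl
    silent (write M₂ v) p₁ p₂ σ₁ 0 κ nh = refl
    silent (write M₂ v) p₁ p₂ σ₁ (suc _) κ nh = refl
    silent (copy M₁) p₁ p₂ 0 σ₂ κ nh = refl
    silent (copy M₁) p₁ p₂ (suc _) σ₂ κ nh = refl
    silent (copy M₂) p₁ p₂ σ₁ 0 κ nh = refl
    silent (copy M₂) p₁ p₂ σ₁ (suc _) κ nh = refl
    silent (negate h) p₁ p₂ σ₁ σ₂ κ nh = refl
    silent sort p₁ p₂ 0 σ₂ κ nh = refl
    silent sort p₁ p₂ (suc σ₁) 0 κ nh = refl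
    silent sort p₁ p₂ (suc σ₁) (suc σ₂) κ nh with p₁ ≟ p₂
    ... | yes _ = refl
    silent sort p₁ p₂ (suc σ₁) (suc σ₂) 0 nh | no _ = refl
    silent sort p₁ p₂ (suc σ₁) (suc σ₂) (suc κ) nh | no _ = refl
    silent (halt h) p₁ p₂ σ₁ σ₂ κ nh = ⊥-elim (nh h refl)

    out-kept : ∀ {u y s s'} (u<V : u < V) (I : Inv u (ns u)) eff → Silent eff → Ok u<V I eff → DataEff eff y s s' → s' (outWire n) ≡ s (outWire n)
    out-kept u<V I idle _ ok e = e _ out≥
    out-kept u<V I (store p κ) _ (p< , κ<) (_ , e) = e _ out≥ (>⇒≢ (rail<out p< κ<))
    out-kept u<V I (cmp p r p' r') _ (p< , r< , p'< , r'< , _) (_ , _ , e) = e _ out≥ (>⇒≢ (rail<out p< r<)) (>⇒≢ (rail<out p'< r'<))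

    out-suc : ∀ {t} → t < D → (∀ h → opAt B t ≢ halt h) → ns (N (suc t)) (outWire n) ≡ ns (N t) (outWire n)
    out-suc {t} t< nh = trans (kept 1 (s≤s z<s) (tick₁ t<)) (kept 0 z<s (tick₀ t<))
      where
      kept : ∀ κ {y s s'} (κ< : κ < 2) → DataEff (effAt B t κ) y s s' → s' (outWire n) ≡ s (outWire n)
      kept κ κ< = out-kept U<V I (effAt B t κ) (silent (opAt B t) _ _ _ _ κ nh) (effAt-ok U<V I t< κ<)
        where
        U<V : U t κ < V
        U<V = path<V B (activeQuery t< κ<)
        I = inv-all (U t κ) (<⇒≤ U<V)

    headAt : ℕ → CHead → ℕ
    headAt t M₁ = hd₁ (X t)
    headAt t M₂ = hd₂ (X t)

    module Output (T : ℕ) (T<D : T < D) (running : ∀ t → t < T → ∀ h → opAt B t ≢ halt h) (h : CHead)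
      (halting : opAt B T ≡ halt h) (after : ∀ t → T < t → opAt B t ≡ noop) (v : Bool) (result : tape T (headAt T h) ≡ just v) where

      upTo-T : ∀ t → t ≤ T → Rails t × ns (N t) (outWire n) ≡ false
      upTo-T zero    _   = rails-zero , trans (cong (λ f → f (outWire n)) (ns≡ 0)) (s₀-data out≥)
      upTo-T (suc t) t<T = let ok , o = upTo-T t (<⇒≤ t<T) in
        AtTime.rails-suc t (<-trans t<T T<D) ok (running t t<T) , trans (out-suc (<-trans t<T T<D) (running t t<T)) o

      headAt< : ∀ h → headAt T h < D
      headAt< M₁ = ≤-<-trans (proj₁ (proj₂ (heads≤ B T))) T<D
      headAt< M₂ = ≤-<-trans (proj₂ (proj₂ (heads≤ B T))) T<D

      emits : ∀ h → effOf (halt h) (hd₁ (X T)) (hd₂ (X T)) (status T (hd₁ (X T))) (status T (hd₂ (X T))) 0 ≡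
        emit (headAt T h) (status T (headAt T h) ∸ 1)
      emits M₁ = refl
      emits M₂ = refl

      quiet₁ : ∀ h → effOf (halt h) (hd₁ (X T)) (hd₂ (X T)) (status T (hd₁ (X T))) (status T (hd₂ (X T))) 1 ≡ idle
      quiet₁ M₁ = refl
      quiet₁ M₂ = refl

      -- The output wire has been 0 until now, so or-ing the value rail into it copies the value.
      at-T : ns (N (suc T)) (outWire n) ≡ v
      at-T = trans (subst (λ e → DataEff e (inBit (opAt B T) 1 (hI (X T))) (ns (mid T)) (ns (N (suc T)))) (trans (eff 1) (quiet₁ h)) (tick₁ T<D) _ out≥)
        (trans (subst (λ e → DataEff e (inBit (opAt B T) 0 (hI (X T))) (ns (N T)) (ns (mid T))) (trans (eff 0) (emits h)) (tick₀ T<D))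
        (trans (cong (ns (N T) (rl (headAt T h) (status T (headAt T h) ∸ 1)) ∨_) (proj₂ (upTo-T T ≤-refl))) (trans (∨-identityʳ _) (value (proj₁ (upTo-T T ≤-refl) (headAt T h) (headAt< h))))))
        where
        eff : ∀ κ → effAt B T κ ≡ effOf (halt h) (hd₁ (X T)) (hd₂ (X T)) (status T (hd₁ (X T))) (status T (hd₂ (X T))) κ
        eff κ = cong (λ o → effOf o (hd₁ (X T)) (hd₂ (X T)) (status T (hd₁ (X T))) (status T (hd₂ (X T))) κ) halting
        value : RailOK (status T (headAt T h)) (tape T (headAt T h)) (λ r → ns (N T) (rl (headAt T h) r)) →
          ns (N T) (rl (headAt T h) (status T (headAt T h) ∸ 1)) ≡ v
        value (inj₁ (_ , blank , _)) = ⊥-elim (nothing≢just (trans (sym blank) result))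
          where
          nothing≢just : ∀ {b : Bool} → nothing ≢ just b
          nothing≢just ()
        value (inj₂ (π , a , σ≡ , _ , cell , r , _)) = trans (cong (λ z → ns (N T) (rl (headAt T h) (z ∸ 1))) σ≡)
          (trans r (just-injective (trans (sym cell) result)))

      -- Walks exist for all times below D, but after the halt the control is dead and their ends do
      -- nothing.
      from-T : ∀ k → suc T + k ≤ D → ns (N (suc T + k)) (outWire n) ≡ v
      from-T zero    _  = trans (cong (λ z → ns (N z) (outWire n)) (+-identityʳ (suc T))) at-T
      from-T (suc k) le = trans (cong (λ z → ns (N z) (outWire n)) (+-suc (suc T) k))
        (trans (out-suc below (λ h e → noop≢halt (trans (sym (after (suc T + k) (s≤s (m≤m+n T k)))) e))) (from-T k (<⇒≤ below)))
        where
        below : suc T + k < D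
        below = subst (_≤ D) (+-suc (suc T) k) le
        noop≢halt : ∀ {h} → Op.noop ≢ halt h
        noop≢halt ()

      output-correct : evalC (TokenFamily.family M E n) (fromList xs) ≡ v
      output-correct = trans (TokenFamily.evalC-family M E (fromList xs)) (trans (cong (λ z → storeAfter gm gM s₀ (V * 4) z) cl-out)
        (trans (cong (λ f → f (outWire n)) (sym (ns≡ V))) (trans (finish (outWire n) out≥)
        (trans (cong (λ z → ns (N z) (outWire n)) (sym (m+[n∸m]≡n T<D))) (from-T (D ∸ suc T) (≤-reflexive (m+[n∸m]≡n T<D)))))))

  -- The trajectory follows the machine, and its length.

  open Polynomials

  rowStep : Row → (L R i h₁ h₂ : ℕ) → Ctl
  rowStep r L R i h₁ h₂ = mkCtl (nextQ r)
    (cond (mvW r) (cond (mvW r ∸ 1) (1 + sym′ r + L * b) L) (L / b))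
    (cond (mvW r) (cond (mvW r ∸ 1) (R / b) (sym′ r + R / b * b)) (cond L (L % b ∸ 1 + (sym′ r + R / b * b) * b) (sym′ r + R / b * b)))
    (shift i (mvI r)) (shift h₁ (mv₁ r)) (shift h₂ (mv₂ r))

  step-row : ∀ c L R i h₁ h₂ → suc (suc c) < 3 + q →
    stepCtl (mkCtl (suc (suc c)) L R i h₁ h₂) ≡ rowStep (row (suc (suc c)) (scan R)) L R i h₁ h₂
  step-row c L R i h₁ h₂ c< = eqs (g fNext) (g fSym) (g fW) (g fI) (g f₁) (g f₂)
    where
    g : ∀ f → get f (suc (suc c)) (scan R) ≡ field′ f (row (suc (suc c)) (scan R))
    g f = get-row f (suc (suc c)) (scan R) c< (m%n<n R b)
    eqs : ∀ {nx nx' w w' m m' mi mi' m₁ m₁' m₂ m₂'} → nx ≡ nx' → w ≡ w' → m ≡ m' → mi ≡ mi' → m₁ ≡ m₁' → m₂ ≡ m₂' →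
      mkCtl nx (cond m (cond (m ∸ 1) (1 + w + L * b) L) (L / b))
        (cond m (cond (m ∸ 1) (R / b) (w + R / b * b)) (cond L (L % b ∸ 1 + (w + R / b * b) * b) (w + R / b * b)))
        (shift i mi) (shift h₁ m₁) (shift h₂ m₂) ≡
      mkCtl nx' (cond m' (cond (m' ∸ 1) (1 + w' + L * b) L) (L / b))
        (cond m' (cond (m' ∸ 1) (R / b) (w' + R / b * b)) (cond L (L % b ∸ 1 + (w' + R / b * b) * b) (w' + R / b * b)))
        (shift i mi') (shift h₁ m₁') (shift h₂ m₂')
    eqs refl refl refl refl refl refl = refl

  step-0 : ∀ L R → stepCtl (mkCtl 0 L R 0 0 0) ≡
    mkCtl (cond R 0 1) (cond R (2 + R % 2 + L * b) (cond L L 2)) (R / 2) 0 0 0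
  step-0 L R = eqs (g fI) (g f₁) (g f₂)
    where
    g : ∀ f → get f 0 (scan R) ≡ field′ f (row 0 (scan R))
    g f = get-row f 0 (scan R) z<s (m%n<n R b)
    eqs : ∀ {a b c d e f} → a ≡ 1 → b ≡ 1 → c ≡ 1 → mkCtl d e f (shift 0 a) (shift 0 b) (shift 0 c) ≡ mkCtl d e f 0 0 0
    eqs refl refl refl = refl

  step-1 : ∀ L R → stepCtl (mkCtl 1 L R 0 0 0) ≡
    mkCtl (cond L 1 (2 + toℕ (Machine.start M))) (L / b) (cond L (L % b ∸ 1 + R * b) R) 0 0 0
  step-1 L R = trans (eqs (g fI) (g f₁) (g f₂) (g fW) (g fSym)) (cong (λ z → mkCtl _ (L / b) (cond L (L % b ∸ 1 + z * b) z) 0 0 0) (sym (m≡m%n+[m/n]*n R b)))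
    where
    g : ∀ f → get f 1 (scan R) ≡ field′ f (row 1 (scan R))
    g f = get-row f 1 (scan R) (s≤s z<s) (m%n<n R b)
    eqs : ∀ {mi m₁ m₂ d m w w'} → mi ≡ 1 → m₁ ≡ 1 → m₂ ≡ 1 → m ≡ 0 → w ≡ w' →
      mkCtl d (cond m (cond (m ∸ 1) (1 + w + L * b) L) (L / b))
        (cond m (cond (m ∸ 1) (R / b) (w + R / b * b)) (cond L (L % b ∸ 1 + (w + R / b * b) * b) (w + R / b * b)))
        (shift 0 mi) (shift 0 m₁) (shift 0 m₂) ≡
      mkCtl d (L / b) (cond L (L % b ∸ 1 + (w' + R / b * b) * b) (w' + R / b * b)) 0 0 0
    eqs refl refl refl refl refl = refl

  symN : Bool → ℕ
  symN false = 1
  symN true  = 2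

  pushes : List Bool → ℕ → ℕ
  pushes []       L = L
  pushes (x ∷ bs) L = pushes bs (suc (symN x) + L * b)

  encB : List Bool → ℕ
  encB []       = 0
  encB (x ∷ bs) = symN x + encB bs * b

  symN<b : ∀ x → suc (symN x) < b
  symN<b false = s≤s (s≤s (s≤s z≤n))
  symN<b true  = s≤s (s≤s (s≤s (s≤s z≤n)))

  cons<^ : ∀ {d a} k → d < b → a < b ^ k → d + a * b < b ^ suc k
  cons<^ {d} {a} k d<b a< = begin-strict
    d + a * b     <⟨ +-monoˡ-< (a * b) d<b ⟩
    suc a * b     ≤⟨ *-monoˡ-≤ b a< ⟩
    b ^ k * b     ≡⟨ *-comm (b ^ k) b ⟩
    b ^ suc k     ∎
    where open ≤-Reasoning

  encB< : ∀ bs → encB bs < b ^ length bs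
  encB< []       = s≤s z≤n
  encB< (x ∷ bs) = cons<^ (length bs) (<-trans ≤-refl (symN<b x)) (encB< bs)

  module Loading (A : ℕ) (n<A : n < A) (Bℓ : b ^ length (binary n) ≤ A) where

    Early : ℕ → Set
    Early t = ctl (X t) ≤ 1 × stL (X t) < A × stR (X t) < A

    ℓ : ℕ
    ℓ = length (binary n)

    ^≤A : ∀ {k} → k ≤ ℓ → b ^ k ≤ A
    ^≤A k≤ = ≤-trans (^-monoʳ-≤ b k≤) Bℓ

    extend : ∀ {l k} → Early l → (∀ t → suc l ≤ t → t < k → Early t) → ∀ t → l ≤ t → t < k → Early t
    extend e r t l≤ t< with m≤n⇒m<n∨m≡n l≤
    ... | inj₁ lt = r t lt t<
    ... | inj₂ refl = e

    early : ∀ {l c L R} → X l ≡ mkCtl c L R 0 0 0 → c ≤ 1 → L < A → R < A → Early l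
    early e p q r rewrite e = p , q , r

    pushing : ∀ f m L j l → m ≤ f → m ≤ n → L < b ^ j → j + length (bitsAux f m) ≤ ℓ → X l ≡ mkCtl 0 L m 0 0 0 →
      X (length (bitsAux f m) + l) ≡ mkCtl 0 (pushes (bitsAux f m) L) 0 0 0 0 ×
      pushes (bitsAux f m) L < b ^ (j + length (bitsAux f m)) × (∀ t → l ≤ t → t < length (bitsAux f m) + l → Early t)
    pushing zero zero L j l _ _ L< _ e = e , subst (λ z → L < b ^ z) (sym (+-identityʳ j)) L< , λ t a c → ⊥-elim (<⇒≱ c a)
    pushing (suc f) zero L j l _ _ L< _ e = e , subst (λ z → L < b ^ z) (sym (+-identityʳ j)) L< , λ t a c → ⊥-elim (<⇒≱ c a)
    pushing (suc f) (suc m) L j l m≤f m≤n L< fit e =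
      let r , bound , es = pushing f (suc m / 2) L₁ (suc j) (suc l) (half≤ m f m≤f) (≤-trans (m/n≤m (suc m) 2) m≤n) L₁< fit' e₁
      in trans (cong X (sym (+-suc k l))) r , subst (λ z → pushes bs L₁ < b ^ z) (sym (+-suc j k)) bound ,
         extend (early {l} e z≤n (<-≤-trans L< (^≤A (≤-trans (m≤m+n j _) fit))) (≤-<-trans m≤n n<A))
                (λ t a c → es t a (subst (t <_) (sym (+-suc k l)) c))
      where
      x = (suc m % 2) ≡ᵇ 1
      L₁ = suc (symN x) + L * b
      bs = bitsAux f (suc m / 2)
      k = length bs
      L₁< : L₁ < b ^ suc j
      L₁< = cons<^ j (symN<b x) L<
      fit' : suc j + k ≤ ℓ
      fit' = subst (_≤ ℓ) (+-suc j k) fit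
      lowBit : ∀ r → r < 2 → 2 + r ≡ suc (symN (r ≡ᵇ 1))
      lowBit 0 _ = refl
      lowBit 1 _ = refl
      lowBit (suc (suc _)) (s≤s (s≤s ()))
      e₁ : X (suc l) ≡ mkCtl 0 L₁ (suc m / 2) 0 0 0
      e₁ = trans (cong stepCtl e) (trans (step-0 L (suc m)) (cong (λ z → mkCtl 0 (z + L * b) (suc m / 2) 0 0 0) (lowBit (suc m % 2) (m%n<n (suc m) 2))))

    -- The bits were pushed with the least significant one first. Popping reverses this, so the
    -- least significant bit ends on top of the right stack, that is at cell 0, as in `binary`.
    popping : ∀ bs L j l → L < b ^ j → j + length bs ≤ ℓ → X l ≡ mkCtl 1 (pushes bs L) 0 0 0 0 → pushes bs L < A →
      X (length bs + l) ≡ mkCtl 1 L (encB bs) 0 0 0 × (∀ t → l ≤ t → t < length bs + l → Early t)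
    popping [] L j l L< fit e _ = e , λ t a c → ⊥-elim (<⇒≱ c a)
    popping (x ∷ bs) L j l L< fit e p< =
      let r , es = popping bs L₁ (suc j) l (cons<^ j (symN<b x) L<) fit' e p<
          l' = length bs + l
      in trans (cong stepCtl r) (trans (step-1 L₁ (encB bs)) (cong₂ (λ u v → mkCtl 1 u (v ∸ 1 + encB bs * b) 0 0 0) (digit-/ L (symN<b x)) (digit-% L (symN<b x)))) ,
         λ t a c → upto es (early {length bs + l} r ≤-refl (<-≤-trans (cons<^ j (symN<b x) L<) (^≤A (≤-trans (m≤m+n (suc j) _) fit'))) (<-≤-trans (encB< bs) (^≤A (≤-trans (m≤n+m _ (suc j)) fit')))) t a c
      where
      L₁ = suc (symN x) + L * b
      fit' : suc j + length bs ≤ ℓ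
      fit' = subst (_≤ ℓ) (+-suc j (length bs)) fit
      upto : ∀ {l'} → (∀ t → l ≤ t → t < l' → Early t) → Early l' → ∀ t → l ≤ t → t < suc l' → Early t
      upto es e t a c with m<1+n⇒m<n∨m≡n c
      ... | inj₁ lt = es t a lt
      ... | inj₂ refl = e

    loaded : 1 ≤ A → Σ ℕ λ pre → X pre ≡ mkCtl (2 + toℕ (Machine.start M)) 0 (encB (binary n)) 0 0 0 × (∀ t → t < pre → Early t)
    loaded 1≤A = suc l₃ , trans (cong stepCtl x₃) (step-1 0 (encB (binary n))) , all
      where
      phase : Σ ℕ λ l → X l ≡ mkCtl 1 (pushes (binary n) 0) 0 0 0 0 × pushes (binary n) 0 < b ^ ℓ × (∀ t → t < l → Early t)
      phase = go n refl
        where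
        go : ∀ m → n ≡ m → Σ ℕ λ l → X l ≡ mkCtl 1 (pushes (binary n) 0) 0 0 0 0 × pushes (binary n) 0 < b ^ ℓ × (∀ t → t < l → Early t)
        go zero e = 1 , trans (step-0 0 n) (trans (cong (λ z → mkCtl (cond z 0 1) (cond z (2 + z % 2 + 0) 2) (z / 2) 0 0 0) e) (cong (λ z → mkCtl 1 (pushes (binary z) 0) 0 0 0 0) (sym e))) ,
          subst (λ z → pushes (binary z) 0 < b ^ length (binary z)) (sym e) (s≤s (s≤s (s≤s z≤n))) , λ { zero _ → z≤n , 1≤A , n<A ; (suc _) (s≤s ()) }
        go (suc m) e = suc k , trans (cong stepCtl r) (trans (step-0 (pushes (bitsAux (suc m) (suc m)) 0) 0)
              (trans (cong (λ z → mkCtl 1 z 0 0 0 0) (nonzero (pushes (bitsAux (suc m) (suc m)) 0) (pushes>0 (bitsAux m (suc m / 2)) _ z<s))) (cong (λ z → mkCtl 1 (pushes (binary z) 0) 0 0 0 0) (sym e)))) ,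
            subst (λ z → pushes (binary z) 0 < b ^ length (binary z)) (sym e) bound ,
            λ t t< → last t t<
          where
          k = length (bitsAux (suc m) (suc m)) + 0
          run′ = pushing (suc m) (suc m) 0 0 0 ≤-refl (≤-reflexive (sym e)) z<s (≤-reflexive (cong (λ z → length (binary z)) (sym e))) (cong (λ z → mkCtl 0 0 z 0 0 0) e)
          r = proj₁ run′
          bound = proj₁ (proj₂ run′)
          pushes>0 : ∀ bs L → 0 < L → 0 < pushes bs L
          pushes>0 []       L p = p
          pushes>0 (x ∷ bs) L p = pushes>0 bs _ z<s
          nonzero : ∀ L → 0 < L → cond L L 2 ≡ L
          nonzero (suc L) _ = refl
          last : ∀ t → t < suc k → Early t
          last t t< with m<1+n⇒m<n∨m≡n t<
          ... | inj₁ lt = proj₂ (proj₂ run′) t z≤n lt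
          ... | inj₂ refl = early {k} r z≤n (<-≤-trans bound (subst (λ z → b ^ length (binary z) ≤ A) e Bℓ)) (≤-<-trans z≤n n<A)
      l₁ = proj₁ phase
      pop = popping (binary n) 0 0 l₁ z<s ≤-refl (proj₁ (proj₂ phase)) (<-≤-trans (proj₁ (proj₂ (proj₂ phase))) Bℓ)
      l₃ = length (binary n) + l₁
      x₃ = proj₁ pop
      all : ∀ t → t < suc l₃ → Early t
      all t t< with m<1+n⇒m<n∨m≡n t<
      ... | inj₂ refl = early {l₃} x₃ ≤-refl 1≤A (<-≤-trans (encB< (binary n)) Bℓ)
      ... | inj₁ lt with t <? l₁
      ...   | yes t<l₁ = proj₂ (proj₂ (proj₂ phase)) t t<l₁
      ...   | no t≮l₁ = proj₂ pop t (≮⇒≥ t≮l₁) lt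

  -- Two of the first N + 1 terms agree, and from the earlier one on the sequence is periodic. A
  -- periodic sequence that is eventually constant is constant throughout.
  orbit-absorbed : ∀ (c : ℕ → ℕ) N {d t} → (∀ k → c k < N) → (∀ i j → c i ≡ c j → c (suc i) ≡ c (suc j)) →
    (∀ k → t ≤ k → c k ≡ d) → c N ≡ d
  orbit-absorbed c N {d} {t} bnd det abs with pigeonhole ≤-refl (λ (i : Fin (suc N)) → fromℕ< (bnd (toℕ i)))
  ... | i , j , i<j , e = trans (cong c (sym (m+[n∸m]≡n (s≤s⁻¹ (toℕ<n i)))))
      (trans (shifted (toℕ i) t (N ∸ toℕ i) (trans ci≡d (sym (abs t ≤-refl)))) (abs (t + (N ∸ toℕ i)) (m≤m+n t _)))
    where
    shifted : ∀ i j k → c i ≡ c j → c (i + k) ≡ c (j + k)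
    shifted i j zero    e = trans (cong c (+-identityʳ i)) (trans e (cong c (sym (+-identityʳ j))))
    shifted i j (suc k) e = trans (cong c (+-suc i k)) (trans (det _ _ (shifted i j k e)) (cong c (sym (+-suc j k))))
    ci≡cj : c (toℕ i) ≡ c (toℕ j)
    ci≡cj = trans (sym (toℕ-fromℕ< (bnd (toℕ i)))) (trans (cong toℕ e) (toℕ-fromℕ< (bnd (toℕ j))))
    p : ℕ
    p = toℕ j ∸ toℕ i
    period : ∀ m → c (toℕ i + m * p) ≡ c (toℕ i)
    period zero    = cong c (+-identityʳ (toℕ i))
    period (suc m) = trans (cong c (trans (sym (+-assoc (toℕ i) p (m * p))) (cong (_+ m * p) (m+[n∸m]≡n (<⇒≤ i<j)))))
      (trans (shifted (toℕ j) (toℕ i) (m * p) (sym ci≡cj)) (period m))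
    ci≡d : c (toℕ i) ≡ d
    ci≡d = trans (sym (period t)) (abs _ (≤-trans (m≤m*n t p {{>-nonZero (m<n⇒0<n∸m i<j)}}) (m≤n+m _ (toℕ i))))

  rdig : ℕ → ℕ → ℕ
  rdig zero    R = R % b
  rdig (suc i) R = rdig i (R / b)

  -- Digits are successors of symbols, so the stack is 0 only at position 0 and blanks to the left
  -- of the head are not lost.
  LRep : (ℕ → Fin (3 + γ)) → ℕ → ℕ → Set
  LRep w zero    L = L ≡ 0
  LRep w (suc p) L = Σ ℕ λ L' → L ≡ suc (toℕ (w p)) + L' * b × LRep w p L'

  LRep-upd : ∀ {w p₀ s} p {L} → p ≤ p₀ → LRep w p L → LRep (upd w p₀ s) p L
  LRep-upd zero    le e = e
  LRep-upd {w} {p₀} {s} (suc p) le (L' , e , r) =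
    L' , trans e (cong (λ z → suc (toℕ z) + L' * b) (sym (upd-other w s (<⇒≢ le)))) , LRep-upd p (<⇒≤ le) r

  sym<b : ∀ (s : Fin (3 + γ)) → suc (toℕ s) < b
  sym<b s = s≤s (toℕ<n s)

  LRep< : ∀ w p {L} → LRep w p L → L < b ^ p
  LRep< w zero    refl = s≤s z≤n
  LRep< w (suc p) (L' , refl , r) = cons<^ p (sym<b (w p)) (LRep< w p r)

  -- The right stack describes the whole tape from the head onwards, with 0 for the blanks. `room`
  -- is the distance to the space bound; it limits the number of digits, since cells from S onwards
  -- have never been written.
  record Follows (S : ℕ) (cfg : Config q γ) (x : Ctl) : Set where
    constructor follows
    open Config cfg
    field
      state≡ : ctl x ≡ 2 + toℕ state
      left≡  : LRep work wpos (stL x)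
      right≡ : ∀ i → rdig i (stR x) ≡ toℕ (work (i + wpos))
      room   : ℕ
      room≡  : room + wpos ≡ S
      right< : stR x < b ^ room
      hI≡    : hI x ≡ ipos
      hd₁≡   : hd₁ x ≡ pos₁
      hd₂≡   : hd₂ x ≡ pos₂

  row-machine : ∀ (st : Fin q) (sy : Fin (3 + γ)) → row (2 + toℕ st) (toℕ sy) ≡ actRow (δ st sy) (toℕ sy) (Action.op (δ st sy))
  row-machine st sy with toℕ st <? q | toℕ sy <? 3 + γ
  ... | yes p | yes r = cong₂ (λ s y → actRow (δ s y) (toℕ sy) (Action.op (δ s y))) (fromℕ<-toℕ st p) (fromℕ<-toℕ sy r)
  ... | no np | _ = ⊥-elim (np (toℕ<n st))
  ... | yes _ | no nr = ⊥-elim (nr (toℕ<n sy))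

  shift-move : ∀ m p → shift p (moveCode m) ≡ move m p
  shift-move left  zero    = refl
  shift-move left  (suc p) = +-identityʳ p
  shift-move stay  p       = m+n∸n≡m p 1
  shift-move right p       = trans (cong (_∸ 1) (+-comm p 2)) refl

  action : Config q γ → Action q γ
  action cfg = δ (Config.state cfg) (Config.work cfg (Config.wpos cfg))

  after : Config q γ → Op → Config q γ
  after c o = record
    { state = Action.next a ; work = upd (Config.work c) (Config.wpos c) (Action.wsym a) ; wpos = move (Action.dW a) (Config.wpos c)
    ; ipos = move (Action.dI a) (Config.ipos c) ; pos₁ = move (Action.dM₁ a) (Config.pos₁ c) ; pos₂ = move (Action.dM₂ a) (Config.pos₂ c)
    ; comp = applyOp xs o c }
    where a = action c

  NonHalt : Op → Set
  NonHalt o = ∀ h → o ≢ halt h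

  doAction-on : ∀ c o → NonHalt o → doAction xs c (action c) o ≡ inj₁ (after c o)
  doAction-on c noop        nh = refl
  doAction-on c (write h v) nh = refl
  doAction-on c (copy h)    nh = refl
  doAction-on c (negate h)  nh = refl
  doAction-on c sort        nh = refl
  doAction-on c (halt h)    nh = ⊥-elim (nh h refl)

  onRow : Action q γ → Op → Row
  onRow a o = mkRow (2 + toℕ (Action.next a)) (toℕ (Action.wsym a)) (moveCode (Action.dW a)) (moveCode (Action.dI a))
    (moveCode (Action.dM₁ a)) (moveCode (Action.dM₂ a)) o

  actRow-on : ∀ a s o → NonHalt o → actRow a s o ≡ onRow a o
  actRow-on a s noop        nh = refl
  actRow-on a s (write h v) nh = refl
  actRow-on a s (copy h)    nh = refl
  actRow-on a s (negate h)  nh = refl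
  actRow-on a s sort        nh = refl
  actRow-on a s (halt h)    nh = ⊥-elim (nh h refl)

  halting? : ∀ o → (Σ CHead λ h → o ≡ halt h) ⊎ NonHalt o
  halting? (halt h)    = inj₁ (h , refl)
  halting? noop        = inj₂ λ h ()
  halting? (write _ _) = inj₂ λ h ()
  halting? (copy _)    = inj₂ λ h ()
  halting? (negate _)  = inj₂ λ h ()
  halting? sort        = inj₂ λ h ()

  scanned≡ : ∀ {S c x} → Follows S c x → scan (stR x) ≡ toℕ (Config.work c (Config.wpos c))
  scanned≡ F = Follows.right≡ F 0

  row≡ : ∀ {S c x} → Follows S c x → row (ctl x) (scan (stR x)) ≡ actRow (action c) (scan (stR x)) (Action.op (action c))
  row≡ {c = c} F = trans (cong₂ row (Follows.state≡ F) (scanned≡ F)) (trans (row-machine _ _) (cong (λ z → actRow (action c) z (Action.op (action c))) (sym (scanned≡ F))))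

  follows-suc : ∀ {S c x} → Follows S c x → Config.wpos c < S → NonHalt (Action.op (action c)) →
    Follows S (after c (Action.op (action c))) (stepCtl x)
  follows-suc {S} {c} {x@(mkCtl _ L R i h₁ h₂)} F@(follows refl left≡ right≡ room room≡ right< refl refl refl) p<S nh =
    subst (Follows S (after c (Action.op (action c)))) (sym stepped) (moved (Action.dW (action c)) refl)
    where
    open Config c
    a : Action q γ
    a = action c
    w : ℕ
    w = toℕ (Action.wsym a)
    R₁ : ℕ
    R₁ = w + R / b * b
    w<b : w < b
    w<b = <-trans ≤-refl (sym<b (Action.wsym a))
    stepped : stepCtl x ≡ rowStep (onRow a (Action.op a)) L R i h₁ h₂
    stepped = trans (step-row (toℕ state) L R i h₁ h₂ (s≤s (s≤s (m<n⇒m<1+n (toℕ<n state)))))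
      (cong (λ r → rowStep r L R i h₁ h₂) (trans (row≡ F) (actRow-on a (scan R) (Action.op a) nh)))
    work' : ℕ → Fin (3 + γ)
    work' = upd work wpos (Action.wsym a)
    room>0 : Σ ℕ λ k → room ≡ suc k
    room>0 = pos-room room room≡
      where
      pos-room : ∀ k → k + wpos ≡ S → Σ ℕ λ k' → k ≡ suc k'
      pos-room zero    e = ⊥-elim (<⇒≢ p<S e)
      pos-room (suc k) e = k , refl
    k = proj₁ room>0
    room-k : room ≡ suc k
    room-k = proj₂ room>0
    R/b< : R / b < b ^ k
    R/b< = *-cancelʳ-< b _ _ (≤-<-trans (m/n*n≤m R b) (subst (R <_) (trans (cong (b ^_) room-k) (*-comm b (b ^ k))) right<))
    R₁< : R₁ < b ^ room
    R₁< = subst (λ z → R₁ < b ^ z) (sym room-k) (cons<^ k w<b R/b<)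
    right₁ : ∀ i → rdig i R₁ ≡ toℕ (work' (i + wpos))
    right₁ zero    = trans (digit-% (R / b) w<b) (cong toℕ (sym (upd-same work wpos _)))
    right₁ (suc i) = trans (cong (rdig i) (digit-/ (R / b) w<b)) (trans (right≡ (suc i)) (cong toℕ (sym (upd-other work _ (λ e → <⇒≢ (s≤s (m≤n+m wpos i)) (sym e))))))
    hs : ∀ {c' L' R' p'} → c' ≡ 2 + toℕ (Action.next a) → p' ≡ move (Action.dW a) wpos → LRep work' p' L' → (∀ i → rdig i R' ≡ toℕ (work' (i + p'))) →
      ∀ rm → rm + p' ≡ S → R' < b ^ rm →
      Follows S (after c (Action.op a)) (mkCtl c' L' R' (shift i (moveCode (Action.dI a))) (shift h₁ (moveCode (Action.dM₁ a))) (shift h₂ (moveCode (Action.dM₂ a))))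
    hs refl refl l r rm e b< = follows refl l r rm e b< (shift-move (Action.dI a) i) (shift-move (Action.dM₁ a) h₁) (shift-move (Action.dM₂ a) h₂)
    moveRow : Move → Row
    moveRow m = mkRow (2 + toℕ (Action.next a)) w (moveCode m) (moveCode (Action.dI a)) (moveCode (Action.dM₁ a)) (moveCode (Action.dM₂ a)) (Action.op a)
    moved : ∀ m → Action.dW a ≡ m → Follows S (after c (Action.op a))
      (rowStep (onRow a (Action.op a)) L R i h₁ h₂)
    moved stay e = subst (λ m → Follows S (after c (Action.op a)) (rowStep (moveRow m) L R i h₁ h₂)) (sym e)
      (hs refl (cong (λ m → move m wpos) (sym e)) (LRep-upd wpos ≤-refl left≡) right₁ room room≡ R₁<)
    moved right e = subst (λ m → Follows S (after c (Action.op a)) (rowStep (moveRow m) L R i h₁ h₂)) (sym e)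
      (hs refl (cong (λ m → move m wpos) (sym e))
        (L , cong (λ z → suc (toℕ z) + L * b) (sym (upd-same work wpos _)) , LRep-upd wpos ≤-refl left≡)
        (λ i → trans (right≡ (suc i)) (cong toℕ (trans (sym (upd-other work _ (λ e → <⇒≢ (s≤s (m≤n+m wpos i)) (sym e)))) (cong work' (sym (+-suc i wpos))))))
        k (trans (+-suc k wpos) (trans (cong (_+ wpos) (sym room-k)) room≡)) R/b<)
    moved left e = subst (λ m → Follows S (after c (Action.op a)) (rowStep (moveRow m) L R i h₁ h₂)) (sym e)
      (hd wpos refl left≡)
      where
      hd : ∀ p → wpos ≡ p → LRep work p L → Follows S (after c (Action.op a))
        (rowStep (mkRow (2 + toℕ (Action.next a)) w 0 (moveCode (Action.dI a)) (moveCode (Action.dM₁ a)) (moveCode (Action.dM₂ a)) (Action.op a)) L R i h₁ h₂)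
      -- At cell 0 the left stack is empty and nothing is moved over, just as the head of the
      -- machine stays where it is.
      hd zero p≡ refl = hs refl (trans (trans p≡ (cong (move left) (sym p≡))) (cong (λ m → move m wpos) (sym e))) (subst (λ z → LRep work' z 0) (sym p≡) refl) right₁ room room≡ R₁<
      hd (suc p) p≡ (L' , refl , r) = hs {p' = p} refl (trans (sym (cong (move left) p≡)) (cong (λ m → move m wpos) (sym e)))
        (subst (LRep work' p) (sym (digit-/ L' (sym<b (work p)))) (LRep-upd p (≤-trans (n≤1+n p) (≤-reflexive (sym p≡))) r))
        digits (suc room) (trans (sym (+-suc room p)) (trans (cong (room +_) (sym p≡)) room≡))
        (cons<^ room top<b R₁<)
        where
        top : (suc (toℕ (work p)) + L' * b) % b ∸ 1 ≡ toℕ (work p)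
        top = cong (_∸ 1) (digit-% L' (sym<b (work p)))
        top<b : (suc (toℕ (work p)) + L' * b) % b ∸ 1 < b
        top<b = subst (_< b) (sym top) (<-trans ≤-refl (sym<b (work p)))
        digits : ∀ i → rdig i ((suc (toℕ (work p)) + L' * b) % b ∸ 1 + R₁ * b) ≡ toℕ (work' (i + p))
        digits zero    = trans (digit-% R₁ top<b) (trans top (cong toℕ (sym (upd-other work _ (λ q → <⇒≢ ≤-refl (trans q p≡))))))
        digits (suc i) = trans (cong (rdig i) (digit-/ R₁ top<b)) (trans (right₁ i) (cong (λ z → toℕ (work' z)) (trans (cong (i +_) p≡) (+-suc i p))))

  op-cong : ∀ o (c : Config q γ) → opTape o (Config.ipos c) (Config.pos₁ c) (Config.pos₂ c) (Config.comp c) ≡ applyOp xs o c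
  op-cong noop         c = refl
  op-cong (write M₁ v) c = refl
  op-cong (write M₂ v) c = refl
  op-cong (copy M₁)    c = refl
  op-cong (copy M₂)    c = refl
  op-cong (negate M₁)  c = refl
  op-cong (negate M₂)  c = refl
  op-cong sort         c = refl
  op-cong (halt h)     c = refl

  rdig-encB : ∀ bs i → rdig i (encB bs) ≡ toℕ (symOf {γ} (nth bs i))
  rdig-encB []           zero    = refl
  rdig-encB []           (suc i) = rdig-encB [] i
  rdig-encB (x ∷ bs)     (suc i) = trans (cong (rdig i) (digit-/ (encB bs) (<-trans ≤-refl (symN<b x)))) (rdig-encB bs i)
  rdig-encB (true ∷ bs)  zero    = digit-% (encB bs) (<-trans ≤-refl (symN<b true))
  rdig-encB (false ∷ bs) zero    = digit-% (encB bs) (<-trans ≤-refl (symN<b false))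

  run-before : ∀ k t {c} → run M xs (k + t) ≡ inj₁ c → Σ (Config q γ) λ c₀ → run M xs t ≡ inj₁ c₀
  run-before zero    t e = _ , e
  run-before (suc k) t e with run M xs (k + t) in eq
  ... | inj₁ c₁ = run-before k t eq

  last-config : ∀ t {o} → run M xs t ≡ inj₂ o → Σ ℕ λ τ → Σ (Config q γ) λ c → run M xs τ ≡ inj₁ c × step M xs c ≡ inj₂ o
  last-config (suc t) e with run M xs t in eq
  ... | inj₁ c = t , c , eq , e
  ... | inj₂ o' = last-config t (trans eq e)

  dead-fixed : ∀ L R i h₁ h₂ → stepCtl (mkCtl (2 + q) L R i h₁ h₂) ≡ mkCtl (2 + q) L R i h₁ h₂
  dead-fixed L R i h₁ h₂ = trans (step-row q L R i h₁ h₂ ≤-refl) (trans (cong (λ r → rowStep r L R i h₁ h₂) dead-row) (stays L R i h₁ h₂))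
    where
    dead-row : row (2 + q) (scan R) ≡ mkRow (2 + q) (scan R) 1 1 1 1 noop
    dead-row with q <? q
    ... | yes q<q = ⊥-elim (<-irrefl refl q<q)
    ... | no _ = refl
    stays : ∀ L R i h₁ h₂ → rowStep (mkRow (2 + q) (scan R) 1 1 1 1 noop) L R i h₁ h₂ ≡ mkCtl (2 + q) L R i h₁ h₂
    stays L R i h₁ h₂ rewrite sym (m≡m%n+[m/n]*n R b) | m+n∸n≡m i 1 | m+n∸n≡m h₁ 1 | m+n∸n≡m h₂ 1 = refl

  dead-op : ∀ s → rowOp (row (2 + q) s) ≡ noop
  dead-op s with q <? q
  ... | yes q<q = ⊥-elim (<-irrefl refl q<q)
  ... | no _ = refl

  early-op : ∀ {c} s → c ≤ 1 → rowOp (row c s) ≡ noop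
  early-op {0} s _ = refl
  early-op {1} s _ = refl
  early-op {suc (suc _)} s (s≤s ())

  module Whole (A S : ℕ) (n<A : n < A) (q<A : 3 + q ≤ A) (ℓ≤S : length (binary n) ≤ S) (bS : b ^ S ≤ A) (A³<D : A * A * A ≤ D)
    (space : ∀ t cfg → run M xs t ≡ inj₁ cfg → Config.wpos cfg < S) (t₁ : ℕ) (v : Bool) (halted : run M xs t₁ ≡ inj₂ (just v)) where

    1≤A : 1 ≤ A
    1≤A = ≤-trans (s≤s z≤n) q<A

    Bℓ : b ^ length (binary n) ≤ A
    Bℓ = ≤-trans (^-monoʳ-≤ b ℓ≤S) bS

    open Loading A n<A Bℓ using (Early; loaded)

    pre : ℕ
    pre = proj₁ (loaded 1≤A)

    early : ∀ t → t < pre → Early t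
    early = proj₂ (proj₂ (loaded 1≤A))

    follow : ∀ τ c → run M xs τ ≡ inj₁ c → Follows S c (X (τ + pre))
    follow zero c refl = subst (Follows S c) (sym (proj₁ (proj₂ (loaded 1≤A))))
      (follows refl refl (λ i → trans (rdig-encB (binary n) i) (cong (λ z → toℕ (symOf {γ} (nth (binary n) z))) (sym (+-identityʳ i))))
        S (+-identityʳ S) (<-≤-trans (encB< (binary n)) (^-monoʳ-≤ b ℓ≤S)) refl refl refl)
    follow (suc τ) c e with run M xs τ in eq
    ... | inj₁ c₀ with halting? (Action.op (action c₀))
    ...   | inj₁ (h , isHalt) with trans (sym e) (cong (doAction xs c₀ (action c₀)) isHalt)
    ...     | ()
    follow (suc τ) c e | inj₁ c₀ | inj₂ nh with trans (sym e) (doAction-on c₀ (Action.op (action c₀)) nh)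
    ...     | refl = follows-suc (follow τ c₀ eq) (space τ c₀ eq) nh

    final : Σ ℕ λ τ → Σ (Config q γ) λ c → run M xs τ ≡ inj₁ c × step M xs c ≡ inj₂ (just v)
    final = last-config t₁ halted

    τ T : ℕ
    τ = proj₁ final
    T = τ + pre

    cF : Config q γ
    cF = proj₁ (proj₂ final)

    runF : run M xs τ ≡ inj₁ cF
    runF = proj₁ (proj₂ (proj₂ final))

    haltF : Σ CHead λ h → Action.op (action cF) ≡ halt h × Config.comp cF (headPos cF h) ≡ just v
    haltF with halting? (Action.op (action cF))
    ... | inj₂ nh with trans (sym (proj₂ (proj₂ (proj₂ final)))) (doAction-on cF (Action.op (action cF)) nh)
    ...   | ()
    haltF | inj₁ (h , isHalt) with trans (sym (proj₂ (proj₂ (proj₂ final)))) (cong (doAction xs cF (action cF)) isHalt)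
    ...   | e = h , isHalt , sym (inj₂-injective e)
      where
      inj₂-injective : {A B : Set} {a b : B} → inj₂ {A = A} a ≡ inj₂ b → a ≡ b
      inj₂-injective refl = refl

    followF : Follows S cF (X T)
    followF = follow τ cF runF

    rowF : row (ctl (X T)) (scan (stR (X T))) ≡ mkRow (2 + q) (scan (stR (X T))) 1 1 1 1 (halt (proj₁ haltF))
    rowF = trans (row≡ followF) (cong (actRow (action cF) (scan (stR (X T)))) (proj₁ (proj₂ haltF)))

    deadF : X (suc T) ≡ mkCtl (2 + q) (stL (X T)) (stR (X T)) (hI (X T)) (hd₁ (X T)) (hd₂ (X T))
    deadF = go (X T) refl
      where
      go : ∀ x → X T ≡ x → X (suc T) ≡ mkCtl (2 + q) (stL x) (stR x) (hI x) (hd₁ x) (hd₂ x)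
      go x@(mkCtl c L R i h₁ h₂) e = trans (cong stepCtl (trans e (cong (λ z → mkCtl z L R i h₁ h₂) c≡)))
        (trans (step-row (toℕ (Config.state cF)) L R i h₁ h₂ (s≤s (s≤s (m<n⇒m<1+n (toℕ<n (Config.state cF))))))
        (trans (cong (λ r → rowStep r L R i h₁ h₂) (trans (cong (λ z → row z (scan R)) (sym c≡)) (subst (λ z → row (ctl z) (scan (stR z)) ≡ mkRow (2 + q) (scan (stR z)) 1 1 1 1 (halt (proj₁ haltF))) e rowF))) stays))
        where
        c≡ : c ≡ 2 + toℕ (Config.state cF)
        c≡ = trans (cong ctl (sym e)) (Follows.state≡ followF)
        stays : rowStep (mkRow (2 + q) (scan R) 1 1 1 1 (halt (proj₁ haltF))) L R i h₁ h₂ ≡ mkCtl (2 + q) L R i h₁ h₂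
        stays rewrite sym (m≡m%n+[m/n]*n R b) | m+n∸n≡m i 1 | m+n∸n≡m h₁ 1 | m+n∸n≡m h₂ 1 = refl

    dead : ∀ k → X (k + suc T) ≡ X (suc T)
    dead zero    = refl
    dead (suc k) = trans (cong stepCtl (trans (dead k) deadF)) (trans (dead-fixed _ _ _ _ _) (sym deadF))

    Tame : Ctl → Set
    Tame x = ctl x < 3 + q × stL x < A × stR x < A

    tame-follows : ∀ {c x} → Follows S c x → Tame x
    tame-follows {c} {x} F = subst (_< 3 + q) (sym (Follows.state≡ F)) (s≤s (s≤s (m<n⇒m<1+n (toℕ<n (Config.state c))))) ,
      <-≤-trans (LRep< _ _ (Follows.left≡ F)) (≤-trans (^-monoʳ-≤ b (≤-trans (m≤n+m _ (Follows.room F)) (≤-reflexive (Follows.room≡ F)))) bS) ,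
      <-≤-trans (Follows.right< F) (≤-trans (^-monoʳ-≤ b (≤-trans (m≤m+n (Follows.room F) _) (≤-reflexive (Follows.room≡ F)))) bS)

    config-at : ∀ {l} → pre ≤ l → l ≤ T → Σ (Config q γ) λ c → run M xs (l ∸ pre) ≡ inj₁ c × Follows S c (X l)
    config-at {l} pre≤l l≤T =
      let c , r = run-before (τ ∸ (l ∸ pre)) (l ∸ pre) (trans (cong (run M xs) (m∸n+n≡m (m≤n+o⇒m∸n≤o l pre (subst (l ≤_) (+-comm τ pre) l≤T)))) runF)
      in c , r , subst (λ z → Follows S c (X z)) (m∸n+n≡m pre≤l) (follow (l ∸ pre) c r)

    tame : ∀ l → Tame (X l)
    tame l with l <? pre | l ≤? T
    ... | yes l< | _ = let a , b , c = early l l< in ≤-trans (s≤s a) (s≤s (s≤s z≤n)) , b , c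
    ... | no l≮ | yes l≤ = tame-follows (proj₂ (proj₂ (config-at (≮⇒≥ l≮) l≤)))
    ... | no _ | no l≰ = subst Tame (sym (trans (cong X (sym (m∸n+n≡m (≰⇒> l≰)))) (dead (l ∸ suc T))))
        (subst Tame (sym deadF) (≤-refl , proj₂ (tame-follows followF)))

    -- Control state and stacks determine their own successors, as the control reads neither the
    -- positions of the other heads nor their tapes. Hence fewer than A³ numbers describe everything
    -- that matters for halting.
    code : ℕ → ℕ
    code l = ctl (X l) + (stL (X l) + stR (X l) * A) * A

    code< : ∀ l → code l < A * A * A
    code< l = let a , b , c = tame l in nest (≤-trans a q<A) (nest b c)
      where
      nest : ∀ {d e N} → d < A → e < N → d + e * A < N * A
      nest {d} {e} d< e< = <-≤-trans (+-monoˡ-< (e * A) d<) (*-monoˡ-≤ A e<)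

    code-step : ∀ i j → code i ≡ code j → code (suc i) ≡ code (suc j)
    code-step i j e = stepped (X i) (X j) c≡ L≡ R≡
      where
      instance
        A≢0 : NonZero A
        A≢0 = >-nonZero 1≤A
      c< : ∀ l → ctl (X l) < A
      c< l = ≤-trans (proj₁ (tame l)) q<A
      L< : ∀ l → stL (X l) < A
      L< l = proj₁ (proj₂ (tame l))
      c≡ : ctl (X i) ≡ ctl (X j)
      c≡ = trans (sym (digit-% (stL (X i) + stR (X i) * A) (c< i))) (trans (cong (_% A) e) (digit-% (stL (X j) + stR (X j) * A) (c< j)))
      LR≡ : stL (X i) + stR (X i) * A ≡ stL (X j) + stR (X j) * A
      LR≡ = trans (sym (digit-/ (stL (X i) + stR (X i) * A) (c< i))) (trans (cong (_/ A) e) (digit-/ (stL (X j) + stR (X j) * A) (c< j)))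
      L≡ : stL (X i) ≡ stL (X j)
      L≡ = trans (sym (digit-% (stR (X i)) (L< i))) (trans (cong (_% A) LR≡) (digit-% (stR (X j)) (L< j)))
      R≡ : stR (X i) ≡ stR (X j)
      R≡ = trans (sym (digit-/ (stR (X i)) (L< i))) (trans (cong (_/ A) LR≡) (digit-/ (stR (X j)) (L< j)))
      codeOf : Ctl → ℕ
      codeOf x = ctl x + (stL x + stR x * A) * A
      stepped : ∀ x y → ctl x ≡ ctl y → stL x ≡ stL y → stR x ≡ stR y → codeOf (stepCtl x) ≡ codeOf (stepCtl y)
      stepped (mkCtl c L R _ _ _) (mkCtl .c .L .R _ _ _) refl refl refl = refl

    codeT : ∀ k → suc T ≤ k → code k ≡ code (suc T)
    codeT k le = cong (λ x → ctl x + (stL x + stR x * A) * A) (trans (cong X (sym (m∸n+n≡m le))) (dead (k ∸ suc T)))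

    ctl-after : ∀ k → suc T ≤ k → ctl (X k) ≡ 2 + q
    ctl-after k le = trans (cong (λ l → ctl (X l)) (sym (m∸n+n≡m le))) (trans (cong ctl (dead (k ∸ suc T))) (cong ctl deadF))

    -- Otherwise the orbit would have been absorbed by the dead state at time A³ already, whereas at
    -- time T the control is still in a state of the machine.
    T<A³ : T < A * A * A
    T<A³ with T <? A * A * A
    ... | yes p = p
    ... | no np = ⊥-elim (<⇒≢ (toℕ<n (Config.state cF)) (suc-injective (suc-injective (trans (sym (Follows.state≡ followF)) stuck))))
      where
      instance
        A≢0 : NonZero A
        A≢0 = >-nonZero 1≤A
      N = A * A * A
      absorbed : code N ≡ code (suc T)
      absorbed = orbit-absorbed code N code< code-step codeT
      persists : ∀ k → code (k + N) ≡ code (suc T)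
      persists zero    = absorbed
      persists (suc k) = trans (code-step (k + N) (suc T) (persists k)) (codeT (suc (suc T)) (n≤1+n _))
      ctl-of : ∀ l → code l % A ≡ ctl (X l)
      ctl-of l = digit-% (stL (X l) + stR (X l) * A) (≤-trans (proj₁ (tame l)) q<A)
      stuck : ctl (X T) ≡ 2 + q
      stuck = trans (sym (ctl-of T)) (trans (cong (_% A) (trans (cong code (sym (m∸n+n≡m (≮⇒≥ np)))) (persists (T ∸ N)))) (trans (ctl-of (suc T)) (cong ctl deadF)))

    A≤D : A ≤ D
    A≤D = ≤-trans (≤-trans (m≤m*n A A) (m≤m*n (A * A) A)) A³<D
      where
      instance
        A≢0 : NonZero A
        A≢0 = >-nonZero 1≤A

    bounded : Bounded
    bounded = record
      { 3≤D = ≤-trans (≤-trans (m≤m+n 3 q) q<A) A≤D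
      ; cOK = λ l → proj₁ (tame l)
      ; cD  = λ l → ≤-trans (≤-trans (proj₁ (tame l)) q<A) A≤D
      ; LD  = λ l → <-≤-trans (proj₁ (proj₂ (tame l))) A≤D
      ; RD  = λ l → <-≤-trans (proj₂ (proj₂ (tame l))) A≤D }

    open Timeline bounded using (tape; headAt; module Output)

    op-at : ∀ {c l} → Follows S c (X l) → NonHalt (Action.op (action c)) → opAt bounded l ≡ Action.op (action c)
    op-at {c} {l} F nh = cong rowOp (trans (row≡ F) (actRow-on (action c) (scan (stR (X l))) _ nh))

    op-early : ∀ l → l < pre → opAt bounded l ≡ noop
    op-early l l< = early-op (scan (stR (X l))) (proj₁ (early l l<))

    tape-early : ∀ l → l ≤ pre → tape l ≡ blankTape
    tape-early zero    _  = refl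
    tape-early (suc l) l< = trans (cong (λ o → opTape o (hI (X l)) (hd₁ (X l)) (hd₂ (X l)) (tape l)) (op-early l l<)) (tape-early l (<⇒≤ l<))

    tape-follow : ∀ τ c → run M xs τ ≡ inj₁ c → tape (τ + pre) ≡ Config.comp c
    tape-follow zero c refl = tape-early pre ≤-refl
    tape-follow (suc τ) c e with run M xs τ in eq
    ... | inj₁ c₀ with halting? (Action.op (action c₀))
    ...   | inj₁ (h , isHalt) with trans (sym e) (cong (doAction xs c₀ (action c₀)) isHalt)
    ...     | ()
    tape-follow (suc τ) c e | inj₁ c₀ | inj₂ nh with trans (sym e) (doAction-on c₀ (Action.op (action c₀)) nh)
    ...     | refl = trans (eqs (op-at (follow τ c₀ eq) nh) (Follows.hI≡ (follow τ c₀ eq)) (Follows.hd₁≡ (follow τ c₀ eq)) (Follows.hd₂≡ (follow τ c₀ eq)) (tape-follow τ c₀ eq))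
                           (op-cong (Action.op (action c₀)) c₀)
      where
      eqs : ∀ {o o' i i' p p' r r' t t'} → o ≡ o' → i ≡ i' → p ≡ p' → r ≡ r' → t ≡ t' → opTape o i p r t ≡ opTape o' i' p' r' t'
      eqs refl refl refl refl refl = refl

    running : ∀ t → t < T → ∀ h → opAt bounded t ≢ halt h
    running t t<T h e with t <? pre
    ... | yes t< with trans (sym (op-early t t<)) e
    ...   | ()
    running t t<T h e | no t≮ with config-at (≮⇒≥ t≮) (<⇒≤ t<T)
    ... | c , r , F with halting? (Action.op (action c))
    ...   | inj₂ nh = nh h (trans (sym (op-at F nh)) e)
    ...   | inj₁ (h' , isHalt) = later (τ ∸ suc (t ∸ pre)) (trans (cong (run M xs) (m∸n+n≡m before)) runF)
      where
      before : suc (t ∸ pre) ≤ τ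
      before = subst (_≤ τ) (+-∸-assoc 1 (≮⇒≥ t≮)) (m≤n+o⇒m∸n≤o (suc t) pre (subst (suc t ≤_) (+-comm τ pre) t<T))
      stopped : ∀ {c'} → run M xs (suc (t ∸ pre)) ≢ inj₁ c'
      stopped q with trans (sym (trans (cong (step' M xs) r) (cong (doAction xs c (action c)) isHalt))) q
      ... | ()
      later : ∀ k {c'} → run M xs (k + suc (t ∸ pre)) ≡ inj₁ c' → ⊥
      later k q = stopped (proj₂ (run-before k (suc (t ∸ pre)) q))

    after-T : ∀ t → T < t → opAt bounded t ≡ noop
    after-T t lt = trans (cong (λ z → rowOp (row z (scan (stR (X t))))) (ctl-after t lt)) (dead-op (scan (stR (X t))))

    correct : evalC (TokenFamily.family M E n) (fromList xs) ≡ v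
    correct = Output.output-correct T (<-≤-trans T<A³ A³<D) running (proj₁ haltF) (cong rowOp rowF) after-T v
      (trans (cong₂ (λ f p → f p) (tape-follow τ cF runF) (head (proj₁ haltF))) (proj₂ (proj₂ haltF)))
      where
      head : ∀ h → headAt T h ≡ headPos cF h
      head M₁ = Follows.hd₁≡ followF
      head M₂ = Follows.hd₂≡ followF

-- Logarithmic space gives polynomial size; conclusion.

open Polynomials
open NodeCode
open FromCircuits using (circuits⇒machine)

-- `f` merely bounds the recursion on halves.
2^log≤ : ∀ f n → n ≤ f → 0 < n → 2 ^ ⌊log₂ n ⌋ ≤ n
2^log≤ zero    (suc n) () _
2^log≤ (suc f) 1 _ _ = ≤-refl
2^log≤ (suc f) m@(suc (suc n)) (s≤s n≤f) _ = begin
  2 ^ ⌊log₂ m ⌋               ≤⟨ halve ⌊log₂ m ⌋ ⟩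
  2 * 2 ^ (⌊log₂ m ⌋ ∸ 1)     ≡⟨ cong (λ z → 2 * 2 ^ z) (sym (⌊log₂⌊n/2⌋⌋≡⌊log₂n⌋∸1 m)) ⟩
  2 * 2 ^ ⌊log₂ ⌊ m /2⌋ ⌋     ≤⟨ *-monoʳ-≤ 2 (2^log≤ f ⌊ m /2⌋ (≤-trans (s≤s (⌊n/2⌋≤n n)) n≤f) z<s) ⟩
  2 * ⌊ m /2⌋                 ≡⟨ cong (⌊ m /2⌋ +_) (+-identityʳ ⌊ m /2⌋) ⟩
  ⌊ m /2⌋ + ⌊ m /2⌋           ≤⟨ +-monoʳ-≤ ⌊ m /2⌋ (⌊n/2⌋≤⌈n/2⌉ m) ⟩
  ⌊ m /2⌋ + ⌈ m /2⌉           ≡⟨ ⌊n/2⌋+⌈n/2⌉≡n m ⟩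
  m                           ∎
  where
  open ≤-Reasoning
  halve : ∀ k → 2 ^ k ≤ 2 * 2 ^ (k ∸ 1)
  halve zero    = s≤s z≤n
  halve (suc k) = ≤-refl

2^suc-log≤ : ∀ n → 2 ^ suc ⌊log₂ n ⌋ ≤ 2 * (1 + n)
2^suc-log≤ zero    = ≤-refl
2^suc-log≤ (suc n) = *-monoʳ-≤ 2 (≤-trans (2^log≤ (suc n) (suc n) ≤-refl z<s) (n≤1+n _))

-- The space that the machine is allowed, and room for the digits of n, which are on the tape
-- whether or not the head ever reaches them.
spaceBound : ℕ → ℕ → ℕ
spaceBound c n = c * (⌊log₂ n ⌋ + 1) + length (binary n)

-- Replacing b by 2^b turns a power with exponent 1 + log n into a power of 2^(1 + log n), which is
-- at most 2 (1 + n).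
poly-space : ∀ b c .{{_ : NonZero b}} → PolyBounded (λ n → b ^ spaceBound c n)
poly-space b c = poly-≤ bound (poly-^ (poly-^ (poly-* (poly-const 2) (poly-+ (poly-const 1) poly-id)) b) (suc c))
  where
  open ≤-Reasoning
  bound : ∀ n → b ^ spaceBound c n ≤ ((2 * (1 + n)) ^ b) ^ suc c
  bound n = begin
    b ^ spaceBound c n            ≤⟨ ^-monoʳ-≤ b (+-mono-≤ (≤-reflexive (cong (c *_) (+-comm lg 1))) (length-binary n)) ⟩
    b ^ (c * suc lg + suc lg)   ≡⟨ cong (b ^_) (trans (+-comm (c * suc lg) (suc lg)) (*-comm (suc c) (suc lg))) ⟩
    b ^ (suc lg * suc c)        ≤⟨ ^-monoˡ-≤ (suc lg * suc c) (k≤2^k b) ⟩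
    (2 ^ b) ^ (suc lg * suc c)  ≡⟨ sym (^-*-assoc (2 ^ b) (suc lg) (suc c)) ⟩
    ((2 ^ b) ^ suc lg) ^ suc c  ≡⟨ cong (_^ suc c) (trans (^-*-assoc 2 b (suc lg)) (trans (cong (2 ^_) (*-comm b (suc lg))) (sym (^-*-assoc 2 (suc lg) b)))) ⟩
    ((2 ^ suc lg) ^ b) ^ suc c  ≤⟨ ^-monoˡ-≤ (suc c) (^-monoˡ-≤ b (2^suc-log≤ n)) ⟩
    ((2 * (1 + n)) ^ b) ^ suc c ∎
    where lg = ⌊log₂ n ⌋

module _ (M : Machine) {R : Relation} (computes : MachineComputes M R) (e : ℕ)
  (fits : ∀ n → (1 + n) + ((3 + Machine.q M) + (4 + Machine.γ M) ^ spaceBound (proj₁ computes) n) ≤ (2 + n) ^ e) where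

  private
    c b E : ℕ
    c = proj₁ computes
    b = 4 + Machine.γ M
    -- The control state and both stacks stay below A = (2 + n)^e, so the machine halts before time
    -- A³, and D has to reach that far.
    E = e + e + e

  open Sim M E using (Dp; Vn; Wp; Gn)

  D≡ : ∀ n → suc (Dp n) ≡ (2 + n) ^ E
  D≡ n = m+[n∸m]≡n (m^n>0 (2 + n) E)

  poly-D : PolyBounded (λ n → suc (Dp n))
  poly-D = E , λ n → ≤-reflexive (D≡ n)

  poly-V : PolyBounded Vn
  poly-V = poly-≤ (λ n → ≤-reflexive (Trajectories.V≡ M E n)) (poly-^ poly-D 13)

  poly-circuit : PolyBounded (λ n → suc (Wp n) + Gn n)
  poly-circuit = poly-+ (poly-+ (poly-const 1) (poly-+ (poly-* (poly-const 3) poly-V) (poly-* (poly-const 2) poly-D)))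
                        (poly-* poly-V (poly-const 4))

  family-computes : FamilyComputes (TokenFamily.family M E) R
  family-computes xs = mk⇔ (λ e → Equivalence.to v⇔R (trans (sym correct) e)) (λ r → trans correct (Equivalence.from v⇔R r))
    where
    n = length xs
    A = (2 + n) ^ e
    halting = proj₂ (proj₂ computes xs)
    v : Bool
    v = proj₁ (proj₂ halting)
    v⇔R : (v ≡ true) ⇔ R xs
    v⇔R = proj₂ (proj₂ (proj₂ halting))
    A³ : A * A * A ≤ suc (Dp n)
    A³ = ≤-reflexive (sym (trans (D≡ n) (trans (^-distribˡ-+-* (2 + n) (e + e) e) (cong (_* A) (^-distribˡ-+-* (2 + n) e e)))))
    correct : evalC (TokenFamily.family M E n) (fromList xs) ≡ v
    correct = Runs.Whole.correct M E xs A (spaceBound c n) (≤-trans (m≤m+n (1 + n) _) (fits n))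
      (≤-trans (≤-trans (m≤m+n (3 + Machine.q M) _) (m≤n+m _ (1 + n))) (fits n)) (m≤n+m _ (c * (⌊log₂ n ⌋ + 1)))
      (≤-trans (≤-trans (m≤n+m _ (3 + Machine.q M)) (m≤n+m _ (1 + n))) (fits n)) A³
      (λ t cfg r → <-≤-trans (proj₁ (proj₂ computes xs) t cfg r) (m≤m+n _ _))
      (proj₁ halting) v (proj₁ (proj₂ (proj₂ halting)))

  realised-in-CC : InCC R
  realised-in-CC = TokenFamily.family M E , TokenFamily.polySize M E poly-circuit , TokenFamily.family-uniform M E , family-computes

machine⇒circuits : ∀ M {R} → MachineComputes M R → InCC R
machine⇒circuits M computes = let e , fits = poly-+ (poly-+ (poly-const 1) poly-id)
                                    (poly-+ (poly-const (3 + Machine.q M)) (poly-space (4 + Machine.γ M) (proj₁ computes)))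
                              in realised-in-CC M computes e fits

theorem12 : (R : Relation) → InCC R ⇔ Σ Machine (λ M → MachineComputes M R)
theorem12 R = mk⇔ (λ (F , ps , U , fc) → circuits⇒machine F ps U fc) (λ (M , computes) → machine⇒circuits M computes)
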